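{- Let $\Delta\geq 6$, and let $n=k\Delta+1+j$, where $k\geq\Delta-1$ and $0\leq j\leq\Delta-1$ are integers. Then the maximum $\sigma$-irregularity over all trees on $n$ vertices with maximum degree $\Delta$ equals \[ \max\{\sigma',\sigma'',\sigma'''\}, \] where the term $\sigma'''$ is present only when $2\leq j\leq\Delta-2$, and where for $j=0$ this maximum is understood to be the value $\Delta^{3}k-2\Delta^{2}k-3\Delta k+6k+4\Delta-6$ (the common $\sigma$-irregularity of all nice trees on $n=k\Delta+1$ vertices). Moreover, a tree $T$ on $n$ vertices with maximum degree $\Delta$ is maximal if and only if $T\in\mathcal{T}_{n,\Delta}$.
   Context: All graphs are finite and simple. For a graph $G$, $\sigma(G)=\sum_{uv\in E(G)}(d(u)-d(v))^2$, where $d(u)$ is the degree of $u$. A tree $T$ with maximum degree $\Delta$ is maximal if it attains the largest value of $\sigma$ among all trees on $|V(T)|$ vertices with maximum degree $\Delta$. For a tree $T$, $n_i$ is the number of vertices of degree $i$, and $m_{ij}=m_{ji}$ is the number of edges whose end-vertices have degrees $i$ and $j$. An internal leaf of a tree is a vertex of degree at least $2$ having precisely one neighbor of degree greater than $1$. A medium vertex is a vertex whose degree lies in $\{3,\ldots,\Delta-1\}$. A tree with maximum degree $\Delta$ is nice if every edge $uv$ satisfies $(d(u)-d(v))^2\in\{(\Delta-1)^2,(\Delta-2)^2\}$. Let $n=k\Delta+1+j$ with $k\ge\Delta-1$. The three families consist of trees $T$ on $n$ vertices with maximum degree $\Delta$: Family $\mathcal{T}'_{n,\Delta}$ (for $1\le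 j\le\Delta-1$): all such trees with (1) all internal leaves of $T$ have degree $\Delta$; (2) $m_{22}\le 2$ and $m_{\Delta\Delta}=0$; (3) $\sum_{i=3}^{\Delta-1}n_i\le 1$; (4) $m_{22}=0$ if and only if $\sum_{i=3}^{\Delta-1}n_i=n_a=1$ for some $a\in\{3,\ldots,\Delta-1\}$; (5) if $m_{22}=0$, then $m_{a2}=a$, where $a$ is the degree from (4). Family $\mathcal{T}''_{n,\Delta}$ (for $0\le j\le\Delta-1$): all such trees with (1) all internal leaves of $T$ have degree $\Delta$; (2) all vertices have degree in $\{1,2,\Delta\}$; (3) $m_{22}=0$ and $m_{\Delta\Delta}\le\Delta-1$. Family $\mathcal{T}'''_{n,\Delta}$ (for $2\le j\le\Delta-2$): all such trees with (1) all internal leaves of $T$ have degree $\Delta$; (2) all vertices have degree in $\{1,2,\Delta\}$, except precisely one medium vertex $w$, which has degree $j+1$; (3) $m_{22}=0$; (4) $w$ has precisely $j$ neighbors of degree $2$ and one neighbor of degree $\Delta$; (5) $m_{\Delta\Delta}=0$. For other $j$ this family is considered empty. For $1\le j\le\Delta-1$, each of the families $\mathcal{T}'_{n,\Delta}$, $\mathcal{T}''_{n,\Delta}$ (and $\mathcal{T}'''_{n,\Delta}$ when $2\le j\le\Delta-2$) is nonempty and all its trees have the same $\sigma$-irregularity; these common values are denoted $\sigma'$, $\sigma''$, $\sigma'''$ respectively. Let $r(\Delta)=\frac12\left(\sqrt{5\Delta^2-32\Delta+44}-\Delta+4\right)$. The family $\mathcal{T}_{n,\Delta}$ is defined as follows.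 For $j=0$, $\mathcal{T}_{n,\Delta}=\mathcal{T}''_{n,\Delta}$ (which then consists of nice trees). For $1\le j\le\Delta-1$: - $\mathcal{T}_{n,\Delta}=\mathcal{T}'''_{n,\Delta}$ if $j=2$ and $\Delta\ge 7$, or $(\Delta,j)=(8,3)$; - $\mathcal{T}_{n,\Delta}=\mathcal{T}''_{n,\Delta}\cup\mathcal{T}'''_{n,\Delta}$ if $(\Delta,j)=(6,2)$; - $\mathcal{T}_{n,\Delta}=\mathcal{T}'_{n,\Delta}\cup\mathcal{T}'''_{n,\Delta}$ if $(\Delta,j)=(9,3)$; - in all other cases, $\mathcal{T}_{n,\Delta}=\mathcal{T}'_{n,\Delta}$ if $j<r(\Delta)$, $\mathcal{T}_{n,\Delta}=\mathcal{T}'_{n,\Delta}\cup\mathcal{T}''_{n,\Delta}$ if $j=r(\Delta)$, and $\mathcal{T}_{n,\Delta}=\mathcal{T}''_{n,\Delta}$ if $j>r(\Delta)$. -}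

module Defs where

open import Data.Bool.Base using (Bool; false; T)
open import Data.Bool.Properties using (T?)
open import Data.Fin.Base using (Fin)
import Data.Fin.Properties as Fin
open import Data.Integer.Base as ℤ using (ℤ; +_; 0ℤ)
open import Data.List.Base
  using (List; _∷_; [_]; _++_; length; map; filter; upTo; allFin; cartesianProduct)
open import Data.List.Extrema.Nat using (max)
open import Data.List.Relation.Unary.Linked using (Linked)
open import Data.List.Relation.Unary.Unique.Propositional using (Unique)
open import Data.Nat.Base
open import Data.Nat.ListAction using (sum)
open import Data.Nat.Properties using (_≟_; _<?_)
open import Data.Product.Base using (_×_; _,_; ∃; ∃-syntax)
open import Data.Sum.Base using (_⊎_)
open import Function.Bundles using (_⇔_)
open import Relation.Binary.Construct.Closure.ReflexiveTransitive using (Star)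
open import Relation.Binary.PropositionalEquality.Core using (_≡_; _≢_)
open import Relation.Nullary.Decidable using (_×-dec_; _⊎-dec_)
open import Relation.Nullary.Negation using (¬_)

record Graph (n : ℕ) : Set where
  field
    adj        : Fin n → Fin n → Bool
    adj-sym    : ∀ u v → adj u v ≡ adj v u
    adj-irrefl : ∀ v → adj v v ≡ false

  infix 4 _~_
  _~_ : Fin n → Fin n → Set
  u ~ v = T (adj u v)

module _ {n : ℕ} (G : Graph n) where
  open Graph G

  neighbours : Fin n → List (Fin n)
  neighbours v = filter (λ u → T? (adj v u)) (allFin n)

  deg : Fin n → ℕ
  deg v = length (neighbours v)

  maxDegree : ℕ
  maxDegree = max 0 (map deg (allFin n))

  -- Each edge occurs once, with its smaller end-vertex first.
  edges : List (Fin n × Fin n)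
  edges = filter (λ (u , v) → (u Fin.<? v) ×-dec T? (adj u v))
                 (cartesianProduct (allFin n) (allFin n))

  σ : ℕ
  σ = sum (map (λ (u , v) → ∣ deg u - deg v ∣ ^ 2) edges)

  numDeg : ℕ → ℕ
  numDeg i = length (filter (λ v → deg v ≟ i) (allFin n))

  numEdges : ℕ → ℕ → ℕ
  numEdges i j = length (filter
    (λ (u , v) → ((deg u ≟ i) ×-dec (deg v ≟ j)) ⊎-dec ((deg u ≟ j) ×-dec (deg v ≟ i)))
    edges)

  numNeighbours : Fin n → ℕ → ℕ
  numNeighbours v i = length (filter (λ u → deg u ≟ i) (neighbours v))

  Connected : Set
  Connected = ∀ u v → Star _~_ u v

  -- The cycle visits v and then the vertices of vs, and returns to v.
  IsCycle : Fin n → List (Fin n) → Set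
  IsCycle v vs = 2 ≤ length vs × Unique (v ∷ vs) × Linked _~_ (v ∷ vs ++ [ v ])

  Acyclic : Set
  Acyclic = ∀ v vs → ¬ IsCycle v vs

  IsTree : Set
  IsTree = Connected × Acyclic

  InternalLeaf : Fin n → Set
  InternalLeaf v = 2 ≤ deg v × length (filter (λ u → 1 <? deg u) (neighbours v)) ≡ 1

module _ {n : ℕ} (Δ : ℕ) where

  TreeOfMaxDegree : Graph n → Set
  TreeOfMaxDegree G = IsTree G × maxDegree G ≡ Δ

  Maximal : Graph n → Set
  Maximal G = TreeOfMaxDegree G × (∀ (H : Graph n) → TreeOfMaxDegree H → σ H ≤ σ G)

  NiceTree : Graph n → Set
  NiceTree G = TreeOfMaxDegree G ×
    (∀ u v → Graph._~_ G u v →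
      ∣ deg G u - deg G v ∣ ^ 2 ≡ (Δ ∸ 1) ^ 2 ⊎ ∣ deg G u - deg G v ∣ ^ 2 ≡ (Δ ∸ 2) ^ 2)

  IsMediumDegree : ℕ → Set
  IsMediumDegree a = 3 ≤ a × a < Δ

  -- The sum of n_i over 3 ≤ i ≤ Δ - 1.
  numMedium : Graph n → ℕ
  numMedium G = sum (map (λ i → numDeg G (3 + i)) (upTo (Δ ∸ 3)))

  UniqueMediumDegree : Graph n → ℕ → Set
  UniqueMediumDegree G a = IsMediumDegree a × numMedium G ≡ numDeg G a × numDeg G a ≡ 1

  HasDegree12Δ : Graph n → Fin n → Set
  HasDegree12Δ G v = deg G v ≡ 1 ⊎ deg G v ≡ 2 ⊎ deg G v ≡ Δ

  record Family′ (G : Graph n) : Set where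
    field
      tree         : TreeOfMaxDegree G
      internalLeaf : ∀ v → InternalLeaf G v → deg G v ≡ Δ
      m₂₂≤2        : numEdges G 2 2 ≤ 2
      mΔΔ≡0        : numEdges G Δ Δ ≡ 0
      medium≤1     : numMedium G ≤ 1
      m₂₂≡0⇔medium : numEdges G 2 2 ≡ 0 ⇔ (∃[ a ] UniqueMediumDegree G a)
      mₐ₂≡a        : numEdges G 2 2 ≡ 0 → ∀ a → UniqueMediumDegree G a → numEdges G a 2 ≡ a

  record Family″ (G : Graph n) : Set where
    field
      tree         : TreeOfMaxDegree G
      internalLeaf : ∀ v → InternalLeaf G v → deg G v ≡ Δ
      degrees      : ∀ v → HasDegree12Δ G v
      m₂₂≡0        : numEdges G 2 2 ≡ 0
      mΔΔ≤Δ-1      : numEdges G Δ Δ ≤ Δ ∸ 1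

  record Family‴ (j : ℕ) (G : Graph n) : Set where
    field
      2≤j          : 2 ≤ j
      j≤Δ-2        : j ≤ Δ ∸ 2
      tree         : TreeOfMaxDegree G
      internalLeaf : ∀ v → InternalLeaf G v → deg G v ≡ Δ
      w            : Fin n
      w-medium     : IsMediumDegree (deg G w)
      w-degree     : deg G w ≡ j + 1
      degrees      : ∀ v → v ≢ w → HasDegree12Δ G v
      m₂₂≡0        : numEdges G 2 2 ≡ 0
      w-nbrs₂      : numNeighbours G w 2 ≡ j
      w-nbrsΔ      : numNeighbours G w Δ ≡ 1
      mΔΔ≡0        : numEdges G Δ Δ ≡ 0

-- Comparison of an integer x with the real number √D, for D ≥ 0.
infix 4 _<√_ _≡√_ _>√_

_<√_ _≡√_ _>√_ : ℤ → ℤ → Set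
x <√ D = x ℤ.< 0ℤ ⊎ x ℤ.* x ℤ.< D
x ≡√ D = 0ℤ ℤ.≤ x × x ℤ.* x ≡ D
x >√ D = 0ℤ ℤ.≤ x × D ℤ.< x ℤ.* x

-- For r(Δ) = ½ (√(5Δ² - 32Δ + 44) - Δ + 4), the relation j ⋈ r(Δ) means
-- 2j + Δ - 4 ⋈ √(5Δ² - 32Δ + 44); the radicand is nonnegative for Δ ≥ 5.
radicand : ℕ → ℤ
radicand Δ = + 5 ℤ.* (+ Δ) ℤ.^ 2 ℤ.- + 32 ℤ.* + Δ ℤ.+ + 44

shifted : ℕ → ℕ → ℤ
shifted j Δ = + 2 ℤ.* + j ℤ.+ + Δ ℤ.- + 4

infix 4 _<r_ _≡r_ _>r_

_<r_ _≡r_ _>r_ : ℕ → ℕ → Set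
j <r Δ = shifted j Δ <√ radicand Δ
j ≡r Δ = shifted j Δ ≡√ radicand Δ
j >r Δ = shifted j Δ >√ radicand Δ

Case‴ Case″∪‴ Case′∪‴ Exceptional : ℕ → ℕ → Set
Case‴ Δ j       = (j ≡ 2 × 7 ≤ Δ) ⊎ (Δ ≡ 8 × j ≡ 3)
Case″∪‴ Δ j     = Δ ≡ 6 × j ≡ 2
Case′∪‴ Δ j     = Δ ≡ 9 × j ≡ 3
Exceptional Δ j = Case‴ Δ j ⊎ Case″∪‴ Δ j ⊎ Case′∪‴ Δ j

data Family {n : ℕ} (Δ j : ℕ) (G : Graph n) : Set where
  j≡0      : j ≡ 0 → Family″ Δ G → Family Δ j G
  case‴    : Case‴ Δ j → Family‴ Δ j G → Family Δ j G
  case″∪‴  : Case″∪‴ Δ j → Family″ Δ G ⊎ Family‴ Δ j G → Family Δ j G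
  case′∪‴  : Case′∪‴ Δ j → Family′ Δ G ⊎ Family‴ Δ j G → Family Δ j G
  j<r      : 1 ≤ j → ¬ Exceptional Δ j → j <r Δ → Family′ Δ G → Family Δ j G
  j≡r      : 1 ≤ j → ¬ Exceptional Δ j → j ≡r Δ → Family′ Δ G ⊎ Family″ Δ G → Family Δ j G
  j>r      : 1 ≤ j → ¬ Exceptional Δ j → j >r Δ → Family″ Δ G → Family Δ j G

IsCommonσ : ∀ {n} → (Graph n → Set) → ℕ → Set
IsCommonσ P s = (∃[ G ] P G) × (∀ G → P G → σ G ≡ s)

IsMaxσ : ℕ → ℕ → ℕ → Set
IsMaxσ n Δ s =
  (∃[ G ] TreeOfMaxDegree {n} Δ G × σ G ≡ s) ×
  (∀ G → TreeOfMaxDegree {n} Δ G → σ G ≤ s)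

niceσ : ℕ → ℕ → ℤ
niceσ Δ k = (+ Δ) ℤ.^ 3 ℤ.* + k ℤ.- + 2 ℤ.* (+ Δ) ℤ.^ 2 ℤ.* + k ℤ.- + 3 ℤ.* + Δ ℤ.* + k
            ℤ.+ + 6 ℤ.* + k ℤ.+ + 4 ℤ.* + Δ ℤ.- + 6

module Submission where

open import Defs
open import Data.Nat.Base
open import Data.Nat.ListAction using () renaming (sum to listSum)
open import Data.Nat.ListAction.Properties using (sum-++)
open import Data.Nat.Properties
open import Data.Nat.Tactic.RingSolver using (solve-∀)
open import Algebra.Properties.CommutativeMonoid.Sum +-0-commutativeMonoid using (sum; sum-cong-≗; ∑-distrib-+; ∑-comm; sum-replicate-zero)
open import Algebra.Properties.Semiring.Sum +-*-semiring using (*-distribˡ-sum)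
open import Data.Bool.Base using (Bool; true; false; T; not; _∧_; _∨_)
open import Data.Bool.Properties as Bool using (T?; T-≡; ∧-zeroʳ; ∧-identityʳ)
open import Data.Empty using (⊥; ⊥-elim)
open import Data.Fin.Base as Fin using (Fin; zero; suc)
import Data.Fin.Properties as Fin
open import Data.Integer.Base as ℤ using (ℤ)
import Data.Integer.Properties as ℤ
open import Data.Integer.Tactic.RingSolver using () renaming (solve-∀ to ℤ-solve-∀)
open import Data.List.Base using (List; []; _∷_; _++_; length; map; filter; allFin; tabulate; cartesianProduct; [_]; lookup; upTo; InitLast; initLast; _∷ʳ′_)
import Data.List.Extrema ≤-totalOrder as Extrema
open import Data.List.Membership.Propositional using (_∈_; lose)
open import Data.List.Membership.Propositional.Properties using (∈-lookup; ∈-∃++; ∈-map⁺; ∈-allFin; ∈-map⁻; ∈-upTo⁺; ∈-upTo⁻; ∈-++⁺ʳ; ∈-++⁺ˡ)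
open import Data.List.Properties as List using (map-tabulate; map-++)
open import Data.List.Relation.Unary.All as All using (All; []; _∷_)
import Data.List.Relation.Unary.All.Properties as All
open import Data.List.Relation.Unary.AllPairs using ([]; _∷_)
open import Data.List.Relation.Unary.Any using (here; there; any?)
open import Data.List.Relation.Unary.Linked using (Linked; []; [-]; _∷_)
open import Data.List.Relation.Unary.Unique.Propositional using (Unique)
import Data.List.Relation.Unary.Unique.Propositional.Properties as Unique
open import Data.Product.Base using (_×_; _,_; ∃-syntax; proj₁; proj₂)
open import Data.Sum.Base as Sum using (_⊎_; inj₁; inj₂; map₂)
open import Data.Unit.Base using (⊤; tt)
open import Function.Base using (_$_; _∘_; id)
open import Function.Bundles using (Equivalence; mk⇔; _⇔_)
open import Relation.Binary.Construct.Closure.ReflexiveTransitive using (Star; ε; _◅_; _◅◅_; gmap; reverse)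
open import Relation.Binary.Definitions using (tri<; tri≈; tri>)
open import Relation.Binary.PropositionalEquality hiding ([_])
open import Relation.Nullary.Decidable using (dec-true; dec-false)
open import Relation.Nullary.Decidable.Core using (yes; no; Dec; does; _×-dec_; ¬?; _⊎-dec_)
open import Relation.Nullary.Negation using (¬_; contradiction)
open import Relation.Unary using (Decidable)

-- Write Δ = 2 + E and y v = Δ - deg v. Since the degree sum of a tree is fixed, σ + Ψ is constant, where Ψ is
-- the sum of a penalty ψ (deg v) over the vertices plus the sum of y u * y v over the ordered pairs of
-- neighbours; so σ is maximal where Ψ is minimal. A vertex of degree Δ costs K = ψ Δ and nothing else, and an
-- edge between two vertices of degree 2 costs ℓ = 2 E². If S is a set of vertices whose complement has u
-- elements and contains all vertices of degree Δ, then, G being connected, S spans at least (k - u) Δ + j edges.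
-- A vertex of S whose own penalty and edges in S cost more than K can be moved out of S at the price K, so one
-- may assume that there is none left. Then u > k gives Ψ ≥ (k + 1) K, with equality for 𝒯″, and u < k is too
-- expensive by a linear estimate. For u = k the cost of the forest S is at least ℓ for each edge, up to a
-- saving at the vertices of medium degree; the saving at a vertex with 1 + x edges in S is at most γ x, and as
-- γ is superadditive in the relevant range, a single medium vertex is best. Optimising its degree leaves 𝒯′ and 𝒯‴.

-- The cost of a vertex of medium degree

-- `γ E x` bounds what a vertex of medium degree with `1 + x` edges in S saves against `ℓ` per edge.
-- Two shapes compete: degree `2 + x`, with one edge leaving S (𝒯‴), and degree `1 + x`, with all
-- edges in S (𝒯′). The first saves `4` and `18` at `x ≡ 1` and `x ≡ 2`; the second saves
-- `(x - 1) (2 E + x²)`, which is `0` and `2 E + 4` there. The bound can fail for a vertex that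
-- costs more than `K`; but such a cost already loses to 𝒯″, so the estimates are disjunctions with
-- "more than `K`". Only `j ≤ e` is known of the number `e` of edges of S, so the estimates have to
-- cover all smaller numbers of edges as well. Finally, adjacent medium vertices share an edge. As S
-- is a forest, the sum of their `x` is at most `e - 1`; the edge missing here is paid separately,
-- at the price `ℓ`.

slack : ∀ {a b} c → a + c ≡ b → a ≤ b
slack {a} c refl = m≤m+n a c

slack< : ∀ {a b} c → a + suc c ≡ b → a < b
slack< {a} c refl = m<m+n a (s≤s z≤n)

≤⇒gap : ∀ {a b} → a ≤ b → ∃[ c ] a + c ≡ b
≤⇒gap {a} {b} a≤b = b ∸ a , m+[n∸m]≡n a≤b

private
  linear-descending : ∀ {B F} C p d → (C + d) * p + B ≤ C * p + F →
    ∀ s → s ≤ p → (C + d) * s + B ≤ C * s + F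
  linear-descending {B} {F} C p d h s s≤p with ≤⇒gap s≤p
  ... | r , refl = +-cancelˡ-≤ (C * r) _ _ (begin
    C * r + ((C + d) * s + B)  ≤⟨ slack (d * r) (eq₁ C d s r B) ⟩
    (C + d) * (s + r) + B      ≤⟨ h ⟩
    C * (s + r) + F            ≡⟨ eq₂ C s r F ⟩
    C * r + (C * s + F)        ∎)
    where
    open ≤-Reasoning
    eq₁ : ∀ C d s r B → C * r + ((C + d) * s + B) + d * r ≡ (C + d) * (s + r) + B
    eq₁ = solve-∀
    eq₂ : ∀ C s r F → C * (s + r) + F ≡ C * r + (C * s + F)
    eq₂ = solve-∀

  linear-ascending : ∀ {B F} A d → A * 1 + B ≤ (A + d) * 1 + F →
    ∀ s → 1 ≤ s → A * s + B ≤ (A + d) * s + F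
  linear-ascending {B} {F} A d h (suc s) _ = begin
    A * suc s + B              ≡⟨ eq₁ A s B ⟩
    A * s + (A * 1 + B)        ≤⟨ +-monoʳ-≤ (A * s) h ⟩
    A * s + ((A + d) * 1 + F)  ≤⟨ slack (d * s) (eq₂ A d s F) ⟩
    (A + d) * suc s + F        ∎
    where
    open ≤-Reasoning
    eq₁ : ∀ A s B → A * suc s + B ≡ A * s + (A * 1 + B)
    eq₁ = solve-∀
    eq₂ : ∀ A d s F → A * s + ((A + d) * 1 + F) + d * s ≡ (A + d) * suc s + F
    eq₂ = solve-∀

-- Both sides are affine in `s`, so the two ends suffice; the sign of the slope decides which of
-- them is used.
linear-between : ∀ A B C F p → A * 1 + B ≤ C * 1 + F → A * p + B ≤ C * p + F →
  ∀ s → 1 ≤ s → s ≤ p → A * s + B ≤ C * s + F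
linear-between A B C F p h₁ hₚ s 1≤s s≤p with ≤-total A C
... | inj₁ A≤C with ≤⇒gap A≤C
... | d , refl = linear-ascending A d h₁ s 1≤s
linear-between A B C F p h₁ hₚ s 1≤s s≤p | inj₂ C≤A with ≤⇒gap C≤A
... | d , refl = linear-descending C p d hₚ s s≤p

-- After the substitution of `a + t` for `b`, a polynomial inequality becomes an identity whose
-- slack has natural coefficients, and the ring solver can check it.
gap-elim : (P : ℕ → Set) → ∀ a → (∀ t → P (a + t)) → ∀ {b} → a ≤ b → P b
gap-elim P a f a≤b with ≤⇒gap a≤b
... | t , refl = f t

ℓ : ℕ → ℕ
ℓ E = 2 * (E * E)

K : ℕ → ℕ
K E = suc E * E * pred E

-- The penalty `ψ` at degree `2 + z` when `suc y₀` is missing to the maximum degree. In these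
-- coordinates `E ≡ z + suc y₀`, and no subtraction is left.
medψ : ℕ → ℕ → ℕ
medψ z y₀ = z * suc z * (suc z + 2 * y₀)

-- The penalty together with the edges to `s` neighbours of degree 2, for each of which `y` equals
-- `E`; the factor 2 is that of ordered pairs.
medCost : ℕ → ℕ → ℕ → ℕ
medCost z y₀ s = medψ z y₀ + 2 * (s * (suc y₀ * (z + suc y₀)))

-- Abstract, so that conversion checking never unfolds the polynomials.
abstract
  γ : ℕ → ℕ → ℕ
  γ E 0 = 0
  γ E 1 = 4
  γ E 2 = 18 ⊔ (2 * E + 4)
  γ E (suc x@(suc (suc _))) = x * (2 * E + suc x * suc x)

  γ₀ : ∀ E → γ E 0 ≡ 0
  γ₀ E = refl

  γ₁ : ∀ E → γ E 1 ≡ 4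
  γ₁ E = refl

  γ₂ : ∀ E → γ E 2 ≡ 18 ⊔ (2 * E + 4)
  γ₂ E = refl

  γ₃₊ : ∀ E x → γ E (3 + x) ≡ (2 + x) * (2 * E + (3 + x) * (3 + x))
  γ₃₊ E x = refl

-- The linear estimate at a vertex of medium degree

private
  LowStart : ℕ → ℕ → Set
  LowStart z y = 6 * (z + suc y) * z * 1 + 2 * ((z + suc y) * (z + suc y))
    ≤ 2 * ((z + suc y) * (z + suc y)) * 1 + 3 * (z * suc z * (suc z + 2 * y))

  LowEnd : ℕ → ℕ → Set
  LowEnd z y = 6 * (z + suc y) * z * (2 + z) + 2 * ((z + suc y) * (z + suc y))
    ≤ 2 * ((z + suc y) * (z + suc y)) * (2 + z) + 3 * (z * suc z * (suc z + 2 * y))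

  HighStart : ℕ → ℕ → Set
  HighStart z y = 6 * (z + suc y) * z * 1 + (2 * (2 * ((z + suc y) * (z + suc y))) + 3 * z * ((z + suc y) * (z + suc y) + z * suc y))
    ≤ 2 * (2 * ((z + suc y) * (z + suc y))) * 1 + (6 * (z * suc z * (suc z + 2 * y)) + 3 * z * (2 * z + 1))

  HighEnd : ℕ → ℕ → Set
  HighEnd z y = 6 * (z + suc y) * z * (2 + z) + (2 * (2 * ((z + suc y) * (z + suc y))) + 3 * z * ((z + suc y) * (z + suc y) + z * suc y))
    ≤ 2 * (2 * ((z + suc y) * (z + suc y))) * (2 + z) + (6 * (z * suc z * (suc z + 2 * y)) + 3 * z * (2 * z + 1))

  low-start-eq : ∀ z y → 6 * ((1 + z) + suc y) * (1 + z) * 1 + 2 * (((1 + z) + suc y) * ((1 + z) + suc y))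
    + (6 * y * z * z + 3 * z * z * z + 12 * y * z + 9 * z * z + 6 * y + 6 * z)
    ≡ 2 * (((1 + z) + suc y) * ((1 + z) + suc y)) * 1 + 3 * ((1 + z) * suc (1 + z) * (suc (1 + z) + 2 * y))
  low-start-eq = solve-∀

  low-end-eq₁ : ∀ y → 6 * (1 + suc (2 + y)) * 1 * (2 + 1) + 2 * ((1 + suc (2 + y)) * (1 + suc (2 + y)))
    + (4 * y * y + 26 * y + 28)
    ≡ 2 * ((1 + suc (2 + y)) * (1 + suc (2 + y))) * (2 + 1) + 3 * (1 * suc 1 * (suc 1 + 2 * (2 + y)))
  low-end-eq₁ = solve-∀

  low-end-eq₂ : ∀ z t → 6 * ((2 + z) + suc (2 + z + t)) * (2 + z) * (2 + (2 + z)) + 2 * (((2 + z) + suc (2 + z + t)) * ((2 + z) + suc (2 + z + t)))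
    + (8 * t * z * z + 2 * t * t * z + 5 * z * z * z + 38 * t * z + 6 * t * t + 28 * z * z + 48 * t + 53 * z + 36)
    ≡ 2 * (((2 + z) + suc (2 + z + t)) * ((2 + z) + suc (2 + z + t))) * (2 + (2 + z)) + 3 * ((2 + z) * suc (2 + z) * (suc (2 + z) + 2 * (2 + z + t)))
  low-end-eq₂ = solve-∀

  high-start-eq : ∀ y t → 6 * ((suc y + t) + suc y) * (suc y + t) * 1 + (2 * (2 * (((suc y + t) + suc y) * ((suc y + t) + suc y))) + 3 * (suc y + t) * (((suc y + t) + suc y) * ((suc y + t) + suc y) + (suc y + t) * suc y))
    + (12 * t * y * y + 12 * t * t * y + 3 * t * t * t + 3 * y * y * y + 30 * t * y + 12 * t * t + 15 * y * y + 15 * t + 18 * y + 6)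
    ≡ 2 * (2 * (((suc y + t) + suc y) * ((suc y + t) + suc y))) * 1 + (6 * ((suc y + t) * suc (suc y + t) * (suc (suc y + t) + 2 * y)) + 3 * (suc y + t) * (2 * (suc y + t) + 1))
  high-start-eq = solve-∀

  high-end-eq : ∀ y t → 6 * ((suc y + t) + suc y) * (suc y + t) * (2 + (suc y + t)) + (2 * (2 * (((suc y + t) + suc y) * ((suc y + t) + suc y))) + 3 * (suc y + t) * (((suc y + t) + suc y) * ((suc y + t) + suc y) + (suc y + t) * suc y))
    + (14 * t * y * y + 8 * t * t * y + t * t * t + 7 * y * y * y + 32 * t * y + 6 * t * t + 31 * y * y + 15 * t + 38 * y + 14)
    ≡ 2 * (2 * (((suc y + t) + suc y) * ((suc y + t) + suc y))) * (2 + (suc y + t)) + (6 * ((suc y + t) * suc (suc y + t) * (suc (suc y + t) + 2 * y)) + 3 * (suc y + t) * (2 * (suc y + t) + 1))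
  high-end-eq = solve-∀

  low-end : ∀ z y → 1 ≤ z → z ≤ y → 4 ≤ z + suc y → LowEnd z y
  low-end 1 y _ _ (s≤s 3≤y) = gap-elim (LowEnd 1) 2 (λ y → slack _ (low-end-eq₁ y)) (s≤s⁻¹ 3≤y)
  low-end z@(suc (suc _)) y _ z≤y _ =
    gap-elim (λ z → ∀ y → z ≤ y → LowEnd z y) 2
      (λ z y → gap-elim (LowEnd (2 + z)) (2 + z) λ t → slack _ (low-end-eq₂ z t)) {z} (s≤s (s≤s z≤n)) y z≤y

slope-low : ∀ z y₀ → 1 ≤ z → z ≤ y₀ → 4 ≤ z + suc y₀ → ∀ s → 1 ≤ s → s ≤ 2 + z → let E = z + suc y₀ in
  6 * E * z * s + ℓ E ≤ ℓ E * s + 3 * medψ z y₀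
slope-low z y₀ 1≤z z≤y₀ 4≤E = linear-between (6 * E * z) (ℓ E) (ℓ E) (3 * medψ z y₀) (2 + z)
  (gap-elim (λ z → LowStart z y₀) 1 (λ z → slack _ (low-start-eq z y₀)) 1≤z) (low-end z y₀ 1≤z z≤y₀ 4≤E)
  where
  E = z + suc y₀

-- For `z > y₀` the term `A` of `slope` is kept. Here it stands replaced by its lower bound from
-- `budget`, the origin of `E * E + z * suc y₀` and `2 * z + 1`; as that bound is on `2 * A`,
-- everything is doubled.
slope-high : ∀ z y₀ → suc y₀ ≤ z → ∀ s → 1 ≤ s → s ≤ 2 + z → let E = z + suc y₀ in
  6 * E * z * s + (2 * ℓ E + 3 * z * (E * E + z * suc y₀)) ≤ 2 * ℓ E * s + (6 * medψ z y₀ + 3 * z * (2 * z + 1))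
slope-high z y₀ y₀<z = linear-between (6 * E * z) (2 * ℓ E + 3 * z * (E * E + z * suc y₀)) (2 * ℓ E)
  (6 * medψ z y₀ + 3 * z * (2 * z + 1)) (2 + z)
  (gap-elim (λ z → HighStart z y₀) (suc y₀) (λ t → slack _ (high-start-eq y₀ t)) y₀<z)
  (gap-elim (λ z → HighEnd z y₀) (suc y₀) (λ t → slack _ (high-end-eq y₀ t)) y₀<z)
  where
  E = z + suc y₀

private
  KSplit : ℕ → ℕ → Set
  KSplit y z = suc (z + suc y) * (z + suc y) * pred (z + suc y) + suc y * (2 * z + 1)
    ≡ z * suc z * (suc z + 2 * y) + suc y * ((z + suc y) * (z + suc y) + z * suc y)

  K-split-eq : ∀ z y → suc (1 + z + suc y) * (1 + z + suc y) * (z + suc y) + suc y * (2 * (1 + z) + 1)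
    ≡ (1 + z) * suc (1 + z) * (suc (1 + z) + 2 * y) + suc y * ((1 + z + suc y) * (1 + z + suc y) + (1 + z) * suc y)
  K-split-eq = solve-∀

-- `K` and `medψ` are values of one polynomial at arguments that differ by `suc y₀`, so their
-- difference is divisible by `suc y₀`. This allows a bound of a cost by `K` to be divided by
-- `suc y₀`.
K-split : ∀ z y₀ → 1 ≤ z → let E = z + suc y₀ in K E + suc y₀ * (2 * z + 1) ≡ medψ z y₀ + suc y₀ * (E * E + z * suc y₀)
K-split z y₀ = gap-elim (KSplit y₀) 1 (λ z → K-split-eq z y₀)

-- A and Y are the sums of z and y over the s neighbours in S; y + z ≥ E for each of them.
slope : ∀ z y₀ s A Y → let E = z + suc y₀ in 1 ≤ z → 4 ≤ E → 1 ≤ s → s ≤ 2 + z →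
  E * s ≤ Y + A → medψ z y₀ + 2 * (suc y₀ * Y) ≤ K E →
  6 * E * z * s + ℓ E ≤ ℓ E * s + (3 * medψ z y₀ + 3 * z * A)
slope z y₀ s A Y 1≤z 4≤E 1≤s s≤z+2 Es≤Y+A τ≤K with ≤-<-connex z y₀
... | inj₁ z≤y₀ = ≤-trans (slope-low z y₀ 1≤z z≤y₀ 4≤E s 1≤s s≤z+2)
  (+-monoʳ-≤ (ℓ (z + suc y₀) * s) (m≤m+n _ _))
... | inj₂ y₀<z = *-cancelˡ-≤ 2 (+-cancelʳ-≤ (3 * z * κ + 3 * z * (2 * z + 1)) _ _ (begin
    2 * (6 * E * z * s + ℓ E) + (3 * z * κ + 3 * z * (2 * z + 1))
      ≡⟨ eq₁ E z s (ℓ E) κ (2 * z + 1) ⟩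
    (6 * E * z * s + (2 * ℓ E + 3 * z * κ)) + 3 * z * (2 * (E * s) + (2 * z + 1))
      ≤⟨ +-mono-≤ (slope-high z y₀ y₀<z s 1≤s s≤z+2) (*-monoʳ-≤ (3 * z) budget) ⟩
    (2 * ℓ E * s + (6 * medψ z y₀ + 3 * z * (2 * z + 1))) + 3 * z * (2 * A + κ)
      ≡⟨ eq₂ z s (ℓ E) κ (2 * z + 1) (medψ z y₀) A ⟩
    2 * (ℓ E * s + (3 * medψ z y₀ + 3 * z * A)) + (3 * z * κ + 3 * z * (2 * z + 1)) ∎))
  where
  open ≤-Reasoning
  E = z + suc y₀
  κ = E * E + z * suc y₀
  eq₁ : ∀ E z s l κ c → 2 * (6 * E * z * s + l) + (3 * z * κ + 3 * z * c)
      ≡ (6 * E * z * s + (2 * l + 3 * z * κ)) + 3 * z * (2 * (E * s) + c)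
  eq₁ = solve-∀
  eq₂ : ∀ z s l κ c ψ A → (2 * l * s + (6 * ψ + 3 * z * c)) + 3 * z * (2 * A + κ)
      ≡ 2 * (l * s + (3 * ψ + 3 * z * A)) + (3 * z * κ + 3 * z * c)
  eq₂ = solve-∀
  eq₃ : ∀ ψ y Es c → ψ + y * (2 * Es + c) ≡ ψ + 2 * (y * Es) + y * c
  eq₃ = solve-∀
  eq₄ : ∀ ψ y Y A c → ψ + 2 * (y * (Y + A)) + y * c ≡ (ψ + 2 * (y * Y)) + y * c + y * (2 * A)
  eq₄ = solve-∀
  eq₅ : ∀ ψ y κ A → ψ + y * κ + y * (2 * A) ≡ ψ + y * (2 * A + κ)
  eq₅ = solve-∀
  -- The bound `τ≤K` limits `Y` from above, so `E * s ≤ Y + A` limits `A` from below; by `K-split`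
  -- the factor `suc y₀` cancels.
  budget : 2 * (E * s) + (2 * z + 1) ≤ 2 * A + κ
  budget = *-cancelˡ-≤ (suc y₀) (+-cancelˡ-≤ (medψ z y₀) _ _ (begin
    medψ z y₀ + suc y₀ * (2 * (E * s) + (2 * z + 1))           ≡⟨ eq₃ (medψ z y₀) (suc y₀) (E * s) (2 * z + 1) ⟩
    medψ z y₀ + 2 * (suc y₀ * (E * s)) + suc y₀ * (2 * z + 1)
      ≤⟨ +-monoˡ-≤ _ (+-monoʳ-≤ (medψ z y₀) (*-monoʳ-≤ 2 (*-monoʳ-≤ (suc y₀) Es≤Y+A))) ⟩
    medψ z y₀ + 2 * (suc y₀ * (Y + A)) + suc y₀ * (2 * z + 1)  ≡⟨ eq₄ (medψ z y₀) (suc y₀) Y A (2 * z + 1) ⟩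
    (medψ z y₀ + 2 * (suc y₀ * Y)) + suc y₀ * (2 * z + 1) + suc y₀ * (2 * A)
      ≤⟨ +-monoˡ-≤ _ (+-monoˡ-≤ _ τ≤K) ⟩
    K E + suc y₀ * (2 * z + 1) + suc y₀ * (2 * A)              ≡⟨ cong (_+ suc y₀ * (2 * A)) (K-split z y₀ 1≤z) ⟩
    medψ z y₀ + suc y₀ * κ + suc y₀ * (2 * A)                  ≡⟨ eq₅ (medψ z y₀) (suc y₀) κ A ⟩
    medψ z y₀ + suc y₀ * (2 * A + κ)                           ∎))

-- The saving at a vertex of medium degree

private
  Gain₁ : ℕ → ℕ → Set
  Gain₁ z y = 1 * (2 * ((z + (1 + y)) * (z + (1 + y))))
    < ((z * (1 + z) * ((1 + z) + 2 * y)) + 2 * (1 * ((1 + y) * (z + (1 + y)))))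

  Gain₂< : ℕ → ℕ → Set
  Gain₂< z y = 2 * (2 * ((z + (1 + y)) * (z + (1 + y))))
    < ((z * (1 + z) * ((1 + z) + 2 * y)) + 2 * (2 * ((1 + y) * (z + (1 + y))))) + 4

  Gain₃< : ℕ → ℕ → Set
  Gain₃< z y = 3 * (2 * ((z + (1 + y)) * (z + (1 + y))))
    < ((z * (1 + z) * ((1 + z) + 2 * y)) + 2 * (3 * ((1 + y) * (z + (1 + y))))) + 18

  small-eq₁ : ∀ y → 1 * (2 * ((1 + (1 + (2 + y))) * (1 + (1 + (2 + y))))) + suc (2 * y + 3)
    ≡ ((1 * (1 + 1) * ((1 + 1) + 2 * (2 + y))) + 2 * (1 * ((1 + (2 + y)) * (1 + (1 + (2 + y))))))
  small-eq₁ = solve-∀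

  small-eq₂ : ∀ z y → 1 * (2 * (((2 + z) + (1 + y)) * ((2 + z) + (1 + y)))) + suc (2 * y * z * z + z * z * z + 8 * y * z + 6 * z * z + 8 * y + 11 * z + 5)
    ≡ (((2 + z) * (1 + (2 + z)) * ((1 + (2 + z)) + 2 * y)) + 2 * (1 * ((1 + y) * ((2 + z) + (1 + y)))))
  small-eq₂ = solve-∀

  small-eq₃ : ∀ y → 2 * (2 * ((1 + (1 + y)) * (1 + (1 + y)))) + (0)
    ≡ ((1 * (1 + 1) * ((1 + 1) + 2 * y)) + 2 * (2 * ((1 + y) * (1 + (1 + y))))) + 4
  small-eq₃ = solve-∀

  small-eq₄ : ∀ y → 2 * (2 * ((2 + (1 + (1 + y))) * (2 + (1 + (1 + y))))) + suc (4 * y + 1)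
    ≡ ((2 * (1 + 2) * ((1 + 2) + 2 * (1 + y))) + 2 * (2 * ((1 + (1 + y)) * (2 + (1 + (1 + y)))))) + 4
  small-eq₄ = solve-∀

  small-eq₅ : ∀ z y → 2 * (2 * (((3 + z) + (1 + y)) * ((3 + z) + (1 + y)))) + suc (2 * y * z * z + z * z * z + 10 * y * z + 7 * z * z + 12 * y + 12 * z + 3)
    ≡ (((3 + z) * (1 + (3 + z)) * ((1 + (3 + z)) + 2 * y)) + 2 * (2 * ((1 + y) * ((3 + z) + (1 + y))))) + 4
  small-eq₅ = solve-∀

  small-eq₆ : ∀ y → 3 * (2 * ((1 + (1 + y)) * (1 + (1 + y)))) + (0)
    ≡ ((1 * (1 + 1) * ((1 + 1) + 2 * y)) + 2 * (3 * ((1 + y) * (1 + (1 + y))))) + (2 * (1 + (1 + y)) + 4)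
  small-eq₆ = solve-∀

  small-eq₇ : ∀ y → 3 * (2 * ((2 + (1 + y)) * (2 + (1 + y)))) + (0)
    ≡ ((2 * (1 + 2) * ((1 + 2) + 2 * y)) + 2 * (3 * ((1 + y) * (2 + (1 + y))))) + 18
  small-eq₇ = solve-∀

  small-eq₈ : ∀ y → 3 * (2 * ((3 + (1 + (2 + y))) * (3 + (1 + (2 + y))))) + suc (6 * y + 5)
    ≡ ((3 * (1 + 3) * ((1 + 3) + 2 * (2 + y))) + 2 * (3 * ((1 + (2 + y)) * (3 + (1 + (2 + y)))))) + 18
  small-eq₈ = solve-∀

  small-eq₉ : ∀ y → 3 * (2 * ((4 + (1 + (1 + y))) * (4 + (1 + (1 + y))))) + suc (16 * y + 13)
    ≡ ((4 * (1 + 4) * ((1 + 4) + 2 * (1 + y))) + 2 * (3 * ((1 + (1 + y)) * (4 + (1 + (1 + y)))))) + 18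
  small-eq₉ = solve-∀

  small-eq₁₀ : ∀ z y → 3 * (2 * (((5 + z) + (1 + y)) * ((5 + z) + (1 + y)))) + suc (2 * y * z * z + z * z * z + 16 * y * z + 11 * z * z + 30 * y + 30 * z + 17)
    ≡ (((5 + z) * (1 + (5 + z)) * ((1 + (5 + z)) + 2 * y)) + 2 * (3 * ((1 + y) * ((5 + z) + (1 + y))))) + 18
  small-eq₁₀ = solve-∀

gain₁ : ∀ z y → 1 ≤ z → 4 ≤ z + suc y → 1 * ℓ (z + suc y) < medCost z y 1
gain₁ 1 y _ (s≤s 3≤y) = gap-elim (Gain₁ 1) 2 (λ y → slack< _ (small-eq₁ y)) (s≤s⁻¹ 3≤y)
gain₁ z@(suc (suc _)) y _ _ = gap-elim (λ z → Gain₁ z y) 2 (λ z → slack< _ (small-eq₂ z y)) {z} (s≤s (s≤s z≤n))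

gain₂ : ∀ y → 2 * ℓ (1 + suc y) ≤ medCost 1 y 2 + 4
gain₂ y = slack _ (small-eq₃ y)

gain₂< : ∀ z y → 2 ≤ z → 4 ≤ z + suc y → 2 * ℓ (z + suc y) < medCost z y 2 + 4
gain₂< 1 y (s≤s ()) _
gain₂< 2 y _ (s≤s (s≤s 2≤y)) = gap-elim (Gain₂< 2) 1 (λ y → slack< _ (small-eq₄ y)) (s≤s⁻¹ 2≤y)
gain₂< z@(suc (suc (suc _))) y _ _ = gap-elim (λ z → Gain₂< z y) 3 (λ z → slack< _ (small-eq₅ z y)) {z} (s≤s (s≤s (s≤s z≤n)))

gain₃₁ : ∀ y → 3 * ℓ (1 + suc y) ≤ medCost 1 y 3 + (2 * (1 + suc y) + 4)
gain₃₁ y = slack _ (small-eq₆ y)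

gain₃₂ : ∀ y → 3 * ℓ (2 + suc y) ≤ medCost 2 y 3 + 18
gain₃₂ y = slack _ (small-eq₇ y)

-- The strict inequality with `18` fails at `(z , y)` equal to `(3 , 0)`, `(3 , 1)` and `(4 , 0)`;
-- these vertices cost more than `K`.
gain₃< : ∀ z y → 3 ≤ z → 4 ≤ z + suc y →
  K (z + suc y) < medCost z y 3 ⊎ 3 * ℓ (z + suc y) < medCost z y 3 + 18
gain₃< 1 y (s≤s ()) _
gain₃< 2 y (s≤s (s≤s ())) _
gain₃< 3 0 _ _ = inj₁ (<ᵇ⇒< 60 72 _)
gain₃< 3 1 _ _ = inj₁ (<ᵇ⇒< 120 132 _)
gain₃< 3 (suc (suc y)) _ _ = inj₂ (slack< _ (small-eq₈ y))
gain₃< 4 0 _ _ = inj₁ (<ᵇ⇒< 120 130 _)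
gain₃< 4 (suc y) _ _ = inj₂ (slack< _ (small-eq₉ y))
gain₃< z@(suc (suc (suc (suc (suc _))))) y _ _ =
  inj₂ (gap-elim (λ z → Gain₃< z y) 5 (λ z → slack< _ (small-eq₁₀ z y)) {z} (s≤s (s≤s (s≤s (s≤s (s≤s z≤n))))))

-- With z = 1 + z′ and s = 1 + s′, the marginal gain of lowering z to s - 2 is 2 E z′ - A.
private
  Quartic : ℕ → ℕ → Set
  Quartic z s = ((1 + z) * (1 + z) + (1 + z) * (1 + s) + s * s) * (((1 + z) * (1 + z) + (1 + z) * (1 + s) + s * s) + (2 * z) * (1 + z))
    < (2 * z) * (2 * z) * ((2 + z) * (2 + z)) + 2 * ((1 + s) * (2 * z) * ((1 + z) * (1 + z) + (1 + z) * (1 + s) + s * s))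

  quartic-eq₁ : ∀ s i → ((1 + (3 + s + i)) * (1 + (3 + s + i)) + (1 + (3 + s + i)) * (1 + (4 + s)) + (4 + s) * (4 + s)) * (((1 + (3 + s + i)) * (1 + (3 + s + i)) + (1 + (3 + s + i)) * (1 + (4 + s)) + (4 + s) * (4 + s)) + (2 * (3 + s + i)) * (1 + (3 + s + i))) + suc (4 * i * s * s * s + 5 * i * i * s * s + 4 * i * i * i * s + i * i * i * i + s * s * s * s + 62 * i * s * s + 50 * i * i * s + 18 * i * i * i + 18 * s * s * s + 282 * i * s + 113 * i * i + 101 * s * s + 388 * i + 196 * s + 67)
    ≡ (2 * (3 + s + i)) * (2 * (3 + s + i)) * ((2 + (3 + s + i)) * (2 + (3 + s + i))) + 2 * ((1 + (4 + s)) * (2 * (3 + s + i)) * ((1 + (3 + s + i)) * (1 + (3 + s + i)) + (1 + (3 + s + i)) * (1 + (4 + s)) + (4 + s) * (4 + s)))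
  quartic-eq₁ = solve-∀

  quartic-eq₂ : ∀ i → ((1 + (3 + i)) * (1 + (3 + i)) + (1 + (3 + i)) * (1 + 3) + 3 * 3) * (((1 + (3 + i)) * (1 + (3 + i)) + (1 + (3 + i)) * (1 + 3) + 3 * 3) + (2 * (3 + i)) * (1 + (3 + i))) + suc (i * i * i * i + 18 * i * i * i + 116 * i * i + 346 * i + 202)
    ≡ (2 * (3 + i)) * (2 * (3 + i)) * ((2 + (3 + i)) * (2 + (3 + i))) + 2 * ((1 + 3) * (2 * (3 + i)) * ((1 + (3 + i)) * (1 + (3 + i)) + (1 + (3 + i)) * (1 + 3) + 3 * 3))
  quartic-eq₂ = solve-∀

  quartic : ∀ z s → 3 ≤ s → s ≤ suc z → ¬ (z ≡ 2 × s ≡ 3) → Quartic z s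
  quartic z s 3≤s s≤z+1 ne with m≤n⇒m<n∨m≡n 3≤s
  ... | inj₁ 4≤s = gap-elim (λ s → s ≤ suc z → Quartic z s) 4
    (λ s s≤z+1 → gap-elim (λ z → Quartic z (4 + s)) (3 + s) (λ i → slack< _ (quartic-eq₁ s i)) (s≤s⁻¹ s≤z+1)) 4≤s s≤z+1
  ... | inj₂ refl with m≤n⇒m<n∨m≡n (s≤s⁻¹ s≤z+1)
  ... | inj₁ 3≤z = gap-elim (λ z → Quartic z 3) 3 (λ i → slack< _ (quartic-eq₂ i)) 3≤z
  ... | inj₂ refl = contradiction (refl , refl) ne

  -- A cost of at most `K`, in the form `below`, bounds `E` from below; a marginal gain that is not
  -- positive bounds `E` from above. Eliminating `E` leaves `Quartic`, an inequality in `z` and `s`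
  -- alone, which holds except at `(2 , 3)`.
  marginal : ∀ E z s → 3 ≤ s → s ≤ suc z → ¬ (z ≡ 2 × s ≡ 3) →
    2 * (suc s * E) + suc (suc z) * suc (suc z) ≤ E * E + suc z * E →
    ¬ (E * (2 * z) ≤ ((1 + z) * (1 + z) + (1 + z) * (1 + s) + s * s))
  marginal E z s 3≤s s≤z+1 ne below EB≤A with ≤-total (2 * suc s) (E + suc z)
  ... | inj₂ E+z≤2s = <⇒≱ (begin-strict
      E * E + suc z * E                                <⟨ m<m+n _ (s≤s z≤n) ⟩
      E * E + suc z * E + suc (suc z) * suc (suc z)    ≡⟨ cong (_+ suc (suc z) * suc (suc z)) (factor E (suc z)) ⟩
      (E + suc z) * E + suc (suc z) * suc (suc z)      ≤⟨ +-monoˡ-≤ _ (*-monoˡ-≤ E E+z≤2s) ⟩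
      2 * suc s * E + suc (suc z) * suc (suc z)        ≡⟨ cong (_+ suc (suc z) * suc (suc z)) (*-assoc 2 (suc s) E) ⟩
      2 * (suc s * E) + suc (suc z) * suc (suc z)      ∎) below
    where
    open ≤-Reasoning
    factor : ∀ E z → E * E + z * E ≡ (E + z) * E
    factor = solve-∀
  ... | inj₁ 2s≤E+z with ≤⇒gap 2s≤E+z
  -- In terms of `d` the bound `below` reads `(2 + z)² ≤ E d`. The chain trades each product `E d`
  -- or `E (2 z)` for one without `E`.
  ... | d , 2s+d≡E+z = <⇒≱ (quartic z s 3≤s s≤z+1 ne) (begin
      (2 * z) * (2 * z) * ((2 + z) * (2 + z)) + 2 * (suc s * (2 * z) * ((1 + z) * (1 + z) + (1 + z) * suc s + s * s))
        ≤⟨ +-monoˡ-≤ _ (*-monoʳ-≤ ((2 * z) * (2 * z)) zz≤Ed) ⟩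
      (2 * z) * (2 * z) * (E * d) + 2 * (suc s * (2 * z) * ((1 + z) * (1 + z) + (1 + z) * (1 + s) + s * s))
        ≡⟨ eqA z E d (suc s) ((1 + z) * (1 + z) + (1 + z) * (1 + s) + s * s) ⟩
      (E * (2 * z)) * ((2 * z) * d) + 2 * (suc s * (2 * z) * ((1 + z) * (1 + z) + (1 + z) * (1 + s) + s * s))
        ≤⟨ +-monoˡ-≤ _ (*-monoˡ-≤ ((2 * z) * d) EB≤A) ⟩
      ((1 + z) * (1 + z) + (1 + z) * (1 + s) + s * s) * ((2 * z) * d) + 2 * (suc s * (2 * z) * ((1 + z) * (1 + z) + (1 + z) * (1 + s) + s * s))
        ≡⟨ eqB z d (suc s) ((1 + z) * (1 + z) + (1 + z) * (1 + s) + s * s) ⟩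
      ((1 + z) * (1 + z) + (1 + z) * (1 + s) + s * s) * ((2 * z) * (2 * suc s + d))
        ≡⟨ cong (λ k → ((1 + z) * (1 + z) + (1 + z) * (1 + s) + s * s) * ((2 * z) * k)) 2s+d≡E+z ⟩
      ((1 + z) * (1 + z) + (1 + z) * (1 + s) + s * s) * ((2 * z) * (E + suc z))
        ≡⟨ cong (((1 + z) * (1 + z) + (1 + z) * (1 + s) + s * s) *_) (eqC E z) ⟩
      ((1 + z) * (1 + z) + (1 + z) * (1 + s) + s * s) * (E * (2 * z) + (2 * z) * suc z)
        ≤⟨ *-monoʳ-≤ ((1 + z) * (1 + z) + (1 + z) * (1 + s) + s * s) (+-monoˡ-≤ _ EB≤A) ⟩
      ((1 + z) * (1 + z) + (1 + z) * (1 + s) + s * s) * (((1 + z) * (1 + z) + (1 + z) * (1 + s) + s * s) + (2 * z) * suc z) ∎)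
    where
    open ≤-Reasoning
    eqA : ∀ z E d s A → 2 * z * (2 * z) * (E * d) + 2 * (s * (2 * z) * A) ≡ (E * (2 * z)) * (2 * z * d) + 2 * (s * (2 * z) * A)
    eqA = solve-∀
    eqB : ∀ z d s A → A * (2 * z * d) + 2 * (s * (2 * z) * A) ≡ A * (2 * z * (2 * s + d))
    eqB = solve-∀
    eqC : ∀ E z → 2 * z * (E + suc z) ≡ E * (2 * z) + 2 * z * suc z
    eqC = solve-∀
    eqD : ∀ E s d → E * (2 * s + d) ≡ 2 * (s * E) + E * d
    eqD = solve-∀
    eqE : ∀ E z → E * (E + z) ≡ E * E + z * E
    eqE = solve-∀
    zz≤Ed : suc (suc z) * suc (suc z) ≤ E * d
    zz≤Ed = +-cancelˡ-≤ (2 * (suc s * E)) _ _ (begin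
      2 * (suc s * E) + suc (suc z) * suc (suc z)  ≤⟨ below ⟩
      E * E + suc z * E                            ≡⟨ eqE E (suc z) ⟨
      E * (E + suc z)                              ≡⟨ cong (E *_) 2s+d≡E+z ⟨
      E * (2 * suc s + d)                          ≡⟨ eqD E (suc s) d ⟩
      2 * (suc s * E) + E * d                      ∎)

private
  top-eq : ∀ z y → (2 + z) * (2 * ((z + suc y) * (z + suc y)))
    ≡ (z * suc z * (suc z + 2 * y) + 2 * ((2 + z) * (suc y * (z + suc y)))) + z * (2 * (z + suc y) + suc z * suc z)
  top-eq = solve-∀

  -- With `E` and `s ≡ 2 + w` fixed, the cost at degree `2 + w + i` differs from that at degree
  -- `2 + w` by `i` times the difference of the two last factors; `top-eq` is the case `i ≡ 0`.
  shift-eq : ∀ w i y → (let z = w + i ; E = z + suc y in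
    (z * suc z * (suc z + 2 * y) + 2 * ((2 + w) * (suc y * E)) + w * (2 * E + suc w * suc w))
      + i * (2 * E + 1 + z * z + z * (2 + w) + (2 + w) * (2 + w))
    ≡ (2 + w) * (2 * (E * E)) + i * (2 * E * z + 2 * (2 + w)))
  shift-eq = solve-∀

  below-K : ∀ z y s → 1 ≤ z → let E = z + suc y in medCost z y s ≤ K E → 2 * (s * E) + suc z * suc z ≤ E * E + z * E
  below-K z y s 1≤z c≤K = begin
    2 * (s * E) + suc z * suc z                ≡⟨ eq₁ (s * E) z ⟩
    (2 * (s * E) + (2 * z + 1)) + z * z        ≤⟨ +-monoˡ-≤ (z * z) cancelled ⟩
    (E * E + z * suc y) + z * z                ≡⟨ eq₂ (E * E) z y ⟩
    E * E + z * E                              ∎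
    where
    open ≤-Reasoning
    E = z + suc y
    eq₁ : ∀ a z → 2 * a + suc z * suc z ≡ (2 * a + (2 * z + 1)) + z * z
    eq₁ = solve-∀
    eq₂ : ∀ a z y → (a + z * suc y) + z * z ≡ a + z * (z + suc y)
    eq₂ = solve-∀
    eq₃ : ∀ ψ s y E c → ψ + y * (2 * (s * E) + c) ≡ (ψ + 2 * (s * (y * E))) + y * c
    eq₃ = solve-∀
    cancelled : 2 * (s * E) + (2 * z + 1) ≤ E * E + z * suc y
    cancelled = *-cancelˡ-≤ (suc y) $ +-cancelˡ-≤ (medψ z y) _ _ $ begin
      medψ z y + suc y * (2 * (s * E) + (2 * z + 1))  ≡⟨ eq₃ (medψ z y) s (suc y) E (2 * z + 1) ⟩
      medCost z y s + suc y * (2 * z + 1)             ≤⟨ +-monoˡ-≤ _ c≤K ⟩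
      K E + suc y * (2 * z + 1)                       ≡⟨ K-split z y 1≤z ⟩
      medψ z y + suc y * (E * E + z * suc y)          ∎

  8≤-root : ∀ E → 2 * (4 * E) + 4 * 4 ≤ E * E + 3 * E → 8 ≤ E
  8≤-root E h with ≤-<-connex 8 E
  ... | inj₁ 8≤E = 8≤E
  ... | inj₂ E<8 = contradiction (≤-trans (≤-trans (≤-reflexive (eq₁ E)) h) (≤-trans (+-monoˡ-≤ (3 * E) (*-monoˡ-≤ E (s≤s⁻¹ E<8))) (≤-reflexive (eq₂ E)))) λ h′ → <⇒≱ (bound E E<8) h′
    where
    eq₁ : ∀ E → 8 * E + 16 ≡ 2 * (4 * E) + 4 * 4
    eq₁ = solve-∀
    eq₂ : ∀ E → 7 * E + 3 * E ≡ 8 * E + 2 * E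
    eq₂ = solve-∀
    bound : ∀ E → E < 8 → 8 * E + 2 * E < 8 * E + 16
    bound E E<8 = +-monoʳ-< (8 * E) (*-monoʳ-< 2 E<8)

  marginal<′ : ∀ E z s → ¬ (E * (2 * z) ≤ ((1 + z) * (1 + z) + (1 + z) * (1 + s) + s * s)) →
    2 * E + 1 + suc z * suc z + suc z * suc s + suc s * suc s < 2 * E * suc z + 2 * suc s
  marginal<′ E z s A<EB = subst₂ _<_ (eq₁ E z s) (eq₂ E z s) (+-monoˡ-< (2 * E + 2 * suc s) (≰⇒> A<EB))
    where
    eq₁ : ∀ E z s → (1 + z) * (1 + z) + (1 + z) * (1 + s) + s * s + (2 * E + 2 * suc s)
      ≡ 2 * E + 1 + suc z * suc z + suc z * suc s + suc s * suc s
    eq₁ = solve-∀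
    eq₂ : ∀ E z s → E * (2 * z) + (2 * E + 2 * suc s) ≡ 2 * E * suc z + 2 * suc s
    eq₂ = solve-∀

  marginal< : ∀ E z s → 4 ≤ s → s ≤ suc z → 2 * (s * E) + suc z * suc z ≤ E * E + z * E →
    2 * E + 1 + z * z + z * s + s * s < 2 * E * z + 2 * s
  marginal< E zero _ (s≤s (s≤s _)) (s≤s ())
  marginal< E (suc z) (suc s) (s≤s 3≤s) (s≤s s≤z+1) below with z ≟ 2 | s ≟ 3
  -- The pair at which `Quartic` fails. Here a cost of at most `K` forces `8 ≤ E`, and this is
  -- enough.
  ... | yes refl | yes refl = gap-elim
    (λ E → 2 * E + 1 + 3 * 3 + 3 * 4 + 4 * 4 < 2 * E * 3 + 2 * 4) 8 (λ E → slack< (4 * E + 1) (eq E)) (8≤-root E below)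
    where
    eq : ∀ E → 2 * (8 + E) + 1 + 3 * 3 + 3 * 4 + 4 * 4 + suc (4 * E + 1) ≡ 2 * (8 + E) * 3 + 2 * 4
    eq = solve-∀
  ... | no z≢2 | _ = marginal<′ E z s (marginal E z s 3≤s s≤z+1 (λ e → z≢2 (proj₁ e)) below)
  ... | yes _ | no s≢3 = marginal<′ E z s (marginal E z s 3≤s s≤z+1 (λ e → s≢3 (proj₂ e)) below)

gain-top : ∀ z y → medCost z y (2 + z) + z * (2 * (z + suc y) + suc z * suc z) ≡ (2 + z) * ℓ (z + suc y)
gain-top z y = sym (top-eq z y)

private
  shift : ∀ w i y z → w + i ≡ z → 1 ≤ i → let E = z + suc y in
    2 * E + 1 + z * z + z * (2 + w) + (2 + w) * (2 + w) < 2 * E * z + 2 * (2 + w) →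
    (2 + w) * ℓ E < medCost z y (2 + w) + w * (2 * E + suc w * suc w)
  shift w i y z refl 1≤i N<M = +-cancelʳ-< (i * (2 * E * z + 2 * (2 + w))) _ _ (begin-strict
    (2 + w) * ℓ E + i * (2 * E * z + 2 * (2 + w))                       ≡⟨ shift-eq w i y ⟨
    medCost z y (2 + w) + w * (2 * E + suc w * suc w) + i * (2 * E + 1 + z * z + z * (2 + w) + (2 + w) * (2 + w))
      <⟨ +-monoʳ-< (medCost z y (2 + w) + w * (2 * E + suc w * suc w)) (*-monoʳ-< i {{>-nonZero 1≤i}} N<M) ⟩
    medCost z y (2 + w) + w * (2 * E + suc w * suc w) + i * (2 * E * z + 2 * (2 + w)) ∎)
    where
    open ≤-Reasoning
    E = z + suc y

18≤γ₂ : ∀ E → 18 ≤ γ E 2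
18≤γ₂ E = ≤-trans (m≤m⊔n 18 (2 * E + 4)) (≤-reflexive (sym (γ₂ E)))

2E+4≤γ₂ : ∀ E → 2 * E + 4 ≤ γ E 2
2E+4≤γ₂ E = ≤-trans (m≤n⊔m 18 (2 * E + 4)) (≤-reflexive (sym (γ₂ E)))

-- By `x ≤ z` some edge at the vertex leaves S. Lowering the degree to `1 + x`, the least that
-- admits `1 + x` edges in S, strictly reduces the cost, and there the saving is exactly `γ`.
gain≥₃< : ∀ z y x → 3 ≤ x → x ≤ z → let E = z + suc y in
  K E < medCost z y (suc x) ⊎ suc x * ℓ E < medCost z y (suc x) + γ E x
gain≥₃< z y x 3≤x x≤z with ≤-<-connex (medCost z y (suc x)) (K (z + suc y))
... | inj₂ K<c = inj₁ K<c
... | inj₁ c≤K = inj₂ (gap-elim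
    (λ x → x ≤ z → medCost z y (suc x) ≤ K (z + suc y) → suc x * ℓ (z + suc y) < medCost z y (suc x) + γ (z + suc y) x)
    3 below 3≤x x≤z c≤K)
  where
  below : ∀ t → 3 + t ≤ z → medCost z y (4 + t) ≤ K (z + suc y) →
    (4 + t) * ℓ (z + suc y) < medCost z y (4 + t) + γ (z + suc y) (3 + t)
  below t x≤z c≤K = subst (λ g → (4 + t) * ℓ (z + suc y) < medCost z y (4 + t) + g) (sym (γ₃₊ (z + suc y) t))
    (shift (2 + t) (z ∸ (2 + t)) y z (m+[n∸m]≡n (≤-trans (n≤1+n _) x≤z)) (m<n⇒0<n∸m x≤z)
      (marginal< (z + suc y) z (4 + t) (s≤s (s≤s (s≤s (s≤s z≤n)))) (s≤s x≤z)
        (below-K z y (4 + t) (≤-trans (s≤s z≤n) x≤z) c≤K)))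

-- The excluded shapes `x ≡ z` and `x ≡ suc z` are those of the medium vertex in 𝒯‴ and in 𝒯′; only
-- they can tie.
gain< : ∀ z y x → 1 ≤ z → 4 ≤ z + suc y → x ≤ suc z → x ≢ z → x ≢ suc z → let E = z + suc y in
  K E < medCost z y (suc x) ⊎ suc x * ℓ E < medCost z y (suc x) + γ E x
gain< z y 0 1≤z 4≤E _ _ _ = inj₂ (<-≤-trans (gain₁ z y 1≤z 4≤E) (m≤m+n _ _))
gain< z y 1 1≤z 4≤E _ 1≢z _ = inj₂ (subst (λ g → 2 * ℓ (z + suc y) < medCost z y 2 + g) (sym (γ₁ (z + suc y)))
  (gain₂< z y (≤∧≢⇒< 1≤z 1≢z) 4≤E))
gain< z y 2 1≤z 4≤E _ 2≢z 2≢z+1 = map₂ (λ h → <-≤-trans h (+-monoʳ-≤ (medCost z y 3) (18≤γ₂ (z + suc y))))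
  (gain₃< z y (≤∧≢⇒< (≤∧≢⇒< 1≤z (λ e → 2≢z+1 (cong suc e))) 2≢z) 4≤E)
gain< z y x@(suc (suc (suc _))) _ _ x≤z+1 _ x≢z+1 = gain≥₃< z y x (s≤s (s≤s (s≤s z≤n))) (s≤s⁻¹ (≤∧≢⇒< x≤z+1 x≢z+1))

private
  gain-z : ∀ z y → 1 ≤ z → 4 ≤ z + suc y → let E = z + suc y in
    K E < medCost z y (suc z) ⊎ suc z * ℓ E ≤ medCost z y (suc z) + γ E z
  gain-z z y 1≤z _ with ≤-<-connex 3 z
  ... | inj₁ 3≤z = map₂ <⇒≤ (gain≥₃< z y z 3≤z ≤-refl)
  gain-z 1 y _ _ | inj₂ _ = inj₂ (subst (λ g → 2 * ℓ (1 + suc y) ≤ medCost 1 y 2 + g) (sym (γ₁ (1 + suc y))) (gain₂ y))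
  gain-z 2 y _ _ | inj₂ _ = inj₂ (≤-trans (gain₃₂ y) (+-monoʳ-≤ (medCost 2 y 3) (18≤γ₂ (2 + suc y))))
  gain-z (suc (suc (suc _))) y _ _ | inj₂ (s≤s (s≤s (s≤s ())))

gain-top≡ : ∀ z y → 2 ≤ z → medCost z y (2 + z) + γ (z + suc y) (suc z) ≡ (2 + z) * ℓ (z + suc y)
gain-top≡ z y 2≤z = trans (cong (medCost z y (2 + z) +_)
  (gap-elim (λ z → γ (z + suc y) (suc z) ≡ z * (2 * (z + suc y) + suc z * suc z)) 2 (λ t → γ₃₊ (2 + t + suc y) t) 2≤z)) (gain-top z y)

gain : ∀ z y x → 1 ≤ z → 4 ≤ z + suc y → x ≤ suc z → let E = z + suc y in
  K E < medCost z y (suc x) ⊎ suc x * ℓ E ≤ medCost z y (suc x) + γ E x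
gain z y x 1≤z 4≤E x≤z+1 with x ≟ z | x ≟ suc z
... | no x≢z | no x≢z+1 = map₂ <⇒≤ (gain< z y x 1≤z 4≤E x≤z+1 x≢z x≢z+1)
... | yes refl | _ = gain-z z y 1≤z 4≤E
... | no _ | yes refl with m≤n⇒m<n∨m≡n 1≤z
...   | inj₁ 2≤z = inj₂ (≤-reflexive (sym (gain-top≡ z y 2≤z)))
...   | inj₂ refl = inj₂ (≤-trans (gain₃₁ y) (+-monoʳ-≤ (medCost 1 y 3) (2E+4≤γ₂ (1 + suc y))))

-- Superadditivity and growth of `γ`

private
  super-eq₁ : ∀ E → 4 + (2 * E + 10) + suc (2 * E + 3)
    ≡ 2 * (2 * E + 9)
  super-eq₁ = solve-∀

  super-eq₂ : ∀ E x → 4 + (2 + x) * (2 * E + (3 + x) * (3 + x)) + suc (3 * x * x + 2 * E + 19 * x + 25)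
    ≡ (3 + x) * (2 * E + (4 + x) * (4 + x))
  super-eq₂ = solve-∀

  super-eq₃ : ∀ E → (2 * E + 10) + (2 * E + 10) + suc (2 * E + 27)
    ≡ 3 * (2 * E + 16)
  super-eq₃ = solve-∀

  super-eq₄ : ∀ E x → (2 * E + 10) + (2 + x) * (2 * E + (3 + x) * (3 + x)) + suc (6 * x * x + 2 * E + 44 * x + 71)
    ≡ (4 + x) * (2 * E + (5 + x) * (5 + x))
  super-eq₄ = solve-∀

  super-eq₅ : ∀ E x y → (2 + x) * (2 * E + (3 + x) * (3 + x)) + (2 + y) * (2 * E + (3 + y) * (3 + y)) + suc (3 * x * y * y + 3 * x * x * y + 34 * x * y + 9 * x * x + 9 * y * y + 2 * E + 75 * x + 75 * y + 143)
    ≡ (2 + (x + (3 + y))) * (2 * E + (3 + (x + (3 + y))) * (3 + (x + (3 + y))))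
  super-eq₅ = solve-∀

  γ₂-eq : ∀ E → 18 + (2 * E)
    ≡ 2 * (4 + E) + 10
  γ₂-eq = solve-∀

  step-eq₀ : ∀ E → 4 + suc (2 * E * E + 16 * E + 27)
    ≡ 2 * ((4 + E) * (4 + E))
  step-eq₀ = solve-∀

  step-eq₁ : ∀ E → 2 * (4 + E) + 10 + suc (2 * E * E + 14 * E + 17)
    ≡ 2 * ((4 + E) * (4 + E)) + 4
  step-eq₁ = solve-∀

  step-eq₂ : ∀ E → 2 * (2 * (4 + E) + 9) + suc (2 * E * E + 12 * E + 15)
    ≡ 2 * ((4 + E) * (4 + E)) + 18
  step-eq₂ = solve-∀

  -- A linear bound spares the case distinction on the maximum; it equals `18` at `E ≡ 4`.
  γ₂≤ : ∀ E → 4 ≤ E → γ E 2 ≤ 2 * E + 10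
  γ₂≤ E 4≤E = ≤-trans (≤-reflexive (γ₂ E)) (⊔-lub (gap-elim (λ E → 18 ≤ 2 * E + 10) 4 (λ E → slack _ (γ₂-eq E)) 4≤E)
    (+-monoʳ-≤ (2 * E) (≤ᵇ⇒≤ 4 10 _)))

  via : ∀ {a b c a′ b′ c′} → a ≤ a′ → b ≤ b′ → c ≡ c′ → a′ + b′ < c′ → a + b < c
  via a≤a′ b≤b′ refl h = ≤-<-trans (+-mono-≤ a≤a′ b≤b′) h

  γ-super′ : ∀ E x y → 4 ≤ E → 1 ≤ x → x ≤ y → γ E x + γ E y < γ E (x + y)
  γ-super′ E 1 1 _ _ _ = <-≤-trans (via {c = 18} (≤-reflexive (γ₁ E)) (≤-reflexive (γ₁ E)) refl (<ᵇ⇒< 8 18 _)) (18≤γ₂ E)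
  γ-super′ E 1 2 4≤E _ _ = via (≤-reflexive (γ₁ E)) (γ₂≤ E 4≤E) (γ₃₊ E 0) (slack< _ (super-eq₁ E))
  γ-super′ E 1 (suc (suc (suc x))) _ _ _ = via (≤-reflexive (γ₁ E)) (≤-reflexive (γ₃₊ E x)) (γ₃₊ E (1 + x)) (slack< _ (super-eq₂ E x))
  γ-super′ E 2 1 _ _ (s≤s ())
  γ-super′ E 2 2 4≤E _ _ = via (γ₂≤ E 4≤E) (γ₂≤ E 4≤E) (γ₃₊ E 1) (slack< _ (super-eq₃ E))
  γ-super′ E 2 (suc (suc (suc x))) 4≤E _ _ = via (γ₂≤ E 4≤E) (≤-reflexive (γ₃₊ E x)) (γ₃₊ E (2 + x)) (slack< _ (super-eq₄ E x))
  γ-super′ E (suc (suc (suc _))) 1 _ _ (s≤s ())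
  γ-super′ E (suc (suc (suc _))) 2 _ _ (s≤s (s≤s ()))
  γ-super′ E (suc (suc (suc x))) (suc (suc (suc y))) _ _ _ =
    via (≤-reflexive (γ₃₊ E x)) (≤-reflexive (γ₃₊ E y)) (γ₃₊ E (x + (3 + y))) (slack< _ (super-eq₅ E x y))

γ-superadditive : ∀ E x y → 4 ≤ E → 1 ≤ x → 1 ≤ y → γ E x + γ E y < γ E (x + y)
γ-superadditive E x y 4≤E 1≤x 1≤y with ≤-total x y
... | inj₁ x≤y = γ-super′ E x y 4≤E 1≤x x≤y
... | inj₂ y≤x = subst₂ _<_ (+-comm (γ E y) (γ E x)) (cong (γ E) (+-comm y x)) (γ-super′ E y x 4≤E 1≤y y≤x)

private
  peak-eq : ∀ x y → suc (x + suc y) * (x + suc y) * (x + y) + x * (2 * (x + suc y) + suc x * suc x)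
      + suc y * (x * x + 6 * x + 4 * suc y + 1)
    ≡ (2 + x) * (2 * ((x + suc y) * (x + suc y))) + suc y * (x * suc y + suc y * suc y)
  peak-eq = solve-∀

  peak-bound : ∀ x y → 2 * ((x + y) * (x + y)) ≤ 2 * (x + y) + 3 * (x * x) + x → x * y + y * y < x * x + 6 * x + 4 * y + 1
  peak-bound x y h = begin-strict
    x * y + y * y                      ≤⟨ slack (3 * (x * y) + y * y) (eq₁ x y) ⟩
    4 * (x * y) + 2 * (y * y)          ≤⟨ +-cancelˡ-≤ (2 * (x * x)) _ _ (subst₂ _≤_ (eq₂ x y) (eq₃ x y) h) ⟩
    x * x + 3 * x + 2 * y              <⟨ slack< (3 * x + 2 * y) (eq₄ x y) ⟩
    x * x + 6 * x + 4 * y + 1          ∎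
    where
    open ≤-Reasoning
    eq₁ : ∀ x y → x * y + y * y + (3 * (x * y) + y * y) ≡ 4 * (x * y) + 2 * (y * y)
    eq₁ = solve-∀
    eq₂ : ∀ x y → 2 * ((x + y) * (x + y)) ≡ 2 * (x * x) + (4 * (x * y) + 2 * (y * y))
    eq₂ = solve-∀
    eq₃ : ∀ x y → 2 * (x + y) + 3 * (x * x) + x ≡ 2 * (x * x) + (x * x + 3 * x + 2 * y)
    eq₃ = solve-∀
    eq₄ : ∀ x y → x * x + 3 * x + 2 * y + suc (3 * x + 2 * y) ≡ x * x + 6 * x + 4 * y + 1
    eq₄ = solve-∀

  -- The right side of the hypothesis is the increment from `γ E x` to `γ E (1 + x)`. When it
  -- reaches `ℓ E`, the monotonicity in `γ-step` breaks down, and its other alternative takes over.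
  peak : ∀ E x y → E ≡ x + suc y → ℓ E ≤ 2 * E + 3 * (x * x) + x →
    suc E * E * (x + y) + x * (2 * E + suc x * suc x) < (2 + x) * ℓ E
  peak E x y refl h = +-cancelʳ-< (suc y * (x * suc y + suc y * suc y)) _ _
    (<-≤-trans
      (+-monoʳ-< (suc (x + suc y) * (x + suc y) * (x + y) + x * (2 * (x + suc y) + suc x * suc x)) (*-monoʳ-< (suc y) (peak-bound x (suc y) h)))
      (≤-reflexive (peak-eq x y)))

  K-pred : ∀ E x y → E ≡ x + suc y → K E ≡ suc E * E * (x + y)
  K-pred E x y refl = cong (λ k → suc (x + suc y) * (x + suc y) * pred k) (+-suc x y)

  step-eq₃ : ∀ E x → (3 + x) * (2 * E + (4 + x) * (4 + x))
    ≡ (2 * E + 3 * ((3 + x) * (3 + x)) + (3 + x)) + (2 + x) * (2 * E + (3 + x) * (3 + x))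
  step-eq₃ = solve-∀

-- ℓ + (x ℓ - γ x), the cost of a single medium vertex with 1 + x edges in S, increases until it exceeds K.
γ-step : ∀ E x → 4 ≤ E → suc x ≤ E →
  K E + γ E (suc x) < suc (suc x) * ℓ E ⊎ γ E (suc x) < ℓ E + γ E x
γ-step E 0 4≤E _ = inj₂ (≤-<-trans (≤-reflexive (γ₁ E))
  (<-≤-trans (gap-elim (λ E → 4 < 2 * (E * E)) 4 (λ E → slack< _ (step-eq₀ E)) 4≤E) (m≤m+n (ℓ E) (γ E 0))))
γ-step E 1 4≤E _ = inj₂ (≤-<-trans (γ₂≤ E 4≤E)
  (<-≤-trans (gap-elim (λ E → 2 * E + 10 < 2 * (E * E) + 4) 4 (λ E → slack< _ (step-eq₁ E)) 4≤E)
    (+-monoʳ-≤ (ℓ E) (≤-reflexive (sym (γ₁ E))))))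
γ-step E 2 4≤E _ = inj₂ (≤-<-trans (≤-reflexive (γ₃₊ E 0))
  (<-≤-trans (gap-elim (λ E → 2 * (2 * E + 9) < 2 * (E * E) + 18) 4 (λ E → slack< _ (step-eq₂ E)) 4≤E)
    (+-monoʳ-≤ (ℓ E) (18≤γ₂ E))))
γ-step E (suc (suc (suc x))) _ x<E with ≤-<-connex (ℓ E) (2 * E + 3 * ((3 + x) * (3 + x)) + (3 + x))
... | inj₂ small = inj₂ (subst₂ (λ a b → a < ℓ E + b) (sym (trans (γ₃₊ E (1 + x)) (step-eq₃ E x))) (sym (γ₃₊ E x))
  (+-monoˡ-< ((2 + x) * (2 * E + (3 + x) * (3 + x))) small))
... | inj₁ large = inj₁ (subst₂ (λ k g → k + g < (5 + x) * ℓ E) (sym (K-pred E (3 + x) (E ∸ (4 + x)) eq)) (sym (γ₃₊ E (1 + x)))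
    (peak E (3 + x) (E ∸ (4 + x)) eq large))
  where
  eq : E ≡ 3 + x + suc (E ∸ (4 + x))
  eq = sym (trans (+-suc (3 + x) (E ∸ (4 + x))) (m+[n∸m]≡n x<E))

-- Iterates `γ-step` down from `x`. If the bound exceeds `K` at an intermediate point, the
-- increasing steps above that point carry this up to `x`.
γ-mono : ∀ E x i → 4 ≤ E → i < x → x ≤ E →
  K E + γ E x < suc x * ℓ E ⊎ i * ℓ E + γ E x < x * ℓ E + γ E i
γ-mono E (suc x) i 4≤E (s≤s i≤x) x<E with γ-step E x 4≤E x<E
... | inj₁ above = inj₁ above
... | inj₂ step with m≤n⇒m<n∨m≡n i≤x
... | inj₂ refl = inj₂ (subst (x * ℓ E + γ E (suc x) <_) (eq (ℓ E) (x * ℓ E) (γ E x)) (+-monoʳ-< (x * ℓ E) step))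
  where
  eq : ∀ l a g → a + (l + g) ≡ l + a + g
  eq = solve-∀
... | inj₁ i<x with γ-mono E x i 4≤E i<x (<⇒≤ x<E)
... | inj₁ above = inj₁ (begin-strict
    K E + γ E (suc x)        <⟨ +-monoʳ-< (K E) step ⟩
    K E + (ℓ E + γ E x)      ≡⟨ eq (K E) (ℓ E) (γ E x) ⟩
    ℓ E + (K E + γ E x)      <⟨ +-monoʳ-< (ℓ E) above ⟩
    suc (suc x) * ℓ E        ∎)
  where
  open ≤-Reasoning
  eq : ∀ k l g → k + (l + g) ≡ l + (k + g)
  eq = solve-∀
... | inj₂ below = inj₂ (+-cancelʳ-< (γ E x) _ _ (begin-strict
    i * ℓ E + γ E (suc x) + γ E x              ≡⟨ eq₁ (i * ℓ E) (γ E (suc x)) (γ E x) ⟩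
    (i * ℓ E + γ E x) + γ E (suc x)            <⟨ +-mono-< below step ⟩
    (x * ℓ E + γ E i) + (ℓ E + γ E x)          ≡⟨ eq₂ (ℓ E) (x * ℓ E) (γ E i) (γ E x) ⟩
    (ℓ E + x * ℓ E + γ E i) + γ E x            ∎))
  where
  open ≤-Reasoning
  eq₁ : ∀ a b c → a + b + c ≡ (a + c) + b
  eq₁ = solve-∀
  eq₂ : ∀ l a b c → (a + b) + (l + c) ≡ (l + a + b) + c
  eq₂ = solve-∀

-- A part of the forest on S that pays W for x edges; one further edge, paid by ℓ, is shared by all parts.
Covers Covers< : ℕ → ℕ → ℕ → Set
Covers E x W = ∀ i → i ≤ x → K E < ℓ E + W ⊎ i * ℓ E ≤ W + γ E i
Covers< E x W = ∀ i → i ≤ x → K E < ℓ E + W ⊎ i * ℓ E < W + γ E i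

weaken : ∀ {E x W} → Covers< E x W → Covers E x W
weaken c i i≤x = map₂ <⇒≤ (c i i≤x)

covers-low : ∀ E e → Covers E e (e * ℓ E)
covers-low E e i i≤e = inj₂ (≤-trans (*-monoˡ-≤ (ℓ E) i≤e) (m≤m+n _ _))

covers-+ : ∀ {E x y V W} → 4 ≤ E → Covers E x V → Covers E y W → 0 < V → 0 < W → Covers< E (x + y) (V + W)
covers-+ {E} {x} {y} {V} {W} 4≤E cx cy 0<V 0<W i i≤x+y with ≤-total i x
... | inj₁ i≤x with cx i i≤x
... | inj₁ K< = inj₁ (<-≤-trans K< (+-monoʳ-≤ (ℓ E) (m≤m+n V W)))
... | inj₂ h = inj₂ (≤-<-trans h (+-monoˡ-< (γ E i) (m<m+n V 0<W)))
covers-+ {E} {x} {y} {V} {W} 4≤E cx cy 0<V 0<W i i≤x+y | inj₂ x≤i with cx x ≤-refl | cy (i ∸ x) (m≤n+o⇒m∸n≤o i x i≤x+y)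
... | inj₁ K< | _ = inj₁ (<-≤-trans K< (+-monoʳ-≤ (ℓ E) (m≤m+n V W)))
... | inj₂ _ | inj₁ K< = inj₁ (<-≤-trans K< (+-monoʳ-≤ (ℓ E) (m≤n+m W V)))
... | inj₂ h₁ | inj₂ h₂ = inj₂ (subst (λ i → i * ℓ E < V + W + γ E i) (m+[n∸m]≡n x≤i) (combine x (i ∸ x) h₁ h₂))
  where
  open ≤-Reasoning
  eq : ∀ a b c d → (a + b) + (c + d) ≡ a + c + (b + d)
  eq = solve-∀
  combine : ∀ a b → a * ℓ E ≤ V + γ E a → b * ℓ E ≤ W + γ E b → (a + b) * ℓ E < V + W + γ E (a + b)
  combine 0 b h₁ h₂ = ≤-<-trans h₂ (+-monoˡ-< (γ E b) (m<n+m W 0<V))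
  combine a@(suc _) 0 h₁ h₂ = subst (λ k → k * ℓ E < V + W + γ E k) (sym (+-identityʳ a)) (≤-<-trans h₁ (+-monoˡ-< (γ E a) (m<m+n V 0<W)))
  combine a@(suc _) b@(suc _) h₁ h₂ = begin-strict
    (a + b) * ℓ E                    ≡⟨ *-distribʳ-+ (ℓ E) a b ⟩
    a * ℓ E + b * ℓ E                ≤⟨ +-mono-≤ h₁ h₂ ⟩
    (V + γ E a) + (W + γ E b)        ≡⟨ eq V (γ E a) W (γ E b) ⟩
    V + W + (γ E a + γ E b)          <⟨ +-monoʳ-< (V + W) (γ-superadditive E a b 4≤E (s≤s z≤n) (s≤s z≤n)) ⟩
    V + W + γ E (a + b)              ∎

module _ (z y x : ℕ) (1≤z : 1 ≤ z) (4≤E : 4 ≤ z + suc y) (x≤z+1 : x ≤ suc z) where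
  private
    E = z + suc y
    c = medCost z y (suc x)

    x≤E : x ≤ E
    x≤E = ≤-trans x≤z+1 (≤-trans (s≤s (m≤m+n z y)) (≤-reflexive (sym (+-suc z y))))

  -- The cost without the one edge, at the price `ℓ`, that all parts share.
  excess : ℕ
  excess = c ∸ ℓ E

  ℓ<cost : ℓ E < c
  ℓ<cost = <-≤-trans (≤-<-trans (≤-reflexive (sym (*-identityˡ (ℓ E)))) (gain₁ z y 1≤z 4≤E))
    (+-monoʳ-≤ (medψ z y) (*-monoʳ-≤ 2 (*-monoˡ-≤ (suc y * E) {1} {suc x} (s≤s z≤n))))

  ℓ+excess : ℓ E + excess ≡ c
  ℓ+excess = m+[n∸m]≡n (<⇒≤ ℓ<cost)

  excess>0 : 0 < excess
  excess>0 = m<n⇒0<n∸m ℓ<cost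

  cost-mono : ∀ i → i < x → K E < c ⊎ suc i * ℓ E < c + γ E i
  cost-mono i i<x with gain z y x 1≤z 4≤E x≤z+1 | γ-mono E x i 4≤E i<x x≤E
  ... | inj₁ K<c | _ = inj₁ K<c
  ... | inj₂ h | inj₁ above = inj₁ (+-cancelʳ-< (γ E x) _ _ (<-≤-trans above h))
  ... | inj₂ h | inj₂ below = inj₂ (+-cancelʳ-< (γ E x) _ _ (begin-strict
    suc i * ℓ E + γ E x            ≡⟨ +-assoc (ℓ E) (i * ℓ E) (γ E x) ⟩
    ℓ E + (i * ℓ E + γ E x)        <⟨ +-monoʳ-< (ℓ E) below ⟩
    ℓ E + (x * ℓ E + γ E i)        ≡⟨ +-assoc (ℓ E) (x * ℓ E) (γ E i) ⟨
    suc x * ℓ E + γ E i            ≤⟨ +-monoˡ-≤ (γ E i) h ⟩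
    c + γ E x + γ E i              ≡⟨ eq c (γ E x) (γ E i) ⟩
    c + γ E i + γ E x              ∎))
    where
    open ≤-Reasoning
    eq : ∀ a b c → a + b + c ≡ a + c + b
    eq = solve-∀

  covers-excess : Covers E x excess
  covers-excess i i≤x = Sum.map (subst (K E <_) (sym ℓ+excess))
    (λ h → +-cancelˡ-≤ (ℓ E) _ _ (≤-trans h (≤-reflexive (trans (cong (_+ γ E i) (sym ℓ+excess)) (+-assoc (ℓ E) excess (γ E i))))))
    (bound i i≤x)
    where
    bound : ∀ i → i ≤ x → K E < c ⊎ suc i * ℓ E ≤ c + γ E i
    bound i i≤x with m≤n⇒m<n∨m≡n i≤x
    ... | inj₁ i<x = map₂ <⇒≤ (cost-mono i i<x)
    ... | inj₂ refl = gain z y i 1≤z 4≤E x≤z+1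

-- A single part is kept apart because the bound for two or more is strict: ties need at most one
-- medium vertex.
data Parts (E : ℕ) {n} (x W : Fin n → ℕ) (m : Fin n → Bool) : Set where
  noPart : (∀ v → m v ≡ false) → sum x ≡ 0 → sum W ≡ 0 → Parts E x W m
  onePart  : ∀ v → m v ≡ true → (∀ u → u ≢ v → m u ≡ false) → sum x ≡ x v → sum W ≡ W v → Parts E x W m
  manyParts : Covers< E (sum x) (sum W) → 0 < sum W → Parts E x W m

parts : ∀ {E n} → 4 ≤ E → (x W : Fin n → ℕ) (m : Fin n → Bool) →
  (∀ v → m v ≡ true → Covers E (x v) (W v) × 0 < W v) → (∀ v → m v ≡ false → x v ≡ 0 × W v ≡ 0) → Parts E x W m
parts {n = zero} _ _ _ _ _ _ = noPart (λ ()) refl refl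
parts {E} {suc n} 4≤E x W m c z with m zero in m₀ | parts 4≤E (x ∘ suc) (W ∘ suc) (m ∘ suc) (c ∘ suc) (z ∘ suc)
... | false | noPart ms x≡0 W≡0 = noPart (λ { zero → m₀ ; (suc v) → ms v })
  (cong₂ _+_ (proj₁ (z zero m₀)) x≡0) (cong₂ _+_ (proj₂ (z zero m₀)) W≡0)
... | false | onePart v mv ms x≡ W≡ = onePart (suc v) mv (λ { zero _ → m₀ ; (suc u) u≢v → ms u (u≢v ∘ cong suc) })
  (cong₂ _+_ (proj₁ (z zero m₀)) x≡) (cong₂ _+_ (proj₂ (z zero m₀)) W≡)
... | false | manyParts cs W>0 = manyParts
  (subst₂ (Covers< E) (sym (cong (_+ sum (x ∘ suc)) (proj₁ (z zero m₀)))) (sym (cong (_+ sum (W ∘ suc)) (proj₂ (z zero m₀)))) cs)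
  (<-≤-trans W>0 (m≤n+m _ _))
... | true | noPart ms x≡0 W≡0 = onePart zero m₀ (λ { zero u≢0 → contradiction refl u≢0 ; (suc v) _ → ms v })
  (trans (cong (x zero +_) x≡0) (+-identityʳ _)) (trans (cong (W zero +_) W≡0) (+-identityʳ _))
... | true | onePart v mv _ x≡ W≡ = manyParts
  (covers-+ 4≤E (proj₁ (c zero m₀)) (subst₂ (Covers E) (sym x≡) (sym W≡) (proj₁ (c (suc v) mv)))
    (proj₂ (c zero m₀)) (subst (0 <_) (sym W≡) (proj₂ (c (suc v) mv))))
  (<-≤-trans (proj₂ (c zero m₀)) (m≤m+n _ _))
... | true | manyParts cs W>0 = manyParts (covers-+ 4≤E (proj₁ (c zero m₀)) (weaken cs) (proj₂ (c zero m₀)) W>0)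
  (<-≤-trans W>0 (m≤n+m _ _))

private
  K+E : ∀ E → 1 ≤ E → K E + E ≡ E * E * E
  K+E E 1≤E = gap-elim (λ E → suc E * E * pred E + E ≡ E * E * E) 1 eq 1≤E
    where
    eq : ∀ E → suc (1 + E) * (1 + E) * E + (1 + E) ≡ (1 + E) * (1 + E) * (1 + E)
    eq = solve-∀

  K<E³ : ∀ E → 1 ≤ E → K E < E * E * E
  K<E³ E 1≤E = <-≤-trans (m<m+n (K E) 1≤E) (≤-reflexive (K+E E 1≤E))

  few : ∀ E t j → 2 * j ≤ E + 8 → 3 * (suc t * (E * E * E) + j * ℓ E) ≤ 4 * (E * E) * (suc t * (2 + E) + j)
  few E t j 2j≤E+8 = +-cancelʳ-≤ (E * E * (E + 8)) _ _ (begin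
    3 * (suc t * (E * E * E) + j * ℓ E) + E * E * (E + 8)  ≤⟨ slack (E * E * (t * (E + 8))) (eq E t j) ⟩
    4 * (E * E) * (suc t * (2 + E) + j) + E * E * (2 * j)  ≤⟨ +-monoʳ-≤ _ (*-monoʳ-≤ (E * E) 2j≤E+8) ⟩
    4 * (E * E) * (suc t * (2 + E) + j) + E * E * (E + 8)  ∎)
    where
    open ≤-Reasoning
    eq : ∀ E t j → 3 * (suc t * (E * E * E) + j * (2 * (E * E))) + E * E * (E + 8) + E * E * (t * (E + 8))
      ≡ 4 * (E * E) * (suc t * (2 + E) + j) + E * E * (2 * j)
    eq = solve-∀

  plenty : ∀ E t j → E + 8 ≤ 2 * j → 3 * (suc t * (E * E * E) + E * E * E) ≤ 4 * (E * E) * (suc t * (2 + E) + j)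
  plenty E t j E+8≤2j = begin
    3 * (suc t * (E * E * E) + E * E * E)                              ≤⟨ slack (E * E * (t * E + 8 * suc t + 16)) (eq₁ E t) ⟩
    4 * (E * E) * (suc t * (2 + E)) + 2 * (E * E) * (E + 8)            ≤⟨ +-monoʳ-≤ (4 * (E * E) * (suc t * (2 + E))) (*-monoʳ-≤ (2 * (E * E)) E+8≤2j) ⟩
    4 * (E * E) * (suc t * (2 + E)) + 2 * (E * E) * (2 * j)            ≡⟨ eq₂ E t j ⟩
    4 * (E * E) * (suc t * (2 + E) + j)                                ∎
    where
    open ≤-Reasoning
    eq₁ : ∀ E t → 3 * (suc t * (E * E * E) + E * E * E) + E * E * (t * E + 8 * suc t + 16)
      ≡ 4 * (E * E) * (suc t * (2 + E)) + 2 * (E * E) * (E + 8)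
    eq₁ = solve-∀
    eq₂ : ∀ E t j → 4 * (E * E) * (suc t * (2 + E)) + 2 * (E * E) * (2 * j) ≡ 4 * (E * E) * (suc t * (2 + E) + j)
    eq₂ = solve-∀

-- At `4 E² / 3` per edge, `t (2 + E)` edges pay for `t E³`, hence for `t K`, and leave
-- `t E² (E + 8) / 3`. The price of the remaining `j` edges falls short of `j ℓ` by `2 j E² / 3`,
-- which this covers if `2 j ≤ E + 8`. If `j` is larger, the `j` edges help to pay for one more `K`
-- instead.
slope-bound : ∀ E t j e cost → 1 ≤ E → 1 ≤ t → t * (2 + E) + j ≤ e → 4 * (E * E) * e ≤ 3 * cost →
  t * K E + K E < cost ⊎ t * K E + j * ℓ E < cost
slope-bound E (suc t) j e cost 1≤E _ e≥ h with ≤-total (2 * j) (E + 8)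
... | inj₁ 2j≤E+8 = inj₂ (<-≤-trans (+-monoˡ-< (j * ℓ E) (*-monoʳ-< (suc t) (K<E³ E 1≤E)))
  (*-cancelˡ-≤ 3 (≤-trans (few E t j 2j≤E+8) (≤-trans (*-monoʳ-≤ (4 * (E * E)) e≥) h))))
... | inj₂ E+8≤2j = inj₁ (<-≤-trans (+-mono-< (*-monoʳ-< (suc t) (K<E³ E 1≤E)) (K<E³ E 1≤E))
  (*-cancelˡ-≤ 3 (≤-trans (plenty E t j E+8≤2j) (≤-trans (*-monoʳ-≤ (4 * (E * E)) e≥) h))))

-- Comparison of j with r(Δ)

module Radical where
  open import Data.Integer.Base using (+_; 0ℤ)

  -- j ⋈ r(Δ) amounts to j² + j (E - 2) + 2 E + 1 ⋈ E².
  ρ : ℕ → ℕ → ℕ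
  ρ e j = j * j + j * e + 2 * (2 + e) + 1

  private
    radicand≡ : ∀ E → radicand (2 + E) ≡ + (5 * (E * E)) ℤ.- + (12 * E)
    radicand≡ E = trans (eq (+ E)) (cong₂ ℤ._-_ (trans (cong (+ 5 ℤ.*_) (sym (ℤ.pos-* E E))) (sym (ℤ.pos-* 5 (E * E)))) (sym (ℤ.pos-* 12 E)))
      where
      eq : ∀ x → + 5 ℤ.* ((+ 2 ℤ.+ x) ℤ.* ((+ 2 ℤ.+ x) ℤ.* + 1)) ℤ.- + 32 ℤ.* (+ 2 ℤ.+ x) ℤ.+ + 44 ≡ + 5 ℤ.* (x ℤ.* x) ℤ.- + 12 ℤ.* x
      eq = ℤ-solve-∀

    shifted≡ : ∀ e j → shifted j (4 + e) ≡ + (2 * j + e)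
    shifted≡ e j = trans (eq (+ j) (+ e)) (trans (cong (ℤ._+ + e) (sym (ℤ.pos-* 2 j))) refl)
      where
      eq : ∀ x y → + 2 ℤ.* x ℤ.+ (+ 4 ℤ.+ y) ℤ.- + 4 ≡ + 2 ℤ.* x ℤ.+ y
      eq = ℤ-solve-∀

    -- The comparison of `ρ` with `E²`, multiplied by 4 and shifted by `E²`. The negative term
    -- `12 E` of the radicand is carried over to the square, so that all numbers are natural.
    square≡ : ∀ e j → (2 * j + e) * (2 * j + e) + 12 * (2 + e) ≡ 4 * (j * j + j * e + 2 * (2 + e) + 1) + (2 + e) * (2 + e)
    square≡ = solve-∀

    five≡ : ∀ E → 5 * (E * E) ≡ 4 * (E * E) + E * E
    five≡ = solve-∀

    ℤ-eq : ∀ x y → x ℤ.+ y ℤ.+ ℤ.- y ≡ x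
    ℤ-eq = ℤ-solve-∀

    ℤ-+-cancelʳ-< : ∀ k i j → i ℤ.+ k ℤ.< j ℤ.+ k → i ℤ.< j
    ℤ-+-cancelʳ-< k i j h = subst₂ ℤ._<_ (ℤ-eq i k) (ℤ-eq j k) (ℤ.+-monoˡ-< (ℤ.- k) h)

    ℤ-+-cancelʳ : ∀ k i j → i ℤ.+ k ≡ j ℤ.+ k → i ≡ j
    ℤ-+-cancelʳ k i j h = trans (sym (ℤ-eq i k)) (trans (cong (ℤ._+ ℤ.- k) h) (ℤ-eq j k))

    module _ (e j : ℕ) where
      E = 2 + e
      a = 2 * j + e

      s≡ : shifted j (2 + E) ℤ.* shifted j (2 + E) ≡ + (a * a)
      s≡ = trans (cong₂ ℤ._*_ (shifted≡ e j) (shifted≡ e j)) (sym (ℤ.pos-* a a))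

      R+ : radicand (2 + E) ℤ.+ + (12 * E) ≡ + (5 * (E * E))
      R+ = trans (cong (ℤ._+ + (12 * E)) (radicand≡ E)) (eq (+ (5 * (E * E))) (+ (12 * E)))
        where
        eq : ∀ x y → x ℤ.- y ℤ.+ y ≡ x
        eq = ℤ-solve-∀

      0≤s : 0ℤ ℤ.≤ shifted j (2 + E)
      0≤s = subst (0ℤ ℤ.≤_) (sym (shifted≡ e j)) (ℤ.+≤+ z≤n)

      scale< : a * a + 12 * E < 5 * (E * E) → ρ e j < E * E
      scale< h = *-cancelˡ-< 4 _ _ (+-cancelʳ-< (E * E) _ _ (subst₂ _<_ (square≡ e j) (five≡ E) h))

      scale<⁻ : ρ e j < E * E → a * a + 12 * E < 5 * (E * E)
      scale<⁻ h = subst₂ _<_ (sym (square≡ e j)) (sym (five≡ E)) (+-monoˡ-< (E * E) (*-monoʳ-< 4 h))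

      scale> : 5 * (E * E) < a * a + 12 * E → E * E < ρ e j
      scale> h = *-cancelˡ-< 4 _ _ (+-cancelʳ-< (E * E) _ _ (subst₂ _<_ (five≡ E) (square≡ e j) h))

      scale>⁻ : E * E < ρ e j → 5 * (E * E) < a * a + 12 * E
      scale>⁻ h = subst₂ _<_ (sym (five≡ E)) (sym (square≡ e j)) (+-monoˡ-< (E * E) (*-monoʳ-< 4 h))

  module _ (e j : ℕ) where
    <r⇒ : j <r (4 + e) → ρ e j < (2 + e) * (2 + e)
    <r⇒ (inj₁ s<0) = contradiction (ℤ.<-≤-trans s<0 (0≤s e j)) (ℤ.<-irrefl refl)
    <r⇒ (inj₂ h) = scale< e j (ℤ.drop‿+<+ (subst₂ ℤ._<_ (cong (ℤ._+ + (12 * (2 + e))) (s≡ e j)) (R+ e j) (ℤ.+-monoˡ-< (+ (12 * (2 + e))) h)))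

    ⇒<r : ρ e j < (2 + e) * (2 + e) → j <r (4 + e)
    ⇒<r h = inj₂ (subst₂ ℤ._<_ (sym (s≡ e j)) refl (ℤ-+-cancelʳ-< (+ (12 * (2 + e))) _ _
      (subst₂ ℤ._<_ refl (sym (R+ e j)) (ℤ.+<+ (scale<⁻ e j h)))))

    >r⇒ : j >r (4 + e) → (2 + e) * (2 + e) < ρ e j
    >r⇒ (_ , h) = scale> e j (ℤ.drop‿+<+ (subst₂ ℤ._<_ (R+ e j) (cong (ℤ._+ + (12 * (2 + e))) (s≡ e j)) (ℤ.+-monoˡ-< (+ (12 * (2 + e))) h)))

    ⇒>r : (2 + e) * (2 + e) < ρ e j → j >r (4 + e)
    ⇒>r h = 0≤s e j , subst₂ ℤ._<_ refl (sym (s≡ e j)) (ℤ-+-cancelʳ-< (+ (12 * (2 + e))) _ _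
      (subst₂ ℤ._<_ (sym (R+ e j)) refl (ℤ.+<+ (scale>⁻ e j h))))

    ≡r⇒ : j ≡r (4 + e) → ρ e j ≡ (2 + e) * (2 + e)
    ≡r⇒ (_ , h) = *-cancelˡ-≡ _ _ 4 (+-cancelʳ-≡ ((2 + e) * (2 + e)) _ _ (trans (sym (square≡ e j)) (trans (ℤ.+-injective
      (trans (cong (ℤ._+ + (12 * (2 + e))) (trans (sym (s≡ e j)) h)) (R+ e j))) (five≡ (2 + e)))))

    ⇒≡r : ρ e j ≡ (2 + e) * (2 + e) → j ≡r (4 + e)
    ⇒≡r h = 0≤s e j , trans (s≡ e j) (ℤ-+-cancelʳ (+ (12 * (2 + e))) _ _
      (trans (cong +_ (trans (square≡ e j) (trans (cong (λ r → 4 * r + (2 + e) * (2 + e)) h) (sym (five≡ (2 + e)))))) (sym (R+ e j))))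

open Radical

-- Sums over vertices and edges

𝟙 : Bool → ℕ
𝟙 true  = 1
𝟙 false = 0

𝟙≤1 : ∀ b → 𝟙 b ≤ 1
𝟙≤1 true  = ≤-refl
𝟙≤1 false = z≤n

sum-mono : ∀ {n} {f g : Fin n → ℕ} → (∀ i → f i ≤ g i) → sum f ≤ sum g
sum-mono {zero}  h = z≤n
sum-mono {suc n} h = +-mono-≤ (h zero) (sum-mono (h ∘ suc))

sum-mono-< : ∀ {n} {f g : Fin n → ℕ} → (∀ i → f i ≤ g i) → ∀ i → f i < g i → sum f < sum g
sum-mono-< {suc n} h zero    f<g = +-mono-<-≤ f<g (sum-mono (h ∘ suc))
sum-mono-< {suc n} h (suc i) f<g = +-mono-≤-< (h zero) (sum-mono-< (h ∘ suc) i f<g)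

sum-zero : ∀ {n} {f : Fin n → ℕ} → (∀ i → f i ≡ 0) → sum f ≡ 0
sum-zero {n} h = trans (sum-cong-≗ h) (sum-replicate-zero n)

sum-const : ∀ n c → sum {n} (λ _ → c) ≡ n * c
sum-const zero    c = refl
sum-const (suc n) c = cong (c +_) (sum-const n c)

term≤sum : ∀ {n} (f : Fin n → ℕ) i → f i ≤ sum f
term≤sum f zero    = m≤m+n _ _
term≤sum f (suc i) = ≤-trans (term≤sum (f ∘ suc) i) (m≤n+m _ _)

sum≡0⇒ : ∀ {n} (f : Fin n → ℕ) → sum f ≡ 0 → ∀ i → f i ≡ 0
sum≡0⇒ f h i = n≤0⇒n≡0 (subst (f i ≤_) h (term≤sum f i))

sum-*ˡ : ∀ {n} c (f : Fin n → ℕ) → sum (λ i → c * f i) ≡ c * sum f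
sum-*ˡ c f = sym (*-distribˡ-sum c f)

sum-*ʳ : ∀ {n} c (f : Fin n → ℕ) → sum (λ i → f i * c) ≡ sum f * c
sum-*ʳ c f = trans (sum-cong-≗ (λ i → *-comm (f i) c)) (trans (sum-*ˡ c f) (*-comm c (sum f)))

sum-single : ∀ {n} (f : Fin n → ℕ) i → (∀ j → j ≢ i → f j ≡ 0) → sum f ≡ f i
sum-single f zero    h = trans (cong (f zero +_) (sum-zero (λ j → h (suc j) λ ()))) (+-identityʳ _)
sum-single f (suc i) h = trans (cong (_+ sum (f ∘ suc)) (h zero λ ()))
  (sum-single (f ∘ suc) i (λ j j≢i → h (suc j) (j≢i ∘ Fin.suc-injective)))

sum-positive : ∀ {n} (f : Fin n → ℕ) → 0 < sum f → ∃[ i ] 0 < f i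
sum-positive {suc n} f h with f zero in f₀
... | suc _ = zero , subst (0 <_) (sym f₀) (s≤s z≤n)
... | zero with sum-positive (f ∘ suc) h
...   | i , fi>0 = suc i , fi>0

δ : ∀ {n} → Fin n → Fin n → ℕ
δ i j = 𝟙 (does (i Fin.≟ j))

δ-refl : ∀ {n} (i : Fin n) → δ i i ≡ 1
δ-refl i with i Fin.≟ i
... | yes _  = refl
... | no i≢i = contradiction refl i≢i

δ-≢ : ∀ {n} {i j : Fin n} → i ≢ j → δ i j ≡ 0
δ-≢ {i = i} {j} i≢j with i Fin.≟ j
... | yes i≡j = contradiction i≡j i≢j
... | no _    = refl

sum-δ : ∀ {n} (f : Fin n → ℕ) i → sum (λ j → δ i j * f j) ≡ f i
sum-δ f i = trans (sum-single _ i (λ j j≢i → cong (_* f j) (δ-≢ (j≢i ∘ sym))))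
  (trans (cong (_* f i) (δ-refl i)) (*-identityˡ (f i)))

length-filter : ∀ {a p} {A : Set a} {P : A → Set p} (P? : Decidable P) xs →
  length (filter P? xs) ≡ listSum (map (λ x → 𝟙 (does (P? x))) xs)
length-filter P? []       = refl
length-filter P? (x ∷ xs) with does (P? x)
... | true  = cong suc (length-filter P? xs)
... | false = length-filter P? xs

sum-filter : ∀ {a p} {A : Set a} {P : A → Set p} (P? : Decidable P) (f : A → ℕ) xs →
  listSum (map f (filter P? xs)) ≡ listSum (map (λ x → 𝟙 (does (P? x)) * f x) xs)
sum-filter P? f []       = refl
sum-filter P? f (x ∷ xs) with does (P? x)
... | true  = cong₂ _+_ (sym (+-identityʳ (f x))) (sum-filter P? f xs)
... | false = sum-filter P? f xs

listSum-tabulate : ∀ {n} (f : Fin n → ℕ) → listSum (tabulate f) ≡ sum f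
listSum-tabulate {zero}  f = refl
listSum-tabulate {suc n} f = cong (f zero +_) (listSum-tabulate (f ∘ suc))

listSum-allFin : ∀ {n} (f : Fin n → ℕ) → listSum (map f (allFin n)) ≡ sum f
listSum-allFin f = trans (cong listSum (map-tabulate id f)) (listSum-tabulate f)

count-allFin : ∀ {n p} {P : Fin n → Set p} (P? : Decidable P) →
  length (filter P? (allFin n)) ≡ sum (λ v → 𝟙 (does (P? v)))
count-allFin {n} P? = trans (length-filter P? (allFin n)) (listSum-allFin (λ v → 𝟙 (does (P? v))))

listSum-product : ∀ {a b} {A : Set a} {B : Set b} (f : A × B → ℕ) xs (ys : List B) →
  listSum (map f (cartesianProduct xs ys)) ≡ listSum (map (λ x → listSum (map (λ y → f (x , y)) ys)) xs)
listSum-product f []       ys = refl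
listSum-product f (x ∷ xs) ys = begin
  listSum (map f (map (x ,_) ys ++ cartesianProduct xs ys))                    ≡⟨ cong listSum (map-++ f (map (x ,_) ys) _) ⟩
  listSum (map f (map (x ,_) ys) ++ map f (cartesianProduct xs ys))            ≡⟨ sum-++ (map f (map (x ,_) ys)) _ ⟩
  listSum (map f (map (x ,_) ys)) + listSum (map f (cartesianProduct xs ys))
    ≡⟨ cong₂ _+_ (cong listSum (sym (List.map-∘ ys))) (listSum-product f xs ys) ⟩
  listSum (map (λ y → f (x , y)) ys) + listSum (map (λ x → listSum (map (λ y → f (x , y)) ys)) xs) ∎
  where open ≡-Reasoning

listSum-cong : ∀ {a} {A : Set a} {f g : A → ℕ} → f ≗ g → ∀ xs → listSum (map f xs) ≡ listSum (map g xs)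
listSum-cong h xs = cong listSum (List.map-cong h xs)

listSum-pairs : ∀ {n} (f : Fin n × Fin n → ℕ) →
  listSum (map f (cartesianProduct (allFin n) (allFin n))) ≡ sum (λ u → sum (λ v → f (u , v)))
listSum-pairs {n} f = trans (listSum-product f (allFin n) (allFin n))
  (trans (listSum-cong (λ u → listSum-allFin (λ v → f (u , v))) (allFin n)) (listSum-allFin (λ u → sum (λ v → f (u , v)))))

private
  unique-lookup : ∀ {a} {A : Set a} {xs : List A} → Unique xs → ∀ i j → lookup xs i ≡ lookup xs j → i ≡ j
  unique-lookup (_ ∷ _)   zero    zero    _ = refl
  unique-lookup {xs = _ ∷ xs} (x∉ ∷ _)  zero    (suc j) e = contradiction e (All.lookup x∉ (∈-lookup {xs = xs} j))
  unique-lookup {xs = _ ∷ xs} (x∉ ∷ _)  (suc i) zero    e = contradiction (sym e) (All.lookup x∉ (∈-lookup {xs = xs} i))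
  unique-lookup (_ ∷ uxs) (suc i) (suc j) e = cong suc (unique-lookup uxs i j e)

  unique-length : ∀ {n} {xs : List (Fin n)} → Unique xs → length xs ≤ n
  unique-length uxs = Fin.injective⇒≤ (unique-lookup uxs _ _)

  unique-prefix : ∀ {a} {A : Set a} (xs : List A) {w ys} → Unique (xs ++ w ∷ ys) → Unique (xs ++ [ w ])
  unique-prefix []       _          = [] ∷ []
  unique-prefix (x ∷ xs) (x∉ ∷ uxs) = All.++⁺ (All.++⁻ˡ xs x∉) (All.head (All.++⁻ʳ xs x∉) ∷ []) ∷ unique-prefix xs uxs

  linked-prefix : ∀ {a r} {A : Set a} {R : A → A → Set r} (xs : List A) {w ys x} →
    Linked R (xs ++ w ∷ ys) → R w x → Linked R (xs ++ w ∷ [ x ])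
  linked-prefix []           _       Rwx = Rwx ∷ [-]
  linked-prefix (_ ∷ [])     (R ∷ l) Rwx = R ∷ linked-prefix [] l Rwx
  linked-prefix (_ ∷ y ∷ xs) (R ∷ l) Rwx = R ∷ linked-prefix (y ∷ xs) l Rwx

true≢false : ∀ {b} → b ≡ true → b ≢ false
true≢false refl ()

-- Degrees, edges and forests through the adjacency matrix

module _ {n} (G : Graph n) where
  open Graph G

  a : Fin n → Fin n → ℕ
  a u v = 𝟙 (adj u v)

  a-sym : ∀ u v → a u v ≡ a v u
  a-sym u v = cong 𝟙 (adj-sym u v)

  a-irrefl : ∀ v → a v v ≡ 0
  a-irrefl v = cong 𝟙 (adj-irrefl v)

  ~⇒a : ∀ {u v} → u ~ v → a u v ≡ 1
  ~⇒a u~v = cong 𝟙 (Equivalence.to T-≡ u~v)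

  ~-sym : ∀ {u v} → u ~ v → v ~ u
  ~-sym {u} {v} = subst T (adj-sym u v)

  ~⇒≢ : ∀ {u v} → u ~ v → u ≢ v
  ~⇒≢ {u} u~v refl = subst T (adj-irrefl u) u~v

  deg≡ : ∀ v → deg G v ≡ sum (a v)
  deg≡ v = count-allFin (λ u → T? (adj v u))

  private
    half : (Fin n → Fin n → ℕ) → Fin n → Fin n → ℕ
    half F u v = 𝟙 (does (u Fin.<? v) ∧ adj u v) * F u v

    half-split : ∀ F → (∀ u v → F u v ≡ F v u) → ∀ u v → a u v * F u v ≡ half F u v + half F v u
    half-split F F-sym u v with Fin.<-cmp u v
    ... | tri< u<v _ v≮u rewrite dec-true (u Fin.<? v) u<v | dec-false (v Fin.<? u) v≮u = sym (+-identityʳ _)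
    ... | tri> u≮v _ v<u rewrite dec-false (u Fin.<? v) u≮v | dec-true (v Fin.<? u) v<u = cong₂ _*_ (a-sym u v) (F-sym u v)
    ... | tri≈ u≮u refl _ rewrite dec-false (u Fin.<? u) u≮u | adj-irrefl u = refl

  edge-sum : ∀ F → (∀ u v → F u v ≡ F v u) →
    2 * listSum (map (λ (u , v) → F u v) (edges G)) ≡ sum (λ u → sum (λ v → a u v * F u v))
  edge-sum F F-sym = begin
    2 * listSum (map (λ (u , v) → F u v) (edges G))
      ≡⟨ cong (2 *_) (trans (sum-filter (λ (u , v) → (u Fin.<? v) ×-dec T? (adj u v)) (λ (u , v) → F u v) (cartesianProduct (allFin n) (allFin n)))
          (listSum-pairs (λ (u , v) → half F u v))) ⟩
    2 * sum (λ u → sum (half F u))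
      ≡⟨ cong (H +_) (+-identityʳ H) ⟩
    H + H
      ≡⟨ cong (H +_) (∑-comm (half F)) ⟩
    H + sum (λ u → sum (λ v → half F v u))
      ≡⟨ ∑-distrib-+ (λ u → sum (half F u)) (λ u → sum (λ v → half F v u)) ⟨
    sum (λ u → sum (half F u) + sum (λ v → half F v u))
      ≡⟨ sum-cong-≗ (λ u → sym (∑-distrib-+ (half F u) (λ v → half F v u))) ⟩
    sum (λ u → sum (λ v → half F u v + half F v u))
      ≡⟨ sum-cong-≗ (λ u → sum-cong-≗ (λ v → sym (half-split F F-sym u v))) ⟩
    sum (λ u → sum (λ v → a u v * F u v)) ∎
    where
    open ≡-Reasoning
    H = sum (λ u → sum (half F u))

  count-edges : ∀ {P : Fin n × Fin n → Set} (P? : Decidable P) →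
    (∀ u v → does (P? (u , v)) ≡ does (P? (v , u))) →
    2 * length (filter P? (edges G)) ≡ sum (λ u → sum (λ v → a u v * 𝟙 (does (P? (u , v)))))
  count-edges P? P-sym = trans (cong (2 *_) (length-filter P? (edges G)))
    (edge-sum (λ u v → 𝟙 (does (P? (u , v)))) (λ u v → cong 𝟙 (P-sym u v)))

  -- The bilinear form of the adjacency matrix. On the indicator function of a set it is twice the
  -- number of edges spanned by the set.
  form : (f g : Fin n → ℕ) → ℕ
  form f g = sum (λ u → f u * sum (λ v → a u v * g v))

  form-flat : ∀ f g → form f g ≡ sum (λ u → sum (λ v → a u v * (f u * g v)))
  form-flat f g = sum-cong-≗ λ u → trans (sym (sum-*ˡ (f u) (λ v → a u v * g v))) (sum-cong-≗ λ v → eq (f u) (a u v) (g v))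
    where
    eq : ∀ x y z → x * (y * z) ≡ y * (x * z)
    eq = solve-∀

  form-cong : ∀ {f f′ g g′} → f ≗ f′ → g ≗ g′ → form f g ≡ form f′ g′
  form-cong f≗ g≗ = sum-cong-≗ λ u → cong₂ _*_ (f≗ u) (sum-cong-≗ λ v → cong (a u v *_) (g≗ v))

  form-sym : ∀ f g → form f g ≡ form g f
  form-sym f g = trans (form-flat f g) (trans (∑-comm (λ u v → a u v * (f u * g v))) (trans
    (sum-cong-≗ λ v → sum-cong-≗ λ u → cong₂ _*_ (a-sym u v) (*-comm (f u) (g v))) (sym (form-flat g f))))

  form-+ˡ : ∀ f f′ g → form (λ v → f v + f′ v) g ≡ form f g + form f′ g
  form-+ˡ f f′ g = trans (sum-cong-≗ λ u → *-distribʳ-+ _ (f u) (f′ u)) (∑-distrib-+ (λ u → f u * sum (λ v → a u v * g v)) (λ u → f′ u * sum (λ v → a u v * g v)))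

  form-+ʳ : ∀ f g g′ → form f (λ v → g v + g′ v) ≡ form f g + form f g′
  form-+ʳ f g g′ = trans (form-sym f _) (trans (form-+ˡ g g′ f) (cong₂ _+_ (form-sym g f) (form-sym g′ f)))

  form-δ : ∀ v g → form (δ v) g ≡ sum (λ u → a v u * g u)
  form-δ v g = sum-δ (λ u → sum (λ w → a u w * g w)) v

  -- There is no diagonal term, as no vertex is adjacent to itself, and the two mixed terms agree by
  -- symmetry.
  form-add : ∀ v g → form (λ u → g u + δ v u) (λ u → g u + δ v u) ≡ form g g + 2 * sum (λ u → a v u * g u)
  form-add v g = begin
    form (λ u → g u + δ v u) (λ u → g u + δ v u)
      ≡⟨ trans (form-+ˡ g (δ v) _) (cong₂ _+_ (form-+ʳ g g (δ v)) (form-+ʳ (δ v) g (δ v))) ⟩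
    form g g + form g (δ v) + (form (δ v) g + form (δ v) (δ v))
      ≡⟨ cong₂ (λ x y → form g g + x + (form (δ v) g + y)) (form-sym g (δ v)) δδ ⟩
    form g g + form (δ v) g + (form (δ v) g + 0)
      ≡⟨ +-assoc (form g g) _ _ ⟩
    form g g + 2 * form (δ v) g
      ≡⟨ cong (λ x → form g g + 2 * x) (form-δ v g) ⟩
    form g g + 2 * sum (λ u → a v u * g u) ∎
    where
    open ≡-Reasoning
    δδ : form (δ v) (δ v) ≡ 0
    δδ = trans (form-δ v (δ v)) (trans (sum-cong-≗ λ u → *-comm (a v u) (δ v u)) (trans (sum-δ (a v) v) (a-irrefl v)))

  remove : (Fin n → Bool) → Fin n → Fin n → Bool
  remove S v u = S u ∧ not (does (v Fin.≟ u))

  remove-split : ∀ S v → S v ≡ true → ∀ u → 𝟙 (S u) ≡ 𝟙 (remove S v u) + δ v u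
  remove-split S v Sv u with v Fin.≟ u
  ... | yes refl rewrite Sv = refl
  ... | no _ rewrite ∧-identityʳ (S u) = sym (+-identityʳ _)

  private
    module Path (acyclic : Acyclic G) (S : Fin n → Bool)
      (branching : ∀ v → S v ≡ true → 2 ≤ sum (λ u → a v u * 𝟙 (S u))) where

      other : ∀ v x → S v ≡ true → ∃[ w ] w ≢ x × v ~ w × S w ≡ true
      other v x Sv with Fin.any? (λ w → ¬? (w Fin.≟ x) ×-dec (T? (adj v w) ×-dec (S w Bool.≟ true)))
      ... | yes found = found
      ... | no none = contradiction (subst (2 ≤_) (sum-single _ x zeros) (branching v Sv))
        (<⇒≱ (s≤s (*-mono-≤ (𝟙≤1 (adj v x)) (𝟙≤1 (S x)))))
        where
        zeros : ∀ w → w ≢ x → a v w * 𝟙 (S w) ≡ 0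
        zeros w w≢x with adj v w in e | S w in Sw
        ... | false | _     = refl
        ... | true  | false = refl
        ... | true  | true  = contradiction (w , w≢x , subst T (sym e) _ , Sw) none

      -- The path has its head `x` in front. By `branching`, `x` has a neighbour in S other than its
      -- predecessor `y`; it either prolongs the path or lies on it and closes a cycle. A path
      -- without repetitions has at most `n` vertices, so the recursion ends.
      extend : ∀ fuel x y p → suc n ≤ fuel + length (x ∷ y ∷ p) → S x ≡ true →
        Linked _~_ (x ∷ y ∷ p) → Unique (x ∷ y ∷ p) → ⊥
      extend zero       x y p long Sx l u = <⇒≱ long (unique-length u)
      extend (suc fuel) x y p long Sx l u with other x y Sx
      ... | w , w≢y , x~w , Sw with any? (w Fin.≟_) p
      ... | no w∉p = extend fuel w x (y ∷ p) (subst (suc n ≤_) (sym (+-suc fuel _)) long) Sw (~-sym x~w ∷ l)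
        ((~⇒≢ (~-sym x~w) ∷ w≢y ∷ All.¬Any⇒All¬ p w∉p) ∷ u)
      ... | yes w∈p with ∈-∃++ w∈p
      ... | as , bs , refl = acyclic x (y ∷ as ++ [ w ])
        ( s≤s (subst (1 ≤_) (sym (List.length-++ as)) (m≤n+m 1 (length as)))
        , unique-prefix (x ∷ y ∷ as) u
        , subst (λ zs → Linked _~_ (x ∷ y ∷ zs)) (sym (List.++-assoc as [ w ] [ x ]))
            (linked-prefix (x ∷ y ∷ as) l (~-sym x~w)))

      impossible : ∀ v → S v ≡ true → ⊥
      impossible v Sv with other v v Sv
      ... | w , w≢v , v~w , Sw = extend n w v [] (≤-trans (n≤1+n (suc n)) (≤-reflexive (+-comm 2 n))) Sw
        (~-sym v~w ∷ [-]) ((w≢v ∷ []) ∷ [] ∷ [])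

    low-degree : Acyclic G → ∀ S v → S v ≡ true → ∃[ w ] S w ≡ true × sum (λ u → a w u * 𝟙 (S u)) ≤ 1
    low-degree acyclic S v Sv with Fin.any? (λ w → (S w Bool.≟ true) ×-dec (sum (λ u → a w u * 𝟙 (S u)) ≤? 1))
    ... | yes found = found
    ... | no none = ⊥-elim (Path.impossible acyclic S (λ w Sw → ≰⇒> λ small → none (w , Sw , small)) v Sv)

    -- Induction on the size: a vertex with at most one neighbour in S, from `low-degree`, takes at
    -- most one edge along when it is removed. The bound needs a nonempty set, hence the witness
    -- `v`.
    forest-bound′ : Acyclic G → ∀ m (S : Fin n → Bool) v → S v ≡ true → sum (𝟙 ∘ S) ≡ m →
      form (𝟙 ∘ S) (𝟙 ∘ S) + 2 ≤ 2 * m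
    forest-bound′ acyclic zero S v Sv ∣S∣ = contradiction (trans (cong 𝟙 (sym Sv)) (sum≡0⇒ (𝟙 ∘ S) ∣S∣ v)) λ ()
    forest-bound′ acyclic (suc m) S v Sv ∣S∣ with low-degree acyclic S v Sv
    ... | w , Sw , small = begin
      form (𝟙 ∘ S) (𝟙 ∘ S) + 2              ≡⟨ cong (_+ 2) (trans (form-cong split split) (form-add w (𝟙 ∘ S′))) ⟩
      form (𝟙 ∘ S′) (𝟙 ∘ S′) + 2 * d + 2    ≤⟨ rest ⟩
      2 * suc m                             ∎
      where
      open ≤-Reasoning
      S′ = remove S w
      split = remove-split S w Sw
      d = sum (λ u → a w u * 𝟙 (S′ u))
      d≤1 : d ≤ 1
      d≤1 = ≤-trans (sum-mono λ u → *-monoʳ-≤ (a w u) (≤-trans (m≤m+n _ (δ w u)) (≤-reflexive (sym (split u))))) small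
      ∣S′∣ : sum (𝟙 ∘ S′) ≡ m
      ∣S′∣ = +-cancelʳ-≡ 1 _ _ (begin-equality
        sum (𝟙 ∘ S′) + 1                    ≡⟨ cong (sum (𝟙 ∘ S′) +_) (trans (sum-cong-≗ λ u → sym (*-identityʳ (δ w u))) (sum-δ (λ _ → 1) w)) ⟨
        sum (𝟙 ∘ S′) + sum (δ w)            ≡⟨ ∑-distrib-+ (𝟙 ∘ S′) (δ w) ⟨
        sum (λ u → 𝟙 (S′ u) + δ w u)        ≡⟨ sum-cong-≗ split ⟨
        sum (𝟙 ∘ S)                         ≡⟨ ∣S∣ ⟩
        suc m                               ≡⟨ +-comm 1 m ⟩
        m + 1                               ∎)
      eq₁ : ∀ f d → f + 2 * d + 2 ≡ (f + 2) + 2 * d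
      eq₁ = solve-∀
      eq₂ : ∀ m → 2 * m + 2 * 1 ≡ 2 * suc m
      eq₂ = solve-∀
      rest : form (𝟙 ∘ S′) (𝟙 ∘ S′) + 2 * d + 2 ≤ 2 * suc m
      rest with Fin.any? (λ u → S′ u Bool.≟ true)
      ... | yes (u , S′u) = begin
        form (𝟙 ∘ S′) (𝟙 ∘ S′) + 2 * d + 2    ≡⟨ eq₁ (form (𝟙 ∘ S′) (𝟙 ∘ S′)) d ⟩
        form (𝟙 ∘ S′) (𝟙 ∘ S′) + 2 + 2 * d    ≤⟨ +-mono-≤ (forest-bound′ acyclic m S′ u S′u ∣S′∣) (*-monoʳ-≤ 2 d≤1) ⟩
        2 * m + 2 * 1                         ≡⟨ eq₂ m ⟩
        2 * suc m                             ∎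
      ... | no empty = ≤-trans (≤-reflexive (cong (λ x → x + 2) (cong₂ (λ x y → x + 2 * y)
          (sum-zero λ u → cong (_* sum (λ x → a u x * 𝟙 (S′ x))) (S′≡0 u))
          (sum-zero λ u → trans (cong (a w u *_) (S′≡0 u)) (*-zeroʳ (a w u)))))) (*-monoʳ-≤ 2 (s≤s z≤n))
        where
        S′≡0 : ∀ u → 𝟙 (S′ u) ≡ 0
        S′≡0 u with S′ u in e
        ... | true  = contradiction (u , e) empty
        ... | false = refl

  forest-bound : Acyclic G → ∀ (S : Fin n → Bool) v → S v ≡ true →
    form (𝟙 ∘ S) (𝟙 ∘ S) + 2 ≤ 2 * sum (𝟙 ∘ S)
  forest-bound acyclic S v Sv = forest-bound′ acyclic _ S v Sv refl

  private
    exit : (S : Fin n → Bool) → ∀ {u v} → Star _~_ u v → S u ≡ true → S v ≡ false →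
      ∃[ x ] ∃[ y ] x ~ y × S x ≡ true × S y ≡ false
    exit S ε Su Sv = contradiction Sv (true≢false Su)
    exit S (_◅_ {j = w} u~w path) Su Sv with S w in Sw
    ... | true  = exit S path Sw Sv
    ... | false = _ , w , u~w , Su , Sw

    insert : (Fin n → Bool) → Fin n → Fin n → Bool
    insert S v u = S u ∨ does (v Fin.≟ u)

    insert-split : ∀ S v → S v ≡ false → ∀ u → 𝟙 (insert S v u) ≡ 𝟙 (S u) + δ v u
    insert-split S v Sv u with v Fin.≟ u
    ... | yes refl rewrite Sv = refl
    ... | no _ with S u
    ...   | true  = refl
    ...   | false = refl

    one : Fin n → ℕ
    one _ = 1

    -- While something is missing from S, connectedness gives an edge that leaves S. Adding its far
    -- end raises the size by one and the number of edges by at least one. `fuel` bounds the number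
    -- of missing vertices.
    grow : Connected G → ∀ fuel (S : Fin n → Bool) r → S r ≡ true → n ≤ sum (𝟙 ∘ S) + fuel →
      2 * sum (𝟙 ∘ S) ≤ form (𝟙 ∘ S) (𝟙 ∘ S) + 2 → 2 * n ≤ form one one + 2
    grow connected fuel S r Sr big h with Fin.any? (λ u → S u Bool.≟ false)
    ... | no full = begin
      2 * n                             ≡⟨ cong (2 *_) (trans (sum-cong-≗ S≡1) (trans (sum-const n 1) (*-identityʳ n))) ⟨
      2 * sum (𝟙 ∘ S)                   ≤⟨ h ⟩
      form (𝟙 ∘ S) (𝟙 ∘ S) + 2          ≡⟨ cong (_+ 2) (form-cong S≡1 S≡1) ⟩
      form one one + 2                  ∎
      where
      open ≤-Reasoning
      S≡1 : ∀ u → 𝟙 (S u) ≡ 1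
      S≡1 u with S u in e
      ... | true  = refl
      ... | false = contradiction (u , e) full
    grow connected zero S r Sr big h | yes (u , Su) = contradiction
      (≤-trans big (≤-reflexive (+-identityʳ _)))
      (<⇒≱ (<-≤-trans (sum-mono-< (λ v → 𝟙≤1 (S v)) u (subst (λ b → 𝟙 b < 1) (sym Su) (s≤s z≤n)))
        (≤-reflexive (trans (sum-const n 1) (*-identityʳ n)))))
    grow connected (suc fuel) S r Sr big h | yes (u , Su) with exit S (connected r u) Sr Su
    ... | x , y , x~y , Sx , Sy = grow connected fuel S′ r S′r
      (subst (n ≤_) (trans (+-suc (sum (𝟙 ∘ S)) fuel) (cong (_+ fuel) (trans (+-comm 1 _) (sym ∣S′∣)))) big) (begin
        2 * sum (𝟙 ∘ S′)                                  ≡⟨ cong (2 *_) ∣S′∣ ⟩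
        2 * (sum (𝟙 ∘ S) + 1)                             ≡⟨ *-distribˡ-+ 2 (sum (𝟙 ∘ S)) 1 ⟩
        2 * sum (𝟙 ∘ S) + 2                               ≤⟨ +-mono-≤ h (*-monoʳ-≤ 2 1≤d) ⟩
        form (𝟙 ∘ S) (𝟙 ∘ S) + 2 + 2 * d                  ≡⟨ eq (form (𝟙 ∘ S) (𝟙 ∘ S)) d ⟩
        form (𝟙 ∘ S) (𝟙 ∘ S) + 2 * d + 2                  ≡⟨ cong (_+ 2) (trans (form-cong split split) (form-add y (𝟙 ∘ S))) ⟨
        form (𝟙 ∘ S′) (𝟙 ∘ S′) + 2                        ∎)
      where
      open ≤-Reasoning
      S′ = insert S y
      split = insert-split S y Sy
      d = sum (λ u → a y u * 𝟙 (S u))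
      S′r : S′ r ≡ true
      S′r rewrite Sr = refl
      eq : ∀ f d → f + 2 + 2 * d ≡ f + 2 * d + 2
      eq = solve-∀
      1≤d : 1 ≤ d
      1≤d = ≤-trans (≤-reflexive (sym (cong₂ _*_ (~⇒a (~-sym x~y)) (cong 𝟙 Sx)))) (term≤sum (λ u → a y u * 𝟙 (S u)) x)
      ∣S′∣ : sum (𝟙 ∘ S′) ≡ sum (𝟙 ∘ S) + 1
      ∣S′∣ = trans (sum-cong-≗ split) (trans (∑-distrib-+ (𝟙 ∘ S) (δ y)) (cong (sum (𝟙 ∘ S) +_)
        (trans (sum-cong-≗ λ u → sym (*-identityʳ (δ y u))) (sum-δ (λ _ → 1) y))))

    form-one : form one one ≡ sum (deg G)
    form-one = sum-cong-≗ λ u → trans (+-identityʳ _) (trans (sum-cong-≗ λ v → *-identityʳ (a u v)) (sym (deg≡ u)))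

  handshake : IsTree G → Fin n → sum (deg G) + 2 ≡ 2 * n
  handshake (connected , acyclic) r = ≤-antisym upper lower
    where
    open ≤-Reasoning
    n≡ : sum one ≡ n
    n≡ = trans (sum-const n 1) (*-identityʳ n)
    upper : sum (deg G) + 2 ≤ 2 * n
    upper = begin
      sum (deg G) + 2       ≡⟨ cong (_+ 2) form-one ⟨
      form one one + 2      ≤⟨ forest-bound acyclic (λ _ → true) r refl ⟩
      2 * sum one           ≡⟨ cong (2 *_) n≡ ⟩
      2 * n                 ∎
    root = λ u → does (r Fin.≟ u)
    ∣root∣ : sum (𝟙 ∘ root) ≡ 1
    ∣root∣ = trans (sum-cong-≗ λ u → sym (*-identityʳ (δ r u))) (sum-δ (λ _ → 1) r)
    lower : 2 * n ≤ sum (deg G) + 2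
    lower = begin
      2 * n                 ≤⟨ grow connected n root r (dec-true (r Fin.≟ r) refl) (m≤n+m n _)
                                 (≤-trans (≤-reflexive (cong (2 *_) ∣root∣)) (m≤n+m 2 _)) ⟩
      form one one + 2      ≡⟨ cong (_+ 2) form-one ⟩
      sum (deg G) + 2       ∎

-- The penalty Ψ

-- The penalty of a vertex of degree d: the degree sum of a tree being fixed, the sum over the edges of
-- (Δ - d)² + (Δ - d′)² equals a constant minus the sum of the penalties. Here and below Δ = 2 + E.
ψ : ℕ → ℕ → ℕ
ψ E d = (d ∸ 2) * (d ∸ 1) * (suc (2 * E) ∸ d)

ψ-low : ∀ E d → d ≤ 2 → ψ E d ≡ 0
ψ-low E d d≤2 = cong (λ k → k * (d ∸ 1) * (suc (2 * E) ∸ d)) (m≤n⇒m∸n≡0 d≤2)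

ψ-med : ∀ z y₀ → ψ (z + suc y₀) (2 + z) ≡ medψ z y₀
ψ-med z y₀ = cong (z * suc z *_) (trans (cong (_∸ suc z) (eq z y₀)) (m+n∸m≡n (suc z) (suc z + 2 * y₀)))
  where
  eq : ∀ z y → 2 * (z + suc y) ≡ suc z + (suc z + 2 * y)
  eq = solve-∀

ψ-top : ∀ E → 1 ≤ E → ψ E (2 + E) ≡ K E
ψ-top E 1≤E = trans (cong (E * suc E *_) (trans (cong (_∸ suc E) (eq E 1≤E)) (m+n∸m≡n (suc E) (pred E)))) (cong (_* pred E) (*-comm E (suc E)))
  where
  eq : ∀ E → 1 ≤ E → 2 * E ≡ suc E + pred E
  eq (suc e) _ = trans (cong (suc e +_) (+-identityʳ (suc e))) (+-suc (suc e) e)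

-- From degree 2 on, `y ≡ E - z`, and expanding `y y′` gives equality. A leaf has the truncated
-- value `z ≡ 0` but `y ≡ 1 + E`, so the right side is larger.
low-pair : ∀ E d d′ → 1 ≤ d → d < 2 + E → 1 ≤ d′ → d′ < 2 + E →
  E * E + (d ∸ 2) * (d′ ∸ 2) ≤ (2 + E ∸ d) * (2 + E ∸ d′) + (E * (d ∸ 2) + E * (d′ ∸ 2))
low-pair E 1 1 _ _ _ _ = slack (2 * E + 1) (eq E)
  where
  eq : ∀ E → E * E + 0 * 0 + (2 * E + 1) ≡ suc E * suc E + (E * 0 + E * 0)
  eq = solve-∀
low-pair E 1 (suc (suc z)) _ _ _ (s≤s (s≤s z<E)) = gap-elim
  (λ E → E * E + 0 * z ≤ suc E * (E ∸ z) + (E * 0 + E * z)) z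
  (λ y → subst (λ w → (z + y) * (z + y) + 0 * z ≤ suc (z + y) * w + ((z + y) * 0 + (z + y) * z)) (sym (m+n∸m≡n z y)) (slack y (eq z y)))
  (<⇒≤ z<E)
  where
  eq : ∀ z y → (z + y) * (z + y) + 0 * z + y ≡ suc (z + y) * y + ((z + y) * 0 + (z + y) * z)
  eq = solve-∀
low-pair E (suc (suc z)) 1 _ (s≤s (s≤s z<E)) _ _ = gap-elim
  (λ E → E * E + z * 0 ≤ (E ∸ z) * suc E + (E * z + E * 0)) z
  (λ y → subst (λ w → (z + y) * (z + y) + z * 0 ≤ w * suc (z + y) + ((z + y) * z + (z + y) * 0)) (sym (m+n∸m≡n z y)) (slack y (eq z y)))
  (<⇒≤ z<E)
  where
  eq : ∀ z y → (z + y) * (z + y) + z * 0 + y ≡ y * suc (z + y) + ((z + y) * z + (z + y) * 0)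
  eq = solve-∀
low-pair E (suc (suc z)) (suc (suc z′)) _ (s≤s (s≤s z<E)) _ (s≤s (s≤s z′<E)) =
  ≤-reflexive (eq E z (E ∸ z) z′ (E ∸ z′) (m+[n∸m]≡n (<⇒≤ z<E)) (m+[n∸m]≡n (<⇒≤ z′<E)))
  where
  poly : ∀ z y z′ y′ → (z + y) * (z′ + y′) + z * z′ ≡ y * y′ + ((z′ + y′) * z + (z + y) * z′)
  poly = solve-∀
  eq : ∀ E z y z′ y′ → z + y ≡ E → z′ + y′ ≡ E → E * E + z * z′ ≡ y * y′ + (E * z + E * z′)
  eq E z y z′ y′ p q = subst₂ (λ A B → A * B + z * z′ ≡ y * y′ + (B * z + A * z′)) p q (poly z y z′ y′)

-- Being strict, it excludes leaves from the edges of S in the case of equality.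
leaf-pair : ∀ E d′ → 1 ≤ d′ → d′ < 2 + E →
  E * E + (1 ∸ 2) * (d′ ∸ 2) < (2 + E ∸ 1) * (2 + E ∸ d′) + (E * (1 ∸ 2) + E * (d′ ∸ 2))
leaf-pair E 1 _ _ = slack< (2 * E) (eq E)
  where
  eq : ∀ E → E * E + 0 * 0 + suc (2 * E) ≡ suc E * suc E + (E * 0 + E * 0)
  eq = solve-∀
leaf-pair E (suc (suc z)) _ (s≤s (s≤s z<E)) = gap-elim
  (λ E → E * E + 0 * z < suc E * (E ∸ z) + (E * 0 + E * z)) (suc z)
  (λ y → subst (λ w → (suc z + y) * (suc z + y) + 0 * z < suc (suc z + y) * w + ((suc z + y) * 0 + (suc z + y) * z))
    (sym (trans (+-∸-assoc 1 (m≤m+n z y)) (cong suc (m+n∸m≡n z y)))) (slack< y (eq z y)))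
  z<E
  where
  eq : ∀ z y → (suc z + y) * (suc z + y) + 0 * z + suc y ≡ suc (suc z + y) * suc y + ((suc z + y) * 0 + (suc z + y) * z)
  eq = solve-∀

module _ {n} (G : Graph n) where

  form-add-* : ∀ c v g → form G (λ u → g u + c * δ v u) (λ u → g u + c * δ v u)
    ≡ form G g g + 2 * (c * sum (λ u → a G v u * g u))
  form-add-* c v g = begin
    form G (λ u → g u + c * δ v u) (λ u → g u + c * δ v u)
      ≡⟨ trans (form-+ˡ G g cδ _) (cong₂ _+_ (form-+ʳ G g g cδ) (form-+ʳ G cδ g cδ)) ⟩
    form G g g + form G g cδ + (form G cδ g + form G cδ cδ)
      ≡⟨ cong₂ (λ x y → form G g g + x + (form G cδ g + y)) (form-sym G g cδ) cδcδ ⟩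
    form G g g + form G cδ g + (form G cδ g + 0)
      ≡⟨ +-assoc (form G g g) _ _ ⟩
    form G g g + 2 * form G cδ g
      ≡⟨ cong (λ x → form G g g + 2 * x) (cδ-form g) ⟩
    form G g g + 2 * (c * sum (λ u → a G v u * g u)) ∎
    where
    open ≡-Reasoning
    cδ = λ u → c * δ v u
    cδ-form : ∀ g → form G cδ g ≡ c * sum (λ u → a G v u * g u)
    cδ-form g = trans (sum-cong-≗ λ u → *-assoc c (δ v u) (sum (λ w → a G u w * g w)))
      (trans (sum-*ˡ c (λ u → δ v u * sum (λ w → a G u w * g w))) (cong (c *_) (form-δ G v g)))
    cδcδ : form G cδ cδ ≡ 0
    cδcδ = trans (cδ-form cδ) (trans (cong (c *_) (sum-zero zero-term)) (*-zeroʳ c))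
      where
      zero-term : ∀ u → a G v u * (c * δ v u) ≡ 0
      zero-term u with v Fin.≟ u
      ... | yes refl = cong (_* (c * 1)) (a-irrefl G v)
      ... | no _     = trans (cong (a G v u *_) (*-zeroʳ c)) (*-zeroʳ (a G v u))

module Penalty {n} (G : Graph n) (E : ℕ) where

  y z pen : Fin n → ℕ
  y v   = 2 + E ∸ deg G v
  z v   = deg G v ∸ 2
  pen v = ψ E (deg G v)

  Ψ : ℕ
  Ψ = sum pen + form G y y

  module Subset (S : Fin n → Bool) where
    size s Y A : Fin n → ℕ
    size v = 𝟙 (S v)
    s v = sum (λ u → a G v u * size u)
    Y v = sum (λ u → a G v u * (size u * y u))
    A v = sum (λ u → a G v u * (size u * z u))

    cost : ℕ
    cost = sum (λ v → size v * pen v) + form G (λ v → size v * y v) (λ v → size v * y v)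

    edgeCount : ℕ
    edgeCount = length (filter (λ (u , v) → (S u Bool.≟ true) ×-dec (S v Bool.≟ true)) (edges G))

    2edges : 2 * edgeCount ≡ form G size size
    2edges = trans (count-edges G (λ (u , v) → (S u Bool.≟ true) ×-dec (S v Bool.≟ true)) symm)
      (sum-cong-≗ λ u → trans (sum-cong-≗ λ v → term u v) (sum-*ˡ (size u) (λ v → a G u v * size v)))
      where
      symm : ∀ u v → does ((S u Bool.≟ true) ×-dec (S v Bool.≟ true)) ≡ does ((S v Bool.≟ true) ×-dec (S u Bool.≟ true))
      symm u v = Bool.∧-comm (does (S u Bool.≟ true)) _
      term : ∀ u v → a G u v * 𝟙 (does ((S u Bool.≟ true) ×-dec (S v Bool.≟ true))) ≡ size u * (a G u v * size v)
      term u v with S u | S v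
      ... | true  | true  = sym (+-identityʳ _)
      ... | true  | false = sym (+-identityʳ _)
      ... | false | true  = *-zeroʳ (a G u v)
      ... | false | false = *-zeroʳ (a G u v)

∧-dec-true : ∀ {p} {P : Set p} b (P? : Dec P) → b ∧ does P? ≡ true → b ≡ true × P
∧-dec-true true (yes p) refl = refl , p

∧-dec-false : ∀ {p} {P : Set p} b (P? : Dec P) → b ∧ does P? ≡ false → b ≡ true → ¬ P
∧-dec-false true (no ¬p) _ _ = ¬p

𝟙-split : ∀ b c → 𝟙 b ≡ 𝟙 (b ∧ c) + 𝟙 (b ∧ not (b ∧ c))
𝟙-split false c     = refl
𝟙-split true  true  = refl
𝟙-split true  false = refl

-- The cost of a forest of vertices of degree less than Δ

module _ {n} (G : Graph n) (E : ℕ) where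
  open Penalty G E

  module Forest (4≤E : 4 ≤ E) (acyclic : Acyclic G) (S : Fin n → Bool)
    (inner : ∀ v → S v ≡ true → 1 ≤ deg G v × deg G v < 2 + E) where
    open Subset S

    surplus : Fin n → Fin n → ℕ
    surplus u v = y u * y v + (E * z u + E * z v) ∸ (E * E + z u * z v)

    X : Fin n → ℕ
    X u = sum (λ v → a G u v * (size v * surplus u v))

    row : ∀ u → S u ≡ true → E * E * s u + z u * A u + X u ≡ y u * Y u + (E * z u * s u + E * A u)
    row u Su = begin
      E * E * s u + z u * A u + X u
        ≡⟨ cong₂ (λ p q → p + q + X u) (sum-*ˡ (E * E) (λ v → a G u v * size v)) (sum-*ˡ (z u) (λ v → a G u v * (size v * z v))) ⟨
      sum (λ v → E * E * (a G u v * size v)) + sum (λ v → z u * (a G u v * (size v * z v))) + X u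
        ≡⟨ trans (cong (_+ X u) (sym (∑-distrib-+ (λ v → E * E * (a G u v * size v)) (λ v → z u * (a G u v * (size v * z v))))))
             (sym (∑-distrib-+ (λ v → E * E * (a G u v * size v) + z u * (a G u v * (size v * z v))) (λ v → a G u v * (size v * surplus u v)))) ⟩
      sum (λ v → E * E * (a G u v * size v) + z u * (a G u v * (size v * z v)) + a G u v * (size v * surplus u v))
        ≡⟨ sum-cong-≗ term ⟩
      sum (λ v → y u * (a G u v * (size v * y v)) + (E * z u * (a G u v * size v) + E * (a G u v * (size v * z v))))
        ≡⟨ trans (∑-distrib-+ (λ v → y u * (a G u v * (size v * y v))) (λ v → E * z u * (a G u v * size v) + E * (a G u v * (size v * z v))))
             (cong₂ _+_ (sum-*ˡ (y u) (λ v → a G u v * (size v * y v))) (trans (∑-distrib-+ (λ v → E * z u * (a G u v * size v)) (λ v → E * (a G u v * (size v * z v))))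
               (cong₂ _+_ (sum-*ˡ (E * z u) (λ v → a G u v * size v)) (sum-*ˡ E (λ v → a G u v * (size v * z v)))))) ⟩
      y u * Y u + (E * z u * s u + E * A u) ∎
      where
      open ≡-Reasoning
      eq₁ : ∀ e a z z′ x → e * (a * 1) + z * (a * (1 * z′)) + a * (1 * x) ≡ a * (e + z * z′ + x)
      eq₁ = solve-∀
      eq₂ : ∀ E a y y′ z z′ → a * (y * y′ + (E * z + E * z′)) ≡ y * (a * (1 * y′)) + (E * z * (a * 1) + E * (a * (1 * z′)))
      eq₂ = solve-∀
      zeros : ∀ e a b c d f → e * (a * 0) + b * (a * 0) + a * 0 ≡ c * (a * 0) + (d * (a * 0) + f * (a * 0))
      zeros = solve-∀
      term : ∀ v → E * E * (a G u v * size v) + z u * (a G u v * (size v * z v)) + a G u v * (size v * surplus u v)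
        ≡ y u * (a G u v * (size v * y v)) + (E * z u * (a G u v * size v) + E * (a G u v * (size v * z v)))
      term v with S v in Sv
      ... | false = zeros (E * E) (a G u v) (z u) (y u) (E * z u) E
      ... | true = trans (eq₁ (E * E) (a G u v) (z u) (z v) (surplus u v)) (trans
        (cong (a G u v *_) (m+[n∸m]≡n (low-pair E (deg G u) (deg G v) (proj₁ (inner u Su)) (proj₂ (inner u Su)) (proj₁ (inner v Sv)) (proj₂ (inner v Sv)))))
        (eq₂ E (a G u v) (y u) (y v) (z u) (z v)))

    total : (Fin n → ℕ) → ℕ
    total f = sum (λ u → size u * f u)

    total-+ : ∀ f g → total (λ u → f u + g u) ≡ total f + total g
    total-+ f g = trans (sum-cong-≗ λ u → *-distribˡ-+ (size u) (f u) (g u)) (∑-distrib-+ (λ u → size u * f u) (λ u → size u * g u))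

    total-* : ∀ c f → total (λ u → c * f u) ≡ c * total f
    total-* c f = trans (sum-cong-≗ λ u → eq (size u) c (f u)) (sum-*ˡ c (λ u → size u * f u))
      where
      eq : ∀ a b c → a * (b * c) ≡ b * (a * c)
      eq = solve-∀

    total-cong : ∀ {f g} → (∀ u → S u ≡ true → f u ≡ g u) → total f ≡ total g
    total-cong {f} {g} h = sum-cong-≗ term
      where
      term : ∀ u → size u * f u ≡ size u * g u
      term u with S u in Su
      ... | true  = cong (_+ 0) (h u Su)
      ... | false = refl

    zs YY ZZ XX P : ℕ
    zs = total (λ u → z u * s u)
    YY = form G (λ v → size v * y v) (λ v → size v * y v)
    ZZ = total (λ u → z u * A u)
    XX = total X
    P  = total pen

    e : ℕ
    e = edgeCount

    private
      YY≡ : total (λ u → y u * Y u) ≡ YY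
      YY≡ = sum-cong-≗ λ u → sym (*-assoc (size u) (y u) (Y u))

      A≡ : total A ≡ zs
      A≡ = trans (form-sym G size (λ v → size v * z v)) (sum-cong-≗ λ u → *-assoc (size u) (z u) (s u))

      edge-eq : E * E * (2 * e) + ZZ + XX ≡ YY + (E * zs + E * zs)
      edge-eq = begin
        E * E * (2 * e) + ZZ + XX
          ≡⟨ cong (λ k → k + ZZ + XX) (trans (cong (E * E *_) 2edges) (sym (total-* (E * E) s))) ⟩
        total (λ u → E * E * s u) + ZZ + XX
          ≡⟨ trans (cong (_+ XX) (sym (total-+ (λ u → E * E * s u) (λ u → z u * A u)))) (sym (total-+ (λ u → E * E * s u + z u * A u) X)) ⟩
        total (λ u → E * E * s u + z u * A u + X u)
          ≡⟨ total-cong row ⟩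
        total (λ u → y u * Y u + (E * z u * s u + E * A u))
          ≡⟨ trans (total-+ (λ u → y u * Y u) (λ u → E * z u * s u + E * A u)) (cong₂ _+_ YY≡
               (trans (total-+ (λ u → E * z u * s u) (λ u → E * A u)) (cong₂ _+_
                 (trans (total-cong (λ u _ → *-assoc E (z u) (s u))) (total-* E (λ u → z u * s u)))
                 (trans (total-* E A) (cong (E *_) A≡))))) ⟩
        YY + (E * zs + E * zs) ∎
        where open ≡-Reasoning

    -- The basic identity: each edge of S costs at least 2 y y′ = 2 (E - z)(E - z′) ≥ ℓ - 2 E z - 2 E z′.
    cost-eq : ℓ E * e + (ZZ + XX) + P ≡ cost + 2 * (E * zs)
    cost-eq = begin
      ℓ E * e + (ZZ + XX) + P              ≡⟨ eq₁ E e ZZ XX P ⟩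
      P + (E * E * (2 * e) + ZZ + XX)      ≡⟨ cong (P +_) edge-eq ⟩
      P + (YY + (E * zs + E * zs))         ≡⟨ eq₂ P YY (E * zs) ⟩
      P + YY + 2 * (E * zs)                ∎
      where
      open ≡-Reasoning
      eq₁ : ∀ E e z x p → 2 * (E * E) * e + (z + x) + p ≡ p + (E * E * (2 * e) + z + x)
      eq₁ = solve-∀
      eq₂ : ∀ p y k → p + (y + (k + k)) ≡ p + y + 2 * k
      eq₂ = solve-∀

    s≤deg : ∀ v → s v ≤ deg G v
    s≤deg v = ≤-trans (sum-mono λ u → ≤-trans (*-monoʳ-≤ (a G v u) (𝟙≤1 (S u))) (≤-reflexive (*-identityʳ _))) (≤-reflexive (sym (deg≡ G v)))

    -- A vertex of medium degree without edges in S saves nothing. It is left to `rest`, where its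
    -- penalty is pure loss.
    m : Fin n → Bool
    m v = S v ∧ does ((3 ≤? deg G v) ×-dec (1 ≤? s v))

    record Medium (v : Fin n) : Set where
      field
        inS : S v ≡ true
        1≤z : 1 ≤ z v
        1≤s : 1 ≤ s v
        d≡  : deg G v ≡ 2 + z v
        E≡  : z v + suc (pred (y v)) ≡ E
        y≡  : suc (pred (y v)) ≡ y v
        pen≡ : pen v ≡ medψ (z v) (pred (y v))

    medium-facts : ∀ v → S v ≡ true → 3 ≤ deg G v → 1 ≤ s v → Medium v
    medium-facts v Sv 3≤d 1≤s = record
      { inS = Sv ; 1≤z = m<n⇒0<n∸m 3≤d ; 1≤s = 1≤s ; d≡ = d≡ ; E≡ = E≡ ; y≡ = y≡
      ; pen≡ = trans (cong₂ ψ (sym E≡) d≡) (ψ-med (z v) (pred (y v))) }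
      where
      d≡ : deg G v ≡ 2 + z v
      d≡ = sym (m+[n∸m]≡n (≤-trans (n≤1+n 2) 3≤d))
      y≡ : suc (pred (y v)) ≡ y v
      y≡ = suc-pred (y v) {{>-nonZero (m<n⇒0<n∸m (proj₂ (inner v Sv)))}}
      E≡ : z v + suc (pred (y v)) ≡ E
      E≡ = trans (cong (z v +_) y≡) (+-cancelˡ-≡ 2 _ _ (trans (cong (_+ y v) (sym d≡)) (m+[n∸m]≡n (<⇒≤ (proj₂ (inner v Sv))))))

    m-true : ∀ v → m v ≡ true → Medium v
    m-true v mv with ∧-dec-true (S v) ((3 ≤? deg G v) ×-dec (1 ≤? s v)) mv
    ... | Sv , 3≤d , 1≤s = medium-facts v Sv 3≤d 1≤s

    m-false : ∀ v → m v ≡ false → S v ≡ true → z v * s v ≡ 0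
    m-false v mv Sv with 3 ≤? deg G v | 1 ≤? s v
    ... | no d<3  | _       = cong (_* s v) (m≤n⇒m∸n≡0 (s≤s⁻¹ (≰⇒> d<3)))
    ... | yes _   | no s<1  = trans (cong (z v *_) (n<1⇒n≡0 (≰⇒> s<1))) (*-zeroʳ (z v))
    ... | yes 3≤d | yes 1≤s = contradiction (3≤d , 1≤s) (∧-dec-false (S v) ((3 ≤? deg G v) ×-dec (1 ≤? s v)) mv Sv)

    μ : Fin n → ℕ
    μ v = 𝟙 (m v)

    rest : Fin n → ℕ
    rest v = 𝟙 (S v ∧ not (m v))

    size-split : ∀ v → size v ≡ μ v + rest v
    size-split v = 𝟙-split (S v) (does ((3 ≤? deg G v) ×-dec (1 ≤? s v)))

    r : ℕ
    r = sum μ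

    -- The sum counts an edge between two medium vertices twice and any other edge at most once. The
    -- former edges form a forest on `r` vertices, so there are at most `r - 1` of them.
    forest : ∀ v → m v ≡ true → sum (λ v → μ v * s v) + 1 ≤ e + r
    forest v mv = *-cancelˡ-≤ 2 (begin
      2 * (sum (λ v → μ v * s v) + 1)                          ≡⟨ cong (λ k → 2 * (k + 1)) mS ⟩
      2 * (mm + mr + 1)                                        ≡⟨ eq₁ mm mr ⟩
      (mm + mr + mr) + (mm + 2)                                ≤⟨ +-mono-≤ le (forest-bound G acyclic m v mv) ⟩
      2 * e + 2 * r                                            ≡⟨ *-distribˡ-+ 2 e r ⟨
      2 * (e + r)                                              ∎)
      where
      open ≤-Reasoning
      mm = form G μ μ
      mr = form G μ rest
      mS : form G μ size ≡ mm + mr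
      mS = trans (form-cong G {μ} (λ _ → refl) size-split) (form-+ʳ G μ μ rest)
      eq₁ : ∀ p q → 2 * (p + q + 1) ≡ (p + q + q) + (p + 2)
      eq₁ = solve-∀
      le : mm + mr + mr ≤ 2 * e
      le = begin
        mm + mr + mr                          ≤⟨ m≤m+n _ (form G rest rest) ⟩
        mm + mr + mr + form G rest rest       ≡⟨ +-assoc (mm + mr) mr (form G rest rest) ⟩
        mm + mr + (mr + form G rest rest)     ≡⟨ cong₂ _+_ (sym mS) (cong (_+ form G rest rest) (form-sym G μ rest)) ⟩
        form G μ size + (form G rest μ + form G rest rest)
                                              ≡⟨ cong (form G μ size +_) (trans (sym (form-+ʳ G rest μ rest)) (form-cong G {rest} (λ _ → refl) (sym ∘ size-split))) ⟩
        form G μ size + form G rest size      ≡⟨ form-+ˡ G μ rest size ⟨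
        form G (λ v → μ v + rest v) size      ≡⟨ form-cong G {g = size} (sym ∘ size-split) (λ _ → refl) ⟩
        form G size size                      ≡⟨ 2edges ⟨
        2 * e                                 ∎

𝟙-vanish : ∀ b c {k} → (c ≡ false → b ≡ true → k ≡ 0) → 𝟙 (b ∧ not c) * k ≡ 0
𝟙-vanish false _     _ = refl
𝟙-vanish true  true  _ = refl
𝟙-vanish true  false h = trans (+-identityʳ _) (h refl refl)

part-covers : ∀ E z y₀ s → z + suc y₀ ≡ E → 1 ≤ z → 4 ≤ E → 1 ≤ s → s ≤ 2 + z →
  Covers E (pred s) (medCost z y₀ s ∸ ℓ E) × 0 < medCost z y₀ s ∸ ℓ E × ℓ E < medCost z y₀ s
part-covers E z y₀ (suc x) refl 1≤z 4≤E _ (s≤s x≤z+1) =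
  covers-excess z y₀ x 1≤z 4≤E x≤z+1 , excess>0 z y₀ x 1≤z 4≤E x≤z+1 , ℓ<cost z y₀ x 1≤z 4≤E x≤z+1

medCost-eq : ∀ E z y₀ s → z + suc y₀ ≡ E → medψ z y₀ + s * ℓ E ≡ medCost z y₀ s + 2 * (E * (z * s))
medCost-eq E z y₀ s refl = eq (medψ z y₀) s z y₀
  where
  eq : ∀ ψ s z y → ψ + s * (2 * ((z + suc y) * (z + suc y))) ≡ ψ + 2 * (s * (suc y * (z + suc y))) + 2 * ((z + suc y) * (z * s))
  eq = solve-∀

single-cost : ∀ E z y₀ s j → z + suc y₀ ≡ E → 1 ≤ z → 4 ≤ E → s ≤ 2 + z → 1 ≤ j → j ≤ s → let c = medCost z y₀ s in
  (K E < c ⊎ j * ℓ E < c + γ E (pred j)) ⊎ (j ≡ s × (j ≡ 1 + z ⊎ j ≡ 2 + z) × (K E < c ⊎ j * ℓ E ≤ c + γ E (pred j)))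
single-cost E z y₀ (suc x) (suc i) refl 1≤z 4≤E (s≤s x≤z+1) _ (s≤s i≤x) with m≤n⇒m<n∨m≡n i≤x
... | inj₁ i<x = inj₁ (cost-mono z y₀ x 1≤z 4≤E x≤z+1 i i<x)
... | inj₂ refl with x ≟ z | x ≟ suc z
...   | yes refl | _        = inj₂ (refl , inj₁ refl , gain z y₀ x 1≤z 4≤E x≤z+1)
...   | no _     | yes refl = inj₂ (refl , inj₂ refl , gain z y₀ x 1≤z 4≤E x≤z+1)
...   | no x≢z   | no x≢z+1 = inj₁ (gain< z y₀ x 1≤z 4≤E x≤z+1 x≢z x≢z+1)

-- Lower bounds for the cost of S and the cases of equality

module Estimate {n} (G : Graph n) (E : ℕ) (4≤E : 4 ≤ E) (acyclic : Acyclic G) (S : Fin n → Bool)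
  (inner : ∀ v → S v ≡ true → 1 ≤ deg G v × deg G v < 2 + E) where
  open Penalty G E
  open Subset S
  open Forest G E 4≤E acyclic S inner

  c x W : Fin n → ℕ
  c v = medCost (z v) (pred (y v)) (s v)
  x v = μ v * pred (s v)
  W v = μ v * (c v ∸ ℓ E)

  s≤ : ∀ v → Medium v → s v ≤ 2 + z v
  s≤ v med = subst (s v ≤_) (Medium.d≡ med) (s≤deg v)

  covers : ∀ v → (med : Medium v) → Covers E (pred (s v)) (c v ∸ ℓ E) × 0 < c v ∸ ℓ E × ℓ E < c v
  covers v med = part-covers E (z v) (pred (y v)) (s v) E≡ 1≤z 4≤E 1≤s (s≤ v med)
    where open Medium med

  -- All that must vanish in a tie: `ZZ` is due to adjacent medium vertices, `XX` to leaves at edges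
  -- of S, and `R` to vertices of medium degree without edges in S.
  Q R : ℕ
  R = sum (λ v → rest v * pen v)
  Q = ZZ + XX + R

  private
    P≡ : P ≡ sum (λ v → μ v * pen v) + R
    P≡ = trans (sum-cong-≗ λ v → trans (cong (_* pen v) (size-split v)) (*-distribʳ-+ (pen v) (μ v) (rest v)))
      (∑-distrib-+ (λ v → μ v * pen v) (λ v → rest v * pen v))

    zs≡ : zs ≡ sum (λ v → μ v * (z v * s v))
    zs≡ = sum-cong-≗ λ v → trans (cong (_* (z v * s v)) (size-split v)) (trans (*-distribʳ-+ (z v * s v) (μ v) (rest v))
      (trans (cong (μ v * (z v * s v) +_) (vanish v)) (+-identityʳ _)))
      where
      vanish : ∀ v → rest v * (z v * s v) ≡ 0
      vanish v = 𝟙-vanish (S v) (m v) (m-false v)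

    vertex-eq : ∀ v → μ v * pen v + ℓ E * x v ≡ W v + 2 * (E * (μ v * (z v * s v)))
    vertex-eq v with m v in mv
    ... | false = trans (*-zeroʳ (ℓ E)) (sym (cong (2 *_) (*-zeroʳ E)))
    ... | true = +-cancelʳ-≡ (ℓ E) _ _ (begin
      1 * pen v + ℓ E * (1 * pred (s v)) + ℓ E                         ≡⟨ eq₁ (pen v) (ℓ E) (pred (s v)) ⟩
      pen v + suc (pred (s v)) * ℓ E                                   ≡⟨ cong₂ (λ p k → p + k * ℓ E) pen≡ (suc-pred (s v) {{>-nonZero 1≤s}}) ⟩
      medψ (z v) (pred (y v)) + s v * ℓ E                              ≡⟨ medCost-eq E (z v) (pred (y v)) (s v) E≡ ⟩
      c v + 2 * (E * (z v * s v))                                      ≡⟨ cong (_+ 2 * (E * (z v * s v))) (m∸n+n≡m (<⇒≤ (proj₂ (proj₂ (covers v med))))) ⟨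
      c v ∸ ℓ E + ℓ E + 2 * (E * (z v * s v))                          ≡⟨ eq₂ (c v ∸ ℓ E) (ℓ E) E (z v * s v) ⟩
      1 * (c v ∸ ℓ E) + 2 * (E * (1 * (z v * s v))) + ℓ E              ∎)
      where
      open ≡-Reasoning
      med = m-true v mv
      open Medium med
      eq₁ : ∀ p l x → 1 * p + l * (1 * x) + l ≡ p + suc x * l
      eq₁ = solve-∀
      eq₂ : ∀ w l e k → w + l + 2 * (e * k) ≡ 1 * w + 2 * (e * (1 * k)) + l
      eq₂ = solve-∀

    vertex-sum : sum (λ v → μ v * pen v) + ℓ E * sum x ≡ sum W + 2 * (E * zs)
    vertex-sum = begin
      sum (λ v → μ v * pen v) + ℓ E * sum x
        ≡⟨ cong (sum (λ v → μ v * pen v) +_) (sum-*ˡ (ℓ E) x) ⟨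
      sum (λ v → μ v * pen v) + sum (λ v → ℓ E * x v)
        ≡⟨ ∑-distrib-+ (λ v → μ v * pen v) (λ v → ℓ E * x v) ⟨
      sum (λ v → μ v * pen v + ℓ E * x v)
        ≡⟨ sum-cong-≗ vertex-eq ⟩
      sum (λ v → W v + 2 * (E * (μ v * (z v * s v))))
        ≡⟨ ∑-distrib-+ W (λ v → 2 * (E * (μ v * (z v * s v)))) ⟩
      sum W + sum (λ v → 2 * (E * (μ v * (z v * s v))))
        ≡⟨ cong (sum W +_) (trans (sum-*ˡ 2 (λ v → E * (μ v * (z v * s v)))) (cong (2 *_) (trans (sum-*ˡ E (λ v → μ v * (z v * s v))) (cong (E *_) (sym zs≡))))) ⟩
      sum W + 2 * (E * zs) ∎
      where open ≡-Reasoning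

  -- Solved for `cost`: one `ℓ`, the weight `W` of each medium vertex, an `ℓ` for each of the
  -- remaining `e - 1 - sum x` edges, and `Q`.
  balance : ℓ E * e + Q + sum W ≡ cost + ℓ E * sum x
  balance = +-cancelʳ-≡ (2 * (E * zs)) _ _ (begin
    ℓ E * e + (ZZ + XX + R) + sum W + 2 * (E * zs)
      ≡⟨ eq₁ (ℓ E * e) (ZZ + XX) R (sum W) (2 * (E * zs)) ⟩
    ℓ E * e + (ZZ + XX) + (R + (sum W + 2 * (E * zs)))
      ≡⟨ cong (λ k → ℓ E * e + (ZZ + XX) + (R + k)) vertex-sum ⟨
    ℓ E * e + (ZZ + XX) + (R + (M + ℓ E * sum x))
      ≡⟨ eq₂ (ℓ E * e + (ZZ + XX)) R M (ℓ E * sum x) ⟩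
    ℓ E * e + (ZZ + XX) + (M + R) + ℓ E * sum x
      ≡⟨ cong (_+ ℓ E * sum x) (trans (cong (ℓ E * e + (ZZ + XX) +_) (sym P≡)) cost-eq) ⟩
    cost + 2 * (E * zs) + ℓ E * sum x
      ≡⟨ eq₃ cost (2 * (E * zs)) (ℓ E * sum x) ⟩
    cost + ℓ E * sum x + 2 * (E * zs) ∎)
    where
    open ≡-Reasoning
    M = sum (λ v → μ v * pen v)
    eq₁ : ∀ a b r w k → a + (b + r) + w + k ≡ a + b + (r + (w + k))
    eq₁ = solve-∀
    eq₂ : ∀ a r m l → a + (r + (m + l)) ≡ a + (m + r) + l
    eq₂ = solve-∀
    eq₃ : ∀ a b c → a + b + c ≡ a + c + b
    eq₃ = solve-∀

  edges≥ : ∀ v → m v ≡ true → suc (sum x) ≤ e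
  edges≥ v mv = +-cancelʳ-≤ r _ _ (begin
    suc (sum x) + r                       ≡⟨ eq (sum x) r ⟩
    sum x + r + 1                         ≡⟨ cong (_+ 1) (∑-distrib-+ x μ) ⟨
    sum (λ v → x v + μ v) + 1             ≡⟨ cong (_+ 1) (sum-cong-≗ term) ⟩
    sum (λ v → μ v * s v) + 1             ≤⟨ forest v mv ⟩
    e + r                                 ∎)
    where
    open ≤-Reasoning
    eq : ∀ a b → suc a + b ≡ a + b + 1
    eq = solve-∀
    term : ∀ v → x v + μ v ≡ μ v * s v
    term v with m v in mv
    ... | false = refl
    ... | true  = trans (eq′ (pred (s v))) (cong (1 *_) (suc-pred (s v) {{>-nonZero (Medium.1≤s (m-true v mv))}}))
      where
      eq′ : ∀ a → 1 * a + 1 ≡ 1 * suc a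
      eq′ = solve-∀

  -- With `k` vertices outside S, `above` loses to 𝒯″, and `over` to 𝒯′ or 𝒯‴ because `γ E (pred j)`
  -- is the saving of one of them. The exact outcomes are the possible members of 𝒯′ and 𝒯‴.
  data Outcome (j : ℕ) : Set where
    above  : K E < cost → Outcome j
    over   : j * ℓ E < cost + γ E (pred j) → Outcome j
    exact₀ : j ≡ 1 → e ≡ 1 → (∀ v → m v ≡ false) → Q ≡ 0 → cost ≡ ℓ E → Outcome j
    exact₁ : ∀ v → Medium v → (∀ u → u ≢ v → m u ≡ false) → e ≡ j → s v ≡ j → j ≡ 1 + z v ⊎ j ≡ 2 + z v →
      Q ≡ 0 → cost ≡ medCost (z v) (pred (y v)) j → Outcome j

  private
    -- With k further edges in S, paid at the rate ℓ of an edge between two vertices of degree 2.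
    cost≡ : ∀ k → suc (sum x) + k ≡ e → ℓ E + (sum W + k * ℓ E) + Q ≡ cost
    cost≡ k e≡ = +-cancelʳ-≡ (ℓ E * sum x) _ _ (trans (eq (ℓ E) (sum W) k Q (sum x)) (trans (cong (λ e → ℓ E * e + Q + sum W) e≡) balance))
      where
      eq : ∀ l w k q x → l + (w + k * l) + q + l * x ≡ l * (suc x + k) + q + w
      eq = solve-∀

    from-covers : ∀ j V X → 1 ≤ j → j ≤ suc X → Covers< E X V → ℓ E + V ≤ cost → Outcome j
    from-covers (suc i) V X _ (s≤s i≤X) cov V≤ with cov i i≤X
    ... | inj₁ K< = above (<-≤-trans K< V≤)
    ... | inj₂ h  = over (<-≤-trans (+-monoʳ-< (ℓ E) h) (≤-trans (≤-reflexive (sym (+-assoc (ℓ E) V (γ E i)))) (+-monoˡ-≤ (γ E i) V≤)))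

    0<ℓ : 0 < ℓ E
    0<ℓ = *-mono-≤ {1} {2} (s≤s z≤n) (*-mono-≤ {1} {E} (≤-trans (s≤s z≤n) 4≤E) (≤-trans (s≤s z≤n) 4≤E))

    gap : ∀ v → m v ≡ true → ∃[ k ] suc (sum x) + k ≡ e
    gap v mv = ≤⇒gap (edges≥ v mv)

    μ-cov : ∀ v → m v ≡ true → Covers E (x v) (W v) × 0 < W v
    μ-cov v mv with m v | m-true v
    ... | true | med = subst₂ (Covers E) (sym (*-identityˡ _)) (sym (*-identityˡ _)) (proj₁ (covers v (med refl)))
      , subst (0 <_) (sym (*-identityˡ _)) (proj₁ (proj₂ (covers v (med refl))))

    μ-zero : ∀ v → m v ≡ false → x v ≡ 0 × W v ≡ 0
    μ-zero v mv with m v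
    ... | false = refl , refl

    x≡ : ∀ v → m v ≡ true → x v ≡ pred (s v)
    x≡ v mv = trans (cong (λ b → 𝟙 b * pred (s v)) mv) (*-identityˡ _)

    W≡ : ∀ v → m v ≡ true → W v ≡ c v ∸ ℓ E
    W≡ v mv = trans (cong (λ b → 𝟙 b * (c v ∸ ℓ E)) mv) (*-identityˡ _)

    many-case : ∀ j → 1 ≤ j → j ≤ e → Covers< E (sum x) (sum W) → 0 < sum W → ∀ k → suc (sum x) + k ≡ e → Outcome j
    many-case j 1≤j j≤e cov W>0 zero e≡ = from-covers j (sum W) (sum x) 1≤j (subst (j ≤_) (trans (sym e≡) (+-identityʳ _)) j≤e) cov
      (≤-trans (+-monoʳ-≤ (ℓ E) (m≤m+n (sum W) 0)) (≤-trans (m≤m+n _ Q) (≤-reflexive (cost≡ 0 e≡))))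
    many-case j 1≤j j≤e cov W>0 (suc k) e≡ = from-covers j (sum W + suc k * ℓ E) (sum x + suc k) 1≤j (subst (j ≤_) (sym e≡) j≤e)
      (covers-+ 4≤E (weaken cov) (covers-low E (suc k)) W>0 (≤-trans 0<ℓ (m≤m+n (ℓ E) (k * ℓ E))))
      (≤-trans (m≤m+n _ Q) (≤-reflexive (cost≡ (suc k) e≡)))

    one-case : ∀ j → 1 ≤ j → j ≤ e → ∀ v → m v ≡ true → (∀ u → u ≢ v → m u ≡ false) → sum x ≡ x v → sum W ≡ W v →
      ∀ k → suc (sum x) + k ≡ e → Outcome j
    one-case j 1≤j j≤e v mv others sx sW (suc k) e≡ = from-covers j (sum W + suc k * ℓ E) (sum x + suc k) 1≤j (subst (j ≤_) (sym e≡) j≤e)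
      (covers-+ 4≤E (subst₂ (Covers E) (sym sx) (sym sW) (proj₁ (μ-cov v mv))) (covers-low E (suc k))
        (subst (0 <_) (sym sW) (proj₂ (μ-cov v mv))) (≤-trans 0<ℓ (m≤m+n (ℓ E) (k * ℓ E))))
      (≤-trans (m≤m+n _ Q) (≤-reflexive (cost≡ (suc k) e≡)))
    one-case j 1≤j j≤e v mv others sx sW zero e≡ =
      finish (single-cost E (z v) (pred (y v)) (s v) j E≡ 1≤z 4≤E (s≤ v med) 1≤j (subst (j ≤_) e≡s j≤e))
      where
      med = m-true v mv
      open Medium med
      e≡s : e ≡ s v
      e≡s = trans (sym e≡) (trans (+-identityʳ _) (trans (cong suc (trans sx (x≡ v mv))) (suc-pred (s v) {{>-nonZero 1≤s}})))
      cost≡c : c v + Q ≡ cost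
      cost≡c = trans (cong (_+ Q) (trans (sym (m+[n∸m]≡n (<⇒≤ (proj₂ (proj₂ (covers v med))))))
        (cong (ℓ E +_) (trans (sym (trans sW (W≡ v mv))) (sym (+-identityʳ (sum W))))))) (cost≡ 0 e≡)
      c≤cost : c v ≤ cost
      c≤cost = ≤-trans (m≤m+n (c v) Q) (≤-reflexive cost≡c)
      tie : j ≡ s v → j ≡ 1 + z v ⊎ j ≡ 2 + z v → K E < c v ⊎ j * ℓ E ≤ c v + γ E (pred j) → ∀ q → Q ≡ q → Outcome j
      tie j≡s shape _ zero Q≡ = exact₁ v med others (trans e≡s (sym j≡s)) (sym j≡s) shape Q≡
        (trans (sym cost≡c) (trans (cong (c v +_) Q≡) (trans (+-identityʳ (c v)) (cong (medCost (z v) (pred (y v))) (sym j≡s)))))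
      -- A positive `Q` turns the tie into a strict inequality.
      tie _ _ (inj₁ K<) (suc q) _ = above (<-≤-trans K< c≤cost)
      tie _ _ (inj₂ h) (suc q) Q≡ = over (≤-<-trans h (+-monoˡ-< (γ E (pred j))
        (<-≤-trans (m<m+n (c v) (s≤s z≤n)) (≤-reflexive (trans (cong (c v +_) (sym Q≡)) cost≡c)))))
      finish : (K E < c v ⊎ j * ℓ E < c v + γ E (pred j)) ⊎ (j ≡ s v × (j ≡ 1 + z v ⊎ j ≡ 2 + z v) × (K E < c v ⊎ j * ℓ E ≤ c v + γ E (pred j))) → Outcome j
      finish (inj₁ (inj₁ K<)) = above (<-≤-trans K< c≤cost)
      finish (inj₁ (inj₂ h))  = over (<-≤-trans h (+-monoˡ-≤ (γ E (pred j)) c≤cost))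
      finish (inj₂ (j≡s , shape , bound)) = tie j≡s shape bound Q refl

    0<γ : ∀ j → 2 ≤ j → 0 < γ E (pred j)
    0<γ 2 _ = ≤-trans (s≤s z≤n) (≤-reflexive (sym (γ₁ E)))
    0<γ 3 _ = ≤-trans (s≤s z≤n) (18≤γ₂ E)
    0<γ (suc (suc (suc (suc t)))) _ = ≤-trans (*-mono-≤ {1} {2 + t} (s≤s z≤n)
      (≤-trans (*-mono-≤ {1} {3 + t} {1} {3 + t} (s≤s z≤n) (s≤s z≤n)) (m≤n+m _ (2 * E)))) (≤-reflexive (sym (γ₃₊ E t)))
    0<γ 1 (s≤s ())

    -- Without a medium vertex nothing is saved, so a tie requires `γ E (pred j)` to vanish, that is
    -- `j ≡ 1`.
    none-case : ∀ j → 1 ≤ j → j ≤ e → (∀ v → m v ≡ false) → sum x ≡ 0 → sum W ≡ 0 → Outcome j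
    none-case j 1≤j j≤e ms sx sW = finish (m≤n⇒m<n∨m≡n j≤e)
      where
      cost≡ℓ : ℓ E * e + Q ≡ cost
      cost≡ℓ = trans (sym (+-identityʳ _)) (trans (cong (ℓ E * e + Q +_) (sym sW)) (trans balance
        (trans (cong (cost +_) (trans (cong (ℓ E *_) sx) (*-zeroʳ (ℓ E)))) (+-identityʳ cost))))
      jℓ≤ : j * ℓ E ≤ ℓ E * e
      jℓ≤ = ≤-trans (≤-reflexive (*-comm j (ℓ E))) (*-monoʳ-≤ (ℓ E) j≤e)
      single : j ≡ e → 1 ≡ j → ∀ q → Q ≡ q → Outcome j
      single j≡e 1≡j (suc q) Q≡ = over (≤-<-trans jℓ≤ (<-≤-trans (<-≤-trans (m<m+n (ℓ E * e) (subst (0 <_) (sym Q≡) (s≤s z≤n)))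
        (≤-reflexive cost≡ℓ)) (m≤m+n cost _)))
      single j≡e 1≡j zero Q≡ = exact₀ (sym 1≡j) (trans (sym j≡e) (sym 1≡j)) ms Q≡
        (trans (sym cost≡ℓ) (trans (cong₂ (λ e q → ℓ E * e + q) (trans (sym j≡e) (sym 1≡j)) Q≡) (trans (+-identityʳ _) (*-identityʳ (ℓ E)))))
      finish′ : j ≡ e → 1 < j ⊎ 1 ≡ j → Outcome j
      finish′ _ (inj₁ 2≤j) = over (≤-<-trans (≤-trans jℓ≤ (≤-trans (m≤m+n _ Q) (≤-reflexive cost≡ℓ))) (m<m+n cost (0<γ j 2≤j)))
      finish′ j≡e (inj₂ 1≡j) = single j≡e 1≡j Q refl
      finish : j < e ⊎ j ≡ e → Outcome j
      finish (inj₁ j<e) = over (≤-trans (≤-<-trans (≤-reflexive (*-comm j (ℓ E))) (*-monoʳ-< (ℓ E) {{>-nonZero 0<ℓ}} j<e))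
        (≤-trans (m≤m+n _ Q) (≤-trans (≤-reflexive cost≡ℓ) (m≤m+n cost _))))
      finish (inj₂ j≡e) = finish′ j≡e (m≤n⇒m<n∨m≡n 1≤j)

    some-medium : 0 < sum W → ∃[ v ] m v ≡ true
    some-medium W>0 = found (sum-positive W W>0)
      where
      found : ∃[ v ] 0 < W v → ∃[ v ] m v ≡ true
      found (v , Wv>0) = v , Bool.¬-not (λ mv → <⇒≢ Wv>0 (sym (proj₂ (μ-zero v mv))))

  estimate : ∀ j → 1 ≤ j → j ≤ e → Outcome j
  estimate j 1≤j j≤e = cases (parts 4≤E x W m μ-cov μ-zero)
    where
    cases : Parts E x W m → Outcome j
    cases (noPart ms sx sW)          = none-case j 1≤j j≤e ms sx sW
    cases (onePart v mv others sx sW)  = one-case j 1≤j j≤e v mv others sx sW (proj₁ (gap v mv)) (proj₂ (gap v mv))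
    cases (manyParts cov W>0)           = many-case j 1≤j j≤e cov W>0 (proj₁ (gap v mv)) (proj₂ (gap v mv))
      where
      v  = proj₁ (some-medium W>0)
      mv = proj₂ (some-medium W>0)

  -- An edge of S pays at least two thirds of `ℓ` on average. In three times `cost-eq` the deduction
  -- `6 E zs` has to be matched by penalties, `ZZ` and one `ℓ` per edge; this is `slope` summed over
  -- the medium vertices, with `forest` bounding the sum of their `s`.
  slope-cost : (∀ v → S v ≡ true → pen v + 2 * (y v * Y v) ≤ K E) → 4 * (E * E) * e ≤ 3 * cost
  slope-cost τ≤K = +-cancelʳ-≤ (6 * (E * zs)) _ _ (begin
    4 * (E * E) * e + 6 * (E * zs)                              ≤⟨ +-monoʳ-≤ (4 * (E * E) * e) key ⟩
    4 * (E * E) * e + (ℓ E * e + (3 * P + 3 * ZZ))              ≤⟨ slack (3 * XX) (eq₁ E e P ZZ XX) ⟩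
    3 * (ℓ E * e + (ZZ + XX) + P)                               ≡⟨ cong (3 *_) cost-eq ⟩
    3 * (cost + 2 * (E * zs))                                   ≡⟨ eq₂ cost (E * zs) ⟩
    3 * cost + 6 * (E * zs)                                     ∎)
    where
    open ≤-Reasoning
    eq₁ : ∀ E e p q w → 4 * (E * E) * e + (2 * (E * E) * e + (3 * p + 3 * q)) + 3 * w ≡ 3 * (2 * (E * E) * e + (q + w) + p)
    eq₁ = solve-∀
    eq₂ : ∀ a b → 3 * (a + 2 * b) ≡ 3 * a + 6 * b
    eq₂ = solve-∀
    Es≤ : ∀ v → E * s v ≤ Y v + A v
    Es≤ v = begin
      E * s v                                                                   ≡⟨ sum-*ˡ E (λ u → a G v u * size u) ⟨
      sum (λ u → E * (a G v u * size u))                                        ≤⟨ sum-mono term ⟩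
      sum (λ u → a G v u * (size u * y u) + a G v u * (size u * z u))           ≡⟨ ∑-distrib-+ (λ u → a G v u * (size u * y u)) (λ u → a G v u * (size u * z u)) ⟩
      Y v + A v                                                                 ∎
      where
      eq : ∀ e a s y z → a * (s * (y + z)) ≡ a * (s * y) + a * (s * z)
      eq _ = λ a s y z → trans (cong (a *_) (*-distribˡ-+ s y z)) (*-distribˡ-+ a (s * y) (s * z))
      comm : ∀ e a s → e * (a * s) ≡ a * (s * e)
      comm = solve-∀
      E≤ : ∀ d → d < 2 + E → E ≤ 2 + E ∸ d + (d ∸ 2)
      E≤ 0 _ = ≤-trans (m≤n+m E 2) (m≤m+n _ 0)
      E≤ 1 _ = ≤-trans (m≤n+m E 1) (m≤m+n _ 0)
      E≤ (suc (suc z)) (s≤s (s≤s z<E)) = ≤-reflexive (sym (m∸n+n≡m (<⇒≤ z<E)))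
      term : ∀ u → E * (a G v u * size u) ≤ a G v u * (size u * y u) + a G v u * (size u * z u)
      term u with S u in Su
      ... | false = ≤-trans (≤-reflexive (trans (cong (E *_) (*-zeroʳ (a G v u))) (*-zeroʳ E))) z≤n
      ... | true  = ≤-trans (≤-reflexive (comm E (a G v u) 1))
        (≤-trans (*-monoʳ-≤ (a G v u) (*-monoʳ-≤ 1 (E≤ (deg G u) (proj₂ (inner u Su))))) (≤-reflexive (eq E (a G v u) 1 (y u) (z u))))
    medium≤ : ∀ v → 6 * (E * (μ v * (z v * s v))) + ℓ E * μ v ≤ ℓ E * (μ v * s v) + (3 * (μ v * pen v) + 3 * (μ v * (z v * A v)))
    medium≤ v with m v in mv
    ... | false = ≤-reflexive (eq (6 * E) (ℓ E) E)
      where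
      eq : ∀ a l E → 6 * (E * 0) + l * 0 ≡ l * 0 + 0
      eq = solve-∀
    ... | true = subst₂ _≤_ (eq₃ E (z v) (s v) (ℓ E)) (eq₄ (ℓ E) (s v) (pen v) (z v) (A v)) (slope′ E≡ pen≡ y≡ 4≤E (Es≤ v) (τ≤K v inS))
      where
      med = m-true v mv
      open Medium med
      eq₃ : ∀ E z s l → 6 * E * z * s + l ≡ 6 * (E * (1 * (z * s))) + l * 1
      eq₃ = solve-∀
      eq₄ : ∀ l s p z A → l * s + (3 * p + 3 * z * A) ≡ l * (1 * s) + (3 * (1 * p) + 3 * (1 * (z * A)))
      eq₄ = solve-∀
      slope′ : ∀ {y₀ F yv p} → z v + suc y₀ ≡ F → p ≡ medψ (z v) y₀ → suc y₀ ≡ yv → 4 ≤ F → F * s v ≤ Y v + A v → p + 2 * (yv * Y v) ≤ K F →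
        6 * F * z v * s v + ℓ F ≤ ℓ F * s v + (3 * p + 3 * z v * A v)
      slope′ {y₀} refl refl refl 4≤F h τ = slope (z v) y₀ (s v) (A v) (Y v) 1≤z 4≤F 1≤s (s≤ v med) h τ
    key : 6 * (E * zs) ≤ ℓ E * e + (3 * P + 3 * ZZ)
    key with Fin.any? (λ v → m v Bool.≟ true)
    ... | no none₁ = ≤-trans (≤-reflexive (cong (λ k → 6 * (E * k)) (trans zs≡ (sum-zero λ v → cong (_* (z v * s v)) (μ≡0 v)))))
      (≤-trans (≤-reflexive (cong (6 *_) (*-zeroʳ E))) z≤n)
      where
      μ≡0 : ∀ v → μ v ≡ 0
      μ≡0 v = cong 𝟙 (Bool.¬-not (λ mv → none₁ (v , mv)))
    ... | yes (v , mv) = +-cancelʳ-≤ (ℓ E * r) _ _ (begin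
      6 * (E * zs) + ℓ E * r
        ≡⟨ cong (_+ ℓ E * r) (trans (cong (λ k → 6 * (E * k)) zs≡) (trans (cong (6 *_) (sym (sum-*ˡ E (λ v → μ v * (z v * s v))))) (sym (sum-*ˡ 6 (λ v → E * (μ v * (z v * s v))))))) ⟩
      sum (λ v → 6 * (E * (μ v * (z v * s v)))) + ℓ E * r
        ≡⟨ trans (cong (sum (λ v → 6 * (E * (μ v * (z v * s v)))) +_) (sym (sum-*ˡ (ℓ E) μ))) (sym (∑-distrib-+ (λ v → 6 * (E * (μ v * (z v * s v)))) (λ v → ℓ E * μ v))) ⟩
      sum (λ v → 6 * (E * (μ v * (z v * s v))) + ℓ E * μ v)
        ≤⟨ sum-mono medium≤ ⟩
      sum (λ v → ℓ E * (μ v * s v) + (3 * (μ v * pen v) + 3 * (μ v * (z v * A v))))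
        ≤⟨ sum-mono (λ v → +-monoʳ-≤ (ℓ E * (μ v * s v)) (+-mono-≤ (*-monoʳ-≤ 3 (*-monoˡ-≤ (pen v) (μ≤size v))) (*-monoʳ-≤ 3 (*-monoˡ-≤ (z v * A v) (μ≤size v))))) ⟩
      sum (λ v → ℓ E * (μ v * s v) + (3 * (size v * pen v) + 3 * (size v * (z v * A v))))
        ≡⟨ trans (∑-distrib-+ (λ v → ℓ E * (μ v * s v)) (λ v → 3 * (size v * pen v) + 3 * (size v * (z v * A v))))
             (cong₂ _+_ (sum-*ˡ (ℓ E) (λ v → μ v * s v)) (trans (∑-distrib-+ (λ v → 3 * (size v * pen v)) (λ v → 3 * (size v * (z v * A v))))
               (cong₂ _+_ (sum-*ˡ 3 (λ v → size v * pen v)) (sum-*ˡ 3 (λ v → size v * (z v * A v)))))) ⟩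
      ℓ E * sum (λ v → μ v * s v) + (3 * P + 3 * ZZ)
        ≤⟨ +-monoˡ-≤ (3 * P + 3 * ZZ) (*-monoʳ-≤ (ℓ E) (≤-trans (m≤m+n _ 1) (forest v mv))) ⟩
      ℓ E * (e + r) + (3 * P + 3 * ZZ)
        ≡⟨ eq₅ (ℓ E) e r (3 * P + 3 * ZZ) ⟩
      ℓ E * e + (3 * P + 3 * ZZ) + ℓ E * r ∎)
      where
      eq₅ : ∀ l e r p → l * (e + r) + p ≡ l * e + p + l * r
      eq₅ = solve-∀
      μ≤size : ∀ v → μ v ≤ size v
      μ≤size v = ≤-trans (m≤m+n (μ v) (rest v)) (≤-reflexive (sym (size-split v)))

-- Moving vertices out of S

not-does : ∀ {p} {P : Set p} (P? : Dec P) → not (does P?) ≡ true → ¬ P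
not-does (no ¬p) _ = ¬p

not-does⁻ : ∀ {p} {P : Set p} (P? : Dec P) → not (does P?) ≡ false → P
not-does⁻ (yes p) _ = p

∧-true₁ : ∀ b {c} → b ∧ c ≡ true → b ≡ true
∧-true₁ true _ = refl

-- The values of Ψ - k K on the families 𝒯′ and 𝒯‴.
c′ c‴ : ℕ → ℕ → ℕ
c′ E 0 = 0
c′ E 1 = ℓ E
c′ E j@(suc (suc z)) = medCost z (E ∸ suc z) j
c‴ E j = medCost (pred j) (E ∸ j) j

private
  gain₂≡ : ∀ y → 1 * 2 * (2 + 2 * y) + 2 * (2 * (suc y * (1 + suc y))) + 4 ≡ 2 * (2 * ((2 + y) * (2 + y)))
  gain₂≡ = solve-∀

  gain₃₂≡ : ∀ y → 2 * 3 * (3 + 2 * y) + 2 * (3 * (suc y * (2 + suc y))) + 18 ≡ 3 * (2 * ((3 + y) * (3 + y)))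
  gain₃₂≡ = solve-∀

  gain₃₁≡ : ∀ y → 1 * 2 * (2 + 2 * y) + 2 * (3 * (suc y * (1 + suc y))) + (2 * (2 + y) + 4) ≡ 3 * (2 * ((2 + y) * (2 + y)))
  gain₃₁≡ = solve-∀

c₂ : ∀ E → 4 ≤ E → c‴ E 2 + 4 ≡ 2 * ℓ E
c₂ E 4≤E = gap-elim (λ E → medCost 1 (E ∸ 2) 2 + 4 ≡ 2 * ℓ E) 2 gain₂≡ (≤-trans (≤ᵇ⇒≤ 2 4 _) 4≤E)

c‴₃ : ∀ E → 4 ≤ E → c‴ E 3 + 18 ≡ 3 * ℓ E
c‴₃ E 4≤E = gap-elim (λ E → medCost 2 (E ∸ 3) 3 + 18 ≡ 3 * ℓ E) 3 gain₃₂≡ (≤-trans (≤ᵇ⇒≤ 3 4 _) 4≤E)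

c′₃ : ∀ E → 4 ≤ E → c′ E 3 + (2 * E + 4) ≡ 3 * ℓ E
c′₃ E 4≤E = gap-elim (λ E → medCost 1 (E ∸ 2) 3 + (2 * E + 4) ≡ 3 * ℓ E) 2 gain₃₁≡ (≤-trans (≤ᵇ⇒≤ 2 4 _) 4≤E)

c′₄₊ : ∀ E z → 2 ≤ z → z < E → c′ E (2 + z) + γ E (suc z) ≡ (2 + z) * ℓ E
c′₄₊ E z 2≤z z<E = eq E (trans (+-suc z _) (m+[n∸m]≡n z<E))
  where
  eq : ∀ F → z + suc (E ∸ suc z) ≡ F → medCost z (E ∸ suc z) (2 + z) + γ F (suc z) ≡ (2 + z) * ℓ F
  eq F refl = gain-top≡ z (E ∸ suc z) 2≤z

over⇒ : ∀ E j C → 4 ≤ E → 1 ≤ j → j ≤ suc E → j * ℓ E < C + γ E (pred j) → c′ E j < C ⊎ (2 ≤ j × j ≤ E × c‴ E j < C)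
over⇒ E 1 C _ _ _ h = inj₁ (subst₂ _<_ (*-identityˡ (ℓ E)) (trans (cong (C +_) (γ₀ E)) (+-identityʳ C)) h)
over⇒ E 2 C 4≤E _ _ h = inj₂ (≤-refl , ≤-trans (≤ᵇ⇒≤ 2 4 _) 4≤E ,
  +-cancelʳ-< 4 _ _ (subst₂ _<_ (sym (c₂ E 4≤E)) (cong (C +_) (γ₁ E)) h))
over⇒ E 3 C 4≤E _ _ h with ⊔-sel 18 (2 * E + 4)
... | inj₁ e = inj₂ (≤ᵇ⇒≤ 2 3 _ , ≤-trans (≤ᵇ⇒≤ 3 4 _) 4≤E ,
  +-cancelʳ-< 18 _ _ (subst₂ _<_ (sym (c‴₃ E 4≤E)) (cong (C +_) (trans (γ₂ E) e)) h))
... | inj₂ e = inj₁ (+-cancelʳ-< (2 * E + 4) _ _ (subst₂ _<_ (sym (c′₃ E 4≤E)) (cong (C +_) (trans (γ₂ E) e)) h))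
over⇒ E (suc (suc z@(suc (suc _)))) C 4≤E _ (s≤s z<E) h =
  inj₁ (+-cancelʳ-< (γ E (suc z)) _ _ (subst (_< C + γ E (suc z)) (sym (c′₄₊ E z (s≤s (s≤s z≤n)) z<E)) h))

module MaxDegreeTree {n} (G : Graph n) (E k j : ℕ) (4≤E : 4 ≤ E) (n≡ : n ≡ k * (2 + E) + 1 + j) (1≤k : 1 ≤ k)
  (tree : TreeOfMaxDegree (2 + E) G) where
  open Penalty G E

  Δ : ℕ
  Δ = 2 + E

  deg≤ : ∀ v → deg G v ≤ Δ
  deg≤ v = subst (deg G v ≤_) (proj₂ tree) (All.lookup (Extrema.xs≤max 0 _) (∈-map⁺ (deg G) (∈-allFin v)))

  2≤n : 2 ≤ n
  2≤n = subst (2 ≤_) (sym n≡) (≤-trans (+-monoˡ-≤ 1 (*-mono-≤ 1≤k (s≤s (z≤n {suc E})))) (m≤m+n _ j))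

  other-vertex : ∀ {n} → 2 ≤ n → (v : Fin n) → ∃[ u ] v ≢ u
  other-vertex (s≤s (s≤s _)) zero    = suc zero , λ ()
  other-vertex (s≤s (s≤s _)) (suc v) = zero , λ ()

  1≤deg : ∀ v → 1 ≤ deg G v
  1≤deg v = from-path (proj₁ (proj₁ tree) v u) v≢u
    where
    u = proj₁ (other-vertex 2≤n v)
    v≢u = proj₂ (other-vertex 2≤n v)
    from-path : ∀ {u} → Star (Graph._~_ G) v u → v ≢ u → 1 ≤ deg G v
    from-path ε v≢v = contradiction refl v≢v
    from-path (_◅_ {j = w} v~w _) _ = ≤-trans (≤-reflexive (sym (~⇒a G v~w))) (≤-trans (term≤sum (a G v) w) (≤-reflexive (sym (deg≡ G v))))

  deg-sum : sum (deg G) ≡ 2 * (k * Δ + j)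
  deg-sum = +-cancelʳ-≡ 2 _ _ (trans (handshake G (proj₁ tree) (subst Fin (sym n≡′) zero)) (trans (cong (2 *_) n≡) (eq (k * Δ) j)))
    where
    n≡′ : n ≡ suc (k * Δ + j)
    n≡′ = trans n≡ (cong (_+ j) (+-comm (k * Δ) 1))
    eq : ∀ a j → 2 * (a + 1 + j) ≡ 2 * (a + j) + 2
    eq = solve-∀

  S₀ : Fin n → Bool
  S₀ v = not (does (deg G v ≟ Δ))

  S₀-inner : ∀ v → S₀ v ≡ true → 1 ≤ deg G v × deg G v < 2 + E
  S₀-inner v S₀v = 1≤deg v , ≤∧≢⇒< (deg≤ v) (not-does (deg G v ≟ Δ) S₀v)

  S₀-false : ∀ v → S₀ v ≡ false → deg G v ≡ Δ
  S₀-false v e = not-does⁻ (deg G v ≟ Δ) e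

  module _ (S : Fin n → Bool) where
    open Subset S
    co : Fin n → ℕ
    co v = 𝟙 (not (S v))

    U : ℕ
    U = sum co

    Φ : ℕ
    Φ = U * K E + cost

    size+co : ∀ v → 1 ≡ size v + co v
    size+co v with S v
    ... | true  = refl
    ... | false = refl

    -- The degrees of the complement count the edges to S once and the edges inside the complement
    -- twice; the latter account for the last term on the right.
    cut : 2 * edgeCount + 2 * sum (λ v → co v * deg G v) ≡ 2 * (k * Δ + j) + form G co co
    cut = begin
      2 * edgeCount + 2 * sum (λ v → co v * deg G v)
        ≡⟨ cong₂ (λ p q → p + 2 * q) 2edges (trans (sum-cong-≗ λ v → cong (co v *_) (row v)) (form-+ʳ G co size co)) ⟩
      form G size size + 2 * (form G co size + form G co co)
        ≡⟨ eq (form G size size) (form G co size) (form G co co) ⟩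
      (form G size size + form G co size) + (form G co size + form G co co) + form G co co
        ≡⟨ cong (λ p → form G size size + form G co size + (p + form G co co) + form G co co) (form-sym G co size) ⟩
      (form G size size + form G co size) + (form G size co + form G co co) + form G co co
        ≡⟨ cong (_+ form G co co) (cong₂ _+_ (sym (form-+ˡ G size co size)) (sym (form-+ˡ G size co co))) ⟩
      form G (λ v → size v + co v) size + form G (λ v → size v + co v) co + form G co co
        ≡⟨ cong (_+ form G co co) (form-+ʳ G (λ v → size v + co v) size co) ⟨
      form G (λ v → size v + co v) (λ v → size v + co v) + form G co co
        ≡⟨ cong (_+ form G co co) (trans (form-cong G (sym ∘ size+co) (sym ∘ size+co)) all) ⟩
      sum (deg G) + form G co co
        ≡⟨ cong (_+ form G co co) deg-sum ⟩
      2 * (k * Δ + j) + form G co co ∎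
      where
      open ≡-Reasoning
      eq : ∀ a b c → a + 2 * (b + c) ≡ (a + b) + (b + c) + c
      eq = solve-∀
      row : ∀ v → deg G v ≡ sum (λ u → a G v u * (size u + co u))
      row v = trans (deg≡ G v) (sum-cong-≗ λ u → trans (sym (*-identityʳ (a G v u))) (cong (a G v u *_) (size+co u)))
      all : form G (λ _ → 1) (λ _ → 1) ≡ sum (deg G)
      all = sum-cong-≗ λ v → trans (*-identityˡ _) (trans (sum-cong-≗ λ u → *-identityʳ (a G v u)) (sym (deg≡ G v)))

    edges-≥ : k * Δ + j ≤ edgeCount + U * Δ
    edges-≥ = *-cancelˡ-≤ 2 (begin
      2 * (k * Δ + j)                                         ≤⟨ m≤m+n _ (form G co co) ⟩
      2 * (k * Δ + j) + form G co co                          ≡⟨ cut ⟨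
      2 * edgeCount + 2 * sum (λ v → co v * deg G v)          ≤⟨ +-monoʳ-≤ (2 * edgeCount) (*-monoʳ-≤ 2 (sum-mono λ v → *-monoʳ-≤ (co v) (deg≤ v))) ⟩
      2 * edgeCount + 2 * sum (λ v → co v * Δ)                ≡⟨ cong (λ p → 2 * edgeCount + 2 * p) (sum-*ʳ Δ co) ⟩
      2 * edgeCount + 2 * (U * Δ)                             ≡⟨ *-distribˡ-+ 2 edgeCount (U * Δ) ⟨
      2 * (edgeCount + U * Δ)                                 ∎)
      where open ≤-Reasoning

  Φ₀ : Φ S₀ ≡ Ψ
  Φ₀ = trans (sym (+-assoc (U S₀ * K E) (sum (λ v → 𝟙 (S₀ v) * pen v)) _)) (cong₂ _+_
    (trans (cong (_+ sum (λ v → 𝟙 (S₀ v) * pen v)) (sym (sum-*ʳ (K E) (co S₀))))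
      (trans (sym (∑-distrib-+ (λ v → co S₀ v * K E) (λ v → 𝟙 (S₀ v) * pen v))) (sum-cong-≗ pens)))
    (form-cong G ys ys))
    where
    pens : ∀ v → co S₀ v * K E + 𝟙 (S₀ v) * pen v ≡ pen v
    pens v with S₀ v in e
    ... | true  = +-identityʳ (pen v)
    ... | false = trans (+-identityʳ _) (trans (+-identityʳ _) (trans (sym (ψ-top E (≤-trans (s≤s z≤n) 4≤E))) (cong (ψ E) (sym (S₀-false v e)))))
    ys : ∀ v → 𝟙 (S₀ v) * y v ≡ y v
    ys v with S₀ v in e
    ... | true  = +-identityʳ (y v)
    ... | false = sym (m≤n⇒m∸n≡0 (≤-reflexive (sym (S₀-false v e))))

  module _ (S : Fin n → Bool) (v : Fin n) (Sv : S v ≡ true) where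
    private
      S′ = remove G S v
      module S = Subset S
      module S′ = Subset S′

      split : ∀ u → 𝟙 (S u) ≡ 𝟙 (S′ u) + δ v u
      split = remove-split G S v Sv

    Y-remove : S.Y v ≡ S′.Y v
    Y-remove = sum-cong-≗ term
      where
      term : ∀ u → a G v u * (𝟙 (S u) * y u) ≡ a G v u * (𝟙 (S′ u) * y u)
      term u with v Fin.≟ u
      ... | yes refl = trans (cong (_* (𝟙 (S v) * y v)) (a-irrefl G v)) (sym (cong (_* (𝟙 (S v ∧ false) * y v)) (a-irrefl G v)))
      ... | no _     = cong (λ b → a G v u * (𝟙 b * y u)) (sym (Bool.∧-identityʳ (S u)))

    cost-remove : S.cost ≡ S′.cost + (pen v + 2 * (y v * S.Y v))
    cost-remove = begin
      sum (λ u → 𝟙 (S u) * pen u) + form G (λ u → 𝟙 (S u) * y u) (λ u → 𝟙 (S u) * y u)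
        ≡⟨ cong₂ _+_ pens (trans (form-cong G ys ys) (form-add-* G (y v) v (λ u → 𝟙 (S′ u) * y u))) ⟩
      sum (λ u → 𝟙 (S′ u) * pen u) + pen v + (F′ + 2 * (y v * S′.Y v))
        ≡⟨ cong (λ Y → sum (λ u → 𝟙 (S′ u) * pen u) + pen v + (F′ + 2 * (y v * Y))) (sym Y-remove) ⟩
      sum (λ u → 𝟙 (S′ u) * pen u) + pen v + (F′ + 2 * (y v * S.Y v))
        ≡⟨ eq (sum (λ u → 𝟙 (S′ u) * pen u)) (pen v) F′ (2 * (y v * S.Y v)) ⟩
      S′.cost + (pen v + 2 * (y v * S.Y v)) ∎
      where
      open ≡-Reasoning
      F′ = form G (λ u → 𝟙 (S′ u) * y u) (λ u → 𝟙 (S′ u) * y u)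
      eq : ∀ p q f k → p + q + (f + k) ≡ p + f + (q + k)
      eq = solve-∀
      pens : sum (λ u → 𝟙 (S u) * pen u) ≡ sum (λ u → 𝟙 (S′ u) * pen u) + pen v
      pens = trans (sum-cong-≗ λ u → trans (cong (_* pen u) (split u)) (*-distribʳ-+ (pen u) (𝟙 (S′ u)) (δ v u)))
        (trans (∑-distrib-+ (λ u → 𝟙 (S′ u) * pen u) (λ u → δ v u * pen u)) (cong (sum (λ u → 𝟙 (S′ u) * pen u) +_) (sum-δ pen v)))
      ys : ∀ u → 𝟙 (S u) * y u ≡ 𝟙 (S′ u) * y u + y v * δ v u
      ys u = trans (cong (_* y u) (split u)) (trans (*-distribʳ-+ (y u) (𝟙 (S′ u)) (δ v u)) (cong (𝟙 (S′ u) * y u +_) (point u)))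
        where
        point : ∀ u → δ v u * y u ≡ y v * δ v u
        point u with v Fin.≟ u
        ... | yes refl = *-comm 1 (y v)
        ... | no _     = sym (*-zeroʳ (y v))

    size-remove : sum S.size ≡ suc (sum S′.size)
    size-remove = trans (sum-cong-≗ split) (trans (∑-distrib-+ S′.size (δ v)) (trans (cong (sum S′.size +_)
      (trans (sum-cong-≗ λ u → sym (*-identityʳ (δ v u))) (sum-δ (λ _ → 1) v))) (+-comm _ 1)))

    U-remove : U S′ ≡ suc (U S)
    U-remove = +-cancelˡ-≡ (sum S′.size) _ _ (trans (total S′) (trans (sym (total S)) (trans (cong (_+ U S) size-remove) (sym (+-suc _ (U S))))))
      where
      total : ∀ T → sum (λ u → 𝟙 (T u)) + U T ≡ sum {n} (λ _ → 1)
      total T = trans (sym (∑-distrib-+ (λ u → 𝟙 (T u)) (co T))) (sum-cong-≗ (sym ∘ size+co T))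

    Φ-remove : K E < pen v + 2 * (y v * S.Y v) → Φ S′ < Φ S
    Φ-remove K<τ = begin-strict
      U S′ * K E + S′.cost                                      ≡⟨ cong (λ u → u * K E + S′.cost) U-remove ⟩
      K E + U S * K E + S′.cost                                 ≡⟨ eq (K E) (U S * K E) S′.cost ⟩
      U S * K E + (S′.cost + K E)                               <⟨ +-monoʳ-< (U S * K E) (+-monoʳ-< S′.cost K<τ) ⟩
      U S * K E + (S′.cost + (pen v + 2 * (y v * S.Y v)))       ≡⟨ cong (U S * K E +_) cost-remove ⟨
      U S * K E + S.cost                                        ∎
      where
      open ≤-Reasoning
      eq : ∀ a b c → a + b + c ≡ b + (c + a)
      eq = solve-∀

  -- The field `change` keeps track of equality: moving any vertex makes `Φ` smaller than `Ψ`, so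
  -- only a tree in which nothing is moved can be optimal.
  record Reduced : Set where
    field
      S       : Fin n → Bool
      S⊆S₀    : ∀ v → S v ≡ true → S₀ v ≡ true
      τ≤K     : ∀ v → S v ≡ true → pen v + 2 * (y v * Subset.Y S v) ≤ K E
      change  : S ≡ S₀ ⊎ Φ S < Ψ

  private
    reduce : ∀ fuel S → sum (λ v → 𝟙 (S v)) ≤ fuel → (∀ v → S v ≡ true → S₀ v ≡ true) → S ≡ S₀ ⊎ Φ S < Ψ → Reduced
    reduce-step : ∀ fuel S → sum (λ v → 𝟙 (S v)) ≤ fuel → (∀ v → S v ≡ true → S₀ v ≡ true) → S ≡ S₀ ⊎ Φ S < Ψ →
      ∀ v → S v ≡ true → K E < pen v + 2 * (y v * Subset.Y S v) → Reduced

    reduce fuel S small S⊆S₀ ch with Fin.any? (λ v → (S v Bool.≟ true) ×-dec (K E <? pen v + 2 * (y v * Subset.Y S v)))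
    ... | no none₁ = record { S = S ; S⊆S₀ = S⊆S₀ ; τ≤K = λ v Sv → ≮⇒≥ (λ K< → none₁ (v , Sv , K<)) ; change = ch }
    ... | yes (v , Sv , K<τ) = reduce-step fuel S small S⊆S₀ ch v Sv K<τ

    reduce-step zero S small _ _ v Sv _ = contradiction (≤-trans (≤-reflexive (sym (size-remove S v Sv))) small) λ ()
    reduce-step (suc fuel) S small S⊆S₀ ch v Sv K<τ = reduce fuel (remove G S v)
      (s≤s⁻¹ (≤-trans (≤-reflexive (sym (size-remove S v Sv))) small))
      (λ u S′u → S⊆S₀ u (∧-true₁ (S u) S′u))
      (inj₂ (<-≤-trans (Φ-remove S v Sv K<τ) (Sum.[ (λ S≡ → ≤-reflexive (trans (cong Φ S≡) Φ₀)) , <⇒≤ ]′ ch)))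

  reduced : Reduced
  reduced = reduce _ S₀ ≤-refl (λ _ S₀v → S₀v) (inj₁ refl)

-- The number of vertices of degree Δ of the trees in 𝒯″.
bigs : ℕ → ℕ → ℕ
bigs k zero    = k
bigs k (suc _) = suc k

bigs≤ : ∀ k j → bigs k j ≤ suc k
bigs≤ k zero    = n≤1+n k
bigs≤ k (suc j) = ≤-refl

-- The hypothesis of `over⇒` is strict, so it is applied to `suc (j * ℓ E)`, and the successor comes
-- off again.
c≤jℓ : ∀ E j → 4 ≤ E → 1 ≤ j → j ≤ suc E → c′ E j ≤ j * ℓ E ⊎ (2 ≤ j × j ≤ E × c‴ E j ≤ j * ℓ E)
c≤jℓ E j 4≤E 1≤j j≤E+1 = Sum.map s≤s⁻¹ (λ (2≤j , j≤E , h) → 2≤j , j≤E , s≤s⁻¹ h)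
  (over⇒ E j (suc (j * ℓ E)) 4≤E 1≤j j≤E+1 (s≤s (m≤m+n (j * ℓ E) _)))

-- The number of vertices outside S compared with `k`

module Trichotomy {n} (G : Graph n) (E k j : ℕ) (4≤E : 4 ≤ E) (n≡ : n ≡ k * (2 + E) + 1 + j) (1≤k : 1 ≤ k)
  (j≤E+1 : j ≤ suc E) (tree : TreeOfMaxDegree (2 + E) G) where
  open Penalty G E
  open MaxDegreeTree G E k j 4≤E n≡ 1≤k tree

  acyclic : Acyclic G
  acyclic = proj₂ (proj₁ tree)

  open Subset S₀ public
  module Estimated = Estimate G E 4≤E acyclic S₀ S₀-inner
  open Forest G E 4≤E acyclic S₀ S₀-inner using (Medium; m; XX; ZZ; rest; X; surplus; m-true; medium-facts) public

  data Class : Set where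
    in″    : U S₀ ≡ bigs k j → cost ≡ 0 → Class
    in₀    : U S₀ ≡ k → j ≡ 1 → edgeCount ≡ 1 → (∀ v → m v ≡ false) → Estimated.Q ≡ 0 → Class
    in₁    : U S₀ ≡ k → ∀ w → Medium w → (∀ u → u ≢ w → m u ≡ false) → edgeCount ≡ j → s w ≡ j →
             j ≡ 1 + z w ⊎ j ≡ 2 + z w → Estimated.Q ≡ 0 → Class
    worse″ : bigs k j * K E < Ψ → Class
    worse′ : 1 ≤ j → k * K E + c′ E j < Ψ → Class
    worse‴ : 2 ≤ j → j ≤ E → k * K E + c‴ E j < Ψ → Class

  private
    0<K : 0 < K E
    0<K = *-mono-≤ {1} {suc E * E} (*-mono-≤ {1} {suc E} (s≤s z≤n) (≤-trans (s≤s z≤n) 4≤E)) (s≤s⁻¹ (≤-trans (≤ᵇ⇒≤ 2 4 _) (≤-trans 4≤E (≤-reflexive (sym (suc-pred E {{>-nonZero (≤-trans (s≤s z≤n) 4≤E)}}))))))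

    -- Turns a bound over j ℓ (or j ℓ - γ) into one over the value of a family.
    lift : ∀ {C} → k * K E + C ≤ Ψ → c′ E j < C ⊎ (2 ≤ j × j ≤ E × c‴ E j < C) → 1 ≤ j → Class
    lift h (inj₁ c<) 1≤j             = worse′ 1≤j (<-≤-trans (+-monoʳ-< (k * K E) c<) h)
    lift h (inj₂ (2≤j , j≤E , c<)) _ = worse‴ 2≤j j≤E (<-≤-trans (+-monoʳ-< (k * K E) c<) h)

    above-Ψ : ∀ {C} → K E < C → k * K E + C ≤ Ψ → Class
    above-Ψ K< h = worse″ (≤-<-trans (≤-trans (*-monoˡ-≤ (K E) (bigs≤ k j)) (≤-reflexive (+-comm (K E) (k * K E))))
      (<-≤-trans (+-monoʳ-< (k * K E) K<) h))

    j-cases : ∀ j′ → j ≡ j′ → k * K E + j′ * ℓ E < Ψ → Class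
    j-cases zero    refl h = worse″ (≤-<-trans (m≤m+n (k * K E) 0) h)
    j-cases (suc i) refl h with c≤jℓ E (suc i) 4≤E (s≤s z≤n) j≤E+1
    ... | inj₁ c≤                = worse′ (s≤s z≤n) (≤-<-trans (+-monoʳ-≤ (k * K E) c≤) h)
    ... | inj₂ (2≤j , j≤E , c≤) = worse‴ 2≤j j≤E (≤-<-trans (+-monoʳ-≤ (k * K E) c≤) h)

    module _ (S : Fin n → Bool) (S⊆S₀ : ∀ v → S v ≡ true → S₀ v ≡ true)
      (τ≤K : ∀ v → S v ≡ true → pen v + 2 * (y v * Subset.Y S v) ≤ K E) (change : S ≡ S₀ ⊎ Φ S < Ψ) where
      open Subset S using () renaming (cost to costS; edgeCount to eS)

      inner : ∀ v → S v ≡ true → 1 ≤ deg G v × deg G v < 2 + E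
      inner v Sv = S₀-inner v (S⊆S₀ v Sv)

      module ES = Estimate G E 4≤E acyclic S inner

      Φ≤Ψ : Φ S ≤ Ψ
      Φ≤Ψ = Sum.[ (λ S≡ → ≤-reflexive (trans (cong Φ S≡) Φ₀)) , <⇒≤ ]′ change

      few-bigs : U S < k → Class
      few-bigs u<k = finish (slope-bound E t j eS costS (≤-trans (s≤s z≤n) 4≤E) (m<n⇒0<n∸m u<k) edges≤ (ES.slope-cost τ≤K))
        where
        t = k ∸ U S
        k≡ : U S + t ≡ k
        k≡ = m+[n∸m]≡n (<⇒≤ u<k)
        eq : ∀ t D j u → t * D + j + u * D ≡ (u + t) * D + j
        eq = solve-∀
        edges≤ : t * (2 + E) + j ≤ eS
        edges≤ = +-cancelʳ-≤ (U S * Δ) _ _ (≤-trans (≤-reflexive (trans (eq t Δ j (U S)) (cong (λ k → k * Δ + j) k≡))) (edges-≥ S))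
        whole : ∀ C → U S * K E + (t * K E + C) ≡ k * K E + C
        whole C = trans (sym (+-assoc (U S * K E) (t * K E) C)) (cong (_+ C) (trans (sym (*-distribʳ-+ (K E) (U S) t)) (cong (_* K E) k≡)))
        up : ∀ {C} → t * K E + C < costS → k * K E + C < Ψ
        up {C} h = <-≤-trans (≤-<-trans (≤-reflexive (sym (whole C))) (+-monoʳ-< (U S * K E) h)) Φ≤Ψ
        finish : t * K E + K E < costS ⊎ t * K E + j * ℓ E < costS → Class
        finish (inj₁ h) = worse″ (≤-<-trans (≤-trans (*-monoˡ-≤ (K E) (bigs≤ k j)) (≤-reflexive (+-comm (K E) (k * K E)))) (up h))
        finish (inj₂ h) = j-cases j refl (up h)

      many-bigs : suc k < U S → Class
      many-bigs h = worse″ (<-≤-trans (*-monoˡ-< (K E) {{>-nonZero 0<K}} (≤-<-trans (bigs≤ k j) h)) (≤-trans (m≤m+n _ costS) Φ≤Ψ))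

      equal-bigs : U S ≡ bigs k j → S ≡ S₀ → Class
      equal-bigs u≡ refl = by-cost costS refl
        where
        by-cost : ∀ q → costS ≡ q → Class
        by-cost zero    c≡ = in″ u≡ c≡
        by-cost (suc q) c≡ = worse″ (<-≤-trans (<-≤-trans (m<m+n _ {suc q} (s≤s z≤n)) (≤-reflexive (cong₂ (λ u c → u * K E + c) (sym u≡) (sym c≡)))) Φ≤Ψ)

      enough-bigs : U S ≡ bigs k j → Class
      enough-bigs u≡ = Sum.[ equal-bigs u≡
        , (λ h → worse″ (≤-<-trans (≤-trans (≤-reflexive (cong (_* K E) (sym u≡))) (m≤m+n _ costS)) h)) ]′ change

      one-more : U S ≡ suc k → Class
      one-more u≡ = by-j j refl
        where
        by-j : ∀ j′ → j ≡ j′ → Class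
        by-j zero    refl = worse″ (<-≤-trans (*-monoˡ-< (K E) {{>-nonZero 0<K}} (subst (k <_) (sym u≡) ≤-refl)) (≤-trans (m≤m+n _ costS) Φ≤Ψ))
        by-j (suc _) refl = enough-bigs u≡

      k-bigs : U S ≡ k → Class
      k-bigs u≡ = by-j j refl
        where
        k*K+ : k * K E + costS ≤ Ψ
        k*K+ = ≤-trans (≤-reflexive (cong (λ u → u * K E + costS) (sym u≡))) Φ≤Ψ
        j≤e : j ≤ eS
        j≤e = +-cancelʳ-≤ (k * Δ) _ _ (≤-trans (≤-reflexive (+-comm j (k * Δ))) (≤-trans (edges-≥ S) (≤-reflexive (cong (λ u → eS + u * Δ) u≡))))
        shape-value : ∀ z′ y′ → z′ + suc y′ ≡ E → 1 ≤ z′ → j ≡ 1 + z′ ⊎ j ≡ 2 + z′ → costS ≡ medCost z′ y′ j → Φ S < Ψ → Class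
        shape-value z′ y′ E≡ 1≤z (inj₁ j≡) c≡ strict = worse‴ (≤-trans (s≤s 1≤z) (≤-reflexive (sym j≡))) (≤-trans (≤-reflexive j≡) 1+z≤E)
          (≤-<-trans (≤-reflexive (cong₂ (λ u c → u * K E + c) (sym u≡) (trans value (sym c≡)))) strict)
          where
          1+z≤E : 1 + z′ ≤ E
          1+z≤E = ≤-trans (s≤s (m≤m+n z′ y′)) (≤-reflexive (trans (sym (+-suc z′ y′)) E≡))
          y≡ : E ∸ (1 + z′) ≡ y′
          y≡ = trans (cong (_∸ (1 + z′)) (trans (sym E≡) (+-suc z′ y′))) (m+n∸m≡n (1 + z′) y′)
          value : c‴ E j ≡ medCost z′ y′ j
          value = cong₂ (λ p q → medCost p q j) (cong pred j≡) (trans (cong (E ∸_) j≡) y≡)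
        shape-value z′ y′ E≡ 1≤z (inj₂ j≡) c≡ strict = worse′ (≤-trans (s≤s z≤n) (≤-reflexive (sym j≡)))
          (≤-<-trans (≤-reflexive (cong₂ (λ u c → u * K E + c) (sym u≡) (trans value (sym c≡)))) strict)
          where
          y≡ : E ∸ (1 + z′) ≡ y′
          y≡ = trans (cong (_∸ (1 + z′)) (trans (sym E≡) (+-suc z′ y′))) (m+n∸m≡n (1 + z′) y′)
          value : c′ E j ≡ medCost z′ y′ j
          value = trans (cong (c′ E) j≡) (cong₂ (medCost z′) y≡ (sym j≡))
        -- If vertices have been moved, the exact outcomes describe the reduced set and not the tree
        -- itself. Their cost is the value of a family, which `Ψ` then strictly exceeds.
        strict-value : ES.Outcome j → 1 ≤ j → Φ S < Ψ → Class
        strict-value (ES.above K<) 1≤j _ = above-Ψ K< k*K+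
        strict-value (ES.over h) 1≤j _ = lift k*K+ (over⇒ E j costS 4≤E 1≤j j≤E+1 h) 1≤j
        strict-value (ES.exact₀ j≡1 _ _ _ c≡) 1≤j strict = worse′ 1≤j
          (≤-<-trans (≤-reflexive (cong₂ (λ u c → u * K E + c) (sym u≡) (trans (cong (c′ E) j≡1) (sym c≡)))) strict)
        strict-value (ES.exact₁ w med _ _ _ shape _ c≡) 1≤j strict =
          shape-value (z w) (pred (y w)) (Forest.Medium.E≡ med) (Forest.Medium.1≤z med) shape c≡ strict
        equal-value : ES.Outcome j → 1 ≤ j → S ≡ S₀ → Class
        equal-value (ES.above K<) 1≤j _ = above-Ψ K< k*K+
        equal-value (ES.over h) 1≤j _ = lift k*K+ (over⇒ E j costS 4≤E 1≤j j≤E+1 h) 1≤j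
        equal-value (ES.exact₀ j≡1 e≡ ms Q≡ c≡) 1≤j refl = in₀ u≡ j≡1 e≡ ms Q≡
        equal-value (ES.exact₁ w med others e≡ s≡ shape Q≡ c≡) 1≤j refl = in₁ u≡ w (record { Forest.Medium med }) others e≡ s≡ shape Q≡
        by-j : ∀ j′ → j ≡ j′ → Class
        by-j zero    refl = enough-bigs u≡
        by-j (suc i) refl = Sum.[ equal-value (ES.estimate j (s≤s z≤n) j≤e) (s≤s z≤n) , strict-value (ES.estimate j (s≤s z≤n) j≤e) (s≤s z≤n) ]′ change

      classify′ : Class
      classify′ with <-cmp (U S) k
      ... | tri< u<k _ _ = few-bigs u<k
      ... | tri≈ _ u≡k _ = k-bigs u≡k
      ... | tri> _ _ k<u with m≤n⇒m<n∨m≡n k<u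
      ...   | inj₁ h = many-bigs h
      ...   | inj₂ e = one-more (sym e)

  classify : Class
  classify = classify′ S S⊆S₀ τ≤K change
    where open Reduced reduced

-- Counting vertices and edges by degree

listSum-∈ : ∀ {A : Set} (f : A → ℕ) {x xs} → x ∈ xs → f x ≤ listSum (map f xs)
listSum-∈ f (here refl) = m≤m+n _ _
listSum-∈ f (there x∈)  = ≤-trans (listSum-∈ f x∈) (m≤n+m _ _)

private
  listSum-zero : ∀ {A : Set} (f : A → ℕ) xs → (∀ y → y ∈ xs → f y ≡ 0) → listSum (map f xs) ≡ 0
  listSum-zero f []       h = refl
  listSum-zero f (x ∷ xs) h = cong₂ _+_ (h x (here refl)) (listSum-zero f xs (λ y y∈ → h y (there y∈)))

  listSum-unique : ∀ {A : Set} (f : A → ℕ) {x} xs → Unique xs → x ∈ xs → (∀ y → y ∈ xs → y ≢ x → f y ≡ 0) → listSum (map f xs) ≡ f x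
  listSum-unique f (_ ∷ xs) (x∉ ∷ _) (here refl) h = trans (cong (f _ +_) (listSum-zero f xs
    (λ y y∈ → h y (there y∈) (λ y≡x → All.lookup x∉ y∈ (sym y≡x))))) (+-identityʳ _)
  listSum-unique f (x′ ∷ xs) (x′∉ ∷ uxs) (there x∈) h = cong₂ _+_ (h x′ (here refl) (All.lookup x′∉ x∈))
    (listSum-unique f xs uxs x∈ (λ y y∈ → h y (there y∈)))

  𝟙-does : ∀ {p} {P : Set p} (P? : Dec P) → P → 𝟙 (does P?) ≡ 1
  𝟙-does P? p = cong 𝟙 (dec-true P? p)

  𝟙-does⁻ : ∀ {p} {P : Set p} (P? : Dec P) → ¬ P → 𝟙 (does P?) ≡ 0
  𝟙-does⁻ P? ¬p = cong 𝟙 (dec-false P? ¬p)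

module Counting {n} (G : Graph n) where
  open Graph G

  nbr-count : ∀ {P : Fin n → Set} (P? : Decidable P) v →
    length (filter P? (neighbours G v)) ≡ sum (λ u → a G v u * 𝟙 (does (P? u)))
  nbr-count P? v = trans (length-filter P? (neighbours G v)) (trans
    (sum-filter (λ u → T? (adj v u)) (λ u → 𝟙 (does (P? u))) (allFin n))
    (listSum-allFin (λ u → a G v u * 𝟙 (does (P? u)))))

  nbr-all : ∀ {P : Fin n → Set} (P? : Decidable P) v → (∀ u → v ~ u → P u) → length (filter P? (neighbours G v)) ≡ deg G v
  nbr-all P? v h = trans (nbr-count P? v) (trans (sum-cong-≗ term) (sym (deg≡ G v)))
    where
    term : ∀ u → a G v u * 𝟙 (does (P? u)) ≡ a G v u
    term u with adj v u in e
    ... | false = refl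
    ... | true  = trans (+-identityʳ _) (𝟙-does (P? u) (h u (subst T (sym e) _)))

  nbr-not-all : ∀ {P : Fin n → Set} (P? : Decidable P) v u → v ~ u → ¬ P u → length (filter P? (neighbours G v)) < deg G v
  nbr-not-all P? v u v~u ¬Pu = subst₂ _<_ (sym (nbr-count P? v)) (sym (deg≡ G v)) (sum-mono-<
    (λ w → ≤-trans (*-monoʳ-≤ (a G v w) (𝟙≤1 (does (P? w)))) (≤-reflexive (*-identityʳ (a G v w)))) u
    (subst₂ _<_ (sym (trans (cong (a G v u *_) (𝟙-does⁻ (P? u) ¬Pu)) (*-zeroʳ (a G v u)))) (sym (~⇒a G v~u)) (s≤s z≤n)))

  nbr-some : ∀ {P : Fin n → Set} (P? : Decidable P) v u → v ~ u → P u → 1 ≤ length (filter P? (neighbours G v))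
  nbr-some P? v u v~u Pu = subst (1 ≤_) (sym (nbr-count P? v))
    (≤-trans (≤-reflexive (sym (cong₂ _*_ (~⇒a G v~u) (𝟙-does (P? u) Pu)))) (term≤sum (λ u → a G v u * 𝟙 (does (P? u))) u))

  nbr-two : ∀ v u w → v ~ u → v ~ w → u ≢ w → 2 ≤ deg G v
  nbr-two v u w v~u v~w u≢w = ≤-trans (s≤s (nbr-some (λ x → x Fin.≟ w) v w v~w refl)) (nbr-not-all (λ x → x Fin.≟ w) v u v~u u≢w)

  module _ (i i′ : ℕ) where
    private
      P? : ∀ (e : Fin n × Fin n) → Dec ((deg G (proj₁ e) ≡ i × deg G (proj₂ e) ≡ i′) ⊎ (deg G (proj₁ e) ≡ i′ × deg G (proj₂ e) ≡ i))
      P? (u , v) = ((deg G u ≟ i) ×-dec (deg G v ≟ i′)) ⊎-dec ((deg G u ≟ i′) ×-dec (deg G v ≟ i))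

      P-sym : ∀ u v → does (P? (u , v)) ≡ does (P? (v , u))
      P-sym u v = trans (Bool.∨-comm (does (deg G u ≟ i) ∧ does (deg G v ≟ i′)) _)
        (cong₂ _∨_ (Bool.∧-comm (does (deg G u ≟ i′)) _) (Bool.∧-comm (does (deg G u ≟ i)) _))

    numEdges-sum : 2 * numEdges G i i′ ≡ sum (λ u → sum (λ v → a G u v * 𝟙 (does (P? (u , v)))))
    numEdges-sum = count-edges G P? P-sym

    numEdges-term : ∀ (f : Fin n → Fin n → ℕ) →
      (∀ u v → u ~ v → (deg G u ≡ i × deg G v ≡ i′) ⊎ (deg G u ≡ i′ × deg G v ≡ i) → f u v ≡ 1) →
      (∀ u v → u ~ v → ¬ ((deg G u ≡ i × deg G v ≡ i′) ⊎ (deg G u ≡ i′ × deg G v ≡ i)) → f u v ≡ 0) →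
      2 * numEdges G i i′ ≡ sum (λ u → sum (λ v → a G u v * f u v))
    numEdges-term f h₁ h₀ = trans numEdges-sum (sum-cong-≗ λ u → sum-cong-≗ λ v → term u v (adj u v) refl (P? (u , v)))
      where
      term : ∀ u v b → adj u v ≡ b → (d : Dec ((deg G u ≡ i × deg G v ≡ i′) ⊎ (deg G u ≡ i′ × deg G v ≡ i))) → 𝟙 b * 𝟙 (does d) ≡ 𝟙 b * f u v
      term u v false e _       = refl
      term u v true  e (yes p) = cong (_+ 0) (sym (h₁ u v (subst T (sym e) _) p))
      term u v true  e (no ¬p) = cong (_+ 0) (sym (h₀ u v (subst T (sym e) _) ¬p))

    numEdges-zero : (∀ u v → u ~ v → deg G u ≡ i → deg G v ≡ i′ → ⊥) → numEdges G i i′ ≡ 0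
    numEdges-zero none = m*n≡0⇒n≡0 2 (trans (numEdges-term (λ _ _ → 0)
      (λ { u v u~v (inj₁ (p , q)) → ⊥-elim (none u v u~v p q) ; u v u~v (inj₂ (p , q)) → ⊥-elim (none v u (~-sym G u~v) q p) }) (λ _ _ _ _ → refl))
      (sum-zero λ u → sum-zero λ v → *-zeroʳ (a G u v)))
      where
      m*n≡0⇒n≡0 : ∀ m {n} .{{_ : NonZero m}} → m * n ≡ 0 → n ≡ 0
      m*n≡0⇒n≡0 m {n} e = *-cancelˡ-≡ n 0 m (trans e (sym (*-zeroʳ m)))

    numEdges-zero⁻ : numEdges G i i′ ≡ 0 → ∀ u v → u ~ v → deg G u ≡ i → deg G v ≡ i′ → ⊥
    numEdges-zero⁻ e u v u~v p q = 1+n≢0 (trans (sym (cong₂ _*_ (~⇒a G u~v) (𝟙-does (P? (u , v)) (inj₁ (p , q)))))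
      (sum≡0⇒ (λ v → a G u v * 𝟙 (does (P? (u , v)))) (sum≡0⇒ (λ u → sum (λ v → a G u v * 𝟙 (does (P? (u , v))))) (trans (sym numEdges-sum) (cong (2 *_) e)) u) v))

  -- Both sides count the edges at w when w is the only vertex of degree i ≠ i′.
  numEdges-single : ∀ w i′ → deg G w ≢ i′ → (∀ u → u ≢ w → deg G u ≢ deg G w) → numEdges G (deg G w) i′ ≡ numNeighbours G w i′
  numEdges-single w i′ ≢i′ single = *-cancelˡ-≡ _ _ 2 (begin
    2 * numEdges G (deg G w) i′
      ≡⟨ numEdges-term (deg G w) i′ (λ u v → δ w u * B v + δ w v * B u) one-side none ⟩
    sum (λ u → sum (λ v → a G u v * (δ w u * B v + δ w v * B u)))
      ≡⟨ sum-cong-≗ (λ u → trans (sum-cong-≗ λ v → *-distribˡ-+ (a G u v) (δ w u * B v) (δ w v * B u))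
           (∑-distrib-+ (λ v → a G u v * (δ w u * B v)) (λ v → a G u v * (δ w v * B u)))) ⟩
    sum (λ u → sum (λ v → a G u v * (δ w u * B v)) + sum (λ v → a G u v * (δ w v * B u)))
      ≡⟨ ∑-distrib-+ (λ u → sum (λ v → a G u v * (δ w u * B v))) (λ u → sum (λ v → a G u v * (δ w v * B u))) ⟩
    sum (λ u → sum (λ v → a G u v * (δ w u * B v))) + sum (λ u → sum (λ v → a G u v * (δ w v * B u)))
      ≡⟨ cong₂ _+_ left right ⟩
    N + N
      ≡⟨ cong (N +_) (+-identityʳ N) ⟨
    2 * N
      ≡⟨ cong (2 *_) (nbr-count (λ u → deg G u ≟ i′) w) ⟨
    2 * numNeighbours G w i′ ∎)
    where
    open ≡-Reasoning
    B : Fin n → ℕ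
    B v = 𝟙 (does (deg G v ≟ i′))
    N = sum (λ v → a G w v * B v)
    swap : ∀ x y z → x * (y * z) ≡ y * (x * z)
    swap = solve-∀
    left : sum (λ u → sum (λ v → a G u v * (δ w u * B v))) ≡ N
    left = trans (sum-cong-≗ λ u → trans (sum-cong-≗ λ v → swap (a G u v) (δ w u) (B v)) (sum-*ˡ (δ w u) (λ v → a G u v * B v))) (sum-δ (λ u → sum (λ v → a G u v * B v)) w)
    right : sum (λ u → sum (λ v → a G u v * (δ w v * B u))) ≡ N
    right = trans (∑-comm (λ u v → a G u v * (δ w v * B u))) (trans (sum-cong-≗ λ v → sum-cong-≗ λ u → cong (_* (δ w v * B u)) (a-sym G u v)) left)
    not-w : ∀ {u} → deg G u ≢ deg G w → w ≢ u
    not-w d≢ refl = d≢ refl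
    is-w : ∀ {u} → deg G u ≡ deg G w → w ≡ u
    is-w {u} d≡ with w Fin.≟ u
    ... | yes w≡u = w≡u
    ... | no w≢u  = ⊥-elim (single u (w≢u ∘ sym) d≡)
    one-side : ∀ u v → Graph._~_ G u v → (deg G u ≡ deg G w × deg G v ≡ i′) ⊎ (deg G u ≡ i′ × deg G v ≡ deg G w) → δ w u * B v + δ w v * B u ≡ 1
    one-side u v _ (inj₁ (p , q)) with refl ← is-w p = cong₂ (λ x y → x + y * B w) (trans (cong₂ _*_ (δ-refl w) (𝟙-does (deg G v ≟ i′) q)) refl)
      (δ-≢ (not-w (λ e → ≢i′ (trans (sym e) q))))
    one-side u v _ (inj₂ (p , q)) with refl ← is-w q = cong₂ (λ x y → x * B w + y) (δ-≢ (not-w (λ e → ≢i′ (trans (sym e) p)))) (cong₂ _*_ (δ-refl w) (𝟙-does (deg G u ≟ i′) p))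
    none : ∀ u v → Graph._~_ G u v → ¬ ((deg G u ≡ deg G w × deg G v ≡ i′) ⊎ (deg G u ≡ i′ × deg G v ≡ deg G w)) → δ w u * B v + δ w v * B u ≡ 0
    none u v _ ¬p = cong₂ _+_ (half u v (λ e q → ¬p (inj₁ (cong (deg G) (sym e) , q)))) (half v u (λ e q → ¬p (inj₂ (q , cong (deg G) (sym e)))))
      where
      half : ∀ u v → (w ≡ u → deg G v ≡ i′ → ⊥) → δ w u * B v ≡ 0
      half u v h with w Fin.≟ u
      ... | no _  = refl
      ... | yes e = trans (+-identityʳ _) (𝟙-does⁻ (deg G v ≟ i′) (h e))

  numDeg≡ : ∀ i → numDeg G i ≡ sum (λ v → 𝟙 (does (deg G v ≟ i)))
  numDeg≡ i = count-allFin (λ v → deg G v ≟ i)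

  numDeg≥ : ∀ v → 1 ≤ numDeg G (deg G v)
  numDeg≥ v = subst (1 ≤_) (sym (numDeg≡ (deg G v)))
    (≤-trans (≤-reflexive (sym (𝟙-does (deg G v ≟ deg G v) refl))) (term≤sum (λ u → 𝟙 (does (deg G u ≟ deg G v))) v))

  numDeg-zero : ∀ i → (∀ v → deg G v ≢ i) → numDeg G i ≡ 0
  numDeg-zero i h = trans (numDeg≡ i) (sum-zero λ v → 𝟙-does⁻ (deg G v ≟ i) (h v))

  numDeg-one : ∀ w → (∀ u → u ≢ w → deg G u ≢ deg G w) → numDeg G (deg G w) ≡ 1
  numDeg-one w single = trans (numDeg≡ (deg G w)) (trans (sum-single _ w (λ u u≢w → 𝟙-does⁻ (deg G u ≟ deg G w) (single u u≢w))) (𝟙-does (deg G w ≟ deg G w) refl))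

  numDeg≡1⇒ : ∀ i → numDeg G i ≡ 1 → ∃[ w ] deg G w ≡ i × (∀ u → u ≢ w → deg G u ≢ i)
  numDeg≡1⇒ i e with Fin.any? (λ v → deg G v ≟ i)
  ... | no none = ⊥-elim (1+n≢0 (trans (sym e) (numDeg-zero i (λ v p → none (v , p)))))
  ... | yes (w , refl) = w , refl , λ u u≢w p → <⇒≱ (s≤s (≤-reflexive (trans (sym (numDeg≡ (deg G w))) e))) (two u u≢w p)
    where
    two : ∀ u → u ≢ w → deg G u ≡ deg G w → 2 ≤ sum (λ v → 𝟙 (does (deg G v ≟ deg G w)))
    two u u≢w p = ≤-trans (≤-reflexive (sym (cong₂ _+_ (ones u) (ones w)))) (≤-trans (≤-reflexive (sym (∑-distrib-+ (δ u) (δ w)))) (sum-mono bound))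
      where
      ones : ∀ x → sum (δ x) ≡ 1
      ones x = trans (sum-cong-≗ λ v → sym (*-identityʳ (δ x v))) (sum-δ (λ _ → 1) x)
      bound : ∀ v → δ u v + δ w v ≤ 𝟙 (does (deg G v ≟ deg G w))
      bound v with u Fin.≟ v | w Fin.≟ v
      ... | yes refl | yes refl = ⊥-elim (u≢w refl)
      ... | yes refl | no _     = ≤-reflexive (sym (𝟙-does (deg G u ≟ deg G w) p))
      ... | no _     | yes refl = ≤-reflexive (sym (𝟙-does (deg G w ≟ deg G w) refl))
      ... | no _     | no _     = z≤n

  module _ (D : ℕ) where
    numDeg≤numMedium : ∀ i → IsMediumDegree {n} D i → numDeg G i ≤ numMedium D G
    numDeg≤numMedium i (3≤i , i<D) = ≤-trans (≤-reflexive (cong (numDeg G) (sym (m+[n∸m]≡n 3≤i))))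
      (listSum-∈ (λ i → numDeg G (3 + i)) (∈-upTo⁺ (∸-monoˡ-< i<D 3≤i)))

    numMedium-zero : (∀ v → ¬ IsMediumDegree {n} D (deg G v)) → numMedium D G ≡ 0
    numMedium-zero h = listSum-zero (λ i → numDeg G (3 + i)) (upTo (D ∸ 3)) λ i i∈ →
      numDeg-zero (3 + i) (λ v e → h v (subst (IsMediumDegree {n} D) (sym e) (m≤m+n 3 i , m<n∸o⇒o+m<n 3 (∈-upTo⁻ i∈))))
      where
      m<n∸o⇒o+m<n : ∀ o {m n} → m < n ∸ o → o + m < n
      m<n∸o⇒o+m<n o {m} {n} h = ≤-trans (+-monoʳ-< o h) (≤-reflexive (m+[n∸m]≡n (<⇒≤ (m∸n≢0⇒n<m {n} {o} (λ e → <⇒≱ h (subst (_≤ m) (sym e) z≤n))))))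

    numMedium-one : ∀ w → IsMediumDegree {n} D (deg G w) → (∀ u → u ≢ w → ¬ IsMediumDegree {n} D (deg G u)) →
      UniqueMediumDegree D G (deg G w)
    numMedium-one w (3≤d , d<D) single = (3≤d , d<D) , trans (listSum-unique (λ i → numDeg G (3 + i)) {deg G w ∸ 3} (upTo (D ∸ 3)) (Unique.upTo⁺ (D ∸ 3))
        (∈-upTo⁺ (∸-monoˡ-< d<D 3≤d)) zeros) (cong (numDeg G) (m+[n∸m]≡n 3≤d)) , numDeg-one w (λ u u≢w e → single u u≢w (subst (IsMediumDegree {n} D) (sym e) (3≤d , d<D)))
      where
      zeros : ∀ i → i ∈ upTo (D ∸ 3) → i ≢ deg G w ∸ 3 → numDeg G (3 + i) ≡ 0
      zeros i i∈ i≢ = numDeg-zero (3 + i) λ v e → other v e (v Fin.≟ w)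
        where
        3+i<D : 3 + i < D
        3+i<D = ≤-trans (+-monoʳ-< 3 (∈-upTo⁻ i∈)) (≤-reflexive (m+[n∸m]≡n (≤-trans 3≤d (<⇒≤ d<D))))
        other : ∀ v → deg G v ≡ 3 + i → Dec (v ≡ w) → ⊥
        other v e (yes refl) = i≢ (sym (trans (cong (_∸ 3) e) (m+n∸m≡n 3 i)))
        other v e (no v≢w)   = single v v≢w (subst (IsMediumDegree {n} D) (sym e) (m≤m+n 3 i , 3+i<D))

listSum-two : ∀ {A : Set} (f : A → ℕ) {x y xs} → x ∈ xs → y ∈ xs → x ≢ y → f x + f y ≤ listSum (map f xs)
listSum-two f (here refl) (here refl) x≢y = contradiction refl x≢y
listSum-two f (here refl) (there y∈)  x≢y = +-monoʳ-≤ (f _) (listSum-∈ f y∈)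
listSum-two f {x} {y} (there x∈) (here refl) x≢y = ≤-trans (≤-reflexive (+-comm (f x) (f y))) (+-monoʳ-≤ (f y) (listSum-∈ f x∈))
listSum-two f (there x∈) (there y∈) x≢y = ≤-trans (listSum-two f x∈ y∈ x≢y) (m≤n+m _ _)

quotient-unique : ∀ D u k e j → e + u * D ≡ k * D + j → e < D → j < D → u ≡ k × e ≡ j
quotient-unique D u k e j eq e<D j<D with <-cmp u k
... | tri≈ _ refl _ = refl , +-cancelʳ-≡ (u * D) _ _ (trans eq (+-comm (u * D) j))
... | tri< u<k _ _ = contradiction (<-≤-trans (+-monoˡ-< (u * D) e<D) (≤-trans (*-monoˡ-≤ D u<k) (m≤m+n (k * D) j))) (<-irrefl eq)
... | tri> _ _ k<u = contradiction (<-≤-trans (+-monoʳ-< (k * D) j<D) (≤-trans (≤-reflexive (+-comm (k * D) D)) (≤-trans (*-monoˡ-≤ D k<u) (m≤n+m (u * D) e)))) (<-irrefl (sym eq))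

-- Degrees, penalties and internal leaves

module Membership {n} (G : Graph n) (E k j : ℕ) (4≤E : 4 ≤ E) (n≡ : n ≡ k * (2 + E) + 1 + j) (1≤k : 1 ≤ k)
  (j≤E+1 : j ≤ suc E) (tree : TreeOfMaxDegree (2 + E) G) where
  open Penalty G E
  open MaxDegreeTree G E k j 4≤E n≡ 1≤k tree
  open Trichotomy G E k j 4≤E n≡ 1≤k j≤E+1 tree hiding (acyclic)
  open Counting G
  open Graph G

  private
    3≤Δ : 3 ≤ Δ
    3≤Δ = ≤-trans (≤ᵇ⇒≤ 3 6 _) (s≤s (s≤s 4≤E))

    Δ≢1 : Δ ≢ 1
    Δ≢1 e = <⇒≢ (≤-trans (≤ᵇ⇒≤ 2 3 _) 3≤Δ) (sym e)

    Δ≢2 : Δ ≢ 2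
    Δ≢2 e = <⇒≢ 3≤Δ (sym e)

  has-big : ∃[ b ] deg G b ≡ Δ
  has-big with Extrema.argmax-sel id 0 (map (deg G) (allFin n))
  ... | inj₁ max≡0 = contradiction (trans (sym (proj₂ tree)) max≡0) λ ()
  ... | inj₂ max∈ with ∈-map⁻ (deg G) max∈
  ...   | b , _ , max≡ = b , trans (sym max≡) (proj₂ tree)

  S₀-intro : ∀ {v} → deg G v ≢ Δ → S₀ v ≡ true
  S₀-intro {v} ne = cong not (dec-false (deg G v ≟ Δ) ne)

  S₀-elim : ∀ {v} → S₀ v ≡ true → deg G v ≢ Δ
  S₀-elim {v} = not-does (deg G v ≟ Δ)

  deg<Δ : ∀ {v} → S₀ v ≡ true → deg G v < Δ
  deg<Δ {v} S₀v = proj₂ (S₀-inner v S₀v)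

  -- A vertex together with its neighbours would be a component if all of these were leaves.
  non-leaf-neighbour : ∀ v → deg G v ≢ Δ → ∃[ u ] v ~ u × 2 ≤ deg G u
  non-leaf-neighbour v v≢Δ with Fin.any? (λ u → T? (adj v u) ×-dec (2 ≤? deg G u))
  ... | yes found = found
  ... | no none = ⊥-elim (excluded (reach (proj₁ (proj₁ tree) v b) (inj₁ refl)))
    where
    b = proj₁ has-big
    leaf : ∀ {u} → v ~ u → deg G u ≤ 1
    leaf v~u = s≤s⁻¹ (≰⇒> λ 2≤ → none (_ , v~u , 2≤))
    step : ∀ {x w} → x ~ w → x ≡ v ⊎ v ~ x → w ≡ v ⊎ v ~ w
    step x~w (inj₁ refl) = inj₂ x~w
    step {x} {w} x~w (inj₂ v~x) with w Fin.≟ v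
    ... | yes w≡v = inj₁ w≡v
    ... | no w≢v  = contradiction (leaf v~x) (<⇒≱ (nbr-two x w v x~w (~-sym G v~x) w≢v))
    reach : ∀ {x w} → Star _~_ x w → x ≡ v ⊎ v ~ x → w ≡ v ⊎ v ~ w
    reach ε         c = c
    reach (x~w ◅ p) c = reach p (step x~w c)
    excluded : b ≡ v ⊎ v ~ b → ⊥
    excluded (inj₁ b≡v) = v≢Δ (trans (cong (deg G) (sym b≡v)) (proj₂ has-big))
    excluded (inj₂ v~b) = <⇒≱ (≤-trans (≤ᵇ⇒≤ 2 3 _) 3≤Δ) (≤-trans (≤-reflexive (sym (proj₂ has-big))) (leaf v~b))

  pen-low : ∀ v → deg G v ≤ 2 → pen v ≡ 0
  pen-low v = ψ-low E (deg G v)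

  pen-medium : ∀ v → 3 ≤ deg G v → deg G v < Δ → 0 < pen v
  pen-medium v 3≤d d<Δ = *-mono-≤ {1} {z v * (deg G v ∸ 1)} (*-mono-≤ {1} {z v} (m<n⇒0<n∸m 3≤d) (m<n⇒0<n∸m (≤-trans (≤ᵇ⇒≤ 2 3 _) 3≤d)))
    (m<n⇒0<n∸m (≤-trans d<Δ (s≤s (≤-trans (+-monoˡ-≤ E (≤-trans (s≤s z≤n) 4≤E)) (≤-reflexive (cong (E +_) (sym (+-identityʳ E))))))))

  pen-zero⇒ : ∀ v → S₀ v ≡ true → pen v ≡ 0 → deg G v ≡ 1 ⊎ deg G v ≡ 2
  pen-zero⇒ v S₀v p≡0 with ≤-<-connex (deg G v) 2
  ... | inj₂ 3≤d = contradiction (pen-medium v 3≤d (deg<Δ S₀v)) (<-irrefl (sym p≡0))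
  ... | inj₁ d≤2 with m≤n⇒m<n∨m≡n d≤2
  ...   | inj₂ d≡2 = inj₂ d≡2
  ...   | inj₁ d<2 = inj₁ (≤-antisym (s≤s⁻¹ d<2) (1≤deg v))

  12Δ : (∀ v → S₀ v ≡ true → deg G v ≡ 1 ⊎ deg G v ≡ 2) → ∀ v → HasDegree12Δ Δ G v
  12Δ low v with deg G v ≟ Δ
  ... | yes d≡Δ = inj₂ (inj₂ d≡Δ)
  ... | no d≢Δ  = Sum.map₂ inj₁ (low v (S₀-intro d≢Δ))

  form-zero⇒ : ∀ f g → form G f g ≡ 0 → ∀ u v → u ~ v → 0 < f u → 0 < g v → ⊥
  form-zero⇒ f g e u v u~v 0<f 0<g = <⇒≢ (*-mono-≤ 0<f (*-mono-≤ (≤-reflexive (sym (~⇒a G u~v))) 0<g)) (sym (n≤0⇒n≡0 (begin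
    f u * (a G u v * g v)                       ≤⟨ *-monoʳ-≤ (f u) (term≤sum (λ v → a G u v * g v) v) ⟩
    f u * sum (λ v → a G u v * g v)             ≤⟨ term≤sum (λ u → f u * sum (λ v → a G u v * g v)) u ⟩
    form G f g                                  ≡⟨ e ⟩
    0                                           ∎)))
    where open ≤-Reasoning

  form-zero⇐ : ∀ f g → (∀ u v → u ~ v → f u * g v ≡ 0) → form G f g ≡ 0
  form-zero⇐ f g h = sum-zero λ u → trans (sym (sum-*ˡ (f u) (λ v → a G u v * g v))) (sum-zero λ v → term u v (adj u v) refl)
    where
    term : ∀ u v b → adj u v ≡ b → f u * (𝟙 b * g v) ≡ 0
    term u v false _ = *-zeroʳ (f u)
    term u v true  e = trans (cong (f u *_) (+-identityʳ (g v))) (h u v (subst T (sym e) _))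

  size-one : ∀ {v} → S₀ v ≡ true → size v ≡ 1
  size-one = cong 𝟙

  y>0 : ∀ {v} → S₀ v ≡ true → 0 < y v
  y>0 S₀v = m<n⇒0<n∸m (deg<Δ S₀v)

  private
    mΔΔ≡ : 2 * numEdges G Δ Δ ≡ form G (co S₀) (co S₀)
    mΔΔ≡ = trans (numEdges-term Δ Δ (λ u v → co S₀ u * co S₀ v) both neither)
      (sum-cong-≗ λ u → trans (sum-cong-≗ λ v → eq (a G u v) (co S₀ u) (co S₀ v)) (sum-*ˡ (co S₀ u) (λ v → a G u v * co S₀ v)))
      where
      eq : ∀ x y z → x * (y * z) ≡ y * (x * z)
      eq = solve-∀
      co-one : ∀ {v} → deg G v ≡ Δ → co S₀ v ≡ 1
      co-one {v} e = cong (λ b → 𝟙 (not (not b))) (dec-true (deg G v ≟ Δ) e)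
      co-zero : ∀ {v} → deg G v ≢ Δ → co S₀ v ≡ 0
      co-zero {v} e = cong (λ b → 𝟙 (not (not b))) (dec-false (deg G v ≟ Δ) e)
      both : ∀ u v → u ~ v → (deg G u ≡ Δ × deg G v ≡ Δ) ⊎ (deg G u ≡ Δ × deg G v ≡ Δ) → co S₀ u * co S₀ v ≡ 1
      both u v _ (inj₁ (p , q)) = cong₂ _*_ (co-one p) (co-one q)
      both u v _ (inj₂ (p , q)) = cong₂ _*_ (co-one p) (co-one q)
      neither : ∀ u v → u ~ v → ¬ ((deg G u ≡ Δ × deg G v ≡ Δ) ⊎ (deg G u ≡ Δ × deg G v ≡ Δ)) → co S₀ u * co S₀ v ≡ 0
      neither u v _ ¬p with deg G u ≟ Δ
      ... | no p  = cong (_* co S₀ v) (co-zero p)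
      ... | yes p = trans (cong (co S₀ u *_) (co-zero (λ q → ¬p (inj₁ (p , q))))) (*-zeroʳ (co S₀ u))

  -- For `S₀` the complement consists exactly of the vertices of degree `Δ`, so `edges-≥` becomes an
  -- equality with the correction `numEdges G Δ Δ`.
  edge-balance : edgeCount + U S₀ * Δ ≡ k * Δ + j + numEdges G Δ Δ
  edge-balance = *-cancelˡ-≡ _ _ 2 (trans (*-distribˡ-+ 2 edgeCount (U S₀ * Δ)) (trans (cong (λ p → 2 * edgeCount + 2 * p) (sym bigs-degree))
    (trans (cut S₀) (trans (cong (2 * (k * Δ + j) +_) (sym mΔΔ≡)) (sym (*-distribˡ-+ 2 (k * Δ + j) (numEdges G Δ Δ)))))))
    where
    term : ∀ v → co S₀ v * deg G v ≡ co S₀ v * Δ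
    term v with S₀ v in e
    ... | true  = refl
    ... | false = cong (_+ 0) (S₀-false v e)
    bigs-degree : sum (λ v → co S₀ v * deg G v) ≡ U S₀ * Δ
    bigs-degree = trans (sum-cong-≗ term) (sum-*ʳ Δ (co S₀))

  no-edges : (∀ u v → u ~ v → S₀ u ≡ true → S₀ v ≡ true → ⊥) → edgeCount ≡ 0
  no-edges h = *-cancelˡ-≡ _ 0 2 (trans 2edges (form-zero⇐ size size zero-term))
    where
    zero-term : ∀ u v → u ~ v → size u * size v ≡ 0
    zero-term u v u~v with S₀ u in p | S₀ v in q
    ... | true  | true  = ⊥-elim (h u v u~v p q)
    ... | true  | false = refl
    ... | false | _     = refl

  Ψ≡ : Ψ ≡ U S₀ * K E + cost
  Ψ≡ = sym Φ₀

  module NoLeaf (no-leaf : ∀ u v → u ~ v → S₀ u ≡ true → S₀ v ≡ true → deg G u ≢ 1) where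
    neighbour≥2 : ∀ u v → S₀ v ≡ true → v ~ u → 1 < deg G u
    neighbour≥2 u v S₀v v~u with deg G u ≟ Δ
    ... | yes d≡Δ = subst (1 <_) (sym d≡Δ) (≤-trans (≤ᵇ⇒≤ 2 3 _) 3≤Δ)
    ... | no d≢Δ  = ≤∧≢⇒< (1≤deg u) (no-leaf u v (~-sym G v~u) (S₀-intro d≢Δ) S₀v ∘ sym)

    -- A vertex of `S₀` has no leaf as a neighbour, so all its neighbours have degree greater than
    -- 1. Exactly one such neighbour would mean degree 1.
    internal : ∀ v → InternalLeaf G v → deg G v ≡ Δ
    internal v (2≤d , one) with deg G v ≟ Δ
    ... | yes d≡Δ = d≡Δ
    ... | no d≢Δ  = contradiction 2≤d (<⇒≱ (s≤s (≤-reflexive (trans (sym (nbr-all (λ u → 1 <? deg G u) v (λ u → neighbour≥2 u v (S₀-intro d≢Δ)))) one))))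

  module Internal (internal : ∀ v → InternalLeaf G v → deg G v ≡ Δ) where
    two⇒non-leaf : ∀ u v → v ~ u → deg G v ≡ 2 → 2 ≤ deg G u
    two⇒non-leaf u v v~u d≡2 with 2 ≤? deg G u
    ... | yes 2≤d = 2≤d
    ... | no 2≰d with non-leaf-neighbour v (λ e → Δ≢2 (trans (sym e) d≡2))
    ...   | w , v~w , 2≤w = contradiction (trans (sym (internal v (≤-reflexive (sym d≡2) , ≤-antisym
              (s≤s⁻¹ (≤-trans (nbr-not-all (λ u → 1 <? deg G u) v u v~u 2≰d) (≤-reflexive d≡2)))
              (nbr-some (λ u → 1 <? deg G u) v w v~w 2≤w)))) d≡2) Δ≢2

    -- A vertex of degree 2 next to a leaf would be an internal leaf of too small a degree, and two
    -- adjacent leaves would form a component.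
    low-pair⇒22 : ∀ u v → u ~ v → deg G u ≡ 1 ⊎ deg G u ≡ 2 → deg G v ≡ 1 ⊎ deg G v ≡ 2 → deg G u ≡ 2 × deg G v ≡ 2
    low-pair⇒22 u v u~v (inj₂ p) (inj₂ q) = p , q
    low-pair⇒22 u v u~v (inj₂ p) (inj₁ q) = contradiction (two⇒non-leaf v u u~v p) (<⇒≱ (s≤s (≤-reflexive q)))
    low-pair⇒22 u v u~v (inj₁ p) (inj₂ q) = contradiction (two⇒non-leaf u v (~-sym G u~v) q) (<⇒≱ (s≤s (≤-reflexive p)))
    low-pair⇒22 u v u~v (inj₁ p) (inj₁ q) with non-leaf-neighbour u (λ e → Δ≢1 (trans (sym e) p))
    ... | w , u~w , 2≤w = contradiction (≤-trans (nbr-two u v w u~v u~w (λ v≡w → <⇒≱ 2≤w (≤-reflexive (trans (cong (deg G) (sym v≡w)) q)))) (≤-reflexive p)) λ { (s≤s ()) }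

  module StarAt (w : Fin n) (S₀w : S₀ w ≡ true) where
    private
      S′ = remove G S₀ w
      module S′ = Subset S′

      S′⇒ : ∀ v → S′ v ≡ true → S₀ v ≡ true × v ≢ w
      S′⇒ v e with w Fin.≟ v
      ... | no w≢v  = trans (sym (Bool.∧-identityʳ (S₀ v))) e , w≢v ∘ sym
      ... | yes w≡v = contradiction e λ p → true≢false p (Bool.∧-zeroʳ (S₀ v))

      s≡ : sum (λ u → a G w u * S′.size u) ≡ s w
      s≡ = sum-cong-≗ term
        where
        term : ∀ u → a G w u * 𝟙 (S′ u) ≡ a G w u * size u
        term u with w Fin.≟ u
        ... | yes refl = trans (cong (_* 𝟙 (S₀ w ∧ false)) (a-irrefl G w)) (sym (cong (_* size w) (a-irrefl G w)))
        ... | no _     = cong (λ b → a G w u * 𝟙 b) (Bool.∧-identityʳ (S₀ u))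

    edges-split : 2 * edgeCount ≡ form G S′.size S′.size + 2 * s w
    edges-split = trans 2edges (trans (form-cong G (remove-split G S₀ w S₀w) (remove-split G S₀ w S₀w))
      (trans (form-add G w S′.size) (cong (λ p → form G S′.size S′.size + 2 * p) s≡)))

    -- Removing `w` deletes `s w` edges from `S₀`; if these are all, none remains between two other
    -- vertices.
    touching : edgeCount ≡ s w → ∀ u v → u ~ v → S₀ u ≡ true → S₀ v ≡ true → u ≡ w ⊎ v ≡ w
    touching e u v u~v S₀u S₀v with u Fin.≟ w | v Fin.≟ w
    ... | yes u≡w | _       = inj₁ u≡w
    ... | no _    | yes v≡w = inj₂ v≡w
    ... | no u≢w  | no v≢w  = ⊥-elim (form-zero⇒ S′.size S′.size none u v u~v (pos u S₀u u≢w) (pos v S₀v v≢w))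
      where
      none : form G S′.size S′.size ≡ 0
      none = +-cancelʳ-≡ (2 * s w) _ 0 (trans (sym edges-split) (cong (2 *_) e))
      pos : ∀ u → S₀ u ≡ true → u ≢ w → 0 < 𝟙 (S′ u)
      pos u S₀u u≢w = ≤-reflexive (sym (cong₂ (λ p q → 𝟙 (p ∧ not q)) S₀u (dec-false (w Fin.≟ u) (u≢w ∘ sym))))

    module _ (touch : ∀ u v → u ~ v → S₀ u ≡ true → S₀ v ≡ true → u ≡ w ⊎ v ≡ w) where
      private
        product-zero : ∀ (f : Fin n → ℕ) u v → u ~ v → 𝟙 (S′ u) * f u * (𝟙 (S′ v) * f v) ≡ 0
        product-zero f u v u~v with S′ u in p | S′ v in q
        ... | false | _     = refl
        ... | true  | false = *-zeroʳ (1 * f u)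
        ... | true  | true  with touch u v u~v (proj₁ (S′⇒ u p)) (proj₁ (S′⇒ v q))
        ...   | inj₁ u≡w = contradiction u≡w (proj₂ (S′⇒ u p))
        ...   | inj₂ v≡w = contradiction v≡w (proj₂ (S′⇒ v q))

      star-edges : edgeCount ≡ s w
      star-edges = *-cancelˡ-≡ _ _ 2 (trans edges-split (cong (_+ 2 * s w) (form-zero⇐ S′.size S′.size
        (λ u v u~v → trans (sym (cong₂ _*_ (*-identityʳ (𝟙 (S′ u))) (*-identityʳ (𝟙 (S′ v))))) (product-zero (λ _ → 1) u v u~v)))))

      star-cost : (∀ u → w ~ u → S₀ u ≡ true → deg G u ≡ 2) → (∀ u → u ≢ w → S₀ u ≡ true → pen u ≡ 0) →
        cost ≡ pen w + 2 * (y w * (E * s w))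
      star-cost two pens = trans (cost-remove S₀ w S₀w) (cong₂ _+_ zero-cost (cong (λ q → pen w + 2 * (y w * q)) Y≡))
        where
        zero-cost : S′.cost ≡ 0
        zero-cost = cong₂ _+_ (sum-zero pen-term) (form-zero⇐ (λ v → S′.size v * y v) (λ v → S′.size v * y v) (product-zero y))
          where
          pen-term : ∀ u → 𝟙 (S′ u) * pen u ≡ 0
          pen-term u with S′ u in p
          ... | false = refl
          ... | true  = trans (+-identityʳ (pen u)) (pens u (proj₂ (S′⇒ u p)) (proj₁ (S′⇒ u p)))
        Y≡ : Y w ≡ E * s w
        Y≡ = trans (sum-cong-≗ term) (sum-*ˡ E (λ u → a G w u * size u))
          where
          comm : ∀ x e → x * (1 * e) ≡ e * (x * 1)
          comm = solve-∀
          term : ∀ u → a G w u * (size u * y u) ≡ E * (a G w u * size u)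
          term u with adj w u in p | S₀ u in q
          ... | false | _     = sym (*-zeroʳ E)
          ... | true  | false = sym (*-zeroʳ E)
          ... | true  | true  = trans (cong (λ d → 1 * (1 * (2 + E ∸ d))) (two u (subst T (sym p) _) q)) (comm 1 E)

    star-value : ∀ z₀ → deg G w ≡ 2 + z₀ → ∀ t → pen w + 2 * (y w * (E * t)) ≡ medCost z₀ (E ∸ suc z₀) t
    star-value z₀ d≡ t = value (E ∸ suc z₀) E≡
      where
      z<E : suc z₀ ≤ E
      z<E = s≤s⁻¹ (s≤s⁻¹ (subst (_< Δ) d≡ (deg<Δ S₀w)))
      E≡ : z₀ + suc (E ∸ suc z₀) ≡ E
      E≡ = trans (+-suc z₀ _) (m+[n∸m]≡n z<E)
      eq : ∀ y e t → y * (e * t) ≡ t * (y * e)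
      eq = solve-∀
      value : ∀ y₀ → z₀ + suc y₀ ≡ E → pen w + 2 * (y w * (E * t)) ≡ medCost z₀ y₀ t
      value y₀ E≡ = trans (cong₂ (λ p q → p + 2 * (q * (E * t))) (trans (cong₂ ψ (sym E≡) d≡) (ψ-med z₀ y₀)) y≡)
        (cong (medψ z₀ y₀ +_) (cong (2 *_) (trans (eq (suc y₀) E t) (cong (λ e → t * (suc y₀ * e)) (sym E≡)))))
        where
        y≡ : y w ≡ suc y₀
        y≡ = trans (cong₂ (λ e d → 2 + e ∸ d) (sym E≡) d≡) (m+n∸m≡n z₀ (suc y₀))

module _ {n} (G : Graph n) where
  open Graph G
  open Counting G

  nbr-cong : ∀ {P Q : Fin n → Set} (P? : Decidable P) (Q? : Decidable Q) v →
    (∀ u → v ~ u → P u → Q u) → (∀ u → v ~ u → Q u → P u) →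
    length (filter P? (neighbours G v)) ≡ length (filter Q? (neighbours G v))
  nbr-cong P? Q? v f g = trans (nbr-count P? v) (trans (sum-cong-≗ λ u → term u (adj v u) refl (P? u) (Q? u)) (sym (nbr-count Q? v)))
    where
    term : ∀ u b → adj v u ≡ b → ∀ p q → 𝟙 b * 𝟙 (does p) ≡ 𝟙 b * 𝟙 (does q)
    term u false _ _       _       = refl
    term u true  _ (yes _) (yes _) = refl
    term u true  _ (no _)  (no _)  = refl
    term u true  e (yes p) (no ¬q) = contradiction (f u (subst T (sym e) _) p) ¬q
    term u true  e (no ¬p) (yes q) = contradiction (g u (subst T (sym e) _) q) ¬p

  nbr-compl : ∀ {P : Fin n → Set} (P? : Decidable P) v →
    length (filter P? (neighbours G v)) + length (filter (¬? ∘ P?) (neighbours G v)) ≡ deg G v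
  nbr-compl P? v = trans (cong₂ _+_ (nbr-count P? v) (nbr-count (¬? ∘ P?) v))
    (trans (sym (∑-distrib-+ (λ u → a G v u * 𝟙 (does (P? u))) (λ u → a G v u * 𝟙 (does (¬? (P? u))))))
      (trans (sum-cong-≗ λ u → term (a G v u) (does (P? u))) (sym (deg≡ G v))))
    where
    term : ∀ k b → k * 𝟙 b + k * 𝟙 (not b) ≡ k
    term k true  = trans (cong₂ _+_ (*-identityʳ k) (*-zeroʳ k)) (+-identityʳ k)
    term k false = cong₂ _+_ (*-zeroʳ k) (*-identityʳ k)

numDeg-two : ∀ {n} (G : Graph n) D i i′ → IsMediumDegree {n} D i → IsMediumDegree {n} D i′ → i ≢ i′ →
  numDeg G i + numDeg G i′ ≤ numMedium D G
numDeg-two G D i i′ (3≤i , i<D) (3≤i′ , i′<D) i≢i′ = ≤-trans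
  (≤-reflexive (cong₂ (λ p q → numDeg G p + numDeg G q) (sym (m+[n∸m]≡n 3≤i)) (sym (m+[n∸m]≡n 3≤i′))))
  (listSum-two (λ i → numDeg G (3 + i)) (∈-upTo⁺ (∸-monoˡ-< i<D 3≤i)) (∈-upTo⁺ (∸-monoˡ-< i′<D 3≤i′))
    (λ e → i≢i′ (trans (sym (m+[n∸m]≡n 3≤i)) (trans (cong (3 +_) e) (m+[n∸m]≡n 3≤i′)))))

-- At `j ≡ 2` the formula for a medium vertex of degree `j` degenerates to degree 2. It then stands
-- for two edges between vertices of degree 2, the case of 𝒯′ with `m₂₂` equal to 2.
c′₂ : ∀ E → 1 ≤ E → c′ E 2 ≡ ℓ E * 2
c′₂ E 1≤E = gap-elim (λ E → medCost 0 (E ∸ 1) 2 ≡ ℓ E * 2) 1 eq 1≤E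
  where
  eq : ∀ y → 0 * 1 * (1 + 2 * y) + 2 * (2 * (suc y * (0 + suc y))) ≡ 2 * ((1 + y) * (1 + y)) * 2
  eq = solve-∀

-- The value of Ψ on the families, and membership from equality

module Conversion {n} (G : Graph n) (E k j : ℕ) (4≤E : 4 ≤ E) (n≡ : n ≡ k * (2 + E) + 1 + j) (1≤k : 1 ≤ k)
  (j≤E+1 : j ≤ suc E) (tree : TreeOfMaxDegree (2 + E) G) where
  open Penalty G E
  open MaxDegreeTree G E k j 4≤E n≡ 1≤k tree
  open Trichotomy G E k j 4≤E n≡ 1≤k j≤E+1 tree hiding (acyclic)
  open Membership G E k j 4≤E n≡ 1≤k j≤E+1 tree
  open Counting G
  open Graph G

  private
    j<Δ : j < Δ
    j<Δ = s≤s j≤E+1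

    3≤Δ : 3 ≤ Δ
    3≤Δ = ≤-trans (≤ᵇ⇒≤ 3 6 _) (s≤s (s≤s 4≤E))

    2≢Δ : 2 ≢ Δ
    2≢Δ = <⇒≢ 3≤Δ

    S₀-of : ∀ {v d} → deg G v ≡ d → d < Δ → S₀ v ≡ true
    S₀-of refl d<Δ = S₀-intro (<⇒≢ d<Δ)

    low-pen : (∀ v → S₀ v ≡ true → deg G v ≡ 1 ⊎ deg G v ≡ 2) → ∀ v → S₀ v ≡ true → pen v ≡ 0
    low-pen low v S₀v = pen-low v (Sum.[ (λ e → ≤-trans (≤-reflexive e) (s≤s z≤n)) , ≤-reflexive ]′ (low v S₀v))

    degrees⇒low : ∀ v → HasDegree12Δ Δ G v → S₀ v ≡ true → deg G v ≡ 1 ⊎ deg G v ≡ 2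
    degrees⇒low v (inj₁ e)        _   = inj₁ e
    degrees⇒low v (inj₂ (inj₁ e)) _   = inj₂ e
    degrees⇒low v (inj₂ (inj₂ e)) S₀v = contradiction e (S₀-elim S₀v)

    ¬medium⇒low : ∀ v → ¬ IsMediumDegree {n} Δ (deg G v) → S₀ v ≡ true → deg G v ≡ 1 ⊎ deg G v ≡ 2
    ¬medium⇒low v ¬med S₀v with ≤-<-connex 3 (deg G v)
    ... | inj₁ 3≤d = contradiction (3≤d , deg<Δ S₀v) ¬med
    ... | inj₂ d<3 with m≤n⇒m<n∨m≡n (s≤s⁻¹ d<3)
    ...   | inj₂ e = inj₂ e
    ...   | inj₁ d<2 = inj₁ (≤-antisym (s≤s⁻¹ d<2) (1≤deg v))

    mΔΔ-zero : U S₀ ≡ k → edgeCount ≡ j → numEdges G Δ Δ ≡ 0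
    mΔΔ-zero u≡ e≡ = +-cancelˡ-≡ (k * Δ + j) _ 0 (trans (sym edge-balance)
      (trans (cong₂ (λ e u → e + u * Δ) e≡ u≡) (trans (+-comm j (k * Δ)) (sym (+-identityʳ _)))))

  no-pair-cost : (∀ u v → u ~ v → S₀ u ≡ true → S₀ v ≡ true → ⊥) → (∀ v → S₀ v ≡ true → pen v ≡ 0) → cost ≡ 0
  no-pair-cost h pens = cong₂ _+_ (sum-zero term) (form-zero⇐ (λ v → size v * y v) (λ v → size v * y v) pair)
    where
    term : ∀ v → size v * pen v ≡ 0
    term v with S₀ v in e
    ... | false = refl
    ... | true  = trans (+-identityʳ (pen v)) (pens v e)
    pair : ∀ u v → u ~ v → size u * y u * (size v * y v) ≡ 0
    pair u v u~v with S₀ u in p | S₀ v in q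
    ... | false | _     = refl
    ... | true  | false = *-zeroʳ (1 * y u)
    ... | true  | true  = ⊥-elim (h u v u~v p q)

  module _ (u≡ : U S₀ ≡ bigs k j) (cost≡0 : cost ≡ 0) where
    private
      pens : ∀ v → S₀ v ≡ true → pen v ≡ 0
      pens v S₀v = trans (sym (trans (cong (_* pen v) (size-one S₀v)) (*-identityˡ (pen v))))
        (sum≡0⇒ (λ v → size v * pen v) (m+n≡0⇒m≡0 _ cost≡0) v)

      size*y>0 : ∀ v → S₀ v ≡ true → 0 < size v * y v
      size*y>0 v S₀v = subst (0 <_) (sym (trans (cong (_* y v) (size-one S₀v)) (*-identityˡ (y v)))) (y>0 S₀v)

      no-pair : ∀ u v → u ~ v → S₀ u ≡ true → S₀ v ≡ true → ⊥
      no-pair u v u~v S₀u S₀v = form-zero⇒ (λ v → size v * y v) (λ v → size v * y v)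
        (m+n≡0⇒n≡0 (sum (λ v → size v * pen v)) cost≡0) u v u~v (size*y>0 u S₀u) (size*y>0 v S₀v)

      balance₀ : ∀ i → j ≡ i → numEdges G Δ Δ ≤ Δ ∸ 1
      balance₀ zero    refl = ≤-trans (≤-reflexive (+-cancelˡ-≡ (k * Δ + 0) _ 0 (trans (sym edge-balance) (trans
        (cong₂ (λ e u → e + u * Δ) (no-edges no-pair) u≡) (sym (trans (+-identityʳ _) (+-identityʳ (k * Δ)))))))) z≤n
      -- With `suc k` vertices of degree `Δ` and no edge in `S₀`, the balance reads
      -- `j + numEdges G Δ Δ ≡ Δ`.
      balance₀ (suc i) refl = s≤s⁻¹ (≤-trans (s≤s (m≤n+m (numEdges G Δ Δ) i)) (≤-reflexive (sym (+-cancelˡ-≡ (k * Δ) _ _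
        (trans (+-comm (k * Δ) Δ) (trans (sym (cong₂ (λ e u → e + u * Δ) (no-edges no-pair) u≡)) (trans edge-balance (+-assoc (k * Δ) (suc i) _))))))))

    to″ : Family″ Δ G
    to″ = record
      { tree         = tree
      ; internalLeaf = NoLeaf.internal (λ u v u~v S₀u S₀v → ⊥-elim (no-pair u v u~v S₀u S₀v))
      ; degrees      = 12Δ (λ v S₀v → pen-zero⇒ v S₀v (pens v S₀v))
      ; m₂₂≡0        = numEdges-zero 2 2 (λ u v u~v p q → no-pair u v u~v (S₀-of p 3≤Δ) (S₀-of q 3≤Δ))
      ; mΔΔ≤Δ-1      = balance₀ j refl }

  val″ : Family″ Δ G → Ψ ≡ bigs k j * K E
  val″ F = trans Ψ≡ (trans (cong₂ (λ u c → u * K E + c) (count j refl) (no-pair-cost no-pair (low-pen low))) (+-identityʳ _))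
    where
    open Family″ F hiding (tree)
    open Internal internalLeaf
    low : ∀ v → S₀ v ≡ true → deg G v ≡ 1 ⊎ deg G v ≡ 2
    low v = degrees⇒low v (degrees v)
    no-pair : ∀ u v → u ~ v → S₀ u ≡ true → S₀ v ≡ true → ⊥
    no-pair u v u~v S₀u S₀v with low-pair⇒22 u v u~v (low u S₀u) (low v S₀v)
    ... | p , q = numEdges-zero⁻ 2 2 m₂₂≡0 u v u~v p q
    β = numEdges G Δ Δ
    balance₀ : 0 + U S₀ * Δ ≡ k * Δ + (j + β)
    balance₀ = trans (cong (_+ U S₀ * Δ) (sym (no-edges no-pair))) (trans edge-balance (+-assoc (k * Δ) j β))
    β<Δ : β < Δ
    β<Δ = s≤s mΔΔ≤Δ-1
    -- As `S₀` spans no edge, `Δ` divides `j + β`, which is less than `2 Δ`. So it is `0` if `j ≡ 0`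
    -- and `Δ` otherwise.
    count : ∀ i → j ≡ i → U S₀ ≡ bigs k i
    count zero    refl = proj₁ (quotient-unique Δ (U S₀) k 0 β balance₀ (s≤s z≤n) β<Δ)
    count (suc i) refl with ≤-<-connex Δ (j + β)
    ... | inj₂ small = contradiction (proj₂ (quotient-unique Δ (U S₀) k 0 (j + β) balance₀ (s≤s z≤n) small)) λ ()
    ... | inj₁ large = proj₁ (quotient-unique Δ (U S₀) (suc k) 0 (j + β ∸ Δ)
            (trans balance₀ (trans (cong (k * Δ +_) (sym (m+[n∸m]≡n large))) (trans (sym (+-assoc (k * Δ) Δ _)) (cong (_+ (j + β ∸ Δ)) (+-comm (k * Δ) Δ)))))
            (s≤s z≤n) (+-cancelˡ-< Δ _ _ (≤-<-trans (≤-reflexive (m+[n∸m]≡n large)) (+-mono-< j<Δ β<Δ))))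

  m22-count : (∀ u v → u ~ v → S₀ u ≡ true → S₀ v ≡ true → deg G u ≡ 2 × deg G v ≡ 2) → numEdges G 2 2 ≡ edgeCount
  m22-count h = *-cancelˡ-≡ _ _ 2 (trans (numEdges-term 2 2 (λ u v → size u * size v) both neither) (trans
    (sum-cong-≗ λ u → trans (sum-cong-≗ λ v → eq (a G u v) (size u) (size v)) (sum-*ˡ (size u) (λ v → a G u v * size v))) (sym 2edges)))
    where
    eq : ∀ x y z → x * (y * z) ≡ y * (x * z)
    eq = solve-∀
    both : ∀ u v → u ~ v → (deg G u ≡ 2 × deg G v ≡ 2) ⊎ (deg G u ≡ 2 × deg G v ≡ 2) → size u * size v ≡ 1
    both u v _ (inj₁ (p , q)) = cong₂ _*_ (size-one (S₀-of p 3≤Δ)) (size-one (S₀-of q 3≤Δ))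
    both u v _ (inj₂ (p , q)) = cong₂ _*_ (size-one (S₀-of p 3≤Δ)) (size-one (S₀-of q 3≤Δ))
    neither : ∀ u v → u ~ v → ¬ ((deg G u ≡ 2 × deg G v ≡ 2) ⊎ (deg G u ≡ 2 × deg G v ≡ 2)) → size u * size v ≡ 0
    neither u v u~v ¬p with S₀ u in p | S₀ v in q
    ... | false | _     = refl
    ... | true  | false = refl
    ... | true  | true  = ⊥-elim (¬p (inj₁ (h u v u~v p q)))

  private
    module FromQ (Q≡0 : Estimated.Q ≡ 0) where
      low : ∀ v → m v ≡ false → S₀ v ≡ true → deg G v ≡ 1 ⊎ deg G v ≡ 2
      low v mv S₀v = pen-zero⇒ v S₀v (trans (sym (trans (cong₂ (λ p q → 𝟙 (p ∧ not q) * pen v) S₀v mv) (*-identityˡ (pen v))))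
        (sum≡0⇒ (λ v → rest v * pen v) (m+n≡0⇒n≡0 (ZZ + XX) Q≡0) v))

      -- `XX` is a summand of `Q`, and by `leaf-pair` an edge at a leaf has positive surplus.
      no-leaf : ∀ u v → u ~ v → S₀ u ≡ true → S₀ v ≡ true → deg G u ≢ 1
      no-leaf u v u~v S₀u S₀v d≡1 = <⇒≢ positive (sym (sum≡0⇒ (λ v → a G u v * (size v * surplus u v))
        (trans (sym (trans (cong (_* X u) (size-one S₀u)) (*-identityˡ (X u))))
          (sum≡0⇒ (λ u → size u * X u) (m+n≡0⇒n≡0 ZZ (m+n≡0⇒m≡0 (ZZ + XX) Q≡0)) u)) v))
        where
        positive : 0 < a G u v * (size v * surplus u v)
        positive = *-mono-≤ {1} (≤-reflexive (sym (~⇒a G u~v))) (*-mono-≤ {1} (≤-reflexive (sym (size-one S₀v)))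
          (m<n⇒0<n∸m (subst (λ d → E * E + (d ∸ 2) * z v < (2 + E ∸ d) * y v + (E * (d ∸ 2) + E * z v)) (sym d≡1)
            (leaf-pair E (deg G v) (1≤deg v) (deg<Δ S₀v)))))

  to′₀ : U S₀ ≡ k → j ≡ 1 → edgeCount ≡ 1 → (∀ v → m v ≡ false) → Estimated.Q ≡ 0 → Family′ Δ G
  to′₀ u≡ j≡1 e≡1 ms Q≡0 = record
    { tree         = tree
    ; internalLeaf = NoLeaf.internal no-leaf
    ; m₂₂≤2        = ≤-trans (≤-reflexive m22) (s≤s z≤n)
    ; mΔΔ≡0        = mΔΔ-zero u≡ (trans e≡1 (sym j≡1))
    ; medium≤1     = ≤-trans (≤-reflexive no-medium) z≤n
    ; m₂₂≡0⇔medium = mk⇔ (λ e → contradiction (trans (sym m22) e) λ ())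
                       (λ (_ , _ , p , q) → contradiction (trans (sym (trans p q)) no-medium) λ ())
    ; mₐ₂≡a        = λ e → contradiction (trans (sym m22) e) λ () }
    where
    open FromQ Q≡0
    pair : ∀ u v → u ~ v → S₀ u ≡ true → S₀ v ≡ true → deg G u ≡ 2 × deg G v ≡ 2
    pair u v u~v S₀u S₀v = Sum.[ (λ e → contradiction e (no-leaf u v u~v S₀u S₀v)) , id ]′ (low u (ms u) S₀u)
      , Sum.[ (λ e → contradiction e (no-leaf v u (~-sym G u~v) S₀v S₀u)) , id ]′ (low v (ms v) S₀v)
    m22 : numEdges G 2 2 ≡ 1
    m22 = trans (m22-count pair) e≡1
    no-medium : numMedium Δ G ≡ 0
    no-medium = numMedium-zero Δ λ v (3≤d , d<Δ) → Sum.[ (λ e → <⇒≱ (≤-trans (s≤s (≤-reflexive e)) (≤ᵇ⇒≤ 2 3 _)) 3≤d) , (λ e → <⇒≱ (s≤s (≤-reflexive e)) 3≤d) ]′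
      (low v (ms v) (S₀-of refl d<Δ))

  -- All edges between vertices of degree less than Δ meet at w, which has the only medium degree.
  module StarFamily (u≡ : U S₀ ≡ k) (w : Fin n) (inS : S₀ w ≡ true) (3≤deg : 3 ≤ deg G w)
    (low′ : ∀ u → u ≢ w → S₀ u ≡ true → deg G u ≡ 1 ⊎ deg G u ≡ 2)
    (no-leaf : ∀ u v → u ~ v → S₀ u ≡ true → S₀ v ≡ true → deg G u ≢ 1)
    (touch : ∀ u v → u ~ v → S₀ u ≡ true → S₀ v ≡ true → u ≡ w ⊎ v ≡ w)
    (e≡ : edgeCount ≡ j) (s≡ : s w ≡ j) where
    private
      w-medium : IsMediumDegree {n} Δ (deg G w)
      w-medium = 3≤deg , deg<Δ inS

      ¬medium : ∀ u → u ≢ w → ¬ IsMediumDegree {n} Δ (deg G u)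
      ¬medium u u≢w (3≤d , d<Δ) = Sum.[ (λ e → <⇒≱ (≤-trans (s≤s (≤-reflexive e)) (≤ᵇ⇒≤ 2 3 _)) 3≤d) , (λ e → <⇒≱ (s≤s (≤-reflexive e)) 3≤d) ]′
        (low′ u u≢w (S₀-of refl d<Δ))

      deg-w≢2 : deg G w ≢ 2
      deg-w≢2 = <⇒≢ (proj₁ w-medium) ∘ sym

      m22 : numEdges G 2 2 ≡ 0
      m22 = numEdges-zero 2 2 λ u v u~v p q → Sum.[ (λ { refl → deg-w≢2 p }) , (λ { refl → deg-w≢2 q }) ]′
        (touch u v u~v (S₀-of p 3≤Δ) (S₀-of q 3≤Δ))

      two : ∀ u → w ~ u → S₀ u ≡ true → deg G u ≡ 2
      two u w~u S₀u = Sum.[ (λ e → contradiction e (no-leaf u w (~-sym G w~u) S₀u inS)) , id ]′ (low′ u (~⇒≢ G (~-sym G w~u)) S₀u)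

      s-count : length (filter (λ u → ¬? (deg G u ≟ Δ)) (neighbours G w)) ≡ s w
      s-count = nbr-count (λ u → ¬? (deg G u ≟ Δ)) w

    star′ : deg G w ≡ j → Family′ Δ G
    star′ d≡j = record
      { tree         = tree
      ; internalLeaf = NoLeaf.internal no-leaf
      ; m₂₂≤2        = ≤-trans (≤-reflexive m22) z≤n
      ; mΔΔ≡0        = mΔΔ-zero u≡ e≡
      ; medium≤1     = ≤-reflexive (trans (proj₁ (proj₂ unique)) (proj₂ (proj₂ unique)))
      ; m₂₂≡0⇔medium = mk⇔ (λ _ → deg G w , unique) (λ _ → m22)
      ; mₐ₂≡a        = λ _ i (i-medium , _ , one) → for-i i i-medium (numDeg≡1⇒ i one) }
      where
      unique : UniqueMediumDegree Δ G (deg G w)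
      unique = numMedium-one Δ w w-medium ¬medium
      all-two : ∀ u → w ~ u → deg G u ≡ 2
      all-two u w~u with deg G u ≟ Δ
      ... | no d≢Δ = two u w~u (S₀-intro d≢Δ)
      ... | yes d≡Δ = contradiction (trans s-count (trans s≡ (sym d≡j))) (<⇒≢ (nbr-not-all (λ u → ¬? (deg G u ≟ Δ)) w u w~u (λ d≢Δ → d≢Δ d≡Δ)))
      for-w : numEdges G (deg G w) 2 ≡ deg G w
      for-w = trans (numEdges-single w 2 deg-w≢2 (λ u u≢w e → ¬medium u u≢w (subst (IsMediumDegree {n} Δ) (sym e) w-medium)))
        (nbr-all (λ u → deg G u ≟ 2) w all-two)
      for-i : ∀ i → IsMediumDegree {n} Δ i → ∃[ v ] deg G v ≡ i × (∀ u → u ≢ v → deg G u ≢ i) → numEdges G i 2 ≡ i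
      for-i i i-medium (v , refl , _) with v Fin.≟ w
      ... | yes refl = for-w
      ... | no v≢w   = contradiction i-medium (¬medium v v≢w)

    star‴ : deg G w ≡ 1 + j → Family‴ Δ j G
    star‴ d≡ = record
      { 2≤j          = s≤s⁻¹ (subst (3 ≤_) d≡ 3≤deg)
      ; j≤Δ-2        = s≤s⁻¹ (s≤s⁻¹ (subst (_< Δ) d≡ (deg<Δ inS)))
      ; tree         = tree
      ; internalLeaf = NoLeaf.internal no-leaf
      ; w            = w
      ; w-medium     = w-medium
      ; w-degree     = deg-w
      ; degrees      = λ v v≢w → degrees v v≢w (deg G v ≟ Δ)
      ; m₂₂≡0        = m22
      ; w-nbrs₂      = trans nbrs₂ s≡
      ; w-nbrsΔ      = +-cancelʳ-≡ j _ 1 (trans (cong (numNeighbours G w Δ +_) (sym (trans s-count s≡)))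
                         (trans (nbr-compl G (λ u → deg G u ≟ Δ) w) (trans deg-w (+-comm j 1))))
      ; mΔΔ≡0        = mΔΔ-zero u≡ e≡ }
      where
      deg-w : deg G w ≡ j + 1
      deg-w = trans d≡ (+-comm 1 j)
      degrees : ∀ v → v ≢ w → Dec (deg G v ≡ Δ) → HasDegree12Δ Δ G v
      degrees v _   (yes d≡Δ) = inj₂ (inj₂ d≡Δ)
      degrees v v≢w (no d≢Δ)  = Sum.map₂ inj₁ (low′ v v≢w (S₀-intro d≢Δ))
      nbrs₂ : numNeighbours G w 2 ≡ s w
      nbrs₂ = trans (nbr-cong G (λ u → deg G u ≟ 2) (λ u → ¬? (deg G u ≟ Δ)) w
        (λ u _ d≡2 d≡Δ → 2≢Δ (trans (sym d≡2) d≡Δ)) (λ u w~u d≢Δ → two u w~u (S₀-intro d≢Δ))) s-count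

  module _ (u≡ : U S₀ ≡ k) (w : Fin n) (med : Medium w) (others : ∀ u → u ≢ w → m u ≡ false) (e≡ : edgeCount ≡ j)
    (s≡ : s w ≡ j) (Q≡0 : Estimated.Q ≡ 0) where
    open Forest.Medium med
    open FromQ Q≡0
    private
      module SF = StarFamily u≡ w inS (subst (3 ≤_) (sym d≡) (s≤s (s≤s 1≤z))) (λ u u≢w → low u (others u u≢w)) no-leaf
        (StarAt.touching w inS (trans e≡ (sym s≡))) e≡ s≡

    to′₁ : j ≡ 2 + z w → Family′ Δ G
    to′₁ j≡ = SF.star′ (trans d≡ (sym j≡))

    to‴ : j ≡ 1 + z w → Family‴ Δ j G
    to‴ j≡ = SF.star‴ (trans d≡ (cong suc (sym j≡)))

  -- The families with a medium vertex w all of whose neighbours of degree less than Δ have degree 2.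
  private
    module StarValue (internalLeaf : ∀ v → InternalLeaf G v → deg G v ≡ Δ) (m₂₂≡0 : numEdges G 2 2 ≡ 0) (mΔΔ≡0 : numEdges G Δ Δ ≡ 0)
      (w : Fin n) (S₀w : S₀ w ≡ true) (low : ∀ u → u ≢ w → S₀ u ≡ true → deg G u ≡ 1 ⊎ deg G u ≡ 2)
      (two : ∀ u → w ~ u → S₀ u ≡ true → deg G u ≡ 2) where
      open Internal internalLeaf
      open StarAt w S₀w

      touch : ∀ u v → u ~ v → S₀ u ≡ true → S₀ v ≡ true → u ≡ w ⊎ v ≡ w
      touch u v u~v S₀u S₀v with u Fin.≟ w | v Fin.≟ w
      ... | yes u≡w | _       = inj₁ u≡w
      ... | no _    | yes v≡w = inj₂ v≡w
      ... | no u≢w  | no v≢w with low-pair⇒22 u v u~v (low u u≢w S₀u) (low v v≢w S₀v)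
      ...   | p , q = ⊥-elim (numEdges-zero⁻ 2 2 m₂₂≡0 u v u~v p q)

      s-count : length (filter (λ u → ¬? (deg G u ≟ Δ)) (neighbours G w)) ≡ s w
      s-count = nbr-count (λ u → ¬? (deg G u ≟ Δ)) w

      uj : s w < Δ → U S₀ ≡ k × s w ≡ j
      uj s<Δ = quotient-unique Δ (U S₀) k (s w) j (trans (cong (_+ U S₀ * Δ) (sym (star-edges touch)))
        (trans edge-balance (trans (cong (k * Δ + j +_) mΔΔ≡0) (+-identityʳ _)))) s<Δ j<Δ

      value : ∀ z₀ → deg G w ≡ 2 + z₀ → s w < Δ → Ψ ≡ k * K E + medCost z₀ (E ∸ suc z₀) (s w)
      value z₀ d≡ s<Δ = trans Ψ≡ (cong₂ (λ u c → u * K E + c) (proj₁ (uj s<Δ))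
        (trans (star-cost touch two (λ u u≢w S₀u → pen-low u (Sum.[ (λ e → ≤-trans (≤-reflexive e) (s≤s z≤n)) , ≤-reflexive ]′ (low u u≢w S₀u))))
          (star-value z₀ d≡ (s w))))

  val‴ : Family‴ Δ j G → Ψ ≡ k * K E + c‴ E j
  val‴ F = trans (value (pred j) d≡ (subst (_< Δ) (sym s≡j) j<Δ)) (cong (k * K E +_)
      (cong₂ (λ q t → medCost (pred j) (E ∸ q) t) 1+pred s≡j))
    where
    open Family‴ F hiding (tree)
    S₀w : S₀ w ≡ true
    S₀w = S₀-of refl (proj₂ w-medium)
    -- The `j` neighbours of degree 2 and the one of degree `Δ` exhaust the degree `j + 1` of `w`.
    2orΔ : ∀ u → w ~ u → deg G u ≢ Δ → deg G u ≡ 2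
    2orΔ u w~u d≢Δ with deg G u ≟ 2
    ... | yes d≡2 = d≡2
    ... | no d≢2 = contradiction
      (trans (cong₂ _+_ w-nbrs₂ w-nbrsΔ) (sym w-degree))
      (<⇒≢ (subst₂ _<_ (trans (∑-distrib-+ (λ u → a G w u * 𝟙 (does (deg G u ≟ 2))) (λ u → a G w u * 𝟙 (does (deg G u ≟ Δ))))
          (sym (cong₂ _+_ (nbr-count (λ u → deg G u ≟ 2) w) (nbr-count (λ u → deg G u ≟ Δ) w)))) (sym (deg≡ G w))
        (sum-mono-< le u (subst₂ _<_ (sym (cong₂ _+_ (zero-at 2 d≢2) (zero-at Δ d≢Δ))) (sym (~⇒a G w~u)) (s≤s z≤n)))))
      where
      zero-at : ∀ i → deg G u ≢ i → a G w u * 𝟙 (does (deg G u ≟ i)) ≡ 0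
      zero-at i ne = trans (cong (λ b → a G w u * 𝟙 b) (dec-false (deg G u ≟ i) ne)) (*-zeroʳ (a G w u))
      le : ∀ u → a G w u * 𝟙 (does (deg G u ≟ 2)) + a G w u * 𝟙 (does (deg G u ≟ Δ)) ≤ a G w u
      le u = ≤-trans (≤-reflexive (sym (*-distribˡ-+ (a G w u) (𝟙 (does (deg G u ≟ 2))) (𝟙 (does (deg G u ≟ Δ))))))
        (≤-trans (*-monoʳ-≤ (a G w u) (disjoint (deg G u ≟ 2) (deg G u ≟ Δ))) (≤-reflexive (*-identityʳ _)))
        where
        disjoint : (p : Dec (deg G u ≡ 2)) (q : Dec (deg G u ≡ Δ)) → 𝟙 (does p) + 𝟙 (does q) ≤ 1
        disjoint (yes p) (yes q) = contradiction (trans (sym p) q) 2≢Δ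
        disjoint (yes _) (no _)  = ≤-refl
        disjoint (no _)  q       = 𝟙≤1 (does q)
    two : ∀ u → w ~ u → S₀ u ≡ true → deg G u ≡ 2
    two u w~u S₀u = 2orΔ u w~u (S₀-elim S₀u)
    open StarValue internalLeaf m₂₂≡0 mΔΔ≡0 w S₀w (λ u u≢w → degrees⇒low u (degrees u u≢w)) two
    1+pred : suc (pred j) ≡ j
    1+pred = suc-pred j {{>-nonZero (≤-trans (s≤s z≤n) 2≤j)}}
    d≡ : deg G w ≡ 2 + pred j
    d≡ = trans w-degree (trans (+-comm j 1) (cong suc (sym 1+pred)))
    s≡j : s w ≡ j
    s≡j = trans (sym s-count) (trans (nbr-cong G (λ u → ¬? (deg G u ≟ Δ)) (λ u → deg G u ≟ 2) w
      (λ u w~u → 2orΔ u w~u) (λ u _ d≡2 d≡Δ → 2≢Δ (trans (sym d≡2) d≡Δ))) w-nbrs₂)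

  val′ : Family′ Δ G → Ψ ≡ k * K E + c′ E j
  val′ F with numEdges G 2 2 ≟ 0
    where open Family′ F
  ... | yes m₂₂≡0 = from-unique (Equivalence.to m₂₂≡0⇔medium m₂₂≡0)
    where
    open Family′ F hiding (tree)
    from-unique : ∃[ i ] UniqueMediumDegree Δ G i → Ψ ≡ k * K E + c′ E j
    from-unique (i , (3≤i , i<Δ) , numMedium≡ , numDeg≡1) with numDeg≡1⇒ i numDeg≡1
    ... | w , refl , single = trans (value (deg G w ∸ 2) d≡ s<Δ) (cong (k * K E +_)
            (trans (cong (medCost (deg G w ∸ 2) (E ∸ suc (deg G w ∸ 2))) (trans s≡ d≡)) (cong (c′ E) (trans (sym d≡) (trans (sym s≡) (proj₂ (uj s<Δ)))))))
      where
      low : ∀ u → u ≢ w → S₀ u ≡ true → deg G u ≡ 1 ⊎ deg G u ≡ 2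
      -- A second vertex of medium degree would have a degree different from that of `w`, and the
      -- two degrees together would make `numMedium` at least 2.
      low u u≢w = ¬medium⇒low u λ med → <⇒≱ (s≤s (≤-reflexive (trans numMedium≡ numDeg≡1)))
        (≤-trans (+-mono-≤ (numDeg≥ u) (≤-reflexive (sym numDeg≡1))) (numDeg-two G Δ (deg G u) (deg G w) med (3≤i , i<Δ) (single u u≢w)))
      all-two : ∀ u → w ~ u → deg G u ≡ 2
      all-two u w~u with deg G u ≟ 2
      ... | yes d≡2 = d≡2
      ... | no d≢2 = contradiction (trans (sym (numEdges-single w 2 (<⇒≢ 3≤i ∘ sym) single)) (mₐ₂≡a m₂₂≡0 (deg G w) ((3≤i , i<Δ) , numMedium≡ , numDeg≡1)))
              (<⇒≢ (nbr-not-all (λ u → deg G u ≟ 2) w u w~u d≢2))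
      open StarValue internalLeaf m₂₂≡0 mΔΔ≡0 w (S₀-of refl i<Δ) low (λ u w~u _ → all-two u w~u)
      s≡ : s w ≡ deg G w
      s≡ = trans (sym s-count) (nbr-all (λ u → ¬? (deg G u ≟ Δ)) w (λ u w~u d≡Δ → 2≢Δ (trans (sym (all-two u w~u)) d≡Δ)))
      d≡ : deg G w ≡ 2 + (deg G w ∸ 2)
      d≡ = sym (m+[n∸m]≡n (≤-trans (≤ᵇ⇒≤ 2 3 _) 3≤i))
      s<Δ : s w < Δ
      s<Δ = subst (_< Δ) (sym s≡) i<Δ
  ... | no m₂₂≢0 = trans Ψ≡ (cong₂ (λ u c → u * K E + c) (proj₁ uj) (trans cost≡ (small edgeCount refl)))
    where
    open Family′ F hiding (tree)
    open Internal internalLeaf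
    low : ∀ v → S₀ v ≡ true → deg G v ≡ 1 ⊎ deg G v ≡ 2
    low v = ¬medium⇒low v λ med → m₂₂≢0 (Equivalence.from m₂₂≡0⇔medium (deg G v , med ,
      ≤-antisym (≤-trans medium≤1 (numDeg≥ v)) (numDeg≤numMedium Δ (deg G v) med) ,
      ≤-antisym (≤-trans (numDeg≤numMedium Δ (deg G v) med) medium≤1) (numDeg≥ v)))
    pair : ∀ u v → u ~ v → S₀ u ≡ true → S₀ v ≡ true → deg G u ≡ 2 × deg G v ≡ 2
    pair u v u~v S₀u S₀v = low-pair⇒22 u v u~v (low u S₀u) (low v S₀v)
    e≡m22 : edgeCount ≡ numEdges G 2 2
    e≡m22 = sym (m22-count pair)
    e≤2 : edgeCount ≤ 2
    e≤2 = ≤-trans (≤-reflexive e≡m22) m₂₂≤2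
    uj : U S₀ ≡ k × edgeCount ≡ j
    uj = quotient-unique Δ (U S₀) k edgeCount j (trans edge-balance (trans (cong (k * Δ + j +_) mΔΔ≡0) (+-identityʳ _)))
      (≤-trans (s≤s e≤2) 3≤Δ) j<Δ
    cost≡ : cost ≡ ℓ E * edgeCount
    cost≡ = trans (cong₂ _+_ (sum-zero pens) pairs) (trans (cong (E * E *_) (sym 2edges)) (eq E edgeCount))
      where
      eq : ∀ E e → E * E * (2 * e) ≡ 2 * (E * E) * e
      eq = solve-∀
      pens : ∀ v → size v * pen v ≡ 0
      pens v with S₀ v in p
      ... | false = refl
      ... | true  = trans (+-identityʳ (pen v)) (low-pen low v p)
      term : ∀ u v → a G u v * (size u * y u * (size v * y v)) ≡ E * E * (a G u v * (size u * size v))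
      term u v with adj u v in e | S₀ u in p | S₀ v in q
      ... | false | _     | _     = sym (*-zeroʳ (E * E))
      ... | true  | false | _     = sym (*-zeroʳ (E * E))
      ... | true  | true  | false = trans (cong (_+ 0) (*-zeroʳ (1 * y u))) (sym (*-zeroʳ (E * E)))
      ... | true  | true  | true  with pair u v (subst T (sym e) _) p q
      ...   | d₁ , d₂ = trans (cong₂ (λ x y → 1 * (1 * (2 + E ∸ x) * (1 * (2 + E ∸ y)))) d₁ d₂) (eq₂ E)
        where
        eq₂ : ∀ E → 1 * (1 * E * (1 * E)) ≡ E * E * 1
        eq₂ = solve-∀
      pairs : form G (λ v → size v * y v) (λ v → size v * y v) ≡ E * E * form G size size
      pairs = trans (form-flat G (λ v → size v * y v) (λ v → size v * y v)) (trans (sum-cong-≗ λ u → trans (sum-cong-≗ (term u)) (sum-*ˡ (E * E) (λ v → a G u v * (size u * size v))))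
        (trans (sum-*ˡ (E * E) (λ u → sum (λ v → a G u v * (size u * size v)))) (cong (E * E *_) (sym (form-flat G size size)))))
    small : ∀ e → edgeCount ≡ e → ℓ E * edgeCount ≡ c′ E j
    small 0 e≡ = contradiction (trans (sym e≡m22) e≡) m₂₂≢0
    small 1 e≡ = trans (trans (cong (ℓ E *_) e≡) (*-identityʳ (ℓ E))) (cong (c′ E) (trans (sym e≡) (proj₂ uj)))
    small 2 e≡ = trans (cong (ℓ E *_) e≡) (trans (sym (c′₂ E (≤-trans (s≤s z≤n) 4≤E))) (cong (c′ E) (trans (sym e≡) (proj₂ uj))))
    small (suc (suc (suc _))) e≡ = contradiction e≤2 (<⇒≱ (subst (3 ≤_) (sym e≡) (s≤s (s≤s (s≤s z≤n)))))

-- Trees grown leaf by leaf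

private
  linked-middle : ∀ {a r} {A : Set a} {R : A → A → Set r} xs {y z zs} → Linked R (xs ++ y ∷ z ∷ zs) → R y z
  linked-middle []           (R ∷ _) = R
  linked-middle (_ ∷ [])     (_ ∷ l) = linked-middle [] l
  linked-middle (_ ∷ x ∷ xs) (_ ∷ l) = linked-middle (x ∷ xs) l

  unique-apart : ∀ {a} {A : Set a} (xs : List A) {x y ys} → Unique (xs ++ x ∷ ys) → y ∈ ys → x ≢ y
  unique-apart []       (x∉ ∷ _)  y∈ = All.lookup x∉ y∈
  unique-apart (_ ∷ xs) (_ ∷ uxs) y∈ = unique-apart xs uxs y∈

  minimum : ∀ {n} (x : Fin n) xs → ∃[ m ] m ∈ x ∷ xs × All (m Fin.≤_) (x ∷ xs)
  minimum x []       = x , here refl , ≤-refl ∷ []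
  minimum x (y ∷ ys) with minimum y ys
  ... | m , m∈ , m≤ with ≤-total (Fin.toℕ x) (Fin.toℕ m)
  ...   | inj₁ x≤m = x , here refl , ≤-refl ∷ All.map (≤-trans x≤m) m≤
  ...   | inj₂ m≤x = m , there m∈ , m≤x ∷ m≤

module _ {n} (G : Graph n) where
  open Graph G

  private
    Two : Fin n → List (Fin n) → Set
    Two x xs = ∃[ p ] ∃[ q ] p ∈ xs × q ∈ xs × p ≢ q × x ~ p × x ~ q

    at-start : ∀ v s vs → 1 ≤ length vs → Unique (v ∷ s ∷ vs) → Linked _~_ (v ∷ (s ∷ vs) ++ [ v ]) → Two v (v ∷ s ∷ vs)
    at-start v s vs 1≤ u (v~s ∷ l) with initLast vs
    ... | ws ∷ʳ′ t = s , t , there (here refl) , there (there (∈-++⁺ʳ ws (here refl)))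
      , unique-apart [ v ] u (∈-++⁺ʳ ws (here refl)) , v~s
      , ~-sym G (linked-middle (s ∷ ws) (subst (Linked _~_) (cong (s ∷_) (List.++-assoc ws [ t ] [ v ])) l))

    inside : ∀ v as x bs → 2 ≤ length (as ++ x ∷ bs) → Unique (v ∷ as ++ x ∷ bs) →
      Linked _~_ (v ∷ (as ++ x ∷ bs) ++ [ v ]) → Two x (v ∷ as ++ x ∷ bs)
    inside v as x bs 2≤ u@(v∉ ∷ u′) l = pick (initLast as) bs refl refl
      where
      l′ : Linked _~_ (v ∷ as ++ x ∷ bs ++ [ v ])
      l′ = subst (λ zs → Linked _~_ (v ∷ zs)) (List.++-assoc as (x ∷ bs) [ v ]) l
      pick : ∀ {as′} → InitLast as′ → ∀ bs′ → as ≡ as′ → bs ≡ bs′ → Two x (v ∷ as ++ x ∷ bs)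
      pick []          []       refl refl = contradiction 2≤ λ { (s≤s ()) }
      pick []          (q ∷ _)  refl refl = v , q , here refl , there (there (here refl)) , All.lookup v∉ (there (here refl))
        , ~-sym G (linked-middle [] l′) , linked-middle [ v ] l′
      pick (ws ∷ʳ′ p) []       refl refl = p , v , there p∈ , here refl , (All.lookup v∉ p∈ ∘ sym)
        , ~-sym G (linked-middle (v ∷ ws) l″) , linked-middle (v ∷ ws ++ [ p ]) l‴
        where
        p∈ : p ∈ (ws ++ [ p ]) ++ [ x ]
        p∈ = ∈-++⁺ˡ (∈-++⁺ʳ ws (here refl))
        l″ : Linked _~_ (v ∷ ws ++ p ∷ x ∷ [ v ])
        l″ = subst (λ zs → Linked _~_ (v ∷ zs)) (List.++-assoc ws [ p ] (x ∷ [ v ])) l′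
        l‴ : Linked _~_ ((v ∷ ws ++ [ p ]) ++ x ∷ [ v ])
        l‴ = l′
      pick (ws ∷ʳ′ p) (q ∷ bs″) refl refl = p , q , there (∈-++⁺ˡ (∈-++⁺ʳ ws (here refl)))
        , there (∈-++⁺ʳ (ws ++ [ p ]) (there (here refl)))
        , unique-apart ws (subst Unique (List.++-assoc ws [ p ] (x ∷ q ∷ bs″)) u′) (there (here refl))
        , ~-sym G (linked-middle (v ∷ ws) (subst (λ zs → Linked _~_ (v ∷ zs)) (List.++-assoc ws [ p ] (x ∷ q ∷ bs″ ++ [ v ])) l′))
        , linked-middle (v ∷ ws ++ [ p ]) l′

    -- These are the predecessor and the successor in the cyclic order, distinct because a cycle has
    -- at least three vertices. For the starting vertex `v` they are the two ends of `vs`.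
    cycle-two : ∀ v vs → IsCycle G v vs → ∀ x → x ∈ v ∷ vs → Two x (v ∷ vs)
    cycle-two v (s ∷ vs) (s≤s 1≤ , u , l) x (here refl) = at-start v s vs 1≤ u l
    cycle-two v vs (2≤ , u , l) x (there x∈) with ∈-∃++ x∈
    ... | as , bs , refl = inside v as x bs 2≤ u l

  -- The least vertex of a cycle has two greater neighbours.
  Up : Set
  Up = ∀ v x y → v ~ x → v ~ y → v Fin.< x → v Fin.< y → x ≡ y

  up-acyclic : Up → Acyclic G
  up-acyclic up v vs c with minimum v vs
  ... | x , x∈ , x≤ with cycle-two v vs c x x∈
  ...   | p , q , p∈ , q∈ , p≢q , x~p , x~q = p≢q (up x p q x~p x~q (above p∈ x~p) (above q∈ x~q))
    where
    above : ∀ {p} → p ∈ v ∷ vs → x ~ p → x Fin.< p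
    above p∈ x~p = Fin.≤∧≢⇒< (All.lookup x≤ p∈) (~⇒≢ G x~p)

point : Graph 1
point = record { adj = λ _ _ → false ; adj-sym = λ _ _ → refl ; adj-irrefl = λ _ → refl }

module _ {n} (G : Graph n) (u : Fin n) where
  open Graph G
  private
    adj′ : Fin (suc n) → Fin (suc n) → Bool
    adj′ zero    zero    = false
    adj′ zero    (suc y) = does (u Fin.≟ y)
    adj′ (suc x) zero    = does (u Fin.≟ x)
    adj′ (suc x) (suc y) = adj x y

    adj′-sym : ∀ x y → adj′ x y ≡ adj′ y x
    adj′-sym zero    zero    = refl
    adj′-sym zero    (suc y) = refl
    adj′-sym (suc x) zero    = refl
    adj′-sym (suc x) (suc y) = adj-sym x y

    adj′-irrefl : ∀ x → adj′ x x ≡ false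
    adj′-irrefl zero    = refl
    adj′-irrefl (suc x) = adj-irrefl x

  -- The new vertex is zero.
  addLeaf : Graph (suc n)
  addLeaf = record { adj = adj′ ; adj-sym = adj′-sym ; adj-irrefl = adj′-irrefl }

  deg-new : deg addLeaf zero ≡ 1
  deg-new = trans (deg≡ addLeaf zero) (trans (sum-cong-≗ λ y → sym (*-identityʳ (δ u y))) (sum-δ (λ _ → 1) u))

  deg-old : ∀ v → deg addLeaf (suc v) ≡ δ u v + deg G v
  deg-old v = trans (deg≡ addLeaf (suc v)) (cong (δ u v +_) (sym (deg≡ G v)))

  new~ : ∀ {y} → T (does (u Fin.≟ y)) → u ≡ y
  new~ {y} t with u Fin.≟ y
  ... | yes e = e

  -- The new vertex is the least one, so it gives no old vertex a greater neighbour, and it has a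
  -- single neighbour itself.
  addLeaf-up : Up G → Up addLeaf
  addLeaf-up up zero    (suc x) (suc y) p q _        _        = cong suc (trans (sym (new~ p)) (new~ q))
  addLeaf-up up (suc v) (suc x) (suc y) p q (s≤s v<x) (s≤s v<y) = cong suc (up v x y p q v<x v<y)

  addLeaf-connected : Connected G → Connected addLeaf
  addLeaf-connected connected x y = to-u x ◅◅ reverse (λ {x} {y} → ~-sym addLeaf {x} {y}) (to-u y)
    where
    to-u : ∀ x → Star (Graph._~_ addLeaf) x (suc u)
    to-u zero    = subst T (sym (dec-true (u Fin.≟ u) refl)) _ ◅ ε
    to-u (suc x) = gmap suc id (connected x u)

data Ty : Set where
  leaf two big mid : Ty

module Growth (Δ μ : ℕ) (Ok : Ty → Ty → Set) where

  target : Ty → ℕ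
  target leaf = 1
  target two  = 2
  target big  = Δ
  target mid  = μ

  bigs? mids? : Ty → ℕ
  bigs? big = 1
  bigs? _   = 0
  mids? mid = 1
  mids? _   = 0

  -- A tree whose vertex v is to receive d v more neighbours; b and c count the vertices of type big and mid.
  record Partial (n b c : ℕ) : Set where
    field
      G         : Graph n
      connected : Connected G
      up        : Up G
      τ         : Fin n → Ty
      d         : Fin n → ℕ
      deg+d     : ∀ v → deg G v + d v ≡ target (τ v)
      ok        : ∀ u v → Graph._~_ G u v → Ok (τ u) (τ v) ⊎ Ok (τ v) (τ u)
      bigs≡     : sum (bigs? ∘ τ) ≡ b
      mids≡     : sum (mids? ∘ τ) ≡ c

  start : Partial 1 1 0
  start = record
    { G = point ; connected = λ { zero zero → ε } ; up = λ _ _ _ () ; τ = λ _ → big ; d = λ _ → Δ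
    ; deg+d = λ { zero → refl } ; ok = λ _ _ () ; bigs≡ = refl ; mids≡ = refl }

  module _ {n b c} (P : Partial n b c) (u : Fin n) (t : Ty) where
    open Partial P

    grow : 0 < d u → 1 ≤ target t → Ok t (τ u) ⊎ Ok (τ u) t → Partial (suc n) (bigs? t + b) (mids? t + c)
    grow 0<d 1≤t Okt = record
      { G = addLeaf G u ; connected = addLeaf-connected G u connected ; up = addLeaf-up G u up
      ; τ = τ′ ; d = d′ ; deg+d = deg+d′ ; ok = ok′ ; bigs≡ = cong (bigs? t +_) bigs≡ ; mids≡ = cong (mids? t +_) mids≡ }
      where
      τ′ : Fin (suc n) → Ty
      τ′ zero    = t
      τ′ (suc v) = τ v
      d′ : Fin (suc n) → ℕ
      d′ zero    = target t ∸ 1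
      d′ (suc v) = d v ∸ δ u v
      deg+d′ : ∀ v → deg (addLeaf G u) v + d′ v ≡ target (τ′ v)
      deg+d′ zero    = trans (cong (_+ (target t ∸ 1)) (deg-new G u)) (m+[n∸m]≡n 1≤t)
      deg+d′ (suc v) = trans (cong (_+ (d v ∸ δ u v)) (deg-old G u v)) (trans (eq (δ u v) (deg G v) (d v ∸ δ u v))
        (trans (cong (deg G v +_) (m+[n∸m]≡n (δ≤ v))) (deg+d v)))
        where
        eq : ∀ a b c → a + b + c ≡ b + (a + c)
        eq = solve-∀
        δ≤ : ∀ v → δ u v ≤ d v
        δ≤ v with u Fin.≟ v
        ... | yes refl = 0<d
        ... | no _     = z≤n
      ok′ : ∀ x y → Graph._~_ (addLeaf G u) x y → Ok (τ′ x) (τ′ y) ⊎ Ok (τ′ y) (τ′ x)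
      ok′ zero    (suc y) p = subst (λ y → Ok t (τ y) ⊎ Ok (τ y) t) (new~ G u p) Okt
      ok′ (suc x) zero    p = Sum.swap (subst (λ y → Ok t (τ y) ⊎ Ok (τ y) t) (new~ G u p) Okt)
      ok′ (suc x) (suc y) p = ok x y p

  -- The vertices u and w, of types t and t′, are to receive r and r′ more neighbours.
  record State (n b c : ℕ) (t : Ty) (r : ℕ) (t′ : Ty) (r′ : ℕ) : Set where
    constructor state
    field
      partial : Partial n b c
      u w     : Fin n
      τu      : Partial.τ partial u ≡ t
      τw      : Partial.τ partial w ≡ t′
      d≡      : ∀ v → Partial.d partial v ≡ δ u v * r + δ w v * r′

  swap : ∀ {n b c t r t′ r′} → State n b c t r t′ r′ → State n b c t′ r′ t r
  swap {r = r} {r′ = r′} (state P u w τu τw d≡) = state P w u τw τu (λ v → trans (d≡ v) (+-comm (δ u v * r) (δ w v * r′)))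

  private
    available : ∀ {n b c t r t′ r′} (S : State n b c t (suc r) t′ r′) → 0 < Partial.d (State.partial S) (State.u S)
    available {r = r} {r′ = r′} (state P u w τu τw d≡) = subst (0 <_) (sym (trans (d≡ u) (cong (λ k → k * suc r + δ w u * r′) (δ-refl u)))) (s≤s z≤n)

    spend : ∀ x y r → x ≤ 1 → x * suc r + y ∸ x ≡ x * r + y
    spend 0 y r _ = refl
    spend 1 y r _ = refl
    spend (suc (suc _)) y r (s≤s ())

    d-old : ∀ {n b c t r t′ r′} (S : State n b c t (suc r) t′ r′) → let open State S in
      ∀ v → Partial.d partial v ∸ δ u v ≡ δ u v * r + δ w v * r′
    d-old {r = r} {r′ = r′} (state P u w τu τw d≡) v = trans (cong (_∸ δ u v) (d≡ v)) (spend (δ u v) (δ w v * r′) r (𝟙≤1 _))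

  -- The new vertex takes the place of u.
  move : ∀ {n b c t t′ r′} t″ → 1 ≤ target t″ → Ok t″ t ⊎ Ok t t″ → State n b c t 1 t′ r′ →
    State (suc n) (bigs? t″ + b) (mids? t″ + c) t″ (target t″ ∸ 1) t′ r′
  move {r′ = r′} t″ 1≤ Okt S@(state P u w refl τw d≡) = state (grow P u t″ (available S) 1≤ Okt) zero (suc w) refl τw
    λ { zero → sym (trans (+-identityʳ _) (+-identityʳ _)) ; (suc v) → trans (d-old S v) (cong (_+ δ w v * r′) (*-zeroʳ (δ u v))) }

  -- The new vertex takes the place of w, which must be complete, and u is kept.
  branch : ∀ {n b c t r t′} t″ → 1 ≤ target t″ → Ok t″ t ⊎ Ok t t″ → State n b c t (suc r) t′ 0 →
    State (suc n) (bigs? t″ + b) (mids? t″ + c) t″ (target t″ ∸ 1) t r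
  branch {r = r} t″ 1≤ Okt S@(state P u w refl τw d≡) = state (grow P u t″ (available S) 1≤ Okt) zero (suc u) refl refl
    λ { zero → sym (trans (+-identityʳ _) (+-identityʳ _)) ; (suc v) → trans (d-old S v) (trans (cong (δ u v * r +_) (*-zeroʳ (δ w v))) (+-identityʳ _)) }

  leaves : ∀ {n b c r t′ r′} m → Ok leaf big → State n b c big (m + r) t′ r′ → State (m + n) b c big r t′ r′
  leaves zero    Okl S = S
  leaves {n} {b} {c} {r} {t′} {r′} (suc m) Okl S@(state P u w τu τw d≡) = subst (λ n → State n b c big r t′ r′) (+-suc m n)
    (leaves m Okl (state (grow P u leaf (available S) ≤-refl (inj₁ (subst (Ok leaf) (sym τu) Okl))) (suc u) (suc w) τu τw
      λ { zero → refl ; (suc v) → d-old S v }))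

  Complete : ℕ → ℕ → ℕ → Set
  Complete n b c = ∃[ P ] ∀ v → Partial.d {n} {b} {c} P v ≡ 0

  complete : ∀ {n b c t t′} → State n b c t 0 t′ 0 → Complete n b c
  complete (state P u w _ _ d≡) = P , λ v → trans (d≡ v) (cong₂ _+_ (*-zeroʳ (δ u v)) (*-zeroʳ (δ w v)))

-- A tree of vertices of type big, possibly joined through paths, in which one big vertex lacks a neighbour.
module Chains (f μ : ℕ) (Ok : Ty → Ty → Set) (leaf-big : Ok leaf big) (two-big : Ok two big) where
  open Growth (2 + f) μ Ok public

  -- The second marked vertex lacks nothing and is a placeholder; at the start it coincides with the
  -- first.
  Chain : ℕ → ℕ → ℕ → Set
  Chain n b c = State n b c big 1 big 0

  begin′ : Chain (2 + f) 1 0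
  begin′ = subst (λ n → Chain n 1 0) (+-comm (suc f) 1) (leaves (suc f) leaf-big
    (subst (λ r → State 1 1 0 big r big 0) (+-comm 1 (suc f))
      (state start zero zero refl refl λ { zero → sym (trans (+-identityʳ _) (+-identityʳ _)) })))

  full : ∀ {n b c t r} → State n b c big (suc f) t r → State (f + n) b c big 1 t r
  full {n} {b} {c} {t} {r} S = leaves f leaf-big (subst (λ k → State n b c big k t r) (+-comm 1 f) S)

  -- A new vertex of type `big` receives `f` leaves and lacks one more neighbour. Reached through
  -- one vertex of type `two`, it brings `2 + f`, that is `Δ`, vertices along; reached directly, one
  -- less; through two such vertices, one more. This adjusts the residue of the number of vertices.
  big-step : Ok big big → ∀ {n b c} → Chain n b c → Chain (suc f + n) (1 + b) c
  big-step Okb {n} {b} {c} S = subst (λ n → Chain n (1 + b) c) (+-suc f n) (full (move big (s≤s z≤n) (inj₁ Okb) S))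

  two-step : ∀ {n b c} → Chain n b c → Chain (2 + f + n) (1 + b) c
  two-step {n} {b} {c} S = subst (λ n → Chain n (1 + b) c) (trans (+-suc f (suc n)) (cong suc (+-suc f n)))
    (full (move big (s≤s z≤n) (inj₂ two-big) (move two (s≤s z≤n) (inj₁ two-big) S)))

  two-two-step : Ok two two → ∀ {n b c} → Chain n b c → Chain (3 + f + n) (1 + b) c
  two-two-step Okt {n} {b} {c} S = subst (λ n → Chain n (1 + b) c)
    (trans (+-suc f (2 + n)) (cong suc (trans (+-suc f (suc n)) (cong suc (+-suc f n)))))
    (full (move big (s≤s z≤n) (inj₂ two-big) (move two (s≤s z≤n) (inj₁ Okt) (move two (s≤s z≤n) (inj₁ two-big) S))))

  times : ∀ p g {c} → (∀ {n b} → Chain n b c → Chain (g + n) (1 + b) c) → ∀ {n b} → Chain n b c → Chain (p * g + n) (p + b) c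
  times zero    g step S = S
  times (suc p) g {c} step {n} {b} S = subst (λ n → Chain n (suc p + b) c) (sym (+-assoc g (p * g) n)) (step (times p g step S))

  finish : ∀ {n b c} → Chain n b c → Complete (1 + n) b c
  finish S = complete (leaves 1 leaf-big S)

  -- One round uses up one place at the vertex of type `mid`: it attaches a vertex of type `two` and
  -- behind it one of type `big` with `1 + f` leaves, `3 + f` vertices in all.
  rounds : Ok two mid → ∀ r {n b c} → State n b c mid r big 0 → Complete (r * (3 + f) + n) (r + b) c
  rounds Okm zero    S = complete S
  rounds Okm (suc r) {n} {b} {c} S = subst₂ (λ n b → Complete n b c) (eq r f n) (+-suc r b)
    (rounds Okm r (swap (leaves (suc f) leaf-big (subst (λ k → State (2 + n) (1 + b) c big k mid r) (sym (+-identityʳ (suc f)))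
      (move big (s≤s z≤n) (inj₂ two-big) (branch two (s≤s z≤n) (inj₁ Okm) S))))))
    where
    eq : ∀ r f n → r * (3 + f) + (suc f + (2 + n)) ≡ suc r * (3 + f) + n
    eq = solve-∀

-- The kinds of edges of the trees to be built: for 𝒯″, for 𝒯′ with j ≤ 2, for 𝒯′ with j ≥ 3, and for 𝒯‴.
Ok″ Ok₂₂ Ok′ Ok‴ : Ty → Ty → Set
Ok″ _ t = t ≡ big

Ok₂₂ leaf big = ⊤
Ok₂₂ two  big = ⊤
Ok₂₂ two  two = ⊤
Ok₂₂ _    _   = ⊥

Ok′ leaf big = ⊤
Ok′ two  big = ⊤
Ok′ two  mid = ⊤
Ok′ _    _   = ⊥

Ok‴ leaf big = ⊤
Ok‴ two  big = ⊤
Ok‴ two  mid = ⊤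
Ok‴ mid  big = ⊤
Ok‴ _    _   = ⊥

two-terms : ∀ {n} (f : Fin n → ℕ) u w → u ≢ w → f u + f w ≤ sum f
two-terms f u w u≢w = ≤-trans (≤-reflexive (sym (cong₂ _+_ (sum-δ f u) (sum-δ f w))))
  (≤-trans (≤-reflexive (sym (∑-distrib-+ (λ v → δ u v * f v) (λ v → δ w v * f v)))) (sum-mono term))
  where
  term : ∀ v → δ u v * f v + δ w v * f v ≤ f v
  term v with u Fin.≟ v | w Fin.≟ v
  ... | yes refl | yes refl = contradiction refl u≢w
  ... | yes refl | no _     = ≤-reflexive (trans (+-identityʳ _) (*-identityˡ (f v)))
  ... | no _     | yes refl = ≤-reflexive (*-identityˡ (f v))
  ... | no _     | no _     = z≤n

module Typed {n} (E k j : ℕ) (4≤E : 4 ≤ E) (n≡ : n ≡ k * (2 + E) + 1 + j) (1≤k : 1 ≤ k) (j≤E+1 : j ≤ suc E)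
  (μ : ℕ) (μ<Δ : μ < 2 + E) (Ok : Ty → Ty → Set) {b c : ℕ} (1≤b : 1 ≤ b)
  (P : Growth.Partial (2 + E) μ Ok n b c) (done : ∀ v → Growth.Partial.d P v ≡ 0) where
  open Growth (2 + E) μ Ok using (target; bigs?; mids?)
  open Growth.Partial P using (G; connected; up; τ; deg+d; ok; bigs≡; mids≡) public

  3≤Δ : 3 ≤ 2 + E
  3≤Δ = ≤-trans (≤ᵇ⇒≤ 3 6 _) (s≤s (s≤s 4≤E))

  deg-τ : ∀ v → deg G v ≡ target (τ v)
  deg-τ v = trans (sym (+-identityʳ _)) (trans (cong (deg G v +_) (sym (done v))) (deg+d v))

  target≤ : ∀ t → target t ≤ 2 + E
  target≤ leaf = s≤s z≤n
  target≤ two  = s≤s (s≤s z≤n)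
  target≤ big  = ≤-refl
  target≤ mid  = <⇒≤ μ<Δ

  target< : ∀ t → t ≢ big → target t < 2 + E
  target< leaf _ = s≤s (s≤s z≤n)
  target< two  _ = 3≤Δ
  target< big  t≢big = contradiction refl t≢big
  target< mid  _ = μ<Δ

  tree : TreeOfMaxDegree (2 + E) G
  tree = (connected , up-acyclic G up) , ≤-antisym
    (Extrema.max≤v⁺ z≤n (All.tabulate λ d∈ → bound (∈-map⁻ (deg G) d∈)))
    (Extrema.v≤max⁺ 0 (map (deg G) (allFin n)) (inj₂ (lose (∈-map⁺ (deg G) (∈-allFin (proj₁ a-big))) (≤-reflexive (sym (proj₂ a-big))))))
    where
    bound : ∀ {d} → ∃[ v ] v ∈ allFin n × d ≡ deg G v → d ≤ 2 + E
    bound (v , _ , refl) = ≤-trans (≤-reflexive (deg-τ v)) (target≤ (τ v))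
    is-big : ∀ t → 0 < bigs? t → t ≡ big
    is-big big _ = refl
    a-big : ∃[ v ] deg G v ≡ 2 + E
    a-big with sum-positive (bigs? ∘ τ) (subst (0 <_) (sym bigs≡) 1≤b)
    ... | v , pos = v , trans (deg-τ v) (cong target (is-big (τ v) pos))

  open Counting G public
  open Penalty G E public
  open MaxDegreeTree G E k j 4≤E n≡ 1≤k tree public
  open Trichotomy G E k j 4≤E n≡ 1≤k j≤E+1 tree hiding (acyclic) public
  open Membership G E k j 4≤E n≡ 1≤k j≤E+1 tree public
  open Conversion G E k j 4≤E n≡ 1≤k j≤E+1 tree public
  open Graph G using (_~_) public

  S₀⇒≢big : ∀ {v} → S₀ v ≡ true → τ v ≢ big
  S₀⇒≢big {v} S₀v τ≡ = S₀-elim S₀v (trans (deg-τ v) (cong target τ≡))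

  U≡b : U S₀ ≡ b
  U≡b = trans (sum-cong-≗ λ v → term v (τ v) refl) bigs≡
    where
    small : ∀ v t → τ v ≡ t → t ≢ big → co S₀ v ≡ 0
    small v t τ≡ t≢big = cong (λ b → 𝟙 (not b)) (S₀-intro (λ d≡ → <⇒≢ (target< t t≢big) (trans (cong target (sym τ≡)) (trans (sym (deg-τ v)) d≡))))
    term : ∀ v t → τ v ≡ t → co S₀ v ≡ bigs? (τ v)
    term v leaf e = trans (small v leaf e λ ()) (cong bigs? (sym e))
    term v two  e = trans (small v two e λ ()) (cong bigs? (sym e))
    term v mid  e = trans (small v mid e λ ()) (cong bigs? (sym e))
    term v big  e = trans (cong (λ b → 𝟙 (not (not b))) (dec-true (deg G v ≟ Δ) (trans (deg-τ v) (cong target e)))) (cong bigs? (sym e))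

  low-type : ∀ v → τ v ≢ mid → S₀ v ≡ true → deg G v ≡ 1 ⊎ deg G v ≡ 2
  low-type v τ≢mid S₀v = cases (τ v) refl
    where
    cases : ∀ t → τ v ≡ t → deg G v ≡ 1 ⊎ deg G v ≡ 2
    cases leaf e = inj₁ (trans (deg-τ v) (cong target e))
    cases two  e = inj₂ (trans (deg-τ v) (cong target e))
    cases big  e = contradiction e (S₀⇒≢big S₀v)
    cases mid  e = contradiction e τ≢mid

  no-mid : c ≡ 0 → ∀ v → τ v ≢ mid
  no-mid c≡0 v e = contradiction (trans (cong mids? (sym e)) (sum≡0⇒ (mids? ∘ τ) (trans mids≡ c≡0) v)) λ ()

  pair-ok : ∀ {u v t t′} → u ~ v → τ u ≡ t → τ v ≡ t′ → Ok t t′ ⊎ Ok t′ t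
  pair-ok {u} {v} u~v refl refl = ok u v u~v

  mΔΔ-none : ¬ Ok big big → numEdges G Δ Δ ≡ 0
  mΔΔ-none ¬ok = numEdges-zero Δ Δ λ u v u~v p q → Sum.[ ¬ok , ¬ok ]′ (pair-ok u~v (big-type u p) (big-type v q))
    where
    big-type : ∀ v → deg G v ≡ Δ → τ v ≡ big
    big-type v d≡ = cases (τ v) refl
      where
      cases : ∀ t → τ v ≡ t → t ≡ big
      cases big  _ = refl
      cases leaf e = contradiction (trans (cong target (sym e)) (trans (sym (deg-τ v)) d≡)) (<⇒≢ (target< leaf λ ()))
      cases two  e = contradiction (trans (cong target (sym e)) (trans (sym (deg-τ v)) d≡)) (<⇒≢ (target< two λ ()))
      cases mid  e = contradiction (trans (cong target (sym e)) (trans (sym (deg-τ v)) d≡)) (<⇒≢ (target< mid λ ()))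

  count-edges′ : U S₀ ≡ k → numEdges G Δ Δ ≡ 0 → edgeCount ≡ j
  count-edges′ u≡ m≡ = +-cancelʳ-≡ (k * Δ) _ _ (trans (cong (λ u → edgeCount + u * Δ) (sym u≡)) (trans edge-balance
    (trans (cong (k * Δ + j +_) m≡) (trans (+-identityʳ _) (+-comm (k * Δ) j)))))

module _ (E k j : ℕ) (4≤E : 4 ≤ E) (1≤k : 1 ≤ k) (j≤E+1 : j ≤ suc E) where
  family″ : ∀ {n b} → n ≡ k * (2 + E) + 1 + j → b ≡ bigs k j → Growth.Complete (2 + E) 3 Ok″ n b 0 → ∃[ G ] Family″ {n} (2 + E) G
  family″ n≡ b≡ (P , done) = G , to″ (trans U≡b b≡) (no-pair-cost no-pair pens)
    where
    1≤b : ∀ j → 1 ≤ bigs k j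
    1≤b zero    = 1≤k
    1≤b (suc _) = s≤s z≤n
    open Typed E k j 4≤E n≡ 1≤k j≤E+1 3 (s≤s (s≤s (≤-trans (≤ᵇ⇒≤ 2 4 _) 4≤E))) Ok″ (subst (1 ≤_) (sym b≡) (1≤b j)) P done
    no-pair : ∀ u v → u ~ v → S₀ u ≡ true → S₀ v ≡ true → ⊥
    no-pair u v u~v S₀u S₀v = Sum.[ S₀⇒≢big S₀v , S₀⇒≢big S₀u ]′ (ok u v u~v)
    pens : ∀ v → S₀ v ≡ true → pen v ≡ 0
    pens v S₀v = pen-low v (Sum.[ (λ e → ≤-trans (≤-reflexive e) (s≤s z≤n)) , ≤-reflexive ]′ (low-type v (no-mid refl v) S₀v))

  family′-22 : ∀ {n} → n ≡ k * (2 + E) + 1 + j → 1 ≤ j → j ≤ 2 → Growth.Complete (2 + E) 3 Ok₂₂ n k 0 → ∃[ G ] Family′ {n} (2 + E) G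
  family′-22 n≡ 1≤j j≤2 (P , done) = G , record
    { tree         = tree
    ; internalLeaf = NoLeaf.internal no-leaf
    ; m₂₂≤2        = ≤-trans (≤-reflexive m22) j≤2
    ; mΔΔ≡0        = mΔΔ
    ; medium≤1     = ≤-trans (≤-reflexive no-medium) z≤n
    ; m₂₂≡0⇔medium = mk⇔ (λ e → contradiction (trans (sym m22) e) (λ j≡0 → <⇒≢ 1≤j (sym j≡0)))
                       (λ (_ , _ , p , q) → contradiction (trans (sym (trans p q)) no-medium) λ ())
    ; mₐ₂≡a        = λ e → contradiction (trans (sym m22) e) (λ j≡0 → <⇒≢ 1≤j (sym j≡0)) }
    where
    open Typed E k j 4≤E n≡ 1≤k j≤E+1 3 (s≤s (s≤s (≤-trans (≤ᵇ⇒≤ 2 4 _) 4≤E))) Ok₂₂ 1≤k P done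
    mΔΔ : numEdges G Δ Δ ≡ 0
    mΔΔ = mΔΔ-none λ ()
    both-two : ∀ u v → u ~ v → ∀ t t′ → τ u ≡ t → τ v ≡ t′ → t ≢ big → t′ ≢ big → t ≡ two × t′ ≡ two
    both-two u v u~v two  two  p q _ _ = refl , refl
    both-two u v u~v big  _    p q n _ = contradiction refl n
    both-two u v u~v _    big  p q _ n = contradiction refl n
    both-two u v u~v leaf leaf p q _ _ = ⊥-elim (Sum.[ id , id ]′ (pair-ok u~v p q))
    both-two u v u~v leaf two  p q _ _ = ⊥-elim (Sum.[ id , id ]′ (pair-ok u~v p q))
    both-two u v u~v leaf mid  p q _ _ = ⊥-elim (Sum.[ id , id ]′ (pair-ok u~v p q))
    both-two u v u~v two  leaf p q _ _ = ⊥-elim (Sum.[ id , id ]′ (pair-ok u~v p q))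
    both-two u v u~v two  mid  p q _ _ = ⊥-elim (Sum.[ id , id ]′ (pair-ok u~v p q))
    both-two u v u~v mid  leaf p q _ _ = ⊥-elim (Sum.[ id , id ]′ (pair-ok u~v p q))
    both-two u v u~v mid  two  p q _ _ = ⊥-elim (Sum.[ id , id ]′ (pair-ok u~v p q))
    both-two u v u~v mid  mid  p q _ _ = ⊥-elim (Sum.[ id , id ]′ (pair-ok u~v p q))
    pair : ∀ u v → u ~ v → S₀ u ≡ true → S₀ v ≡ true → deg G u ≡ 2 × deg G v ≡ 2
    pair u v u~v S₀u S₀v with both-two u v u~v (τ u) (τ v) refl refl (S₀⇒≢big S₀u) (S₀⇒≢big S₀v)
    ... | p , q = trans (deg-τ u) (cong (Growth.target (2 + E) 3 Ok₂₂) p) , trans (deg-τ v) (cong (Growth.target (2 + E) 3 Ok₂₂) q)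
    no-leaf : ∀ u v → u ~ v → S₀ u ≡ true → S₀ v ≡ true → deg G u ≢ 1
    no-leaf u v u~v S₀u S₀v d≡1 = contradiction (trans (sym (proj₁ (pair u v u~v S₀u S₀v))) d≡1) λ ()
    m22 : numEdges G 2 2 ≡ j
    m22 = trans (m22-count pair) (count-edges′ U≡b mΔΔ)
    no-medium : numMedium Δ G ≡ 0
    no-medium = numMedium-zero Δ λ v (3≤d , d<Δ) → Sum.[ (λ e → <⇒≱ (≤-trans (s≤s (≤-reflexive e)) (≤ᵇ⇒≤ 2 3 _)) 3≤d) , (λ e → <⇒≱ (s≤s (≤-reflexive e)) 3≤d) ]′
      (low-type v (no-mid refl v) (S₀-intro (<⇒≢ d<Δ)))

  module Mid {n} (n≡ : n ≡ k * (2 + E) + 1 + j) (μ : ℕ) (3≤μ : 3 ≤ μ) (μ<Δ : μ < 2 + E) (Ok : Ty → Ty → Set)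
    (no-bb : ¬ Ok big big)
    (mid-two : ∀ t t′ → Ok t t′ → t ≢ big → t′ ≢ big → t ≡ two × t′ ≡ mid)
    (P : Growth.Partial (2 + E) μ Ok n k 1) (done : ∀ v → Growth.Partial.d P v ≡ 0) where
    open Typed E k j 4≤E n≡ 1≤k j≤E+1 μ μ<Δ Ok 1≤k P done public
    open Growth (2 + E) μ Ok using (target; mids?)

    private
      is-mid : ∀ t → 0 < mids? t → t ≡ mid
      is-mid mid _ = refl

      a-mid : ∃[ w ] 0 < mids? (τ w)
      a-mid = sum-positive (mids? ∘ τ) (subst (0 <_) (sym mids≡) (s≤s z≤n))

    w : Fin n
    w = proj₁ a-mid

    τw : τ w ≡ mid
    τw = is-mid (τ w) (proj₂ a-mid)

    deg-w : deg G w ≡ μ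
    deg-w = trans (deg-τ w) (cong target τw)

    only : ∀ u → u ≢ w → τ u ≢ mid
    only u u≢w τu = <⇒≱ (s≤s (≤-reflexive mids≡)) (≤-trans (≤-reflexive (sym (cong₂ _+_ (cong mids? τu) (cong mids? τw)))) (two-terms (mids? ∘ τ) u w u≢w))

    at-w : ∀ {u} → τ u ≡ mid → u ≡ w
    at-w {u} τu with u Fin.≟ w
    ... | yes u≡w = u≡w
    ... | no u≢w  = contradiction τu (only u u≢w)

    mid-pair : ∀ u v → u ~ v → S₀ u ≡ true → S₀ v ≡ true → (τ u ≡ two × τ v ≡ mid) ⊎ (τ v ≡ two × τ u ≡ mid)
    mid-pair u v u~v S₀u S₀v = Sum.map (λ p → mid-two (τ u) (τ v) p (S₀⇒≢big S₀u) (S₀⇒≢big S₀v))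
      (λ p → mid-two (τ v) (τ u) p (S₀⇒≢big S₀v) (S₀⇒≢big S₀u)) (ok u v u~v)

    S₀w : S₀ w ≡ true
    S₀w = S₀-intro (λ e → <⇒≢ μ<Δ (trans (sym deg-w) e))

    touch : ∀ u v → u ~ v → S₀ u ≡ true → S₀ v ≡ true → u ≡ w ⊎ v ≡ w
    touch u v u~v S₀u S₀v = Sum.[ inj₂ ∘ at-w ∘ proj₂ , inj₁ ∘ at-w ∘ proj₂ ]′ (mid-pair u v u~v S₀u S₀v)

    no-leaf : ∀ u v → u ~ v → S₀ u ≡ true → S₀ v ≡ true → deg G u ≢ 1
    no-leaf u v u~v S₀u S₀v d≡1 = Sum.[ (λ (p , _) → contradiction (trans (sym d≡1) (trans (deg-τ u) (cong target p))) λ ())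
      , (λ (_ , p) → <⇒≢ (≤-trans (≤ᵇ⇒≤ 2 3 _) 3≤μ) (trans (sym d≡1) (trans (deg-τ u) (cong target p)))) ]′ (mid-pair u v u~v S₀u S₀v)

    e≡ : edgeCount ≡ j
    e≡ = count-edges′ U≡b (mΔΔ-none no-bb)

    open StarFamily U≡b w S₀w (subst (3 ≤_) (sym deg-w) 3≤μ) (λ u u≢w → low-type u (only u u≢w)) no-leaf touch
      e≡ (trans (sym (StarAt.star-edges w S₀w touch)) e≡) public

  family′-mid : ∀ {n} → n ≡ k * (2 + E) + 1 + j → 3 ≤ j → Growth.Complete (2 + E) j Ok′ n k 1 → ∃[ G ] Family′ {n} (2 + E) G
  family′-mid n≡ 3≤j (P , done) = G , star′ deg-w
    where
    mid-two : ∀ t t′ → Ok′ t t′ → t ≢ big → t′ ≢ big → t ≡ two × t′ ≡ mid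
    mid-two leaf big _ _ n = contradiction refl n
    mid-two two  big _ _ n = contradiction refl n
    mid-two two  mid _ _ _ = refl , refl
    open Mid n≡ j 3≤j (s≤s j≤E+1) Ok′ (λ ()) mid-two P done

  family‴ : ∀ {n} → n ≡ k * (2 + E) + 1 + j → 2 ≤ j → j ≤ E → Growth.Complete (2 + E) (1 + j) Ok‴ n k 1 → ∃[ G ] Family‴ {n} (2 + E) j G
  family‴ n≡ 2≤j j≤E (P , done) = G , star‴ deg-w
    where
    mid-two : ∀ t t′ → Ok‴ t t′ → t ≢ big → t′ ≢ big → t ≡ two × t′ ≡ mid
    mid-two leaf big _ _ n = contradiction refl n
    mid-two two  big _ _ n = contradiction refl n
    mid-two mid  big _ _ n = contradiction refl n
    mid-two two  mid _ _ _ = refl , refl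
    open Mid n≡ (1 + j) (s≤s 2≤j) (s≤s (s≤s j≤E)) Ok‴ (λ ()) mid-two P done

exists″ : ∀ E k j → 4 ≤ E → suc E ≤ k → j ≤ suc E → ∃[ G ] Family″ {k * (2 + E) + 1 + j} (2 + E) G
exists″ E (suc q) zero 4≤E E<k j≤ = family″ E (suc q) 0 4≤E (s≤s z≤n) z≤n refl refl
  (subst₂ (λ n b → Complete n b 0) (size q E) (+-comm q 1) (finish (times q (2 + E) two-step begin′)))
  where
  open Chains E 3 Ok″ refl refl
  size : ∀ q E → 1 + (q * (2 + E) + (2 + E)) ≡ suc q * (2 + E) + 1 + 0
  size = solve-∀
exists″ E k (suc i) 4≤E E<k j≤ = family″ E k (suc i) 4≤E (≤-trans (s≤s z≤n) E<k) j≤ refl refl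
  (subst₂ (λ n b → Complete n b 0) (trans (size E p q i p≡) (cong (λ k → k * (2 + E) + 1 + suc i) k≡)) (trans (count q p) (cong suc k≡))
    (finish (times q (2 + E) two-step (times p (suc E) (big-step refl) begin′))))
  where
  open Chains E 3 Ok″ refl refl
  -- If the `suc k` vertices of degree `Δ` were joined only through vertices of degree 2, there
  -- would be `Δ - j` vertices too many. Each direct edge between two of them saves one vertex.
  -- There are `k` links in the chain, so `p ≤ k` is needed, and `suc E ≤ k` gives it.
  p = suc E ∸ i
  q = k ∸ p
  p≡ : p + i ≡ suc E
  p≡ = m∸n+n≡m (≤-trans (n≤1+n i) j≤)
  k≡ : p + q ≡ k
  k≡ = m+[n∸m]≡n (≤-trans (m∸n≤m (suc E) i) E<k)
  count : ∀ q p → q + (p + 1) ≡ suc (p + q)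
  count = solve-∀
  size : ∀ E p q i → p + i ≡ suc E → 1 + (q * (2 + E) + (p * (suc E) + (2 + E))) ≡ (p + q) * (2 + E) + 1 + suc i
  size E p q i p≡ = +-cancelʳ-≡ p _ _ (trans (eq₁ E p q) (trans (cong (λ k → (p + q) * (2 + E) + 1 + suc k) (sym p≡)) (eq₂ ((p + q) * (2 + E)) p i)))
    where
    eq₁ : ∀ E p q → 1 + (q * (2 + E) + (p * (suc E) + (2 + E))) + p ≡ (p + q) * (2 + E) + 1 + suc (suc E)
    eq₁ = solve-∀
    eq₂ : ∀ a p i → a + 1 + suc (p + i) ≡ a + 1 + suc i + p
    eq₂ = solve-∀

-- For `j ≤ 2`, exactly `j` links of the chain consist of two vertices of degree 2. From `j ≡ 3` on,
-- a medium vertex of degree `j` is joined through vertices of degree 2 to `j` vertices of degree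
-- `Δ`: one at the end of the chain, the others by `rounds`.
exists′ : ∀ E k j → 4 ≤ E → suc E ≤ k → 1 ≤ j → j ≤ suc E → ∃[ G ] Family′ {k * (2 + E) + 1 + j} (2 + E) G
exists′ E k 1 4≤E E<k 1≤j j≤ = family′-22 E k 1 4≤E (≤-trans (s≤s z≤n) E<k) j≤ refl ≤-refl (s≤s z≤n)
  (subst₂ (λ n b → Complete n b 0) (trans (size E q) (cong (λ k → k * (2 + E) + 1 + 1) k≡)) (trans (+-comm q 2) k≡)
    (finish (times q (2 + E) two-step (two-two-step tt begin′))))
  where
  open Chains E 3 Ok₂₂ tt tt
  q = k ∸ 2
  k≡ : 2 + q ≡ k
  k≡ = m+[n∸m]≡n (≤-trans (≤-trans (≤ᵇ⇒≤ 2 5 _) (s≤s 4≤E)) E<k)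
  size : ∀ E q → 1 + (q * (2 + E) + (3 + E + (2 + E))) ≡ (2 + q) * (2 + E) + 1 + 1
  size = solve-∀
exists′ E k 2 4≤E E<k 1≤j j≤ = family′-22 E k 2 4≤E (≤-trans (s≤s z≤n) E<k) j≤ refl (s≤s z≤n) ≤-refl
  (subst₂ (λ n b → Complete n b 0) (trans (size E q) (cong (λ k → k * (2 + E) + 1 + 2) k≡)) (trans (+-comm q 3) k≡)
    (finish (times q (2 + E) two-step (two-two-step tt (two-two-step tt begin′)))))
  where
  open Chains E 3 Ok₂₂ tt tt
  q = k ∸ 3
  k≡ : 3 + q ≡ k
  k≡ = m+[n∸m]≡n (≤-trans (≤-trans (≤ᵇ⇒≤ 3 5 _) (s≤s 4≤E)) E<k)
  size : ∀ E q → 1 + (q * (2 + E) + (3 + E + (3 + E + (2 + E)))) ≡ (3 + q) * (2 + E) + 1 + 2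
  size = solve-∀
exists′ E k j@(suc i@(suc (suc _))) 4≤E E<k 1≤j j≤ = family′-mid E k j 4≤E (≤-trans (s≤s z≤n) E<k) j≤ refl (s≤s (s≤s (s≤s z≤n)))
  (subst₂ (λ n b → Complete n b 1) (trans (size E q i) (cong (λ k → k * (2 + E) + 1 + j) k≡)) (trans (count q i) k≡)
    (rounds tt i (move mid (s≤s z≤n) (inj₂ tt) (move two (s≤s z≤n) (inj₁ tt) (times q (2 + E) two-step begin′)))))
  where
  open Chains E j Ok′ tt tt
  q = k ∸ j
  k≡ : j + q ≡ k
  k≡ = m+[n∸m]≡n (≤-trans j≤ E<k)
  count : ∀ q i → i + (q + 1) ≡ suc i + q
  count = solve-∀
  size : ∀ E q i → i * (3 + E) + (2 + (q * (2 + E) + (2 + E))) ≡ (suc i + q) * (2 + E) + 1 + suc i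
  size = solve-∀

-- The medium vertex is attached directly to the end of the chain, its one neighbour of degree `Δ`;
-- `rounds` supplies its `j` neighbours of degree 2.
exists‴ : ∀ E k j → 4 ≤ E → suc E ≤ k → 2 ≤ j → j ≤ E → ∃[ G ] Family‴ {k * (2 + E) + 1 + j} (2 + E) j G
exists‴ E k j 4≤E E<k 2≤j j≤E = family‴ E k j 4≤E (≤-trans (s≤s z≤n) E<k) (≤-trans j≤E (n≤1+n E)) refl 2≤j j≤E
  (subst₂ (λ n b → Complete n b 1) (trans (size E q j) (cong (λ k → k * (2 + E) + 1 + j) k≡)) (trans (count q j) k≡)
    (rounds tt j (move mid (s≤s z≤n) (inj₁ tt) (times q (2 + E) two-step begin′))))
  where
  open Chains E (1 + j) Ok‴ tt tt
  q = k ∸ suc j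
  k≡ : suc j + q ≡ k
  k≡ = m+[n∸m]≡n (≤-trans (s≤s j≤E) E<k)
  count : ∀ q j → j + (q + 1) ≡ suc j + q
  count = solve-∀
  size : ∀ E q j → j * (3 + E) + (1 + (q * (2 + E) + (2 + E))) ≡ (suc j + q) * (2 + E) + 1 + j
  size = solve-∀

-- The relation between σ and Ψ

module _ {n} (G : Graph n) (E k j : ℕ) (4≤E : 4 ≤ E) (n≡ : n ≡ k * (2 + E) + 1 + j) (1≤k : 1 ≤ k)
  (tree : TreeOfMaxDegree (2 + E) G) where
  open Penalty G E
  open MaxDegreeTree G E k j 4≤E n≡ 1≤k tree

  private
    -- `ψ E d` is what `d (Δ - d)²` lacks to the line through its values at `d ≡ 1` and `d ≡ 2`.
    -- Hence the factors `d - 1` and `d - 2`; the roots of this cubic sum to `2 Δ`, so the third one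
    -- is `2 Δ - 3`, which is `2 E + 1`.
    vertex-eq : ∀ d → 1 ≤ d → d ≤ 2 + E → ψ E d + d * ((2 + E ∸ d) * (2 + E ∸ d)) + (d ∸ 1) * (2 * E + 1) ≡ suc E * suc E + (d ∸ 1) * (E * E)
    vertex-eq 1 _ _ = eq E
      where
      eq : ∀ E → 0 + 1 * (suc E * suc E) + 0 ≡ suc E * suc E + 0
      eq = solve-∀
    vertex-eq (suc (suc z)) _ (s≤s (s≤s z≤E)) with m≤n⇒m<n∨m≡n z≤E
    ... | inj₁ z<E = med (E ∸ suc z) (trans (+-suc z _) (m+[n∸m]≡n z<E))
      where
      poly : ∀ z y → z * suc z * (suc z + 2 * y) + (2 + z) * (suc y * suc y) + suc z * (2 * (z + suc y) + 1)
        ≡ suc (z + suc y) * suc (z + suc y) + suc z * ((z + suc y) * (z + suc y))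
      poly = solve-∀
      med : ∀ y₀ → z + suc y₀ ≡ E → ψ E (2 + z) + (2 + z) * ((E ∸ z) * (E ∸ z)) + suc z * (2 * E + 1) ≡ suc E * suc E + suc z * (E * E)
      med y₀ refl = trans (cong₂ (λ p q → p + (2 + z) * (q * q) + suc z * (2 * (z + suc y₀) + 1)) (ψ-med z y₀) (m+n∸m≡n z (suc y₀))) (poly z y₀)
    ... | inj₂ refl = trans (cong₂ (λ p q → p + (2 + z) * (q * q) + suc z * (2 * z + 1)) (ψ-top z (≤-trans (s≤s z≤n) 4≤E)) (n∸n≡0 z))
        (gap-elim (λ z → suc z * z * pred z + (2 + z) * 0 + suc z * (2 * z + 1) ≡ suc z * suc z + suc z * (z * z)) 1 poly (≤-trans (s≤s z≤n) 4≤E))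
      where
      poly : ∀ e → suc (1 + e) * (1 + e) * e + (2 + (1 + e)) * 0 + suc (1 + e) * (2 * (1 + e) + 1) ≡ suc (1 + e) * suc (1 + e) + suc (1 + e) * ((1 + e) * (1 + e))
      poly = solve-∀

    square-diff : ∀ p q y y′ → p + y ≡ q + y′ → ∣ p - q ∣ ^ 2 + 2 * (y * y′) ≡ y * y + y′ * y′
    square-diff p q y y′ e with ≤-total p q
    ... | inj₁ p≤q with ≤⇒gap p≤q
    ...   | t , refl = trans (cong₂ (λ a b → a ^ 2 + 2 * (b * y′)) (∣m-m+n∣≡n p t) y≡) (trans (eq t y′) (cong (λ b → b * b + y′ * y′) (sym y≡)))
      where
      y≡ : y ≡ t + y′
      y≡ = +-cancelˡ-≡ p _ _ (trans e (+-assoc p t y′))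
      eq : ∀ t y → t * (t * 1) + 2 * ((t + y) * y) ≡ (t + y) * (t + y) + y * y
      eq = solve-∀
    square-diff p q y y′ e | inj₂ q≤p with ≤⇒gap q≤p
    ...   | t , refl = trans (cong₂ (λ a b → a ^ 2 + 2 * (y * b)) (trans (∣-∣-comm (q + t) q) (∣m-m+n∣≡n q t)) y≡) (trans (eq t y) (cong (λ b → y * y + b * b) (sym y≡)))
      where
      y≡ : y′ ≡ t + y
      y≡ = +-cancelˡ-≡ q _ _ (trans (sym e) (+-assoc q t y))
      eq : ∀ t y → t * (t * 1) + 2 * (y * (t + y)) ≡ y * y + (t + y) * (t + y)
      eq = solve-∀

    N : ℕ
    N = k * Δ + j

    σ-form : σ G + form G y y ≡ sum (λ v → deg G v * (y v * y v))
    σ-form = *-cancelˡ-≡ _ _ 2 (begin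
      2 * (σ G + form G y y)
        ≡⟨ *-distribˡ-+ 2 (σ G) (form G y y) ⟩
      2 * σ G + 2 * form G y y
        ≡⟨ cong₂ _+_ (edge-sum G (λ u v → ∣ deg G u - deg G v ∣ ^ 2) (λ u v → cong (_^ 2) (∣-∣-comm (deg G u) (deg G v))))
             (trans (cong (2 *_) (form-flat G y y)) (trans (sym (sum-*ˡ 2 (λ u → sum (λ v → a G u v * (y u * y v))))) (sum-cong-≗ λ u → sym (sum-*ˡ 2 (λ v → a G u v * (y u * y v)))))) ⟩
      sum (λ u → sum (λ v → a G u v * ∣ deg G u - deg G v ∣ ^ 2)) + sum (λ u → sum (λ v → 2 * (a G u v * (y u * y v))))
        ≡⟨ trans (sym (∑-distrib-+ (λ u → sum (λ v → a G u v * ∣ deg G u - deg G v ∣ ^ 2)) (λ u → sum (λ v → 2 * (a G u v * (y u * y v))))))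
             (sum-cong-≗ λ u → sym (∑-distrib-+ (λ v → a G u v * ∣ deg G u - deg G v ∣ ^ 2) (λ v → 2 * (a G u v * (y u * y v))))) ⟩
      sum (λ u → sum (λ v → a G u v * ∣ deg G u - deg G v ∣ ^ 2 + 2 * (a G u v * (y u * y v))))
        ≡⟨ sum-cong-≗ (λ u → sum-cong-≗ (λ v → term u v)) ⟩
      sum (λ u → sum (λ v → a G u v * (y u * y u) + a G u v * (y v * y v)))
        ≡⟨ trans (sum-cong-≗ λ u → ∑-distrib-+ (λ v → a G u v * (y u * y u)) (λ v → a G u v * (y v * y v)))
             (∑-distrib-+ (λ u → sum (λ v → a G u v * (y u * y u))) (λ u → sum (λ v → a G u v * (y v * y v)))) ⟩
      sum (λ u → sum (λ v → a G u v * (y u * y u))) + sum (λ u → sum (λ v → a G u v * (y v * y v)))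
        ≡⟨ cong₂ _+_ rows (trans (∑-comm (λ u v → a G u v * (y v * y v))) (trans (sum-cong-≗ λ v → sum-cong-≗ λ u → cong (_* (y v * y v)) (a-sym G u v)) rows)) ⟩
      sum (λ v → deg G v * (y v * y v)) + sum (λ v → deg G v * (y v * y v))
        ≡⟨ cong (sum (λ v → deg G v * (y v * y v)) +_) (+-identityʳ _) ⟨
      2 * sum (λ v → deg G v * (y v * y v)) ∎)
      where
      open ≡-Reasoning
      rows : sum (λ u → sum (λ v → a G u v * (y u * y u))) ≡ sum (λ v → deg G v * (y v * y v))
      rows = sum-cong-≗ λ u → trans (sum-*ʳ (y u * y u) (a G u)) (cong (_* (y u * y u)) (sym (deg≡ G u)))
      eq : ∀ a d p → a * d + 2 * (a * p) ≡ a * (d + 2 * p)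
      eq = solve-∀
      d+y : ∀ v → deg G v + y v ≡ 2 + E
      d+y v = m+[n∸m]≡n (deg≤ v)
      term : ∀ u v → a G u v * ∣ deg G u - deg G v ∣ ^ 2 + 2 * (a G u v * (y u * y v)) ≡ a G u v * (y u * y u) + a G u v * (y v * y v)
      term u v = trans (eq (a G u v) (∣ deg G u - deg G v ∣ ^ 2) (y u * y v))
        (trans (cong (a G u v *_) (square-diff (deg G u) (deg G v) (y u) (y v) (trans (d+y u) (sym (d+y v))))) (*-distribˡ-+ (a G u v) (y u * y u) (y v * y v)))

  -- Apart from `σ G + Ψ` only `n`, `k`, `j` and `E` occur. The constant involves the differences
  -- `N - 1` and `E² - 2 E - 1`, hence the terms on both sides.
  σ+Ψ : σ G + Ψ + (N * (2 * E + 1) + E * E) ≡ n * (suc E * suc E) + (N * (E * E) + (2 * E + 1))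
  σ+Ψ = begin
    σ G + Ψ + (N * (2 * E + 1) + E * E)
      ≡⟨ cong (λ N → σ G + Ψ + (N * (2 * E + 1) + E * E)) (sym M+1) ⟩
    σ G + (sum pen + form G y y) + ((M + 1) * (2 * E + 1) + E * E)
      ≡⟨ eq₁ (σ G) (sum pen) (form G y y) M E ⟩
    sum pen + (σ G + form G y y) + M * (2 * E + 1) + (2 * E + 1 + E * E)
      ≡⟨ cong (λ q → sum pen + q + M * (2 * E + 1) + (2 * E + 1 + E * E)) σ-form ⟩
    sum pen + sum (λ v → deg G v * (y v * y v)) + M * (2 * E + 1) + (2 * E + 1 + E * E)
      ≡⟨ cong (_+ (2 * E + 1 + E * E)) vertices ⟩
    n * (suc E * suc E) + M * (E * E) + (2 * E + 1 + E * E)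
      ≡⟨ eq₂ (n * (suc E * suc E)) M E ⟩
    n * (suc E * suc E) + ((M + 1) * (E * E) + (2 * E + 1))
      ≡⟨ cong (λ N → n * (suc E * suc E) + (N * (E * E) + (2 * E + 1))) M+1 ⟩
    n * (suc E * suc E) + (N * (E * E) + (2 * E + 1)) ∎
    where
    open ≡-Reasoning
    M : ℕ
    M = sum (λ v → deg G v ∸ 1)
    M+n : M + n ≡ 2 * N
    M+n = trans (cong (M +_) (trans (sym (*-identityʳ n)) (sym (sum-const n 1)))) (trans (sym (∑-distrib-+ (λ v → deg G v ∸ 1) (λ _ → 1)))
      (trans (sum-cong-≗ λ v → m∸n+n≡m (1≤deg v)) deg-sum))
    M+1 : M + 1 ≡ N
    M+1 = +-cancelʳ-≡ N _ _ (trans (eq M N) (trans (cong (M +_) (trans (eq′ (k * Δ) j) (sym n≡))) (trans M+n (cong (N +_) (+-identityʳ N)))))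
      where
      eq : ∀ a b → a + 1 + b ≡ a + (1 + b)
      eq = solve-∀
      eq′ : ∀ a b → 1 + (a + b) ≡ a + 1 + b
      eq′ = solve-∀
    eq₁ : ∀ s p f M E → s + (p + f) + ((M + 1) * (2 * E + 1) + E * E) ≡ p + (s + f) + M * (2 * E + 1) + (2 * E + 1 + E * E)
    eq₁ = solve-∀
    eq₂ : ∀ a M E → a + M * (E * E) + (2 * E + 1 + E * E) ≡ a + ((M + 1) * (E * E) + (2 * E + 1))
    eq₂ = solve-∀
    vertices : sum pen + sum (λ v → deg G v * (y v * y v)) + M * (2 * E + 1) ≡ n * (suc E * suc E) + M * (E * E)
    vertices = begin
      sum pen + sum (λ v → deg G v * (y v * y v)) + M * (2 * E + 1)
        ≡⟨ cong₂ _+_ (sym (∑-distrib-+ pen (λ v → deg G v * (y v * y v)))) (sym (sum-*ʳ (2 * E + 1) (λ v → deg G v ∸ 1))) ⟩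
      sum (λ v → pen v + deg G v * (y v * y v)) + sum (λ v → (deg G v ∸ 1) * (2 * E + 1))
        ≡⟨ ∑-distrib-+ (λ v → pen v + deg G v * (y v * y v)) (λ v → (deg G v ∸ 1) * (2 * E + 1)) ⟨
      sum (λ v → pen v + deg G v * (y v * y v) + (deg G v ∸ 1) * (2 * E + 1))
        ≡⟨ sum-cong-≗ (λ v → vertex-eq (deg G v) (1≤deg v) (deg≤ v)) ⟩
      sum (λ v → suc E * suc E + (deg G v ∸ 1) * (E * E))
        ≡⟨ ∑-distrib-+ (λ _ → suc E * suc E) (λ v → (deg G v ∸ 1) * (E * E)) ⟩
      sum {n} (λ _ → suc E * suc E) + sum (λ v → (deg G v ∸ 1) * (E * E))
        ≡⟨ cong₂ _+_ (sum-const n (suc E * suc E)) (sum-*ʳ (E * E) (λ v → deg G v ∸ 1)) ⟩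
      n * (suc E * suc E) + M * (E * E) ∎

-- Comparison of the three values.

-- For `j ≡ 2 + z`, `suc y₀` equals `Δ - j`, so `c′ - K` is the product of `Δ - j` and `ρ - E²`.
-- This is how the quadratic with the root r(Δ) arises.
c′-balance : ∀ e z y₀ → z + suc y₀ ≡ 2 + e → 2 + z ≤ suc (2 + e) →
  c′ (2 + e) (2 + z) + suc y₀ * ((2 + e) * (2 + e)) ≡ K (2 + e) + suc y₀ * ρ e (2 + z)
c′-balance e z y₀ E≡ _ = trans (cong (λ y → medCost z y (2 + z) + suc y₀ * ((2 + e) * (2 + e))) y≡)
  (trans (core (2 + e) E≡) (cong (λ r → K (2 + e) + suc y₀ * r) (eq e z)))
  where
  y≡ : 2 + e ∸ suc z ≡ y₀
  y≡ = trans (cong (_∸ suc z) (trans (sym E≡) (+-suc z y₀))) (m+n∸m≡n (suc z) y₀)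
  eq : ∀ e z → suc z * suc z + (2 + e) * z + 4 * (2 + e) ≡ (2 + z) * (2 + z) + (2 + z) * e + 2 * (2 + e) + 1
  eq = solve-∀
  poly : ∀ z y → (suc (z + suc y) * (z + suc y) * (z + y)) + suc y * (suc z * suc z + (z + suc y) * z + 4 * (z + suc y))
    ≡ z * suc z * (suc z + 2 * y) + 2 * ((2 + z) * (suc y * (z + suc y))) + suc y * ((z + suc y) * (z + suc y))
  poly = solve-∀
  core : ∀ F → z + suc y₀ ≡ F → medCost z y₀ (2 + z) + suc y₀ * (F * F) ≡ K F + suc y₀ * (suc z * suc z + F * z + 4 * F)
  core F refl = trans (sym (poly z y₀)) (cong (_+ suc y₀ * (suc z * suc z + (z + suc y₀) * z + 4 * (z + suc y₀)))
    (cong (suc (z + suc y₀) * (z + suc y₀) *_) (cong pred (sym (+-suc z y₀)))))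

module _ (e : ℕ) (2≤e : 2 ≤ e) where
  private
    E = 2 + e

    -- The formula of `c′-balance` starts at `j ≡ 2`. The value `j ≡ 1` always lies below r(Δ), and
    -- there `small-K` compares 𝒯′ with 𝒯″ directly.
    small-r : ρ e 1 < E * E
    small-r = gap-elim (λ e → 1 * 1 + 1 * e + 2 * (2 + e) + 1 < (2 + e) * (2 + e)) 2 (λ t → slack< _ (eq t)) 2≤e
      where
      eq : ∀ t → 1 * 1 + 1 * (2 + t) + 2 * (2 + (2 + t)) + 1 + suc (t * t + 5 * t + 3) ≡ (2 + (2 + t)) * (2 + (2 + t))
      eq = solve-∀

    small-K : ℓ E < K E
    small-K = gap-elim (λ e → 2 * ((2 + e) * (2 + e)) < (3 + e) * (2 + e) * (1 + e)) 2 (λ t → slack< _ (eq t)) 2≤e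
      where
      eq : ∀ t → 2 * ((2 + (2 + t)) * (2 + (2 + t))) + suc (t * t * t + 10 * t * t + 31 * t + 27) ≡ (3 + (2 + t)) * (2 + (2 + t)) * (1 + (2 + t))
      eq = solve-∀

    module _ (z : ℕ) (z<E : z < E) where
      y₀ = E ∸ suc z

      bal : c′ E (2 + z) + suc y₀ * (E * E) ≡ K E + suc y₀ * ρ e (2 + z)
      bal = c′-balance e z y₀ (trans (+-suc z y₀) (m+[n∸m]≡n z<E)) (s≤s z<E)

  r<⇒c′< : ∀ j → 1 ≤ j → j ≤ suc E → ρ e j < E * E → c′ E j < K E
  r<⇒c′< 1 _ _ _ = small-K
  r<⇒c′< (suc (suc z)) _ (s≤s z<E) h = +-cancelʳ-< (suc (y₀ z z<E) * ρ e (2 + z)) _ _ (<-≤-trans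
    (+-monoʳ-< (c′ E (2 + z)) (*-monoʳ-< (suc (y₀ z z<E)) h)) (≤-reflexive (bal z z<E)))

  r>⇒c′> : ∀ j → 1 ≤ j → j ≤ suc E → E * E < ρ e j → K E < c′ E j
  r>⇒c′> 1 _ _ h = contradiction small-r (<⇒≯ h)
  r>⇒c′> (suc (suc z)) _ (s≤s z<E) h = +-cancelʳ-< (suc (y₀ z z<E) * (E * E)) _ _ (<-≤-trans
    (+-monoʳ-< (K E) (*-monoʳ-< (suc (y₀ z z<E)) h)) (≤-reflexive (sym (bal z z<E))))

  r≡⇒c′≡ : ∀ j → 1 ≤ j → j ≤ suc E → ρ e j ≡ E * E → c′ E j ≡ K E
  r≡⇒c′≡ 1 _ _ h = contradiction h (<⇒≢ small-r)
  r≡⇒c′≡ (suc (suc z)) _ (s≤s z<E) h = +-cancelʳ-≡ (suc (y₀ z z<E) * (E * E)) _ _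
    (trans (bal z z<E) (cong (λ r → K E + suc (y₀ z z<E) * r) h))

c‴<c′₂ : ∀ E → 4 ≤ E → c‴ E 2 < c′ E 2
c‴<c′₂ E 4≤E = <-≤-trans (m<m+n (c‴ E 2) (s≤s z≤n)) (≤-reflexive (trans (c₂ E 4≤E) (trans (*-comm 2 (ℓ E)) (sym (c′₂ E (≤-trans (s≤s z≤n) 4≤E))))))

c‴₂<K : ∀ E → 5 ≤ E → c‴ E 2 < K E
c‴₂<K E 5≤E = +-cancelʳ-< 4 _ _ (≤-<-trans (≤-reflexive (c₂ E (≤-trans (n≤1+n 4) 5≤E)))
  (gap-elim (λ E → 2 * (2 * (E * E)) < suc E * E * pred E + 4) 5 (λ t → slack< _ (eq t)) 5≤E))
  where
  eq : ∀ t → 2 * (2 * ((5 + t) * (5 + t))) + suc (t * t * t + 11 * t * t + 34 * t + 23) ≡ suc (5 + t) * (5 + t) * (4 + t) + 4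
  eq = solve-∀

-- At `j ≡ 2` every `E` is exceptional. At `j ≡ 3`, 𝒯‴ costs more than `K` for `E ≤ 5`, and from
-- `E ≡ 8` on its saving `18` is less than `2 * E + 4`. From `j ≡ 4` on it is the shape `x ≡ z` of
-- `gain≥₃<`, while `γ` is attained by 𝒯′.
c‴-large : ∀ E j → 4 ≤ E → 2 ≤ j → j ≤ E → ¬ Exceptional (2 + E) j → K E < c‴ E j ⊎ c′ E j < c‴ E j
c‴-large E 1 4≤E (s≤s ()) _ _
c‴-large E 2 4≤E _ _ ne with m≤n⇒m<n∨m≡n 4≤E
... | inj₁ 5≤E  = contradiction (inj₁ (inj₁ (refl , s≤s (s≤s 5≤E)))) ne
... | inj₂ refl = contradiction (inj₂ (inj₁ (refl , refl))) ne
c‴-large 4 3 _ _ _ _ = inj₁ (<ᵇ⇒< 60 78 _)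
c‴-large 5 3 _ _ _ _ = inj₁ (<ᵇ⇒< 120 132 _)
c‴-large 6 3 _ _ _ ne = contradiction (inj₁ (inj₂ (refl , refl))) ne
c‴-large 7 3 _ _ _ ne = contradiction (inj₂ (inj₂ (refl , refl))) ne
c‴-large E@(suc (suc (suc (suc (suc (suc (suc (suc t)))))))) 3 4≤E _ _ _ = inj₂ (+-cancelʳ-< 18 _ _
  (<-≤-trans (+-monoʳ-< (c′ E 3) 18<) (≤-reflexive (trans (c′₃ E 4≤E) (sym (c‴₃ E 4≤E))))))
  where
  18< : 18 < 2 * E + 4
  18< = +-monoˡ-≤ 4 (≤-trans (≤ᵇ⇒≤ 15 16 _) (*-monoʳ-≤ 2 (m≤m+n 8 t)))
c‴-large 1 3 (s≤s ()) _ _ _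
c‴-large 2 3 (s≤s (s≤s ())) _ _ _
c‴-large 3 3 (s≤s (s≤s (s≤s ()))) _ _ _
c‴-large E (suc (suc (suc (suc i)))) 4≤E _ j≤E _ = large (E ∸ (4 + i)) refl (trans (+-suc (3 + i) _) (m+[n∸m]≡n j≤E))
  where
  large : ∀ y₀ → E ∸ (4 + i) ≡ y₀ → 3 + i + suc y₀ ≡ E → K E < medCost (3 + i) (E ∸ (4 + i)) (4 + i) ⊎ c′ E (4 + i) < medCost (3 + i) (E ∸ (4 + i)) (4 + i)
  large y₀ refl E≡ = Sum.map (subst (λ F → K F < medCost (3 + i) y₀ (4 + i)) E≡)
    (λ h → +-cancelʳ-< (γ E (3 + i)) _ _ (≤-<-trans (≤-reflexive (c′₄₊ E (2 + i) (s≤s (s≤s z≤n)) (≤-trans (n≤1+n _) j≤E)))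
      (subst (λ F → (4 + i) * ℓ F < medCost (3 + i) y₀ (4 + i) + γ F (3 + i)) E≡ h)))
    (gain≥₃< (3 + i) y₀ (3 + i) (s≤s (s≤s (s≤s z≤n))) ≤-refl)

exceptional? : ∀ Δ j → Dec (Exceptional Δ j)
exceptional? Δ j = (((j ≟ 2) ×-dec (7 ≤? Δ)) ⊎-dec ((Δ ≟ 8) ×-dec (j ≟ 3)))
  ⊎-dec (((Δ ≟ 6) ×-dec (j ≟ 2)) ⊎-dec ((Δ ≟ 9) ×-dec (j ≟ 3)))

case‴-order : ∀ E j → 4 ≤ E → Case‴ (2 + E) j → c‴ E j < c′ E j × c‴ E j < K E × 2 ≤ j × j ≤ E
case‴-order E _ 4≤E (inj₁ (refl , s≤s (s≤s 5≤E))) = c‴<c′₂ E 4≤E , c‴₂<K E 5≤E , ≤-refl , ≤-trans (≤ᵇ⇒≤ 2 4 _) 4≤E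
case‴-order _ _ _ (inj₂ (refl , refl)) = <ᵇ⇒< 198 200 _ , <ᵇ⇒< 198 210 _ , ≤ᵇ⇒≤ 2 3 _ , ≤ᵇ⇒≤ 3 6 _

case″∪‴-order : ∀ E j → Case″∪‴ (2 + E) j → c‴ E j ≡ K E × K E < c′ E j × 2 ≤ j × j ≤ E
case″∪‴-order _ _ (refl , refl) = refl , <ᵇ⇒< 60 64 _ , ≤-refl , ≤ᵇ⇒≤ 2 4 _

case′∪‴-order : ∀ E j → Case′∪‴ (2 + E) j → c‴ E j ≡ c′ E j × c′ E j < K E × 2 ≤ j × j ≤ E
case′∪‴-order _ _ (refl , refl) = refl , <ᵇ⇒< 276 336 _ , ≤ᵇ⇒≤ 2 3 _ , ≤ᵇ⇒≤ 3 7 _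

-- Maximal trees for a given number of vertices

module Maxima (e k j : ℕ) (2≤e : 2 ≤ e) (E<k : suc (2 + e) ≤ k) (j≤E+1 : j ≤ suc (2 + e)) where
  E Δ n : ℕ
  E = 2 + e
  Δ = 2 + E
  n = k * Δ + 1 + j

  4≤E : 4 ≤ E
  4≤E = s≤s (s≤s 2≤e)

  1≤k : 1 ≤ k
  1≤k = ≤-trans (s≤s z≤n) E<k

  Ψ : Graph n → ℕ
  Ψ G = Penalty.Ψ G E

  Tree : Graph n → Set
  Tree = TreeOfMaxDegree Δ

  σ+Ψ≡ : ∀ G H → Tree G → Tree H → σ G + Ψ G ≡ σ H + Ψ H
  σ+Ψ≡ G H tG tH = +-cancelʳ-≡ _ _ _ (trans (σ+Ψ G E k j 4≤E refl 1≤k tG) (sym (σ+Ψ H E k j 4≤E refl 1≤k tH)))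

  Ψ-≡⇒σ : ∀ G H → Tree G → Tree H → Ψ G ≡ Ψ H → σ G ≡ σ H
  Ψ-≡⇒σ G H tG tH e = +-cancelʳ-≡ (Ψ H) _ _ (trans (cong (σ G +_) (sym e)) (σ+Ψ≡ G H tG tH))

  Ψ-≤⇒σ : ∀ G H → Tree G → Tree H → Ψ G ≤ Ψ H → σ H ≤ σ G
  Ψ-≤⇒σ G H tG tH h = +-cancelʳ-≤ (Ψ G) _ _ (≤-trans (+-monoʳ-≤ (σ H) h) (≤-reflexive (sym (σ+Ψ≡ G H tG tH))))

  σ-≤⇒Ψ : ∀ G H → Tree G → Tree H → σ H ≤ σ G → Ψ G ≤ Ψ H
  σ-≤⇒Ψ G H tG tH h = +-cancelˡ-≤ (σ H) _ _ (≤-trans (+-monoˡ-≤ (Ψ G) h) (≤-reflexive (σ+Ψ≡ G H tG tH)))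

  ⊔-attained : ∀ {s t} → ∃[ G ] Tree G × σ G ≡ s → ∃[ G ] Tree G × σ G ≡ t → ∃[ G ] Tree G × σ G ≡ s ⊔ t
  ⊔-attained {s} {t} (G , treeG , p) (H , treeH , q) = Sum.[ (λ e → G , treeG , trans p (sym e)) , (λ e → H , treeH , trans q (sym e)) ]′ (⊔-sel s t)

  Ψ′ Ψ″ Ψ‴ : ℕ
  Ψ′ = k * K E + c′ E j
  Ψ″ = bigs k j * K E
  Ψ‴ = k * K E + c‴ E j

  val′ : ∀ G → Family′ Δ G → Ψ G ≡ Ψ′
  val′ G F = Conversion.val′ G E k j 4≤E refl 1≤k j≤E+1 (Family′.tree F) F

  val″ : ∀ G → Family″ Δ G → Ψ G ≡ Ψ″
  val″ G F = Conversion.val″ G E k j 4≤E refl 1≤k j≤E+1 (Family″.tree F) F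

  val‴ : ∀ G → Family‴ Δ j G → Ψ G ≡ Ψ‴
  val‴ G F = Conversion.val‴ G E k j 4≤E refl 1≤k j≤E+1 (Family‴.tree F) F

  data Verdict (G : Graph n) : Set where
    in′    : Family′ Δ G → Verdict G
    in″    : Family″ Δ G → Verdict G
    in‴    : Family‴ Δ j G → Verdict G
    worse′ : 1 ≤ j → Ψ′ < Ψ G → Verdict G
    worse″ : Ψ″ < Ψ G → Verdict G
    worse‴ : 2 ≤ j → j ≤ E → Ψ‴ < Ψ G → Verdict G

  verdict : ∀ G → Tree G → Verdict G
  verdict G tree = cases C.classify
    where
    module V = Conversion G E k j 4≤E refl 1≤k j≤E+1 tree
    module C = Trichotomy G E k j 4≤E refl 1≤k j≤E+1 tree
    cases : C.Class → Verdict G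
    cases (C.in″ u≡ c≡)                               = in″ (V.to″ u≡ c≡)
    cases (C.in₀ u≡ j≡ e≡ ms Q≡)                      = in′ (V.to′₀ u≡ j≡ e≡ ms Q≡)
    cases (C.in₁ u≡ w med others e≡ s≡ (inj₁ j≡) Q≡)  = in‴ (V.to‴ u≡ w med others e≡ s≡ Q≡ j≡)
    cases (C.in₁ u≡ w med others e≡ s≡ (inj₂ j≡) Q≡)  = in′ (V.to′₁ u≡ w med others e≡ s≡ Q≡ j≡)
    cases (C.worse″ h)                                = worse″ h
    cases (C.worse′ 1≤j h)                            = worse′ 1≤j h
    cases (C.worse‴ 2≤j j≤E h)                        = worse‴ 2≤j j≤E h

  abstract
    G″ : Graph n
    G″ = proj₁ (exists″ E k j 4≤E E<k j≤E+1)

    F″ : Family″ Δ G″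
    F″ = proj₂ (exists″ E k j 4≤E E<k j≤E+1)

  common″ : IsCommonσ (Family″ Δ) (σ G″)
  common″ = (G″ , F″) , λ H F → Ψ-≡⇒σ H G″ (Family″.tree F) (Family″.tree F″) (trans (val″ H F) (sym (val″ G″ F″)))

  module Positive (1≤j : 1 ≤ j) where
    abstract
      G′ : Graph n
      G′ = proj₁ (exists′ E k j 4≤E E<k 1≤j j≤E+1)

      F′ : Family′ Δ G′
      F′ = proj₂ (exists′ E k j 4≤E E<k 1≤j j≤E+1)

    common′ : IsCommonσ (Family′ Δ) (σ G′)
    common′ = (G′ , F′) , λ H F → Ψ-≡⇒σ H G′ (Family′.tree F) (Family′.tree F′) (trans (val′ H F) (sym (val′ G′ F′)))

    Ψ″≡ : Ψ″ ≡ k * K E + K E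
    Ψ″≡ = cases j refl 1≤j
      where
      cases : ∀ i → j ≡ i → 1 ≤ i → bigs k j * K E ≡ k * K E + K E
      cases (suc _) refl _ = +-comm (K E) (k * K E)

    module Third (2≤j : 2 ≤ j) (j≤E : j ≤ E) where
      abstract
        G‴ : Graph n
        G‴ = proj₁ (exists‴ E k j 4≤E E<k 2≤j j≤E)

        F‴ : Family‴ Δ j G‴
        F‴ = proj₂ (exists‴ E k j 4≤E E<k 2≤j j≤E)

      common‴ : IsCommonσ (Family‴ Δ j) (σ G‴)
      common‴ = (G‴ , F‴) , λ H F → Ψ-≡⇒σ H G‴ (Family‴.tree F) (Family‴.tree F‴) (trans (val‴ H F) (sym (val‴ G‴ F‴)))

      upper : ∀ G → Tree G → σ G ≤ σ G′ ⊔ σ G″ ⊔ σ G‴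
      upper G tree = cases (verdict G tree)
        where
        ′≤ : σ G′ ≤ σ G′ ⊔ σ G″ ⊔ σ G‴
        ′≤ = ≤-trans (m≤m⊔n (σ G′) (σ G″)) (m≤m⊔n _ (σ G‴))
        ″≤ : σ G″ ≤ σ G′ ⊔ σ G″ ⊔ σ G‴
        ″≤ = ≤-trans (m≤n⊔m (σ G′) (σ G″)) (m≤m⊔n _ (σ G‴))
        ‴≤ : σ G‴ ≤ σ G′ ⊔ σ G″ ⊔ σ G‴
        ‴≤ = m≤n⊔m (σ G′ ⊔ σ G″) (σ G‴)
        cases : Verdict G → σ G ≤ σ G′ ⊔ σ G″ ⊔ σ G‴
        cases (in′ F)          = ≤-trans (≤-reflexive (proj₂ common′ G F)) ′≤
        cases (in″ F)          = ≤-trans (≤-reflexive (proj₂ common″ G F)) ″≤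
        cases (in‴ F)          = ≤-trans (≤-reflexive (proj₂ common‴ G F)) ‴≤
        cases (worse′ _ h)     = ≤-trans (Ψ-≤⇒σ G′ G (Family′.tree F′) tree (≤-trans (≤-reflexive (val′ G′ F′)) (<⇒≤ h))) ′≤
        cases (worse″ h)       = ≤-trans (Ψ-≤⇒σ G″ G (Family″.tree F″) tree (≤-trans (≤-reflexive (val″ G″ F″)) (<⇒≤ h))) ″≤
        cases (worse‴ _ _ h)   = ≤-trans (Ψ-≤⇒σ G‴ G (Family‴.tree F‴) tree (≤-trans (≤-reflexive (val‴ G‴ F‴)) (<⇒≤ h))) ‴≤

      attained : ∃[ G ] Tree G × σ G ≡ σ G′ ⊔ σ G″ ⊔ σ G‴
      attained = ⊔-attained (⊔-attained (G′ , Family′.tree F′ , refl) (G″ , Family″.tree F″ , refl)) (G‴ , Family‴.tree F‴ , refl)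

    module NoThird (no‴ : ¬ (2 ≤ j × j ≤ E)) where
      upper : ∀ G → Tree G → σ G ≤ σ G′ ⊔ σ G″
      upper G tree = cases (verdict G tree)
        where
        cases : Verdict G → σ G ≤ σ G′ ⊔ σ G″
        cases (in′ F)              = ≤-trans (≤-reflexive (proj₂ common′ G F)) (m≤m⊔n (σ G′) (σ G″))
        cases (in″ F)              = ≤-trans (≤-reflexive (proj₂ common″ G F)) (m≤n⊔m (σ G′) (σ G″))
        cases (in‴ F)              = contradiction (Family‴.2≤j F , Family‴.j≤Δ-2 F) no‴
        cases (worse′ _ h)         = ≤-trans (Ψ-≤⇒σ G′ G (Family′.tree F′) tree (≤-trans (≤-reflexive (val′ G′ F′)) (<⇒≤ h))) (m≤m⊔n (σ G′) (σ G″))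
        cases (worse″ h)           = ≤-trans (Ψ-≤⇒σ G″ G (Family″.tree F″) tree (≤-trans (≤-reflexive (val″ G″ F″)) (<⇒≤ h))) (m≤n⊔m (σ G′) (σ G″))
        cases (worse‴ 2≤j j≤E _)   = contradiction (2≤j , j≤E) no‴

      attained : ∃[ G ] Tree G × σ G ≡ σ G′ ⊔ σ G″
      attained = ⊔-attained (G′ , Family′.tree F′ , refl) (G″ , Family″.tree F″ , refl)

    maxima : ∃[ σ′ ] ∃[ σ″ ] IsCommonσ {n} (Family′ Δ) σ′ × IsCommonσ {n} (Family″ Δ) σ″ ×
      (2 ≤ j × j ≤ E → ∃[ σ‴ ] IsCommonσ {n} (Family‴ Δ j) σ‴ × IsMaxσ n Δ (σ′ ⊔ σ″ ⊔ σ‴)) ×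
      (¬ (2 ≤ j × j ≤ E) → IsMaxσ n Δ (σ′ ⊔ σ″))
    maxima = σ G′ , σ G″ , common′ , common″
      , (λ (2≤j , j≤E) → let open Third 2≤j j≤E in σ G‴ , common‴ , attained , upper)
      , (λ no‴ → let open NoThird no‴ in attained , upper)

    module _ (G : Graph n) (tree : Tree G) where
      optimal : Ψ G ≤ Ψ′ → Ψ G ≤ Ψ″ → (2 ≤ j → j ≤ E → Ψ G ≤ Ψ‴) → Maximal Δ G
      optimal best′ best″ best‴ = tree , λ H treeH → Ψ-≤⇒σ G H tree treeH (cases H (verdict H treeH))
        where
        cases : ∀ H → Verdict H → Ψ G ≤ Ψ H
        cases H (in′ F)            = ≤-trans best′ (≤-reflexive (sym (val′ H F)))
        cases H (in″ F)            = ≤-trans best″ (≤-reflexive (sym (val″ H F)))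
        cases H (in‴ F)            = ≤-trans (best‴ (Family‴.2≤j F) (Family‴.j≤Δ-2 F)) (≤-reflexive (sym (val‴ H F)))
        cases H (worse′ _ h)       = ≤-trans best′ (<⇒≤ h)
        cases H (worse″ h)         = ≤-trans best″ (<⇒≤ h)
        cases H (worse‴ 2≤ ≤E h)   = ≤-trans (best‴ 2≤ ≤E) (<⇒≤ h)

      private
        module _ {c : ℕ} where
          Ψ<″ : c < K E → k * K E + c < Ψ″
          Ψ<″ h = <-≤-trans (+-monoʳ-< (k * K E) h) (≤-reflexive (sym Ψ″≡))

          ″<Ψ : K E < c → Ψ″ < k * K E + c
          ″<Ψ h = ≤-<-trans (≤-reflexive Ψ″≡) (+-monoʳ-< (k * K E) h)

          Ψ≤″ : c ≤ K E → k * K E + c ≤ Ψ″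
          Ψ≤″ h = ≤-trans (+-monoʳ-≤ (k * K E) h) (≤-reflexive (sym Ψ″≡))

          ″≤Ψ : K E ≤ c → Ψ″ ≤ k * K E + c
          ″≤Ψ h = ≤-trans (≤-reflexive Ψ″≡) (+-monoʳ-≤ (k * K E) h)

      maximal⇒ : Maximal Δ G → Family Δ j G
      maximal⇒ (_ , best) = by-verdict (verdict G tree)
        where
        best′ : Ψ G ≤ Ψ′
        best′ = ≤-trans (σ-≤⇒Ψ G G′ tree (Family′.tree F′) (best G′ (Family′.tree F′))) (≤-reflexive (val′ G′ F′))
        best″ : Ψ G ≤ Ψ″
        best″ = ≤-trans (σ-≤⇒Ψ G G″ tree (Family″.tree F″) (best G″ (Family″.tree F″))) (≤-reflexive (val″ G″ F″))
        best‴ : 2 ≤ j → j ≤ E → Ψ G ≤ Ψ‴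
        best‴ 2≤j j≤E = ≤-trans (σ-≤⇒Ψ G G‴ tree (Family‴.tree F‴) (best G‴ (Family‴.tree F‴))) (≤-reflexive (val‴ G‴ F‴))
          where open Third 2≤j j≤E
        absurd : ∀ {p q} → Ψ G ≡ p → q < p → Ψ G ≤ q → Family Δ j G
        absurd refl q<p p≤q = contradiction p≤q (<⇒≱ q<p)
        from′ : Family′ Δ G → Dec (Exceptional Δ j) → Family Δ j G
        from′ F (yes (inj₁ c)) with case‴-order E j 4≤E c
        ... | c‴< , _ , 2≤j , j≤E = absurd (val′ G F) (+-monoʳ-< (k * K E) c‴<) (best‴ 2≤j j≤E)
        from′ F (yes (inj₂ (inj₁ c))) = absurd (val′ G F) (″<Ψ (proj₁ (proj₂ (case″∪‴-order E j c)))) best″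
        from′ F (yes (inj₂ (inj₂ c))) = case′∪‴ c (inj₁ F)
        from′ F (no ne) with <-cmp (ρ e j) (E * E)
        ... | tri< h _ _ = j<r 1≤j ne (⇒<r e j h) F
        ... | tri≈ _ h _ = j≡r 1≤j ne (⇒≡r e j h) (inj₁ F)
        ... | tri> _ _ h = absurd (val′ G F) (″<Ψ (r>⇒c′> e 2≤e j 1≤j j≤E+1 h)) best″
        from″ : Family″ Δ G → Dec (Exceptional Δ j) → Family Δ j G
        from″ F (yes (inj₁ c)) with case‴-order E j 4≤E c
        ... | _ , c‴< , 2≤j , j≤E = absurd (val″ G F) (Ψ<″ c‴<) (best‴ 2≤j j≤E)
        from″ F (yes (inj₂ (inj₁ c))) = case″∪‴ c (inj₁ F)
        from″ F (yes (inj₂ (inj₂ c))) = absurd (val″ G F) (Ψ<″ (proj₁ (proj₂ (case′∪‴-order E j c)))) best′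
        from″ F (no ne) with <-cmp (ρ e j) (E * E)
        ... | tri< h _ _ = absurd (val″ G F) (Ψ<″ (r<⇒c′< e 2≤e j 1≤j j≤E+1 h)) best′
        ... | tri≈ _ h _ = j≡r 1≤j ne (⇒≡r e j h) (inj₂ F)
        ... | tri> _ _ h = j>r 1≤j ne (⇒>r e j h) F
        from‴ : Family‴ Δ j G → Dec (Exceptional Δ j) → Family Δ j G
        from‴ F (yes (inj₁ c))        = case‴ c F
        from‴ F (yes (inj₂ (inj₁ c))) = case″∪‴ c (inj₂ F)
        from‴ F (yes (inj₂ (inj₂ c))) = case′∪‴ c (inj₂ F)
        from‴ F (no ne) with c‴-large E j 4≤E (Family‴.2≤j F) (Family‴.j≤Δ-2 F) ne
        ... | inj₁ K<  = absurd (val‴ G F) (″<Ψ K<) best″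
        ... | inj₂ c′< = absurd (val‴ G F) (+-monoʳ-< (k * K E) c′<) best′
        by-verdict : Verdict G → Family Δ j G
        by-verdict (in′ F)            = from′ F (exceptional? Δ j)
        by-verdict (in″ F)            = from″ F (exceptional? Δ j)
        by-verdict (in‴ F)            = from‴ F (exceptional? Δ j)
        by-verdict (worse′ _ h)       = absurd refl h best′
        by-verdict (worse″ h)         = absurd refl h best″
        by-verdict (worse‴ 2≤ ≤E h)   = absurd refl h (best‴ 2≤ ≤E)

      private
        optimal′ : Family′ Δ G → c′ E j ≤ K E → (2 ≤ j → j ≤ E → c′ E j ≤ c‴ E j) → Maximal Δ G
        optimal′ F ≤K ≤c‴ = optimal (≤-reflexive (val′ G F)) (≤-trans (≤-reflexive (val′ G F)) (Ψ≤″ ≤K))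
          (λ 2≤j j≤E → ≤-trans (≤-reflexive (val′ G F)) (+-monoʳ-≤ (k * K E) (≤c‴ 2≤j j≤E)))

        optimal″ : Family″ Δ G → K E ≤ c′ E j → (2 ≤ j → j ≤ E → K E ≤ c‴ E j) → Maximal Δ G
        optimal″ F K≤ K≤c‴ = optimal (≤-trans (≤-reflexive (val″ G F)) (″≤Ψ K≤)) (≤-reflexive (val″ G F))
          (λ 2≤j j≤E → ≤-trans (≤-reflexive (val″ G F)) (″≤Ψ (K≤c‴ 2≤j j≤E)))

        optimal‴ : Family‴ Δ j G → c‴ E j ≤ c′ E j → c‴ E j ≤ K E → Maximal Δ G
        optimal‴ F ≤c′ ≤K = optimal (≤-trans (≤-reflexive (val‴ G F)) (+-monoʳ-≤ (k * K E) ≤c′))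
          (≤-trans (≤-reflexive (val‴ G F)) (Ψ≤″ ≤K)) (λ _ _ → ≤-reflexive (val‴ G F))

        ordinary : ∀ {c} → ¬ Exceptional Δ j → c ≤ K E → c ≤ c′ E j → 2 ≤ j → j ≤ E → c ≤ c‴ E j
        ordinary ne ≤K ≤c′ 2≤j j≤E = Sum.[ (λ h → ≤-trans ≤K (<⇒≤ h)) , (λ h → ≤-trans ≤c′ (<⇒≤ h)) ]′ (c‴-large E j 4≤E 2≤j j≤E ne)

      family⇒ : Family Δ j G → Maximal Δ G
      family⇒ (j≡0 j≡ _) = contradiction 1≤j (<⇒≱ (s≤s (≤-reflexive j≡)))
      family⇒ (case‴ c F) with case‴-order E j 4≤E c
      ... | c‴<c′ , c‴<K , _ = optimal‴ F (<⇒≤ c‴<c′) (<⇒≤ c‴<K)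
      family⇒ (case″∪‴ c F) with case″∪‴-order E j c
      ... | c‴≡K , K<c′ , _ = Sum.[ (λ F → optimal″ F (<⇒≤ K<c′) (λ _ _ → ≤-reflexive (sym c‴≡K)))
                                  , (λ F → optimal‴ F (≤-trans (≤-reflexive c‴≡K) (<⇒≤ K<c′)) (≤-reflexive c‴≡K)) ]′ F
      family⇒ (case′∪‴ c F) with case′∪‴-order E j c
      ... | c‴≡c′ , c′<K , _ = Sum.[ (λ F → optimal′ F (<⇒≤ c′<K) (λ _ _ → ≤-reflexive (sym c‴≡c′)))
                                   , (λ F → optimal‴ F (≤-reflexive c‴≡c′) (≤-trans (≤-reflexive c‴≡c′) (<⇒≤ c′<K))) ]′ F
      family⇒ (j<r _ ne h F) = optimal′ F (<⇒≤ c′<K) (ordinary ne (<⇒≤ c′<K) ≤-refl)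
        where
        c′<K : c′ E j < K E
        c′<K = r<⇒c′< e 2≤e j 1≤j j≤E+1 (<r⇒ e j h)
      family⇒ (j≡r _ ne h F) = Sum.[ (λ F → optimal′ F (≤-reflexive c′≡K) (ordinary ne (≤-reflexive c′≡K) ≤-refl))
                                   , (λ F → optimal″ F (≤-reflexive (sym c′≡K)) (ordinary ne ≤-refl (≤-reflexive (sym c′≡K)))) ]′ F
        where
        c′≡K : c′ E j ≡ K E
        c′≡K = r≡⇒c′≡ e 2≤e j 1≤j j≤E+1 (≡r⇒ e j h)
      family⇒ (j>r _ ne h F) = optimal″ F (<⇒≤ K<c′) (ordinary ne ≤-refl (<⇒≤ K<c′))
        where
        K<c′ : K E < c′ E j
        K<c′ = r>⇒c′> e 2≤e j 1≤j j≤E+1 (>r⇒ e j h)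

-- The case `j ≡ 0`: nice trees

module NiceMaxima (e k : ℕ) (2≤e : 2 ≤ e) (E<k : suc (2 + e) ≤ k) where
  open Maxima e k 0 2≤e E<k z≤n

  private
    tree″ : Tree G″
    tree″ = Family″.tree F″

    upper : ∀ G → Tree G → σ G ≤ σ G″
    upper G tree = cases (verdict G tree)
      where
      k-bigs : Ψ″ ≤ Ψ G → σ G ≤ σ G″
      k-bigs h = Ψ-≤⇒σ G″ G tree″ tree (≤-trans (≤-reflexive (val″ G″ F″)) h)
      cases : Verdict G → σ G ≤ σ G″
      cases (in′ F)          = k-bigs (≤-trans (m≤m+n Ψ″ 0) (≤-reflexive (sym (val′ G F))))
      cases (in″ F)          = k-bigs (≤-reflexive (sym (val″ G F)))
      cases (in‴ F)          = contradiction (Family‴.2≤j F) λ ()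
      cases (worse′ () _)
      cases (worse″ h)       = k-bigs (<⇒≤ h)
      cases (worse‴ () _ _)

    module Edges (G : Graph n) (tree : Tree G) where
      open MaxDegreeTree G E k 0 4≤E refl 1≤k tree using (S₀; U; 1≤deg; deg≤)
      open Membership G E k 0 4≤E refl 1≤k z≤n tree
      open Conversion G E k 0 4≤E refl 1≤k z≤n tree using (no-pair-cost)
      open Counting G
      open Graph G

      square-injective : ∀ x y → x ^ 2 ≡ y ^ 2 → x ≡ y
      square-injective x y e with <-cmp x y
      ... | tri< x<y _ _ = contradiction e (<⇒≢ (^-monoˡ-< 2 x<y))
      ... | tri≈ _ x≡y _ = x≡y
      ... | tri> _ _ y<x = contradiction (sym e) (<⇒≢ (^-monoˡ-< 2 y<x))

      -- The difference `Δ - 2` also occurs between a leaf and a vertex of degree `Δ - 1`. The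
      -- squares alone do not exclude this; connectedness does, in `no-E+1`.
      NiceEdge : ℕ → ℕ → Set
      NiceEdge p q = (q ≡ Δ × p ≤ 2) ⊎ (p ≡ 1 × q ≡ suc E)

      nice-edge : ∀ p t → 1 ≤ p → p + t ≤ Δ → t ≡ suc E ⊎ t ≡ E → NiceEdge p (p + t)
      nice-edge 1 t _ _ (inj₁ refl) = inj₁ (refl , s≤s z≤n)
      nice-edge 1 t _ _ (inj₂ refl) = inj₂ (refl , refl)
      nice-edge 2 t _ _ (inj₂ refl) = inj₁ (refl , ≤-refl)
      nice-edge (suc (suc p)) t _ (s≤s (s≤s h)) (inj₁ refl) = contradiction h (<⇒≱ (m≤n+m (suc E) p))
      nice-edge (suc (suc (suc p))) t _ (s≤s (s≤s h)) (inj₂ refl) = contradiction h (<⇒≱ (s≤s (m≤n+m E p)))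

      nice-pair : ∀ p q → 1 ≤ p → 1 ≤ q → p ≤ Δ → q ≤ Δ → ∣ p - q ∣ ^ 2 ≡ (Δ ∸ 1) ^ 2 ⊎ ∣ p - q ∣ ^ 2 ≡ (Δ ∸ 2) ^ 2 →
        NiceEdge p q ⊎ NiceEdge q p
      nice-pair p q 1≤p 1≤q p≤ q≤ h with ≤-total p q
      ... | inj₁ p≤q with ≤⇒gap p≤q
      ...   | t , refl = inj₁ (nice-edge p t 1≤p q≤ (Sum.map (trans (sym (∣m-m+n∣≡n p t)) ∘ square-injective _ _) (trans (sym (∣m-m+n∣≡n p t)) ∘ square-injective _ _) h))
      nice-pair p q 1≤p 1≤q p≤ q≤ h | inj₂ q≤p with ≤⇒gap q≤p
      ...   | t , refl = inj₂ (nice-edge q t 1≤q p≤ (Sum.map (trans t≡ ∘ square-injective _ _) (trans t≡ ∘ square-injective _ _) h))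
        where
        t≡ : t ≡ ∣ q + t - q ∣
        t≡ = sym (trans (∣-∣-comm (q + t) q) (∣m-m+n∣≡n q t))

      module Nice (nice : ∀ u v → u ~ v → ∣ deg G u - deg G v ∣ ^ 2 ≡ (Δ ∸ 1) ^ 2 ⊎ ∣ deg G u - deg G v ∣ ^ 2 ≡ (Δ ∸ 2) ^ 2) where
        edge : ∀ u v → u ~ v → NiceEdge (deg G u) (deg G v) ⊎ NiceEdge (deg G v) (deg G u)
        edge u v u~v = nice-pair (deg G u) (deg G v) (1≤deg u) (1≤deg v) (deg≤ u) (deg≤ v) (nice u v u~v)

        E+1≢Δ : suc E ≢ Δ
        E+1≢Δ = <⇒≢ ≤-refl

        -- All neighbours of a vertex of degree Δ - 1 would be leaves.
        no-E+1 : ∀ v → deg G v ≢ suc E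
        no-E+1 v d≡ with non-leaf-neighbour v (λ e → E+1≢Δ (trans (sym d≡) e))
        ... | w , v~w , 2≤w with edge v w v~w
        ...   | inj₁ (inj₁ (_ , d≤2)) = contradiction d≤2 (<⇒≱ (subst (3 ≤_) (sym d≡) (≤-trans (≤ᵇ⇒≤ 3 5 _) (s≤s 4≤E))))
        ...   | inj₁ (inj₂ (d≡1 , _)) = contradiction (trans (sym d≡) d≡1) λ ()
        ...   | inj₂ (inj₁ (dv≡Δ , _)) = E+1≢Δ (trans (sym d≡) dv≡Δ)
        ...   | inj₂ (inj₂ (w≡1 , _)) = <⇒≱ 2≤w (≤-reflexive w≡1)

        big-small : ∀ u v → u ~ v → (deg G v ≡ Δ × deg G u ≤ 2) ⊎ (deg G u ≡ Δ × deg G v ≤ 2)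
        big-small u v u~v with edge u v u~v
        ... | inj₁ (inj₁ p) = inj₁ p
        ... | inj₂ (inj₁ p) = inj₂ p
        ... | inj₁ (inj₂ (_ , d≡)) = contradiction d≡ (no-E+1 v)
        ... | inj₂ (inj₂ (_ , d≡)) = contradiction d≡ (no-E+1 u)

        no-pair : ∀ u v → u ~ v → S₀ u ≡ true → S₀ v ≡ true → ⊥
        no-pair u v u~v S₀u S₀v = Sum.[ S₀-elim S₀v ∘ proj₁ , S₀-elim S₀u ∘ proj₁ ]′ (big-small u v u~v)

        pens : ∀ v → S₀ v ≡ true → Penalty.pen G E v ≡ 0
        pens v S₀v with non-leaf-neighbour v (S₀-elim S₀v)
        ... | w , v~w , _ = pen-low v (Sum.[ proj₂ , (λ (d≡Δ , _) → contradiction d≡Δ (S₀-elim S₀v)) ]′ (big-small v w v~w))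

        mΔΔ : numEdges G Δ Δ ≡ 0
        mΔΔ = numEdges-zero Δ Δ λ u v u~v p q → Sum.[ (λ (_ , d≤2) → too-big p d≤2) , (λ (_ , d≤2) → too-big q d≤2) ]′ (big-small u v u~v)
          where
          too-big : ∀ {v} → deg G v ≡ Δ → ¬ deg G v ≤ 2
          too-big d≡ d≤2 = <⇒≱ (subst (3 ≤_) (sym d≡) (s≤s (s≤s (s≤s z≤n)))) d≤2

        value : Ψ G ≡ Ψ″
        value = trans Ψ≡ (trans (cong₂ (λ u c → u * K E + c) U≡k (no-pair-cost no-pair pens)) (+-identityʳ _))
          where
          U≡k : U S₀ ≡ k
          U≡k = *-cancelʳ-≡ _ _ Δ (trans (cong (_+ U S₀ * Δ) (sym (no-edges no-pair))) (trans edge-balance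
            (trans (cong (k * Δ + 0 +_) mΔΔ) (trans (+-identityʳ _) (+-identityʳ _)))))

    nice⇒Ψ : ∀ G → NiceTree Δ G → Ψ G ≡ Ψ″
    nice⇒Ψ G (tree , nice) = Edges.Nice.value G tree nice

    family″⇒nice : ∀ G → Family″ Δ G → NiceTree Δ G
    family″⇒nice G F = Family″.tree F , edge
      where
      open Family″ F
      open MaxDegreeTree G E k 0 4≤E refl 1≤k tree using (S₀; U)
      open Membership G E k 0 4≤E refl 1≤k z≤n tree
      open Internal internalLeaf
      open Counting G
      open Graph G
      small : ∀ v → deg G v ≢ Δ → deg G v ≡ 1 ⊎ deg G v ≡ 2
      small v d≢Δ = Sum.map₂ (λ { (inj₁ d≡2) → d≡2 ; (inj₂ d≡Δ) → contradiction d≡Δ d≢Δ }) (degrees v)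
      no-pair : ∀ u v → u ~ v → deg G u ≢ Δ → deg G v ≢ Δ → ⊥
      no-pair u v u~v u≢Δ v≢Δ with low-pair⇒22 u v u~v (small u u≢Δ) (small v v≢Δ)
      ... | p , q = numEdges-zero⁻ 2 2 m₂₂≡0 u v u~v p q
      mΔΔ : numEdges G Δ Δ ≡ 0
      mΔΔ = sym (proj₂ (quotient-unique Δ (U S₀) k 0 (numEdges G Δ Δ)
        (trans (cong (_+ U S₀ * Δ) (sym (no-edges λ u v u~v S₀u S₀v → no-pair u v u~v (S₀-elim S₀u) (S₀-elim S₀v))))
          (trans edge-balance (cong (_+ numEdges G Δ Δ) (+-identityʳ (k * Δ)))))
        (s≤s z≤n) (s≤s mΔΔ≤Δ-1)))
      value : ∀ p q → p ≡ Δ → q ≡ 1 ⊎ q ≡ 2 → ∣ p - q ∣ ^ 2 ≡ (Δ ∸ 1) ^ 2 ⊎ ∣ p - q ∣ ^ 2 ≡ (Δ ∸ 2) ^ 2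
      value p q refl (inj₁ refl) = inj₁ refl
      value p q refl (inj₂ refl) = inj₂ refl
      edge : ∀ u v → u ~ v → ∣ deg G u - deg G v ∣ ^ 2 ≡ (Δ ∸ 1) ^ 2 ⊎ ∣ deg G u - deg G v ∣ ^ 2 ≡ (Δ ∸ 2) ^ 2
      edge u v u~v with deg G u ≟ Δ | deg G v ≟ Δ
      ... | no u≢Δ  | no v≢Δ  = ⊥-elim (no-pair u v u~v u≢Δ v≢Δ)
      ... | yes u≡Δ | yes v≡Δ = ⊥-elim (numEdges-zero⁻ Δ Δ mΔΔ u v u~v u≡Δ v≡Δ)
      ... | yes u≡Δ | no v≢Δ  = value (deg G u) (deg G v) u≡Δ (small v v≢Δ)
      ... | no u≢Δ  | yes v≡Δ = subst (λ d → d ^ 2 ≡ (Δ ∸ 1) ^ 2 ⊎ d ^ 2 ≡ (Δ ∸ 2) ^ 2) (∣-∣-comm (deg G v) (deg G u))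
        (value (deg G v) (deg G u) v≡Δ (small u u≢Δ))

    σ-nice : σ G″ + (2 * (Δ * Δ) * k + 3 * Δ * k + 6) ≡ Δ * (Δ * Δ) * k + 6 * k + 4 * Δ
    σ-nice = +-cancelʳ-≡ (k * (E * E * E) + A) _ _ (begin
      σ G″ + C + (k * (E * E * E) + A)
        ≡⟨ cong (λ q → σ G″ + C + (k * q + A)) cube ⟨
      σ G″ + C + (k * (K E + E) + A)
        ≡⟨ eq₁ (σ G″) C k (K E) E A ⟩
      σ G″ + k * K E + A + (C + k * E)
        ≡⟨ cong (λ q → σ G″ + q + A + (C + k * E)) (sym (val″ G″ F″)) ⟩
      σ G″ + Ψ G″ + A + (C + k * E)
        ≡⟨ cong (_+ (C + k * E)) (σ+Ψ G″ E k 0 4≤E refl 1≤k tree″) ⟩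
      n * (suc E * suc E) + ((k * Δ + 0) * (E * E) + (2 * E + 1)) + (C + k * E)
        ≡⟨ eq₂ E k ⟩
      Δ * (Δ * Δ) * k + 6 * k + 4 * Δ + (k * (E * E * E) + A) ∎)
      where
      open ≡-Reasoning
      A C : ℕ
      A = (k * Δ + 0) * (2 * E + 1) + E * E
      C = 2 * (Δ * Δ) * k + 3 * Δ * k + 6
      -- Trading `K E + E` for `E³` removes the predecessor in `K` before the polynomials are
      -- compared.
      cube : K E + E ≡ E * E * E
      cube = eq e
        where
        eq : ∀ e → suc (2 + e) * (2 + e) * (1 + e) + (2 + e) ≡ (2 + e) * (2 + e) * (2 + e)
        eq = solve-∀
      eq₁ : ∀ s C k K E A → s + C + (k * (K + E) + A) ≡ s + k * K + A + (C + k * E)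
      eq₁ = solve-∀
      eq₂ : ∀ E k → (k * (2 + E) + 1 + 0) * (suc E * suc E) + ((k * (2 + E) + 0) * (E * E) + (2 * E + 1)) + (2 * ((2 + E) * (2 + E)) * k + 3 * (2 + E) * k + 6 + k * E)
        ≡ (2 + E) * ((2 + E) * (2 + E)) * k + 6 * k + 4 * (2 + E) + (k * (E * E * E) + ((k * (2 + E) + 0) * (2 * E + 1) + E * E))
      eq₂ = solve-∀

  nice-value : ℤ.+ σ G″ ≡ niceσ Δ k
  nice-value = solve-for (ℤ.+ σ G″) (ℤ.+ Δ) (ℤ.+ k) (trans (sym push-left) (trans (cong ℤ.+_ σ-nice) push-right))
    where
    push-left : ℤ.+ (σ G″ + (2 * (Δ * Δ) * k + 3 * Δ * k + 6))
      ≡ ℤ.+ σ G″ ℤ.+ (ℤ.+ 2 ℤ.* (ℤ.+ Δ ℤ.* ℤ.+ Δ) ℤ.* ℤ.+ k ℤ.+ ℤ.+ 3 ℤ.* ℤ.+ Δ ℤ.* ℤ.+ k ℤ.+ ℤ.+ 6)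
    push-left = cong₂ (λ p q → ℤ.+ σ G″ ℤ.+ (p ℤ.+ q ℤ.+ ℤ.+ 6))
      (trans (ℤ.pos-* (2 * (Δ * Δ)) k) (cong (ℤ._* ℤ.+ k) (trans (ℤ.pos-* 2 (Δ * Δ)) (cong (ℤ.+ 2 ℤ.*_) (ℤ.pos-* Δ Δ)))))
      (trans (ℤ.pos-* (3 * Δ) k) (cong (ℤ._* ℤ.+ k) (ℤ.pos-* 3 Δ)))
    push-right : ℤ.+ (Δ * (Δ * Δ) * k + 6 * k + 4 * Δ)
      ≡ ℤ.+ Δ ℤ.* (ℤ.+ Δ ℤ.* ℤ.+ Δ) ℤ.* ℤ.+ k ℤ.+ ℤ.+ 6 ℤ.* ℤ.+ k ℤ.+ ℤ.+ 4 ℤ.* ℤ.+ Δ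
    push-right = cong₂ ℤ._+_ (cong₂ ℤ._+_ (trans (ℤ.pos-* (Δ * (Δ * Δ)) k) (cong (ℤ._* ℤ.+ k) (trans (ℤ.pos-* Δ (Δ * Δ)) (cong (ℤ.+ Δ ℤ.*_) (ℤ.pos-* Δ Δ)))))
      (ℤ.pos-* 6 k)) (ℤ.pos-* 4 Δ)
    solve-for : ∀ s x y → s ℤ.+ (ℤ.+ 2 ℤ.* (x ℤ.* x) ℤ.* y ℤ.+ ℤ.+ 3 ℤ.* x ℤ.* y ℤ.+ ℤ.+ 6) ≡ x ℤ.* (x ℤ.* x) ℤ.* y ℤ.+ ℤ.+ 6 ℤ.* y ℤ.+ ℤ.+ 4 ℤ.* x →
      s ≡ x ℤ.* (x ℤ.* (x ℤ.* ℤ.+ 1)) ℤ.* y ℤ.- ℤ.+ 2 ℤ.* (x ℤ.* (x ℤ.* ℤ.+ 1)) ℤ.* y ℤ.- ℤ.+ 3 ℤ.* x ℤ.* y ℤ.+ ℤ.+ 6 ℤ.* y ℤ.+ ℤ.+ 4 ℤ.* x ℤ.- ℤ.+ 6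
    solve-for s x y h = trans (eq₁ s x y) (trans (cong (ℤ._- (ℤ.+ 2 ℤ.* (x ℤ.* x) ℤ.* y ℤ.+ ℤ.+ 3 ℤ.* x ℤ.* y ℤ.+ ℤ.+ 6)) h) (eq₂ x y))
      where
      eq₁ : ∀ s x y → s ≡ s ℤ.+ (ℤ.+ 2 ℤ.* (x ℤ.* x) ℤ.* y ℤ.+ ℤ.+ 3 ℤ.* x ℤ.* y ℤ.+ ℤ.+ 6) ℤ.- (ℤ.+ 2 ℤ.* (x ℤ.* x) ℤ.* y ℤ.+ ℤ.+ 3 ℤ.* x ℤ.* y ℤ.+ ℤ.+ 6)
      eq₁ = ℤ-solve-∀
      eq₂ : ∀ x y → x ℤ.* (x ℤ.* x) ℤ.* y ℤ.+ ℤ.+ 6 ℤ.* y ℤ.+ ℤ.+ 4 ℤ.* x ℤ.- (ℤ.+ 2 ℤ.* (x ℤ.* x) ℤ.* y ℤ.+ ℤ.+ 3 ℤ.* x ℤ.* y ℤ.+ ℤ.+ 6)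
        ≡ x ℤ.* (x ℤ.* (x ℤ.* ℤ.+ 1)) ℤ.* y ℤ.- ℤ.+ 2 ℤ.* (x ℤ.* (x ℤ.* ℤ.+ 1)) ℤ.* y ℤ.- ℤ.+ 3 ℤ.* x ℤ.* y ℤ.+ ℤ.+ 6 ℤ.* y ℤ.+ ℤ.+ 4 ℤ.* x ℤ.- ℤ.+ 6
      eq₂ = ℤ-solve-∀

  nice-maximum : ∃[ s ] (ℤ.+ s ≡ niceσ Δ k) × IsCommonσ {n} (NiceTree Δ) s × IsMaxσ n Δ s
  nice-maximum = σ G″ , nice-value
    , ((G″ , family″⇒nice G″ F″) , λ G N → Ψ-≡⇒σ G G″ (proj₁ N) tree″ (trans (nice⇒Ψ G N) (sym (val″ G″ F″))))
    , (G″ , tree″ , refl) , upper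

  module _ (G : Graph n) (tree : Tree G) where
    maximal⇒ : Maximal Δ G → Family Δ 0 G
    maximal⇒ (_ , best) = cases classify
      where
      open Trichotomy G E k 0 4≤E refl 1≤k z≤n tree
      cases : Class → Family Δ 0 G
      cases (in″ u≡ c≡) = j≡0 refl (Conversion.to″ G E k 0 4≤E refl 1≤k z≤n tree u≡ c≡)
      cases (in₀ _ () _ _ _)
      cases (in₁ _ _ _ _ _ _ (inj₁ ()) _)
      cases (in₁ _ _ _ _ _ _ (inj₂ ()) _)
      cases (worse″ h)  = contradiction (≤-trans (σ-≤⇒Ψ G G″ tree tree″ (best G″ tree″)) (≤-reflexive (val″ G″ F″))) (<⇒≱ h)
      cases (worse′ () _)
      cases (worse‴ () _ _)

    family⇒ : Family Δ 0 G → Maximal Δ G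
    family⇒ (j≡0 _ F) = tree , λ H treeH → ≤-trans (upper H treeH) (≤-reflexive (Ψ-≡⇒σ G″ G tree″ tree (trans (val″ G″ F″) (sym (val″ G F)))))
    family⇒ (case‴ (inj₁ (() , _)) _)
    family⇒ (case‴ (inj₂ (_ , ())) _)
    family⇒ (case″∪‴ (_ , ()) _)
    family⇒ (case′∪‴ (_ , ()) _)
    family⇒ (j<r () _ _ _)
    family⇒ (j≡r () _ _ _)
    family⇒ (j>r () _ _ _)

open import Data.Integer.Base using (+_)

theorem11 : ∀ (Δ k j : ℕ) → 6 ≤ Δ → Δ ∸ 1 ≤ k → j ≤ Δ ∸ 1 →
    let n = k * Δ + 1 + j in
    (j ≡ 0 →
      ∃[ s ] (+ s ≡ niceσ Δ k) × IsCommonσ {n} (NiceTree Δ) s × IsMaxσ n Δ s) ×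
    (1 ≤ j →
      ∃[ σ′ ] ∃[ σ″ ] IsCommonσ {n} (Family′ Δ) σ′ × IsCommonσ {n} (Family″ Δ) σ″ ×
        (2 ≤ j × j ≤ Δ ∸ 2 →
          ∃[ σ‴ ] IsCommonσ {n} (Family‴ Δ j) σ‴ × IsMaxσ n Δ (σ′ ⊔ σ″ ⊔ σ‴)) ×
        (¬ (2 ≤ j × j ≤ Δ ∸ 2) → IsMaxσ n Δ (σ′ ⊔ σ″))) ×
    (∀ (T : Graph n) → TreeOfMaxDegree Δ T → (Maximal Δ T ⇔ Family Δ j T))
theorem11 (suc (suc (suc (suc e)))) k zero (s≤s (s≤s (s≤s (s≤s 2≤e)))) E<k j≤ =
  (λ _ → nice-maximum) , (λ ()) , λ T tree → mk⇔ (maximal⇒ T tree) (family⇒ T tree)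
  where open NiceMaxima e k 2≤e E<k
theorem11 (suc (suc (suc (suc e)))) k j@(suc _) (s≤s (s≤s (s≤s (s≤s 2≤e)))) E<k j≤ =
  (λ ()) , (λ _ → maxima) , λ T tree → mk⇔ (maximal⇒ T tree) (family⇒ T tree)
  where
  open Maxima e k j 2≤e E<k j≤
  open Positive (s≤s z≤n)
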